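{- Let $n$ and $d$ be positive integers with $\gcd(n,d)=1$. Let $r$ be an integer with $n+d-nd\leqslant r\leqslant n$ and $n\equiv r\pmod d$. Let $M=(n-r)/d$ or $M=n-1$. Then, modulo $[n]\Phi_n(q)^4$, \begin{align*} &\sum_{k=0}^{M}[2dk+r]\frac{(q^r;q^d)_k^4}{(q^d;q^d)_k^4}q^{(d-2r)k}\\ &\quad\equiv q^{r(r-n)/d}\frac{(q^{2r};q^d)_{(n-r)/d}}{(q^{d};q^d)_{(n-r)/d}}\Bigg([n]-\big([n]^3+[n]^4(1-q)\big)\sum_{k=1}^{(n-r)/d}\frac{q^{kd}}{[kd]^2}\Bigg)\\ &\qquad+[n]^4\sum_{k=1}^{(n-r)/d}q^{(kd-d-2n+2r)(d-n)/d}\frac{(q^d;q^d)_{k-1}(q^{2r};q^d)_{k-1}}{[dk-d+r]^3(q^r;q^d)_{k-1}^2}. \end{align*}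
   Context: For an integer $m$, $[m]=(1-q^m)/(1-q)$ is the $q$-integer. The $q$-shifted factorial is $(a;q)_0=1$ and $(a;q)_m=(1-a)(1-aq)\cdots(1-aq^{m-1})$ for $m\geqslant1$. $\Phi_n(q)$ denotes the $n$-th cyclotomic polynomial. A congruence $A(q)\equiv B(q)$ modulo a polynomial $P(q)$ between rational functions in $q$ means that $A(q)-B(q)$ can be written as $U(q)/V(q)$ with polynomials $U,V$, $V$ relatively prime to $P$, and $P(q)\mid U(q)$. -}

module Defs where

open import Data.Nat as ℕ using (ℕ; zero; suc)
open import Data.Nat.Divisibility using (_∣?_)
open import Data.Integer as ℤ using (ℤ; +_; -[1+_])
open import Data.List using (List; []; _∷_; _++_; length; foldr; reverse; upTo; filter; map)
open import Data.Product using (Σ; ∃; _×_; _,_)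
open import Data.Bool using (Bool; true; false; if_then_else_)
open import Relation.Binary.PropositionalEquality using (_≡_)
open import Relation.Nullary using (¬_; does)

-- Polynomials with integer coefficients, as coefficient lists
-- (constant term first).  Equality is coefficientwise.

Poly : Set
Poly = List ℤ

coeff : Poly → ℕ → ℤ
coeff []       _       = + 0
coeff (a ∷ _)  zero    = a
coeff (_ ∷ as) (suc i) = coeff as i

infix 4 _≈P_
_≈P_ : Poly → Poly → Set
p ≈P r = ∀ i → coeff p i ≡ coeff r i

constP : ℤ → Poly
constP c = c ∷ []

zeroP oneP : Poly
zeroP = []
oneP  = constP (+ 1)

infixl 6 _+P_ _-P_
infixl 7 _*P_ _·P_

_+P_ : Poly → Poly → Poly
[]       +P r        = r
(a ∷ as) +P []       = a ∷ as
(a ∷ as) +P (b ∷ bs) = (a ℤ.+ b) ∷ (as +P bs)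

negP : Poly → Poly
negP = map (λ a → ℤ.- a)

_-P_ : Poly → Poly → Poly
p -P r = p +P negP r

_·P_ : ℤ → Poly → Poly
c ·P p = map (c ℤ.*_) p

_*P_ : Poly → Poly → Poly
[]       *P _ = []
(a ∷ as) *P r = (a ·P r) +P (+ 0 ∷ (as *P r))

XP : ℕ → Poly
XP zero    = oneP
XP (suc k) = + 0 ∷ XP k

powP : Poly → ℕ → Poly
powP p zero    = oneP
powP p (suc k) = powP p k *P p

prodP : List Poly → Poly
prodP = foldr _*P_ oneP

strip : Poly → Poly
strip [] = []
strip (a ∷ as) with strip as
... | [] = if does (a ℤ.≟ + 0) then [] else a ∷ []
... | bs = a ∷ bs

-- leading coefficient of a stripped list
lead : Poly → ℤ
lead []       = + 0
lead (a ∷ []) = a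
lead (_ ∷ as) = lead as

quotFuel : ℕ → Poly → Poly → Poly
quotFuel zero    f g = []
quotFuel (suc t) f g with strip f | strip g
... | f' | g' with length f' ℕ.<ᵇ length g'
...   | true  = []
...   | false =
  let k = length f' ℕ.∸ length g'
      c = lead f'
      m = c ·P XP k
  in m +P quotFuel t (f' -P (m *P g')) g'

quotMonic : Poly → Poly → Poly
quotMonic f g = quotFuel (suc (length f)) f g

-- Cyclotomic polynomials, defined recursively by
--   q^n - 1 = ∏_{d ∣ n} Φ_d(q),  i.e.  Φ_n = (q^n - 1) / ∏_{d ∣ n, d < n} Φ_d.
-- cycList n = [Φ_1, ..., Φ_n] (as a list of pairs (d , Φ_d)).

cycList : ℕ → List (ℕ × Poly)
cycList zero    = []
cycList (suc n) =
  let prev    = cycList n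
      divs    = filter (λ dp → Data.Product.proj₁ dp ∣? suc n) prev
      denom   = prodP (map Data.Product.proj₂ divs)
      new     = quotMonic (XP (suc n) -P oneP) denom
  in prev ++ ((suc n , new) ∷ [])

lastPoly : List (ℕ × Poly) → Poly
lastPoly []             = oneP
lastPoly ((_ , p) ∷ []) = p
lastPoly (_ ∷ ps)       = lastPoly ps

-- Φ_n(q) for n ≥ 1 (the value at n = 0 is an irrelevant placeholder)
cyclotomic : ℕ → Poly
cyclotomic n = lastPoly (cycList n)

qintPoly : ℕ → Poly
qintPoly zero    = zeroP
qintPoly (suc n) = qintPoly n +P XP n

infix 4 _∣P_
_∣P_ : Poly → Poly → Set
P ∣P U = ∃ λ W → U ≈P P *P W

-- relatively prime (gcd 1 in ℚ[q]): S V + T P is a nonzero integer constant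
CoprimeP : Poly → Poly → Set
CoprimeP V P = Σ Poly λ S → Σ Poly λ T → Σ ℤ λ c →
  (¬ c ≡ + 0) × ((S *P V) +P (T *P P) ≈P constP c)

record RatFun : Set where
  constructor _//_
  field
    num : Poly
    den : Poly
open RatFun public

infixl 6 _+R_ _-R_
infixl 7 _*R_ _/R_
infixr 8 _^R_

polyR : Poly → RatFun
polyR p = p // oneP

intR : ℤ → RatFun
intR c = polyR (constP c)

_+R_ : RatFun → RatFun → RatFun
(a // b) +R (c // d) = ((a *P d) +P (c *P b)) // (b *P d)

-R_ : RatFun → RatFun
-R (a // b) = negP a // b

_-R_ : RatFun → RatFun → RatFun
x -R y = x +R (-R y)

_*R_ : RatFun → RatFun → RatFun
(a // b) *R (c // d) = (a *P c) // (b *P d)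

invR : RatFun → RatFun
invR (a // b) = b // a

_/R_ : RatFun → RatFun → RatFun
x /R y = x *R invR y

_^R_ : RatFun → ℕ → RatFun
x ^R zero    = intR (+ 1)
x ^R (suc k) = (x ^R k) *R x

qR : RatFun
qR = polyR (XP 1)

qpow : ℤ → RatFun
qpow (+ k)      = polyR (XP k)
qpow -[1+ k ]   = oneP // XP (suc k)

qint : ℤ → RatFun
qint m = (intR (+ 1) -R qpow m) /R (intR (+ 1) -R qR)

poch : RatFun → RatFun → ℕ → RatFun
poch a b zero    = intR (+ 1)
poch a b (suc k) = poch a b k *R (intR (+ 1) -R (a *R (b ^R k)))

sum0 : ℕ → (ℕ → RatFun) → RatFun
sum0 zero    f = f zero
sum0 (suc m) f = sum0 m f +R f (suc m)

sum1 : ℕ → (ℕ → RatFun) → RatFun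
sum1 zero    f = intR (+ 0)
sum1 (suc m) f = sum1 m f +R f (suc m)

-- Congruence of rational functions modulo a polynomial P:
-- A - B = U / V with V coprime to P and P ∣ U.

infix 4 _≡R_[mod_]
_≡R_[mod_] : RatFun → RatFun → Poly → Set
A ≡R B [mod P ] = Σ Poly λ U → Σ Poly λ V →
  CoprimeP V P × (P ∣P U) ×
  (((num A *P den B) -P (num B *P den A)) *P V ≈P U *P (den A *P den B))

-- Put p = q^d, u = q^r, N = (n - r)/d, x = q^n = u p^N and y = 1 - x.  The q-Saalschütz
-- summation and telescoping in k turn the truncated very-well-poised sum, for every M,
-- into a sum over i + j = M of products of q-shifted factorials.  For M = N, replacing
-- (p;p)_j² by (xp;p)_j (p/x;p)_j makes that sum summable and gives the main term.  The
-- replacement is a perturbation in τ = -y²/x, as (1 - x p^l)(1 - p^l/x) = (1 - p^l)² + p^l τ,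
-- and modulo y⁵ only its first-order term matters.  That term is at x = 1 an Apéry-type
-- double sum, which satisfies the same first-order recurrence in N as the last sum of the
-- theorem.  The terms with N < k < n cancel in pairs modulo Φ_n⁵.  Modulo Φ_m with m ∣ n and
-- 1 < m < n both sides vanish, by counting the factors 1 - q^(a + id) with m ∣ a + id.
-- Congruences modulo coprime P₁, P₂ with clearing factors V₁, V₂ combine through the
-- clearing factor V₁ P₂ + V₂ P₁.
module Submission where

-- The sum over i + j = N carries y² explicitly, but its coefficients `β u i j` contain 1/(1 - u
-- p^j), which is 1/y at i = 0. One y is spent on this pole, so the perturbation must be known up to
-- an error y⁴, that is, up to its part linear in τ. There the coefficient h_0 + ... + h_(j-1) is
-- written as the full sum over l < N minus the part with j ≤ l < N. The full sum multiplies the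
-- q-Saalschütz total and gives the harmonic sum of the theorem; its coefficient y³/x is y³ + y⁴
-- modulo y⁵. The other part is empty at i = 0, exactly where the pole sits, so what accompanies y⁴
-- is integral and may be evaluated at x = 1.
--
-- Since [n] = y/(1 - q), the work is done on 1 - q times both sides; 1 - q is a unit modulo Φ_m for
-- m > 1, and for n = 1 both sides agree exactly. For n > 1 the modulus is Φ_n⁵ times the other Φ_m
-- with m ∣ n and m > 1. Coprimality is a Bézout identity with a non-zero integer constant, so
-- divisibility first appears up to such constants; monic divisors remove them.

module SparseNormalForms where

  open import Algebra.Bundles using (CommutativeRing)
  open import Data.Nat as ℕ using (ℕ; zero; suc)
  import Data.Nat.Properties as ℕP
  open import Data.Integer as ℤ using (ℤ; +_; -[1+_])
  import Data.Integer.Properties as ℤP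
  open import Data.Fin using (Fin; zero; suc)
  open import Data.Vec using (Vec; []; _∷_; lookup; replicate; allFin)
  import Data.Vec as Vec
  open import Data.Vec.N-ary using (N-ary; _$ⁿ_)
  open import Data.List using (List; []; _∷_)
  open import Data.Product using (_×_; _,_; proj₁; proj₂)
  open import Data.Bool using (Bool; true; false; T)
  open import Data.Unit using (tt)
  open import Relation.Binary.PropositionalEquality as ≡ using (_≡_)
  open import Level using (0ℓ)

  -- Normal forms of polynomial expressions over a commutative ring

  module RingSolver (R : CommutativeRing 0ℓ 0ℓ) where
    open CommutativeRing R
    open import Relation.Binary.Reasoning.Setoid setoid
    open import Algebra.Properties.Ring ring
      using (-‿distribˡ-*; -‿distribʳ-*; -0#≈0#; -‿involutive; -‿+-comm)

    infixr 8 _^_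
    _^_ : Carrier → ℕ → Carrier
    x ^ zero  = 1#
    x ^ suc k = x ^ k * x

    ^-cong : ∀ {x y} k → x ≈ y → x ^ k ≈ y ^ k
    ^-cong zero    e = refl
    ^-cong (suc k) e = *-cong (^-cong k e) e

    ^-+ : ∀ x m n → x ^ (m ℕ.+ n) ≈ x ^ m * x ^ n
    ^-+ x zero    n = sym (*-identityˡ _)
    ^-+ x (suc m) n = begin
      x ^ (m ℕ.+ n) * x     ≈⟨ *-congʳ (^-+ x m n) ⟩
      x ^ m * x ^ n * x     ≈⟨ *-assoc _ _ _ ⟩
      x ^ m * (x ^ n * x)   ≈⟨ *-congˡ (*-comm _ _) ⟩
      x ^ m * (x * x ^ n)   ≈⟨ *-assoc _ _ _ ⟨
      x ^ m * x * x ^ n     ∎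

    -- The separate clause at one makes `integer (+ 1)` equal to `1#` by computation, so that `:1`
    -- denotes `1#` itself and not `0# + 1#`.
    natural : ℕ → Carrier
    natural zero          = 0#
    natural (suc zero)    = 1#
    natural (suc (suc n)) = natural (suc n) + 1#

    integer : ℤ → Carrier
    integer (+ n)    = natural n
    integer -[1+ n ] = - natural (suc n)

    private
      swap-mid : ∀ a b c d → (a + b) + (c + d) ≈ (a + c) + (b + d)
      swap-mid a b c d = begin
        (a + b) + (c + d)  ≈⟨ +-assoc _ _ _ ⟩
        a + (b + (c + d))  ≈⟨ +-congˡ (trans (sym (+-assoc _ _ _)) (trans (+-congʳ (+-comm _ _)) (+-assoc _ _ _))) ⟩
        a + (c + (b + d))  ≈⟨ +-assoc _ _ _ ⟨
        (a + c) + (b + d)  ∎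

      mswap-mid : ∀ a b c d → (a * b) * (c * d) ≈ (a * c) * (b * d)
      mswap-mid a b c d = begin
        (a * b) * (c * d)  ≈⟨ *-assoc _ _ _ ⟩
        a * (b * (c * d))  ≈⟨ *-congˡ (trans (sym (*-assoc _ _ _)) (trans (*-congʳ (*-comm _ _)) (*-assoc _ _ _))) ⟩
        a * (c * (b * d))  ≈⟨ *-assoc _ _ _ ⟨
        (a * c) * (b * d)  ∎

    natural-suc : ∀ n → natural (suc n) ≈ 1# + natural n
    natural-suc zero    = sym (+-identityʳ _)
    natural-suc (suc n) = +-comm _ _

    natural-+ : ∀ m n → natural (m ℕ.+ n) ≈ natural m + natural n
    natural-+ zero    n = sym (+-identityˡ _)
    natural-+ (suc m) n = begin
      natural (suc (m ℕ.+ n))       ≈⟨ natural-suc (m ℕ.+ n) ⟩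
      1# + natural (m ℕ.+ n)        ≈⟨ +-congˡ (natural-+ m n) ⟩
      1# + (natural m + natural n)  ≈⟨ +-assoc _ _ _ ⟨
      (1# + natural m) + natural n  ≈⟨ +-congʳ (natural-suc m) ⟨
      natural (suc m) + natural n   ∎

    natural-* : ∀ m n → natural (m ℕ.* n) ≈ natural m * natural n
    natural-* zero    n = sym (zeroˡ _)
    natural-* (suc m) n = begin
      natural (n ℕ.+ m ℕ.* n)            ≈⟨ natural-+ n (m ℕ.* n) ⟩
      natural n + natural (m ℕ.* n)      ≈⟨ +-cong (sym (*-identityˡ _)) (natural-* m n) ⟩
      1# * natural n + natural m * natural n ≈⟨ distribʳ _ _ _ ⟨
      (1# + natural m) * natural n       ≈⟨ *-congʳ (natural-suc m) ⟨
      natural (suc m) * natural n        ∎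

    integer-⊖ : ∀ m n → integer (m ℤ.⊖ n) ≈ natural m + - natural n
    integer-⊖ m zero = begin
      integer (m ℤ.⊖ 0)     ≡⟨ ≡.cong integer (ℤP.⊖-≥ (ℕ.z≤n {m})) ⟩
      natural m            ≈⟨ +-identityʳ _ ⟨
      natural m + 0#       ≈⟨ +-congˡ -0#≈0# ⟨
      natural m + - 0#     ∎
    integer-⊖ zero    (suc n) = sym (+-identityˡ _)
    integer-⊖ (suc m) (suc n) = begin
      integer (suc m ℤ.⊖ suc n)                ≡⟨ ≡.cong integer (ℤP.[1+m]⊖[1+n]≡m⊖n m n) ⟩
      integer (m ℤ.⊖ n)                        ≈⟨ integer-⊖ m n ⟩
      natural m + - natural n                  ≈⟨ +-identityˡ _ ⟨
      0# + (natural m + - natural n)           ≈⟨ +-congʳ (-‿inverseʳ 1#) ⟨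
      (1# + - 1#) + (natural m + - natural n)  ≈⟨ swap-mid _ _ _ _ ⟩
      (1# + natural m) + (- 1# + - natural n)  ≈⟨ +-congˡ (-‿+-comm _ _) ⟩
      (1# + natural m) + - (1# + natural n)    ≈⟨ +-cong (natural-suc m) (-‿cong (natural-suc n)) ⟨
      natural (suc m) + - natural (suc n)      ∎

    integer-neg : ∀ i → integer (ℤ.- i) ≈ - integer i
    integer-neg (+ zero)  = sym -0#≈0#
    integer-neg (+ suc n) = refl
    integer-neg -[1+ n ]  = sym (-‿involutive _)

    integer-+ : ∀ i j → integer (i ℤ.+ j) ≈ integer i + integer j
    integer-+ (+ m)    (+ n)    = natural-+ m n
    integer-+ (+ m)    -[1+ n ] = integer-⊖ m (suc n)
    integer-+ -[1+ m ] (+ n)    = trans (integer-⊖ n (suc m)) (+-comm _ _)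
    integer-+ -[1+ m ] -[1+ n ] = begin
      - natural (suc (suc (m ℕ.+ n)))          ≡⟨ ≡.cong (λ k → - natural (suc k)) (ℕP.+-suc m n) ⟨
      - natural (suc m ℕ.+ suc n)              ≈⟨ -‿cong (natural-+ (suc m) (suc n)) ⟩
      - (natural (suc m) + natural (suc n))    ≈⟨ -‿+-comm _ _ ⟨
      - natural (suc m) + - natural (suc n)    ∎

    integer-* : ∀ i j → integer (i ℤ.* j) ≈ integer i * integer j
    integer-* (+ m) (+ n) = trans (reflexive (≡.cong integer (≡.sym (ℤP.pos-* m n)))) (natural-* m n)
    integer-* (+ m) -[1+ n ] = begin
      integer (+ m ℤ.* -[1+ n ])          ≡⟨ ≡.cong integer (≡.sym (ℤP.neg-distribʳ-* (+ m) (+ suc n))) ⟩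
      integer (ℤ.- (+ m ℤ.* + suc n))     ≈⟨ integer-neg (+ m ℤ.* + suc n) ⟩
      - integer (+ m ℤ.* + suc n)         ≈⟨ -‿cong (integer-* (+ m) (+ suc n)) ⟩
      - (natural m * natural (suc n))     ≈⟨ -‿distribʳ-* _ _ ⟩
      natural m * - natural (suc n)       ∎
    integer-* -[1+ m ] (+ n) = begin
      integer (-[1+ m ] ℤ.* + n)          ≡⟨ ≡.cong integer (≡.sym (ℤP.neg-distribˡ-* (+ suc m) (+ n))) ⟩
      integer (ℤ.- (+ suc m ℤ.* + n))     ≈⟨ integer-neg (+ suc m ℤ.* + n) ⟩
      - integer (+ suc m ℤ.* + n)         ≈⟨ -‿cong (integer-* (+ suc m) (+ n)) ⟩
      - (natural (suc m) * natural n)     ≈⟨ -‿distribˡ-* _ _ ⟩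
      - natural (suc m) * natural n       ∎
    integer-* -[1+ m ] -[1+ n ] = begin
      natural (suc m ℕ.* suc n)               ≈⟨ natural-* (suc m) (suc n) ⟩
      natural (suc m) * natural (suc n)       ≈⟨ -‿involutive _ ⟨
      - - (natural (suc m) * natural (suc n)) ≈⟨ -‿cong (-‿distribˡ-* _ _) ⟩
      - (- natural (suc m) * natural (suc n)) ≈⟨ -‿distribʳ-* _ _ ⟩
      - natural (suc m) * - natural (suc n)   ∎

    infix  9 :-_
    infixr 8 _:^_
    infixl 7 _:*_
    infixl 6 _:+_ _:-_
    infix  4 _:=_

    data Expr (n : ℕ) : Set where
      var  : Fin n → Expr n
      con  : ℤ → Expr n
      _:+_ : Expr n → Expr n → Expr n
      _:*_ : Expr n → Expr n → Expr n
      :-_  : Expr n → Expr n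
      _:^_ : Expr n → ℕ → Expr n

    _:-_ : ∀ {n} → Expr n → Expr n → Expr n
    a :- b = a :+ (:- b)

    :1 :0 : ∀ {n} → Expr n
    :1 = con (+ 1)
    :0 = con (+ 0)

    Env : ℕ → Set
    Env = Vec Carrier

    ⟦_⟧ : ∀ {n} → Expr n → Env n → Carrier
    ⟦ var i ⟧ ρ  = lookup ρ i
    ⟦ con c ⟧ ρ  = integer c
    ⟦ a :+ b ⟧ ρ = ⟦ a ⟧ ρ + ⟦ b ⟧ ρ
    ⟦ a :* b ⟧ ρ = ⟦ a ⟧ ρ * ⟦ b ⟧ ρ
    ⟦ :- a ⟧ ρ   = - ⟦ a ⟧ ρ
    ⟦ a :^ k ⟧ ρ = ⟦ a ⟧ ρ ^ k

    -- Sparse normal forms: monomials sorted by exponent vector.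
    Mon : ℕ → Set
    Mon n = Vec ℕ n

    NF : ℕ → Set
    NF n = List (ℤ × Mon n)

    private
      data Order : Set where
        lt eq gt : Order

      compareℕ : Bool → Bool → Order → Order
      compareℕ true  _     r = r
      compareℕ false true  r = lt
      compareℕ false false r = gt

      compare : ∀ {n} → Mon n → Mon n → Order
      compare [] [] = eq
      compare (a ∷ v) (b ∷ w) = compareℕ (a ℕ.≡ᵇ b) (a ℕ.<ᵇ b) (compare v w)

      -- Soundness depends on the order only through this: coefficients are merged exactly when the
      -- answer is `eq`, while `lt` and `gt` merely decide which term comes next.
      compare-eq : ∀ {n} (v w : Mon n) → compare v w ≡ eq → v ≡ w
      compare-eq [] [] e = ≡.refl
      compare-eq (a ∷ v) (b ∷ w) e = aux (a ℕ.≡ᵇ b) (a ℕ.<ᵇ b) ≡.refl e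
        where
        aux : ∀ s t → (a ℕ.≡ᵇ b) ≡ s → compareℕ s t (compare v w) ≡ eq → a ∷ v ≡ b ∷ w
        aux true t s e = ≡.cong₂ _∷_ (ℕP.≡ᵇ⇒≡ a b (≡.subst T (≡.sym s) tt)) (compare-eq v w e)
        aux false true  s ()
        aux false false s ()

      -- Zero coefficients are dropped, so that a cancellation leaves no trace in the list.
      cons : ∀ {n} → ℤ → Mon n → NF n → NF n
      cons (+ zero) m p = p
      cons c@(+ suc _)  m p = (c , m) ∷ p
      cons c@(-[1+ _ ]) m p = (c , m) ∷ p

      mutual
        addNF : ∀ {n} → NF n → NF n → NF n
        addNF []      q = q
        addNF (t ∷ p) q = addTo t p q

        addTo : ∀ {n} → ℤ × Mon n → NF n → NF n → NF n
        addTo t p []      = t ∷ p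
        addTo t p (s ∷ q) = addCase (compare (proj₂ t) (proj₂ s)) t p s q

        addCase : ∀ {n} → Order → ℤ × Mon n → NF n → ℤ × Mon n → NF n → NF n
        addCase lt t p s q = t ∷ addNF p (s ∷ q)
        addCase gt t p s q = s ∷ addTo t p q
        addCase eq (c , m) p (d , _) q = cons (c ℤ.+ d) m (addNF p q)

      scaleNF : ∀ {n} → ℤ → Mon n → NF n → NF n
      scaleNF c m []            = []
      scaleNF c m ((d , l) ∷ p) = cons (c ℤ.* d) (Vec.zipWith ℕ._+_ m l) (scaleNF c m p)

      mulNF : ∀ {n} → NF n → NF n → NF n
      mulNF []            q = []
      mulNF ((c , m) ∷ p) q = addNF (scaleNF c m q) (mulNF p q)

      unitMon : ∀ {n} → Fin n → Mon n
      unitMon {suc n} zero    = 1 ∷ replicate n 0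
      unitMon {suc n} (suc i) = 0 ∷ unitMon i

      powNF : ∀ {n} → NF n → ℕ → NF n
      powNF p zero    = (+ 1 , replicate _ 0) ∷ []
      powNF p (suc k) = mulNF (powNF p k) p

    nf : ∀ {n} → Expr n → NF n
    nf (var i)  = (+ 1 , unitMon i) ∷ []
    nf (con c)  = cons c (replicate _ 0) []
    nf (a :+ b) = addNF (nf a) (nf b)
    nf (a :* b) = mulNF (nf a) (nf b)
    nf (:- a)   = scaleNF -[1+ 0 ] (replicate _ 0) (nf a)
    nf (a :^ k) = powNF (nf a) k

    private
      evalMon : ∀ {n} → Mon n → Env n → Carrier
      evalMon []      []      = 1#
      evalMon (k ∷ m) (x ∷ ρ) = x ^ k * evalMon m ρ

      evalNF : ∀ {n} → NF n → Env n → Carrier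
      evalNF []            ρ = 0#
      evalNF ((c , m) ∷ p) ρ = integer c * evalMon m ρ + evalNF p ρ

      evalMon-0 : ∀ {n} (ρ : Env n) → evalMon (replicate n 0) ρ ≈ 1#
      evalMon-0 []      = refl
      evalMon-0 (x ∷ ρ) = trans (*-identityˡ _) (evalMon-0 ρ)

      evalMon-+ : ∀ {n} (m l : Mon n) ρ → evalMon (Vec.zipWith ℕ._+_ m l) ρ ≈ evalMon m ρ * evalMon l ρ
      evalMon-+ []      []      []      = sym (*-identityˡ _)
      evalMon-+ (a ∷ m) (b ∷ l) (x ∷ ρ) = begin
        x ^ (a ℕ.+ b) * evalMon (Vec.zipWith ℕ._+_ m l) ρ ≈⟨ *-cong (^-+ x a b) (evalMon-+ m l ρ) ⟩
        (x ^ a * x ^ b) * (evalMon m ρ * evalMon l ρ)     ≈⟨ mswap-mid _ _ _ _ ⟩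
        (x ^ a * evalMon m ρ) * (x ^ b * evalMon l ρ)     ∎

      evalMon-unit : ∀ {n} (i : Fin n) ρ → evalMon (unitMon i) ρ ≈ lookup ρ i
      evalMon-unit zero    (x ∷ ρ) = trans (*-cong (*-identityˡ _) (evalMon-0 ρ)) (*-identityʳ _)
      evalMon-unit (suc i) (x ∷ ρ) = trans (*-identityˡ _) (evalMon-unit i ρ)

      eval-cons : ∀ {n} c (m : Mon n) p ρ → evalNF (cons c m p) ρ ≈ integer c * evalMon m ρ + evalNF p ρ
      eval-cons (+ zero)   m p ρ = sym (trans (+-congʳ (zeroˡ _)) (+-identityˡ _))
      eval-cons (+ suc _)  m p ρ = refl
      eval-cons -[1+ _ ]   m p ρ = refl

      mutual
        eval-add : ∀ {n} (p q : NF n) ρ → evalNF (addNF p q) ρ ≈ evalNF p ρ + evalNF q ρ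
        eval-add []      q ρ = sym (+-identityˡ _)
        eval-add (t ∷ p) q ρ = eval-addTo t p q ρ

        eval-addTo : ∀ {n} t (p q : NF n) ρ → evalNF (addTo t p q) ρ ≈ evalNF (t ∷ p) ρ + evalNF q ρ
        eval-addTo t p []      ρ = sym (+-identityʳ _)
        eval-addTo t p (s ∷ q) ρ = eval-addCase (compare (proj₂ t) (proj₂ s)) t p s q ρ ≡.refl

        eval-addCase : ∀ {n} o (t : ℤ × Mon n) (p : NF n) s q ρ →
                       compare (proj₂ t) (proj₂ s) ≡ o →
                       evalNF (addCase o t p s q) ρ ≈ evalNF (t ∷ p) ρ + evalNF (s ∷ q) ρ
        eval-addCase lt t p s q ρ _ = trans (+-congˡ (eval-add p (s ∷ q) ρ)) (sym (+-assoc _ _ _))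
        eval-addCase gt t p s q ρ _ = begin
          _ + evalNF (addTo t p q) ρ               ≈⟨ +-congˡ (eval-addTo t p q ρ) ⟩
          _ + (evalNF (t ∷ p) ρ + evalNF q ρ)      ≈⟨ +-assoc _ _ _ ⟨
          (_ + evalNF (t ∷ p) ρ) + evalNF q ρ      ≈⟨ +-congʳ (+-comm _ _) ⟩
          (evalNF (t ∷ p) ρ + _) + evalNF q ρ      ≈⟨ +-assoc _ _ _ ⟩
          evalNF (t ∷ p) ρ + (_ + evalNF q ρ)      ∎
        eval-addCase eq (c , m) p (d , l) q ρ e rewrite ≡.sym (compare-eq m l e) = begin
          evalNF (cons (c ℤ.+ d) m (addNF p q)) ρ                   ≈⟨ eval-cons (c ℤ.+ d) m (addNF p q) ρ ⟩
          integer (c ℤ.+ d) * evalMon m ρ + evalNF (addNF p q) ρ    ≈⟨ +-cong (*-congʳ (integer-+ c d)) (eval-add p q ρ) ⟩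
          (integer c + integer d) * evalMon m ρ + (evalNF p ρ + evalNF q ρ) ≈⟨ +-congʳ (distribʳ _ _ _) ⟩
          (integer c * evalMon m ρ + integer d * evalMon m ρ) + (evalNF p ρ + evalNF q ρ) ≈⟨ swap-mid _ _ _ _ ⟩
          (integer c * evalMon m ρ + evalNF p ρ) + (integer d * evalMon m ρ + evalNF q ρ) ∎

      eval-scale : ∀ {n} c m (p : NF n) ρ → evalNF (scaleNF c m p) ρ ≈ (integer c * evalMon m ρ) * evalNF p ρ
      eval-scale c m []            ρ = sym (zeroʳ _)
      eval-scale c m ((d , l) ∷ p) ρ = begin
        evalNF (cons (c ℤ.* d) (Vec.zipWith ℕ._+_ m l) (scaleNF c m p)) ρ
          ≈⟨ eval-cons (c ℤ.* d) (Vec.zipWith ℕ._+_ m l) (scaleNF c m p) ρ ⟩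
        integer (c ℤ.* d) * evalMon (Vec.zipWith ℕ._+_ m l) ρ + evalNF (scaleNF c m p) ρ
          ≈⟨ +-cong (*-cong (integer-* c d) (evalMon-+ m l ρ)) (eval-scale c m p ρ) ⟩
        (integer c * integer d) * (evalMon m ρ * evalMon l ρ) + (integer c * evalMon m ρ) * evalNF p ρ
          ≈⟨ +-congʳ (mswap-mid _ _ _ _) ⟩
        (integer c * evalMon m ρ) * (integer d * evalMon l ρ) + (integer c * evalMon m ρ) * evalNF p ρ
          ≈⟨ distribˡ _ _ _ ⟨
        (integer c * evalMon m ρ) * (integer d * evalMon l ρ + evalNF p ρ) ∎

      eval-mul : ∀ {n} (p q : NF n) ρ → evalNF (mulNF p q) ρ ≈ evalNF p ρ * evalNF q ρ
      eval-mul []            q ρ = sym (zeroˡ _)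
      eval-mul ((c , m) ∷ p) q ρ = begin
        evalNF (addNF (scaleNF c m q) (mulNF p q)) ρ            ≈⟨ eval-add (scaleNF c m q) (mulNF p q) ρ ⟩
        evalNF (scaleNF c m q) ρ + evalNF (mulNF p q) ρ         ≈⟨ +-cong (eval-scale c m q ρ) (eval-mul p q ρ) ⟩
        (integer c * evalMon m ρ) * evalNF q ρ + evalNF p ρ * evalNF q ρ ≈⟨ distribʳ _ _ _ ⟨
        (integer c * evalMon m ρ + evalNF p ρ) * evalNF q ρ     ∎

      one*mon : ∀ {n} (ρ : Env n) → integer (+ 1) * evalMon (replicate n 0) ρ ≈ 1#
      one*mon ρ = trans (*-identityˡ _) (evalMon-0 ρ)

      eval-pow : ∀ {n} (p : NF n) k ρ → evalNF (powNF p k) ρ ≈ evalNF p ρ ^ k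
      eval-pow p zero    ρ = trans (+-identityʳ _) (one*mon ρ)
      eval-pow p (suc k) ρ = trans (eval-mul (powNF p k) p ρ) (*-congʳ (eval-pow p k ρ))

    private
      correct : ∀ {n} (a : Expr n) ρ → evalNF (nf a) ρ ≈ ⟦ a ⟧ ρ
      correct (var i)  ρ = trans (+-identityʳ _) (trans (*-identityˡ _) (evalMon-unit i ρ))
      correct (con c)  ρ = begin
        evalNF (cons c (replicate _ 0) []) ρ          ≈⟨ eval-cons c (replicate _ 0) [] ρ ⟩
        integer c * evalMon (replicate _ 0) ρ + 0#    ≈⟨ +-identityʳ _ ⟩
        integer c * evalMon (replicate _ 0) ρ         ≈⟨ *-congˡ (evalMon-0 ρ) ⟩
        integer c * 1#                                ≈⟨ *-identityʳ _ ⟩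
        integer c                                     ∎
      correct (a :+ b) ρ = trans (eval-add (nf a) (nf b) ρ) (+-cong (correct a ρ) (correct b ρ))
      correct (a :* b) ρ = trans (eval-mul (nf a) (nf b) ρ) (*-cong (correct a ρ) (correct b ρ))
      correct (:- a)   ρ = begin
        evalNF (scaleNF -[1+ 0 ] (replicate _ 0) (nf a)) ρ    ≈⟨ eval-scale -[1+ 0 ] (replicate _ 0) (nf a) ρ ⟩
        (- 1# * evalMon (replicate _ 0) ρ) * evalNF (nf a) ρ  ≈⟨ *-cong (*-congˡ (evalMon-0 ρ)) (correct a ρ) ⟩
        (- 1# * 1#) * ⟦ a ⟧ ρ                                 ≈⟨ *-congʳ (*-identityʳ _) ⟩
        - 1# * ⟦ a ⟧ ρ                                        ≈⟨ -‿distribˡ-* _ _ ⟨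
        - (1# * ⟦ a ⟧ ρ)                                      ≈⟨ -‿cong (*-identityˡ _) ⟩
        - ⟦ a ⟧ ρ                                             ∎
      correct (a :^ k) ρ = trans (eval-pow (nf a) k ρ) (^-cong k (correct a ρ))

    sound : ∀ {n} (a b : Expr n) → nf a ≡ nf b → ∀ ρ → ⟦ a ⟧ ρ ≈ ⟦ b ⟧ ρ
    sound a b e ρ = begin
      ⟦ a ⟧ ρ         ≈⟨ correct a ρ ⟨
      evalNF (nf a) ρ ≡⟨ ≡.cong (λ t → evalNF t ρ) e ⟩
      evalNF (nf b) ρ ≈⟨ correct b ρ ⟩
      ⟦ b ⟧ ρ         ∎

    _:=_ : ∀ {n} → Expr n → Expr n → Expr n × Expr n
    _:=_ = _,_

    close : ∀ n {B : Set} → N-ary n (Expr n) B → B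
    close n f = f $ⁿ Vec.map var (allFin n)

    -- Both normal forms are closed terms, so the equality between them is discharged by reflexivity
    -- at each call.
    solve : ∀ {n} (ρ : Env n) (f : N-ary n (Expr n) (Expr n × Expr n)) →
            nf (proj₁ (close n f)) ≡ nf (proj₂ (close n f)) →
            ⟦ proj₁ (close n f) ⟧ ρ ≈ ⟦ proj₂ (close n f) ⟧ ρ
    solve {n} ρ f e = sound (proj₁ (close n f)) (proj₂ (close n f)) e ρ

-- The integral domain of polynomials with integer coefficients

module IntegerPolynomials where

  open import Defs
  open import Algebra.Bundles using (CommutativeRing)
  open import Data.Nat using (zero; suc)
  open import Data.Integer as ℤ using (ℤ; +_)
  import Data.Integer.Properties as ℤP
  open import Data.List using ([]; _∷_)
  open import Data.Product using (_,_)
  open import Data.Empty using (⊥-elim)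
  open import Data.Sum using (inj₁; inj₂)
  open import Relation.Nullary using (¬_; Dec; yes; no)
  open import Relation.Binary.PropositionalEquality as ≡ using (_≡_; refl; sym; trans; cong; cong₂)
  open import Data.Integer.Tactic.RingSolver using (solve-∀)
  open import Level using (0ℓ)

  -- Wrapping the pointwise equality keeps its two sides inferable.
  infix 4 _≋_
  record _≋_ (p r : Poly) : Set where
    constructor wrap
    field at : p ≈P r
  open _≋_ public

  coeff-+ : ∀ p r i → coeff (p +P r) i ≡ coeff p i ℤ.+ coeff r i
  coeff-+ []      r       i       = sym (ℤP.+-identityˡ _)
  coeff-+ (a ∷ p) []      i       = sym (ℤP.+-identityʳ _)
  coeff-+ (a ∷ p) (b ∷ r) zero    = refl
  coeff-+ (a ∷ p) (b ∷ r) (suc i) = coeff-+ p r i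

  coeff-neg : ∀ p i → coeff (negP p) i ≡ ℤ.- coeff p i
  coeff-neg []      i       = refl
  coeff-neg (a ∷ p) zero    = refl
  coeff-neg (a ∷ p) (suc i) = coeff-neg p i

  coeff-· : ∀ c p i → coeff (c ·P p) i ≡ c ℤ.* coeff p i
  coeff-· c []      i       = sym (ℤP.*-zeroʳ c)
  coeff-· c (a ∷ p) zero    = refl
  coeff-· c (a ∷ p) (suc i) = coeff-· c p i

  ≈-refl : ∀ {p} → p ≋ p
  ≈-refl = wrap λ i → refl

  ≈-sym : ∀ {p r} → p ≋ r → r ≋ p
  ≈-sym e = wrap λ i → sym (at e i)

  ≈-trans : ∀ {p r s} → p ≋ r → r ≋ s → p ≋ s
  ≈-trans e f = wrap λ i → trans (at e i) (at f i)

  +P-cong : ∀ {p p' r r'} → p ≋ p' → r ≋ r' → p +P r ≋ p' +P r'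
  +P-cong {p} {p'} {r} {r'} e f = wrap λ i → trans (coeff-+ p r i) (trans (cong₂ ℤ._+_ (at e i) (at f i)) (sym (coeff-+ p' r' i)))

  +P-assoc : ∀ p r s → (p +P r) +P s ≋ p +P (r +P s)
  +P-assoc p r s = wrap λ i → begin
    coeff ((p +P r) +P s) i                    ≡⟨ trans (coeff-+ (p +P r) s i) (cong (ℤ._+ _) (coeff-+ p r i)) ⟩
    (coeff p i ℤ.+ coeff r i) ℤ.+ coeff s i    ≡⟨ ℤP.+-assoc (coeff p i) _ _ ⟩
    coeff p i ℤ.+ (coeff r i ℤ.+ coeff s i)    ≡⟨ trans (coeff-+ p (r +P s) i) (cong (λ z → coeff p i ℤ.+ z) (coeff-+ r s i)) ⟨
    coeff (p +P (r +P s)) i                    ∎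
    where open ≡.≡-Reasoning

  +P-comm : ∀ p r → p +P r ≋ r +P p
  +P-comm p r = wrap λ i → trans (coeff-+ p r i) (trans (ℤP.+-comm (coeff p i) _) (sym (coeff-+ r p i)))

  +P-identityʳ : ∀ p → p +P [] ≋ p
  +P-identityʳ p = wrap λ i → trans (coeff-+ p [] i) (ℤP.+-identityʳ _)

  negP-cong : ∀ {p r} → p ≋ r → negP p ≋ negP r
  negP-cong {p} {r} e = wrap λ i → trans (coeff-neg p i) (trans (cong ℤ.-_ (at e i)) (sym (coeff-neg r i)))

  negP-inverseʳ : ∀ p → p +P negP p ≋ []
  negP-inverseʳ p = wrap λ i → trans (coeff-+ p (negP p) i) (trans (cong (λ z → coeff p i ℤ.+ z) (coeff-neg p i)) (ℤP.+-inverseʳ (coeff p i)))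

  ·P-cong : ∀ c {p r} → p ≋ r → c ·P p ≋ c ·P r
  ·P-cong c {p} {r} e = wrap λ i → trans (coeff-· c p i) (trans (cong (c ℤ.*_) (at e i)) (sym (coeff-· c r i)))

  ∷-cong : ∀ {a b p r} → a ≡ b → p ≋ r → a ∷ p ≋ b ∷ r
  ∷-cong e f = wrap λ { zero → e ; (suc i) → at f i }

  0∷[] : + 0 ∷ [] ≋ []
  0∷[] = wrap λ { zero → refl ; (suc i) → refl }

  swap-mid : ∀ p r s t → (p +P r) +P (s +P t) ≋ (p +P s) +P (r +P t)
  swap-mid p r s t = wrap λ i → begin
    coeff ((p +P r) +P (s +P t)) i ≡⟨ four i p r s t ⟩
    (coeff p i ℤ.+ coeff r i) ℤ.+ (coeff s i ℤ.+ coeff t i) ≡⟨ mid (coeff p i) (coeff r i) (coeff s i) (coeff t i) ⟩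
    (coeff p i ℤ.+ coeff s i) ℤ.+ (coeff r i ℤ.+ coeff t i) ≡⟨ four i p s r t ⟨
    coeff ((p +P s) +P (r +P t)) i ∎
    where
    open ≡.≡-Reasoning
    mid : ∀ a b c d → (a ℤ.+ b) ℤ.+ (c ℤ.+ d) ≡ (a ℤ.+ c) ℤ.+ (b ℤ.+ d)
    mid = solve-∀
    four : ∀ i p r s t → coeff ((p +P r) +P (s +P t)) i ≡ (coeff p i ℤ.+ coeff r i) ℤ.+ (coeff s i ℤ.+ coeff t i)
    four i p r s t = trans (coeff-+ (p +P r) (s +P t) i) (cong₂ ℤ._+_ (coeff-+ p r i) (coeff-+ s t i))

  *P-zeroʳ : ∀ p → p *P [] ≋ []
  *P-zeroʳ []      = ≈-refl
  *P-zeroʳ (a ∷ p) = wrap λ { zero → refl ; (suc i) → at (*P-zeroʳ p) i }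

  *P-congˡ : ∀ p {r s} → r ≋ s → p *P r ≋ p *P s
  *P-congˡ []      e = ≈-refl
  *P-congˡ (a ∷ p) {r} {s} e = +P-cong (·P-cong a e) (∷-cong refl (*P-congˡ p e))

  ·P-+ : ∀ c p r → c ·P (p +P r) ≋ c ·P p +P c ·P r
  ·P-+ c p r = wrap λ i → begin
    coeff (c ·P (p +P r)) i                   ≡⟨ trans (coeff-· c (p +P r) i) (cong (c ℤ.*_) (coeff-+ p r i)) ⟩
    c ℤ.* (coeff p i ℤ.+ coeff r i)           ≡⟨ ℤP.*-distribˡ-+ c _ _ ⟩
    c ℤ.* coeff p i ℤ.+ c ℤ.* coeff r i       ≡⟨ trans (coeff-+ (c ·P p) (c ·P r) i) (cong₂ ℤ._+_ (coeff-· c p i) (coeff-· c r i)) ⟨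
    coeff (c ·P p +P c ·P r) i                ∎
    where open ≡.≡-Reasoning

  +·P : ∀ c d p → (c ℤ.+ d) ·P p ≋ c ·P p +P d ·P p
  +·P c d p = wrap λ i → begin
    coeff ((c ℤ.+ d) ·P p) i               ≡⟨ coeff-· (c ℤ.+ d) p i ⟩
    (c ℤ.+ d) ℤ.* coeff p i                ≡⟨ ℤP.*-distribʳ-+ _ c d ⟩
    c ℤ.* coeff p i ℤ.+ d ℤ.* coeff p i    ≡⟨ trans (coeff-+ (c ·P p) (d ·P p) i) (cong₂ ℤ._+_ (coeff-· c p i) (coeff-· d p i)) ⟨
    coeff (c ·P p +P d ·P p) i             ∎
    where open ≡.≡-Reasoning

  ·P-· : ∀ c d p → c ·P (d ·P p) ≋ (c ℤ.* d) ·P p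
  ·P-· c d p = wrap λ i → trans (coeff-· c (d ·P p) i) (trans (cong (c ℤ.*_) (coeff-· d p i))
    (trans (sym (ℤP.*-assoc c d _)) (sym (coeff-· (c ℤ.* d) p i))))

  1·P : ∀ p → + 1 ·P p ≋ p
  1·P p = wrap λ i → trans (coeff-· (+ 1) p i) (ℤP.*-identityˡ _)

  0·P : ∀ p → + 0 ·P p ≋ []
  0·P p = wrap λ i → coeff-· (+ 0) p i

  *P-distribʳ : ∀ p r s → (p +P r) *P s ≋ p *P s +P r *P s
  *P-distribʳ []      r       s = ≈-refl
  *P-distribʳ (a ∷ p) []      s = ≈-sym (+P-identityʳ _)
  *P-distribʳ (a ∷ p) (b ∷ r) s =
    ≈-trans
      (+P-cong (+·P a b s) (∷-cong refl (*P-distribʳ p r s)))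
      (swap-mid (a ·P s) (b ·P s) (+ 0 ∷ (p *P s)) (+ 0 ∷ (r *P s)))

  *P-distribˡ : ∀ p r s → p *P (r +P s) ≋ p *P r +P p *P s
  *P-distribˡ []      r s = ≈-refl
  *P-distribˡ (a ∷ p) r s =
    ≈-trans
      (+P-cong (·P-+ a r s) (∷-cong refl (*P-distribˡ p r s)))
      (swap-mid (a ·P r) (a ·P s) (+ 0 ∷ (p *P r)) (+ 0 ∷ (p *P s)))

  -- Multiplication recurses on its left factor; this is the mirror recursion on the right factor,
  -- from which commutativity follows.
  *P-∷ : ∀ p a r → p *P (a ∷ r) ≋ (a ·P p) +P (+ 0 ∷ (p *P r))
  *P-∷ []      a r = wrap λ { zero → refl ; (suc i) → refl }
  *P-∷ (b ∷ p) a r = wrap λ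
    { zero → trans (ℤP.+-identityʳ _) (trans (ℤP.*-comm b a) (sym (ℤP.+-identityʳ _)))
    ; (suc i) → at tail i }
    where
    tail : b ·P r +P p *P (a ∷ r) ≋ a ·P p +P (b ·P r +P (+ 0 ∷ (p *P r)))
    tail = ≈-trans (+P-cong ≈-refl (*P-∷ p a r))
      (≈-trans (≈-sym (+P-assoc (b ·P r) (a ·P p) _))
      (≈-trans (+P-cong (+P-comm (b ·P r) (a ·P p)) ≈-refl)
        (+P-assoc (a ·P p) (b ·P r) _)))

  *P-comm : ∀ p r → p *P r ≋ r *P p
  *P-comm []      r = ≈-sym (*P-zeroʳ r)
  *P-comm (a ∷ p) r = ≈-trans (+P-cong ≈-refl (∷-cong refl (*P-comm p r)))
    (≈-sym (*P-∷ r a p))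

  *P-cong : ∀ {p p' r r'} → p ≋ p' → r ≋ r' → p *P r ≋ p' *P r'
  *P-cong {p} {p'} {r} {r'} e f = ≈-trans (*P-congˡ p f)
    (≈-trans (*P-comm p r') (≈-trans (*P-congˡ r' e) (*P-comm r' p')))

  ·P-*P : ∀ c p r → (c ·P p) *P r ≋ c ·P (p *P r)
  ·P-*P c []      r = ≈-refl
  ·P-*P c (a ∷ p) r = ≈-trans
    (+P-cong (≈-sym (·P-· c a r)) (∷-cong (sym (ℤP.*-zeroʳ c)) (·P-*P c p r)))
    (≈-sym (·P-+ c (a ·P r) (+ 0 ∷ (p *P r))))

  *P-assoc : ∀ p r s → (p *P r) *P s ≋ p *P (r *P s)
  *P-assoc []      r s = ≈-refl
  *P-assoc (a ∷ p) r s =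
    ≈-trans (*P-distribʳ (a ·P r) (+ 0 ∷ (p *P r)) s)
    (+P-cong (·P-*P a r s)
      (≈-trans (+P-cong (0·P s) ≈-refl) (∷-cong refl (*P-assoc p r s))))

  constP-* : ∀ c p → constP c *P p ≋ c ·P p
  constP-* c p = ≈-trans (+P-cong ≈-refl 0∷[]) (+P-identityʳ _)

  X-* : ∀ p r → (+ 0 ∷ p) *P r ≋ + 0 ∷ (p *P r)
  X-* p r = +P-cong (0·P r) ≈-refl

  polyRing : CommutativeRing 0ℓ 0ℓ
  polyRing = record
    { Carrier = Poly ; _≈_ = _≋_ ; _+_ = _+P_ ; _*_ = _*P_ ; -_ = negP ; 0# = zeroP ; 1# = oneP
    ; isCommutativeRing = record
      { isRing = record
        { +-isAbelianGroup = record
          { isGroup = record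
            { isMonoid = record
              { isSemigroup = record
                { isMagma = record
                  { isEquivalence = record { refl = ≈-refl ; sym = ≈-sym ; trans = ≈-trans }
                  ; ∙-cong = +P-cong }
                ; assoc = +P-assoc }
              ; identity = (λ p → ≈-refl) , +P-identityʳ }
            ; inverse = (λ p → ≈-trans (+P-comm (negP p) p) (negP-inverseʳ p)) , negP-inverseʳ
            ; ⁻¹-cong = negP-cong }
          ; comm = +P-comm }
        ; *-cong = *P-cong
        ; *-assoc = *P-assoc
        ; *-identity = *P-identityˡ , λ p → ≈-trans (*P-comm p oneP) (*P-identityˡ p)
        ; distrib = *P-distribˡ , λ s p r → *P-distribʳ p r s }
      ; *-comm = *P-comm } }
    where
    *P-identityˡ : ∀ p → oneP *P p ≋ p
    *P-identityˡ p = ≈-trans (constP-* (+ 1) p) (1·P p)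

  zero? : ∀ p → Dec (p ≋ [])
  zero? []      = yes ≈-refl
  zero? (a ∷ p) with a ℤ.≟ + 0 | zero? p
  ... | yes e | yes f = yes (wrap λ { zero → e ; (suc i) → at f i })
  ... | no ¬e | _     = no λ e → ¬e (at e 0)
  ... | _     | no ¬f = no λ e → ¬f (wrap λ i → at e (suc i))

  -- The lowest non-zero coefficient of the right factor does the work: low-order zeros of `r` are
  -- shifted off, and once its constant term b is non-zero, a b = 0 removes the coefficients of `p`
  -- one after the other.
  *P-cancel-zero : ∀ p r → ¬ (r ≋ []) → p *P r ≋ [] → p ≋ []
  *P-cancel-zero p [] ¬e f = ⊥-elim (¬e ≈-refl)
  *P-cancel-zero p (b ∷ r) ¬e f with b ℤ.≟ + 0
  ... | yes refl = *P-cancel-zero p r (λ e → ¬e (wrap λ { zero → refl ; (suc i) → at e i }))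
                     (wrap λ i → trans (sym (at shifted (suc i))) (at f (suc i)))
    where
    shifted : p *P (+ 0 ∷ r) ≋ + 0 ∷ (p *P r)
    shifted = ≈-trans (*P-∷ p (+ 0) r) (+P-cong (0·P p) ≈-refl)
  ... | no b≢0 = go p f
    where
    go : ∀ p → p *P (b ∷ r) ≋ [] → p ≋ []
    go []      f = ≈-refl
    go (a ∷ p) f = wrap λ { zero → a≡0 ; (suc i) → at (go p rest) i }
      where
      a≡0 : a ≡ + 0
      a≡0 with ℤP.i*j≡0⇒i≡0∨j≡0 a (trans (sym (ℤP.+-identityʳ (a ℤ.* b))) (at f 0))
      ... | inj₁ e = e
      ... | inj₂ e = ⊥-elim (b≢0 e)
      rest : p *P (b ∷ r) ≋ []
      rest = wrap λ i → trans (sym (ℤP.+-identityˡ _))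
        (trans (cong (λ z → z ℤ.+ coeff (p *P (b ∷ r)) i) (sym (trans (coeff-· a r i) (cong (λ z → z ℤ.* coeff r i) a≡0))))
        (trans (sym (coeff-+ (a ·P r) (p *P (b ∷ r)) i)) (at f (suc i))))

  oneP≉0 : ¬ (oneP ≋ [])
  oneP≉0 e with at e 0
  ... | ()

-- Fields and fields of fractions

module Fields where

  open import Algebra.Bundles using (CommutativeRing)
  open import Data.Product using (_,_)
  open import Data.Vec using ([]; _∷_)
  open import Data.Empty using (⊥-elim)
  open import Relation.Nullary using (¬_; Dec; yes; no)
  open import Relation.Binary.PropositionalEquality as ≡ using (_≡_)
  open import Level using (0ℓ)
  open SparseNormalForms

  -- Inversion is total but characterised only away from zero; the side conditions of the later
  -- identities all have the form `x ≉ 0#`.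
  record Field : Set₁ where
    field
      commutativeRing : CommutativeRing 0ℓ 0ℓ
    open CommutativeRing commutativeRing public
    infix 9 _⁻¹
    field
      _⁻¹      : Carrier → Carrier
      ⁻¹-cong  : ∀ {x y} → x ≈ y → x ⁻¹ ≈ y ⁻¹
      inverseʳ : ∀ {x} → x ≉ 0# → x * x ⁻¹ ≈ 1#
      1≉0      : 1# ≉ 0#

  module Fractions (A : CommutativeRing 0ℓ 0ℓ)
    (zero? : ∀ a → Dec (CommutativeRing._≈_ A a (CommutativeRing.0# A)))
    (cancel-zero : ∀ a b → ¬ CommutativeRing._≈_ A b (CommutativeRing.0# A) →
                   CommutativeRing._≈_ A (CommutativeRing._*_ A a b) (CommutativeRing.0# A) →
                   CommutativeRing._≈_ A a (CommutativeRing.0# A))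
    (1≉0 : ¬ CommutativeRing._≈_ A (CommutativeRing.1# A) (CommutativeRing.0# A))
    where
    open CommutativeRing A
    open RingSolver A
    open import Relation.Binary.Reasoning.Setoid setoid

    cancel : ∀ a b c → ¬ (c ≈ 0#) → a * c ≈ b * c → a ≈ b
    cancel a b c c≉0 e = begin
      a              ≈⟨ solve (a ∷ b ∷ []) (λ a b → a := (a :- b) :+ b) ≡.refl ⟩
      (a + - b) + b  ≈⟨ +-congʳ (cancel-zero (a + - b) c c≉0 (begin
          (a + - b) * c     ≈⟨ solve (a ∷ b ∷ c ∷ []) (λ a b c → (a :- b) :* c := a :* c :- b :* c) ≡.refl ⟩
          a * c + - (b * c) ≈⟨ +-congʳ e ⟩
          b * c + - (b * c) ≈⟨ -‿inverseʳ _ ⟩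
          0#                ∎)) ⟩
      0# + b         ≈⟨ +-identityˡ b ⟩
      b              ∎

    *-≉0 : ∀ {a b} → ¬ (a ≈ 0#) → ¬ (b ≈ 0#) → ¬ (a * b ≈ 0#)
    *-≉0 a≉0 b≉0 e = a≉0 (cancel-zero _ _ b≉0 e)

    record Fraction : Set where
      constructor mk
      field
        numer : Carrier
        denom : Carrier
        denom≉0 : ¬ (denom ≈ 0#)
    open Fraction public

    infix 4 _≃_
    record _≃_ (x y : Fraction) : Set where
      constructor wrap
      field cross : numer x * denom y ≈ numer y * denom x
    open _≃_ public

    -- The denominator in the middle has to be cancelled, so this is where the absence of zero
    -- divisors enters.
    ≃-trans : ∀ {x y z} → x ≃ y → y ≃ z → x ≃ z
    ≃-trans {mk a b _} {mk c d d≉0} {mk e f _} (wrap p) (wrap q) = wrap (cancel _ _ d d≉0 (begin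
      a * f * d    ≈⟨ solve (a ∷ f ∷ d ∷ []) (λ a f d → a :* f :* d := a :* d :* f) ≡.refl ⟩
      a * d * f    ≈⟨ *-congʳ p ⟩
      c * b * f    ≈⟨ solve (c ∷ b ∷ f ∷ []) (λ c b f → c :* b :* f := c :* f :* b) ≡.refl ⟩
      c * f * b    ≈⟨ *-congʳ q ⟩
      e * d * b    ≈⟨ solve (e ∷ d ∷ b ∷ []) (λ c b f → c :* b :* f := c :* f :* b) ≡.refl ⟩
      e * b * d    ∎))

    infixl 6 _⊕_
    infixl 7 _⊗_
    _⊕_ _⊗_ : Fraction → Fraction → Fraction
    mk a b b≉0 ⊕ mk c d d≉0 = mk (a * d + c * b) (b * d) (*-≉0 b≉0 d≉0)
    mk a b b≉0 ⊗ mk c d d≉0 = mk (a * c) (b * d) (*-≉0 b≉0 d≉0)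

    ⊖_ : Fraction → Fraction
    ⊖ mk a b b≉0 = mk (- a) b b≉0

    embed : Carrier → Fraction
    embed a = mk a 1# 1≉0

    -- The zero test makes inversion total, with zero sent to zero; this respects `_≃_` because
    -- equivalent fractions have simultaneously vanishing numerators (`numer-0`).
    recip : Fraction → Fraction
    recip (mk a b b≉0) with zero? a
    ... | yes _  = embed 0#
    ... | no a≉0 = mk b a a≉0

    ⊕-cong : ∀ {x x' y y'} → x ≃ x' → y ≃ y' → x ⊕ y ≃ x' ⊕ y'
    ⊕-cong {mk a b _} {mk a' b' _} {mk c d _} {mk c' d' _} (wrap p) (wrap q) = wrap (begin
      (a * d + c * b) * (b' * d')
        ≈⟨ solve (a ∷ b ∷ c ∷ d ∷ b' ∷ d' ∷ []) (λ a b c d b' d' → (a :* d :+ c :* b) :* (b' :* d') := (a :* b') :* (d :* d') :+ (c :* d') :* (b :* b')) ≡.refl ⟩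
      (a * b') * (d * d') + (c * d') * (b * b') ≈⟨ +-cong (*-congʳ p) (*-congʳ q) ⟩
      (a' * b) * (d * d') + (c' * d) * (b * b')
        ≈⟨ solve (a' ∷ b ∷ c' ∷ d ∷ b' ∷ d' ∷ []) (λ a b c d b' d' → (a :* b) :* (d :* d') :+ (c :* d) :* (b :* b') := (a :* d' :+ c :* b') :* (b :* d)) ≡.refl ⟩
      (a' * d' + c' * b') * (b * d) ∎)

    ⊗-cong : ∀ {x x' y y'} → x ≃ x' → y ≃ y' → x ⊗ y ≃ x' ⊗ y'
    ⊗-cong {mk a b _} {mk a' b' _} {mk c d _} {mk c' d' _} (wrap p) (wrap q) = wrap (begin
      (a * c) * (b' * d') ≈⟨ solve (a ∷ c ∷ b' ∷ d' ∷ []) (λ a c b d → (a :* c) :* (b :* d) := (a :* b) :* (c :* d)) ≡.refl ⟩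
      (a * b') * (c * d') ≈⟨ *-cong p q ⟩
      (a' * b) * (c' * d) ≈⟨ solve (a' ∷ b ∷ c' ∷ d ∷ []) (λ a c b d → (a :* c) :* (b :* d) := (a :* b) :* (c :* d)) ≡.refl ⟩
      (a' * c') * (b * d) ∎)

    ⊖-cong : ∀ {x x'} → x ≃ x' → ⊖ x ≃ ⊖ x'
    ⊖-cong {mk a b _} {mk a' b' _} (wrap p) = wrap (begin
      - a * b'    ≈⟨ solve (a ∷ b' ∷ []) (λ a b → :- a :* b := :- (a :* b)) ≡.refl ⟩
      - (a * b')  ≈⟨ -‿cong p ⟩
      - (a' * b)  ≈⟨ solve (a' ∷ b ∷ []) (λ a b → :- (a :* b) := :- a :* b) ≡.refl ⟩
      - a' * b    ∎)

    fractionRing : CommutativeRing 0ℓ 0ℓ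
    fractionRing = record
      { Carrier = Fraction ; _≈_ = _≃_ ; _+_ = _⊕_ ; _*_ = _⊗_ ; -_ = ⊖_ ; 0# = embed 0# ; 1# = embed 1#
      ; isCommutativeRing = record
        { isRing = record
          { +-isAbelianGroup = record
            { isGroup = record
              { isMonoid = record
                { isSemigroup = record
                  { isMagma = record
                    { isEquivalence = record { refl = wrap refl ; sym = λ e → wrap (sym (cross e)) ; trans = ≃-trans }
                    ; ∙-cong = ⊕-cong }
                  ; assoc = λ { (mk a b _) (mk c d _) (mk e f _) → wrap (solve (a ∷ b ∷ c ∷ d ∷ e ∷ f ∷ [])
                      (λ a b c d e f → ((a :* d :+ c :* b) :* f :+ e :* (b :* d)) :* (b :* (d :* f)) := (a :* (d :* f) :+ (c :* f :+ e :* d) :* b) :* ((b :* d) :* f)) ≡.refl) } }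
                ; identity = (λ { (mk a b _) → wrap (solve (a ∷ b ∷ []) (λ a b → (:0 :* b :+ a :* :1) :* b := a :* (:1 :* b)) ≡.refl) })
                           , (λ { (mk a b _) → wrap (solve (a ∷ b ∷ []) (λ a b → (a :* :1 :+ :0 :* b) :* b := a :* (b :* :1)) ≡.refl) }) }
              ; inverse = (λ { (mk a b _) → wrap (solve (a ∷ b ∷ []) (λ a b → (:- a :* b :+ a :* b) :* :1 := :0 :* (b :* b)) ≡.refl) })
                        , (λ { (mk a b _) → wrap (solve (a ∷ b ∷ []) (λ a b → (a :* b :+ :- a :* b) :* :1 := :0 :* (b :* b)) ≡.refl) })
              ; ⁻¹-cong = ⊖-cong }
            ; comm = λ { (mk a b _) (mk c d _) → wrap (solve (a ∷ b ∷ c ∷ d ∷ []) (λ a b c d → (a :* d :+ c :* b) :* (d :* b) := (c :* b :+ a :* d) :* (b :* d)) ≡.refl) } }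
          ; *-cong = ⊗-cong
          ; *-assoc = λ { (mk a b _) (mk c d _) (mk e f _) → wrap (solve (a ∷ b ∷ c ∷ d ∷ e ∷ f ∷ [])
              (λ a b c d e f → ((a :* c) :* e) :* (b :* (d :* f)) := (a :* (c :* e)) :* ((b :* d) :* f)) ≡.refl) }
          ; *-identity = (λ { (mk a b _) → wrap (solve (a ∷ b ∷ []) (λ a b → (:1 :* a) :* b := a :* (:1 :* b)) ≡.refl) })
                       , (λ { (mk a b _) → wrap (solve (a ∷ b ∷ []) (λ a b → (a :* :1) :* b := a :* (b :* :1)) ≡.refl) })
          ; distrib = (λ { (mk a b _) (mk c d _) (mk e f _) → wrap (solve (a ∷ b ∷ c ∷ d ∷ e ∷ f ∷ [])
                        (λ a b c d e f → (a :* (c :* f :+ e :* d)) :* ((b :* d) :* (b :* f)) := ((a :* c) :* (b :* f) :+ (a :* e) :* (b :* d)) :* (b :* (d :* f))) ≡.refl) })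
                    , (λ { (mk a b _) (mk c d _) (mk e f _) → wrap (solve (a ∷ b ∷ c ∷ d ∷ e ∷ f ∷ [])
                        (λ a b c d e f → ((c :* f :+ e :* d) :* a) :* ((d :* b) :* (f :* b)) := ((c :* a) :* (f :* b) :+ (e :* a) :* (d :* b)) :* ((d :* f) :* b)) ≡.refl) }) }
        ; *-comm = λ { (mk a b _) (mk c d _) → wrap (solve (a ∷ b ∷ c ∷ d ∷ []) (λ a b c d → (a :* c) :* (d :* b) := (c :* a) :* (b :* d)) ≡.refl) } } }

    numer-0 : ∀ {x y} → x ≃ y → numer x ≈ 0# → numer y ≈ 0#
    numer-0 {x} {y} (wrap p) e = cancel-zero _ _ (denom≉0 x) (trans (sym p) (trans (*-congʳ e) (zeroˡ _)))

    recip-cong : ∀ {x y} → x ≃ y → recip x ≃ recip y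
    recip-cong {mk a b b≉0} {mk c d d≉0} (wrap p) with zero? a | zero? c
    ... | yes _  | yes _  = wrap refl
    ... | yes e  | no c≉0 = ⊥-elim (c≉0 (numer-0 {mk a b b≉0} {mk c d d≉0} (wrap p) e))
    ... | no a≉0 | yes e  = ⊥-elim (a≉0 (numer-0 {mk c d d≉0} {mk a b b≉0} (wrap (sym p)) e))
    ... | no a≉0 | no c≉0 = wrap (trans (*-comm _ _) (trans (sym p) (*-comm _ _)))

    recip-inverse : ∀ {x} → ¬ (x ≃ embed 0#) → x ⊗ recip x ≃ embed 1#
    recip-inverse {mk a b b≉0} x≉0 with zero? a
    ... | yes e  = ⊥-elim (x≉0 (wrap (trans (*-congʳ e) (trans (zeroˡ _) (sym (zeroˡ _))))))
    ... | no a≉0 = wrap (solve (a ∷ b ∷ []) (λ a b → (a :* b) :* :1 := :1 :* (b :* a)) ≡.refl)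

    embed-injective : ∀ {a b} → embed a ≃ embed b → a ≈ b
    embed-injective (wrap p) = trans (sym (*-identityʳ _)) (trans p (*-identityʳ _))

    fractionField : Field
    fractionField = record
      { commutativeRing = fractionRing
      ; _⁻¹ = recip
      ; ⁻¹-cong = recip-cong
      ; inverseʳ = recip-inverse
      ; 1≉0 = λ e → 1≉0 (embed-injective e) }

    embed-cong : ∀ {a b} → a ≈ b → embed a ≃ embed b
    embed-cong e = wrap (*-congʳ e)

    embed-+ : ∀ a b → embed (a + b) ≃ embed a ⊕ embed b
    embed-+ a b = wrap (solve (a ∷ b ∷ []) (λ a b → (a :+ b) :* (:1 :* :1) := (a :* :1 :+ b :* :1) :* :1) ≡.refl)

    embed-* : ∀ a b → embed (a * b) ≃ embed a ⊗ embed b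
    embed-* a b = wrap (solve (a ∷ b ∷ []) (λ a b → (a :* b) :* (:1 :* :1) := (a :* b) :* :1) ≡.refl)

-- Rational identities in a field

module FieldSolver where

  open import Algebra.Bundles using (CommutativeRing)
  open import Data.Nat as ℕ using (ℕ; zero; suc)
  open import Data.Integer using (ℤ; +_)
  open import Data.Fin as Fin using (Fin)
  open import Data.Vec using (Vec; []; _∷_; lookup; allFin)
  import Data.Vec as Vec
  import Data.Vec.Properties as VecP
  open import Data.Vec.N-ary using (N-ary; _$ⁿ_)
  open import Data.Product using (_×_; _,_; proj₁; proj₂)
  open import Data.List using (List; []; _∷_; _++_)
  open import Data.Unit using (⊤; tt)
  open import Relation.Binary.PropositionalEquality as ≡ using (_≡_)
  open SparseNormalForms
  open Fields

  module FieldLemmas (K : Field) where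
    open Field K public
    module RS = RingSolver commutativeRing
    open RS public using (_^_; ^-cong; ^-+; integer)
    module ≈R = CommutativeRing commutativeRing
    open import Relation.Binary.Reasoning.Setoid ≈R.setoid public

    infixl 7 _/_
    _/_ : Carrier → Carrier → Carrier
    a / b = a * b ⁻¹

    /-cong : ∀ {a b c d} → a ≈ b → c ≈ d → a / c ≈ b / d
    /-cong e f = *-cong e (⁻¹-cong f)

    sub-cong : ∀ {a b c d} → a ≈ b → c ≈ d → a - c ≈ b - d
    sub-cong e f = +-cong e (-‿cong f)

    inverseˡ : ∀ {x} → x ≉ 0# → x ⁻¹ * x ≈ 1#
    inverseˡ x≉0 = trans (*-comm _ _) (inverseʳ x≉0)

    *-cancelʳ : ∀ {a b} c → c ≉ 0# → a * c ≈ b * c → a ≈ b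
    *-cancelʳ {a} {b} c c≉0 e = begin
      a               ≈⟨ *-identityʳ a ⟨
      a * 1#          ≈⟨ *-congˡ (inverseʳ c≉0) ⟨
      a * (c * c ⁻¹)  ≈⟨ *-assoc _ _ _ ⟨
      a * c * c ⁻¹    ≈⟨ *-congʳ e ⟩
      b * c * c ⁻¹    ≈⟨ *-assoc _ _ _ ⟩
      b * (c * c ⁻¹)  ≈⟨ *-congˡ (inverseʳ c≉0) ⟩
      b * 1#          ≈⟨ *-identityʳ b ⟩
      b               ∎

    *-≉0 : ∀ {a b} → a ≉ 0# → b ≉ 0# → a * b ≉ 0#
    *-≉0 a≉0 b≉0 e = a≉0 (*-cancelʳ _ b≉0 (trans e (sym (zeroˡ _))))

    ⁻¹-≉0 : ∀ {a} → a ≉ 0# → a ⁻¹ ≉ 0#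
    ⁻¹-≉0 a≉0 e = 1≉0 (trans (sym (inverseʳ a≉0)) (trans (*-congˡ e) (zeroʳ _)))

    /-≉0 : ∀ {a b} → a ≉ 0# → b ≉ 0# → a / b ≉ 0#
    /-≉0 a≉0 b≉0 = *-≉0 a≉0 (⁻¹-≉0 b≉0)

    ^-≉0 : ∀ {a} k → a ≉ 0# → a ^ k ≉ 0#
    ^-≉0 zero    a≉0 = 1≉0
    ^-≉0 (suc k) a≉0 = *-≉0 (^-≉0 k a≉0) a≉0

    1^ : ∀ k → 1# ^ k ≈ 1#
    1^ zero    = refl
    1^ (suc k) = trans (*-identityʳ _) (1^ k)

    ≉0-cong : ∀ {a b} → a ≈ b → a ≉ 0# → b ≉ 0#
    ≉0-cong e a≉0 f = a≉0 (trans e f)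

    ^-* : ∀ a b k → (a * b) ^ k ≈ a ^ k * b ^ k
    ^-* a b zero    = sym (*-identityˡ _)
    ^-* a b (suc k) = trans (*-congʳ (^-* a b k))
      (RS.solve (a ^ k ∷ b ^ k ∷ a ∷ b ∷ []) (λ c d a b → (c RS.:* d) RS.:* (a RS.:* b) RS.:= (c RS.:* a) RS.:* (d RS.:* b)) ≡.refl)

    infix  9 :-_
    infixr 8 _:^_
    infixl 7 _:*_ _:/_
    infixl 6 _:+_ _:-_
    infix  4 _:=_

    data FieldExpr (n : ℕ) : Set where
      var  : Fin n → FieldExpr n
      con  : ℤ → FieldExpr n
      _:+_ : FieldExpr n → FieldExpr n → FieldExpr n
      _:*_ : FieldExpr n → FieldExpr n → FieldExpr n
      _:/_ : FieldExpr n → FieldExpr n → FieldExpr n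
      :-_  : FieldExpr n → FieldExpr n
      _:^_ : FieldExpr n → ℕ → FieldExpr n

    _:-_ : ∀ {n} → FieldExpr n → FieldExpr n → FieldExpr n
    a :- b = a :+ (:- b)

    :1 :0 : ∀ {n} → FieldExpr n
    :1 = con (+ 1)
    :0 = con (+ 0)

    ⟦_⟧ : ∀ {n} → FieldExpr n → Vec Carrier n → Carrier
    ⟦ var i ⟧ ρ  = lookup ρ i
    ⟦ con c ⟧ ρ  = integer c
    ⟦ a :+ b ⟧ ρ = ⟦ a ⟧ ρ + ⟦ b ⟧ ρ
    ⟦ a :* b ⟧ ρ = ⟦ a ⟧ ρ * ⟦ b ⟧ ρ
    ⟦ a :/ b ⟧ ρ = ⟦ a ⟧ ρ / ⟦ b ⟧ ρ
    ⟦ :- a ⟧ ρ   = - ⟦ a ⟧ ρ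
    ⟦ a :^ k ⟧ ρ = ⟦ a ⟧ ρ ^ k

    private
      mutual
        num den : ∀ {n} → FieldExpr n → RS.Expr n
        num (var i)  = RS.var i
        num (con c)  = RS.con c
        num (a :+ b) = num a RS.:* den b RS.:+ num b RS.:* den a
        num (a :* b) = num a RS.:* num b
        num (a :/ b) = num a RS.:* den b
        num (:- a)   = RS.:- num a
        num (a :^ k) = num a RS.:^ k
        den (var i)  = RS.:1
        den (con c)  = RS.:1
        den (a :+ b) = den a RS.:* den b
        den (a :* b) = den a RS.:* den b
        den (a :/ b) = den a RS.:* num b
        den (:- a)   = den a
        den (a :^ k) = den a RS.:^ k

    -- Divisors are listed in the order of occurrence, those nested inside a divisor before it; this
    -- is the order of the non-vanishing proofs at each call of the solver.
    divisors : ∀ {n} → FieldExpr n → List (FieldExpr n)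
    divisors (var i)  = []
    divisors (con c)  = []
    divisors (a :+ b) = divisors a ++ divisors b
    divisors (a :* b) = divisors a ++ divisors b
    divisors (a :/ b) = divisors a ++ divisors b ++ b ∷ []
    divisors (:- a)   = divisors a
    divisors (a :^ k) = divisors a

    -- The singleton clause avoids a trailing unit, so that the side conditions of a call form a
    -- plain tuple.
    NonZeros : ∀ {n} → Vec Carrier n → List (FieldExpr n) → Set
    NonZeros ρ []           = ⊤
    NonZeros ρ (e ∷ [])     = ⟦ e ⟧ ρ ≉ 0#
    NonZeros ρ (e ∷ f ∷ es) = (⟦ e ⟧ ρ ≉ 0#) × NonZeros ρ (f ∷ es)

    private
      nz-head : ∀ {n} (ρ : Vec Carrier n) e es → NonZeros ρ (e ∷ es) → ⟦ e ⟧ ρ ≉ 0#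
      nz-head ρ e []      h = h
      nz-head ρ e (_ ∷ _) h = proj₁ h

      nz-tail : ∀ {n} (ρ : Vec Carrier n) e es → NonZeros ρ (e ∷ es) → NonZeros ρ es
      nz-tail ρ e []      h = tt
      nz-tail ρ e (_ ∷ _) h = proj₂ h

      nz-cons : ∀ {n} (ρ : Vec Carrier n) e es → ⟦ e ⟧ ρ ≉ 0# → NonZeros ρ es → NonZeros ρ (e ∷ es)
      nz-cons ρ e []      h t = h
      nz-cons ρ e (_ ∷ _) h t = h , t

      nz-++ : ∀ {n} (ρ : Vec Carrier n) es fs → NonZeros ρ (es ++ fs) → NonZeros ρ es × NonZeros ρ fs
      nz-++ ρ []       fs h = tt , h
      nz-++ ρ (e ∷ es) fs h =
        let h₁ , h₂ = nz-++ ρ es fs (nz-tail ρ e (es ++ fs) h)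
        in nz-cons ρ e es (nz-head ρ e (es ++ fs) h) h₁ , h₂

      -- Division by `b` moves `num b` into the denominator; it is nonzero because `b` and `den b`
      -- are, which is why the first component has to be carried through the induction.
      correct : ∀ {n} (e : FieldExpr n) ρ → NonZeros ρ (divisors e) →
                (RS.⟦ den e ⟧ ρ ≉ 0#) × (⟦ e ⟧ ρ * RS.⟦ den e ⟧ ρ ≈ RS.⟦ num e ⟧ ρ)
      correct (var i) ρ h = 1≉0 , *-identityʳ _
      correct (con c) ρ h = 1≉0 , *-identityʳ _
      correct (a :+ b) ρ h with nz-++ ρ (divisors a) (divisors b) h
      ... | ha , hb with correct a ρ ha | correct b ρ hb
      ... | da , ea | db , eb = *-≉0 da db , (begin
        (⟦ a ⟧ ρ + ⟦ b ⟧ ρ) * (RS.⟦ den a ⟧ ρ * RS.⟦ den b ⟧ ρ)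
          ≈⟨ RS.solve (⟦ a ⟧ ρ ∷ ⟦ b ⟧ ρ ∷ RS.⟦ den a ⟧ ρ ∷ RS.⟦ den b ⟧ ρ ∷ [])
               (λ a b c d → (a RS.:+ b) RS.:* (c RS.:* d) RS.:= (a RS.:* c) RS.:* d RS.:+ (b RS.:* d) RS.:* c) ≡.refl ⟩
        (⟦ a ⟧ ρ * RS.⟦ den a ⟧ ρ) * RS.⟦ den b ⟧ ρ + (⟦ b ⟧ ρ * RS.⟦ den b ⟧ ρ) * RS.⟦ den a ⟧ ρ
          ≈⟨ +-cong (*-congʳ ea) (*-congʳ eb) ⟩
        RS.⟦ num (a :+ b) ⟧ ρ ∎)
      correct (a :* b) ρ h with nz-++ ρ (divisors a) (divisors b) h
      ... | ha , hb with correct a ρ ha | correct b ρ hb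
      ... | da , ea | db , eb = *-≉0 da db , trans
        (RS.solve (⟦ a ⟧ ρ ∷ ⟦ b ⟧ ρ ∷ RS.⟦ den a ⟧ ρ ∷ RS.⟦ den b ⟧ ρ ∷ [])
           (λ a b c d → (a RS.:* b) RS.:* (c RS.:* d) RS.:= (a RS.:* c) RS.:* (b RS.:* d)) ≡.refl)
        (*-cong ea eb)
      correct (a :/ b) ρ h with nz-++ ρ (divisors a) (divisors b ++ b ∷ []) h
      ... | ha , h' with nz-++ ρ (divisors b) (b ∷ []) h'
      ... | hb , b≉0 with correct a ρ ha | correct b ρ hb
      ... | da , ea | db , eb = *-≉0 da (≉0-cong eb (*-≉0 b≉0 db)) , (begin
        (⟦ a ⟧ ρ * ⟦ b ⟧ ρ ⁻¹) * (RS.⟦ den a ⟧ ρ * RS.⟦ num b ⟧ ρ)    ≈⟨ *-congˡ (*-congˡ eb) ⟨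
        (⟦ a ⟧ ρ * ⟦ b ⟧ ρ ⁻¹) * (RS.⟦ den a ⟧ ρ * (⟦ b ⟧ ρ * RS.⟦ den b ⟧ ρ))
          ≈⟨ RS.solve (⟦ a ⟧ ρ ∷ ⟦ b ⟧ ρ ∷ ⟦ b ⟧ ρ ⁻¹ ∷ RS.⟦ den a ⟧ ρ ∷ RS.⟦ den b ⟧ ρ ∷ [])
               (λ a b i c d → (a RS.:* i) RS.:* (c RS.:* (b RS.:* d)) RS.:= (b RS.:* i) RS.:* ((a RS.:* c) RS.:* d)) ≡.refl ⟩
        (⟦ b ⟧ ρ * ⟦ b ⟧ ρ ⁻¹) * ((⟦ a ⟧ ρ * RS.⟦ den a ⟧ ρ) * RS.⟦ den b ⟧ ρ) ≈⟨ *-cong (inverseʳ b≉0) (*-congʳ ea) ⟩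
        1# * (RS.⟦ num a ⟧ ρ * RS.⟦ den b ⟧ ρ)                       ≈⟨ *-identityˡ _ ⟩
        RS.⟦ num a ⟧ ρ * RS.⟦ den b ⟧ ρ                              ∎)
      correct (:- a) ρ h with correct a ρ h
      ... | da , ea = da , trans
        (RS.solve (⟦ a ⟧ ρ ∷ RS.⟦ den a ⟧ ρ ∷ []) (λ a b → RS.:- a RS.:* b RS.:= RS.:- (a RS.:* b)) ≡.refl) (-‿cong ea)
      correct (a :^ k) ρ h with correct a ρ h
      ... | da , ea = ^-≉0 k da , trans (sym (^-* _ _ k)) (^-cong k ea)

    _:=_ : ∀ {n} → FieldExpr n → FieldExpr n → FieldExpr n × FieldExpr n
    _:=_ = _,_

    close : ∀ n {B : Set} → N-ary n (FieldExpr n) B → B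
    close n f = f $ⁿ Vec.map var (allFin n)

    field-sound : ∀ {n} (a b : FieldExpr n) ρ → NonZeros ρ (divisors a ++ divisors b) →
                  RS.⟦ num a RS.:* den b ⟧ ρ ≈ RS.⟦ num b RS.:* den a ⟧ ρ → ⟦ a ⟧ ρ ≈ ⟦ b ⟧ ρ
    field-sound a b ρ h e with nz-++ ρ (divisors a) (divisors b) h
    ... | ha , hb with correct a ρ ha | correct b ρ hb
    ... | da , ea | db , eb = *-cancelʳ _ (*-≉0 da db) (begin
      ⟦ a ⟧ ρ * (RS.⟦ den a ⟧ ρ * RS.⟦ den b ⟧ ρ)  ≈⟨ *-assoc _ _ _ ⟨
      ⟦ a ⟧ ρ * RS.⟦ den a ⟧ ρ * RS.⟦ den b ⟧ ρ    ≈⟨ *-congʳ ea ⟩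
      RS.⟦ num a ⟧ ρ * RS.⟦ den b ⟧ ρ              ≈⟨ e ⟩
      RS.⟦ num b ⟧ ρ * RS.⟦ den a ⟧ ρ              ≈⟨ *-congʳ eb ⟨
      ⟦ b ⟧ ρ * RS.⟦ den b ⟧ ρ * RS.⟦ den a ⟧ ρ    ≈⟨ *-assoc _ _ _ ⟩
      ⟦ b ⟧ ρ * (RS.⟦ den b ⟧ ρ * RS.⟦ den a ⟧ ρ)  ≈⟨ *-congˡ (*-comm _ _) ⟩
      ⟦ b ⟧ ρ * (RS.⟦ den a ⟧ ρ * RS.⟦ den b ⟧ ρ)  ∎)

    solve : ∀ {n} (ρ : Vec Carrier n) (f : N-ary n (FieldExpr n) (FieldExpr n × FieldExpr n)) →
            RS.nf (num (proj₁ (close n f)) RS.:* den (proj₂ (close n f))) ≡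
            RS.nf (num (proj₂ (close n f)) RS.:* den (proj₁ (close n f))) →
            NonZeros ρ (divisors (proj₁ (close n f)) ++ divisors (proj₂ (close n f))) →
            ⟦ proj₁ (close n f) ⟧ ρ ≈ ⟦ proj₂ (close n f) ⟧ ρ
    solve {n} ρ f e h = field-sound a b ρ h (RS.sound (num a RS.:* den b) (num b RS.:* den a) e ρ)
      where
      a = proj₁ (close n f)
      b = proj₂ (close n f)

    -- Only meaningful on expressions without division.
    toRing : ∀ {n} → FieldExpr n → RS.Expr n
    toRing (var i)  = RS.var i
    toRing (con c)  = RS.con c
    toRing (a :+ b) = toRing a RS.:+ toRing b
    toRing (a :* b) = toRing a RS.:* toRing b
    toRing (a :/ b) = toRing a
    toRing (:- a)   = RS.:- toRing a
    toRing (a :^ k) = toRing a RS.:^ k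

    -- Extra atoms together with polynomial expressions for them in the basic atoms.
    infixr 5 _≔_by_∷_
    data Extras {n} (ρ : Vec Carrier n) : ℕ → Set where
      []    : Extras ρ 0
      extra : ∀ {m} (v : Carrier) (e : FieldExpr n) → v ≈ RS.⟦ toRing e ⟧ ρ → Extras ρ m → Extras ρ (suc m)

    _≔_by_∷_ : ∀ {n m} {ρ : Vec Carrier n} (v : Carrier) (f : N-ary n (FieldExpr n) (FieldExpr n)) →
               v ≈ RS.⟦ toRing (close n f) ⟧ ρ → Extras ρ m → Extras ρ (suc m)
    _≔_by_∷_ {n} v f h xs = extra v (close n f) h xs

    private
      values : ∀ {n m} {ρ : Vec Carrier n} → Extras ρ m → Vec Carrier m
      values []                 = []
      values (extra v e h xs) = v ∷ values xs

      exprs : ∀ {n m} {ρ : Vec Carrier n} → Extras ρ m → Vec (RS.Expr n) m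
      exprs []                     = []
      exprs (extra v e h xs) = toRing e ∷ exprs xs

      substitute : ∀ {n m} → Vec (RS.Expr n) m → RS.Expr m → RS.Expr n
      substitute σ (RS.var i)    = lookup σ i
      substitute σ (RS.con c)    = RS.con c
      substitute σ (a RS.:+ b)   = substitute σ a RS.:+ substitute σ b
      substitute σ (a RS.:* b)   = substitute σ a RS.:* substitute σ b
      substitute σ (RS.:- a)     = RS.:- substitute σ a
      substitute σ (a RS.:^ k)   = substitute σ a RS.:^ k

      Agree : ∀ {n m} → Vec Carrier n → Vec Carrier m → Vec (RS.Expr n) m → Set
      Agree ρ []      []      = ⊤
      Agree ρ (v ∷ w) (e ∷ σ) = (v ≈ RS.⟦ e ⟧ ρ) × Agree ρ w σ

      agree-lookup : ∀ {n m} (ρ : Vec Carrier n) (w : Vec Carrier m) σ → Agree ρ w σ →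
                     ∀ i → lookup w i ≈ RS.⟦ lookup σ i ⟧ ρ
      agree-lookup ρ (v ∷ w) (e ∷ σ) (h , t) Fin.zero    = h
      agree-lookup ρ (v ∷ w) (e ∷ σ) (h , t) (Fin.suc i) = agree-lookup ρ w σ t i

      substitute-sound : ∀ {n m} (ρ : Vec Carrier n) (w : Vec Carrier m) σ → Agree ρ w σ →
                         ∀ e → RS.⟦ e ⟧ w ≈ RS.⟦ substitute σ e ⟧ ρ
      substitute-sound ρ w σ h (RS.var i)  = agree-lookup ρ w σ h i
      substitute-sound ρ w σ h (RS.con c)  = refl
      substitute-sound ρ w σ h (a RS.:+ b) = +-cong (substitute-sound ρ w σ h a) (substitute-sound ρ w σ h b)
      substitute-sound ρ w σ h (a RS.:* b) = *-cong (substitute-sound ρ w σ h a) (substitute-sound ρ w σ h b)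
      substitute-sound ρ w σ h (RS.:- a)   = -‿cong (substitute-sound ρ w σ h a)
      substitute-sound ρ w σ h (a RS.:^ k) = ^-cong k (substitute-sound ρ w σ h a)

      agree-extras : ∀ {n m} {ρ : Vec Carrier n} (xs : Extras ρ m) → Agree ρ (values xs) (exprs xs)
      agree-extras []                 = tt
      agree-extras (extra v e h xs) = h , agree-extras xs

      agree-++ : ∀ {n k m} (ρ : Vec Carrier n) (v : Vec Carrier k) (w : Vec Carrier m) σ τ →
                 Agree ρ v σ → Agree ρ w τ → Agree ρ (v Vec.++ w) (σ Vec.++ τ)
      agree-++ ρ []      w []      τ h t = t
      agree-++ ρ (a ∷ v) w (e ∷ σ) τ (h , t) u = h , agree-++ ρ v w σ τ t u

      agree-map : ∀ {n m} (ρ : Vec Carrier n) (is : Vec (Fin n) m) →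
                  Agree ρ (Vec.map (lookup ρ) is) (Vec.map RS.var is)
      agree-map ρ []       = tt
      agree-map ρ (i ∷ is) = refl , agree-map ρ is

      agree-vars : ∀ {n} (ρ : Vec Carrier n) → Agree ρ ρ (Vec.map RS.var (allFin n))
      agree-vars {n} ρ = ≡.subst (λ v → Agree ρ v (Vec.map RS.var (allFin n))) (VecP.map-lookup-allFin ρ) (agree-map ρ (allFin n))

      simultaneous : ∀ {n m} {ρ : Vec Carrier n} → Extras ρ m → Vec (RS.Expr n) (n ℕ.+ m)
      simultaneous {n} xs = Vec.map RS.var (allFin n) Vec.++ exprs xs

      cross₁ cross₂ : ∀ n (f : N-ary n (FieldExpr n) (FieldExpr n × FieldExpr n)) → RS.Expr n
      cross₁ n f = num (proj₁ (close n f)) RS.:* den (proj₂ (close n f))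
      cross₂ n f = num (proj₂ (close n f)) RS.:* den (proj₁ (close n f))

    -- Covers identities that hold only modulo relations between the atoms, such as `p ^ (i + j)`
    -- being `p ^ i * p ^ j`: each extra atom is replaced by its polynomial before the
    -- cross-multiplied sides are normalised. The divisors keep the extra atoms, so that their
    -- non-vanishing is stated for the terms as they occur.
    solve-with : ∀ {n m} (ρ : Vec Carrier n) (xs : Extras ρ m)
                 (f : N-ary (n ℕ.+ m) (FieldExpr (n ℕ.+ m)) (FieldExpr (n ℕ.+ m) × FieldExpr (n ℕ.+ m))) →
                 RS.nf (substitute (simultaneous xs) (cross₁ (n ℕ.+ m) f)) ≡ RS.nf (substitute (simultaneous xs) (cross₂ (n ℕ.+ m) f)) →
                 NonZeros (ρ Vec.++ values xs) (divisors (proj₁ (close (n ℕ.+ m) f)) ++ divisors (proj₂ (close (n ℕ.+ m) f))) →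
                 ⟦ proj₁ (close (n ℕ.+ m) f) ⟧ (ρ Vec.++ values xs) ≈ ⟦ proj₂ (close (n ℕ.+ m) f) ⟧ (ρ Vec.++ values xs)
    solve-with {n} {m} ρ xs f e h = field-sound (proj₁ (close (n ℕ.+ m) f)) (proj₂ (close (n ℕ.+ m) f)) (ρ Vec.++ values xs) h
      (trans (substitute-sound ρ _ _ agree (cross₁ _ f))
      (trans (RS.sound (substitute (simultaneous xs) (cross₁ _ f)) (substitute (simultaneous xs) (cross₂ _ f)) e ρ)
             (sym (substitute-sound ρ _ _ agree (cross₂ _ f)))))
      where
      agree : Agree ρ (ρ Vec.++ values xs) (simultaneous xs)
      agree = agree-++ ρ ρ (values xs) _ _ (agree-vars ρ) (agree-extras xs)

    neg-≉0 : ∀ {a} → a ≉ 0# → - a ≉ 0#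
    neg-≉0 {a} a≉0 e = a≉0 (trans (solve (a ∷ []) (λ a → a := :- :- a) ≡.refl _) (trans (-‿cong e) (solve [] (:- :0 := :0) ≡.refl _)))

    /-^ : ∀ {a b} k → b ≉ 0# → (a / b) ^ k ≈ a ^ k / b ^ k
    /-^ zero    b≉0 = solve [] (:1 := :1 :/ :1) ≡.refl 1≉0
    /-^ {a} {b} (suc k) b≉0 = trans (*-congʳ (/-^ k b≉0)) (solve (a ∷ b ∷ a ^ k ∷ b ^ k ∷ [])
      (λ a b c d → c :/ d :* (a :/ b) := c :* a :/ (d :* b)) ≡.refl (^-≉0 k b≉0 , b≉0 , ^-≉0 (suc k) b≉0))

    1/-^ : ∀ {b} k → b ≉ 0# → (1# / b) ^ k ≈ 1# / b ^ k
    1/-^ k b≉0 = trans (/-^ k b≉0) (*-congʳ (1^ k))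

-- Finite sums, q-shifted factorials and the q-Saalschütz sum

module QSeries where

  open import Data.Nat as ℕ using (ℕ; zero; suc)
  import Data.Nat.Properties as ℕP
  open import Data.Vec using ([]; _∷_)
  open import Data.Product using (_,_)
  open import Relation.Binary.PropositionalEquality as ≡ using (_≡_)
  open Fields
  open FieldSolver

  module Sums (K : Field) where
    open FieldLemmas K

    ∑ : ℕ → (ℕ → Carrier) → Carrier
    ∑ zero    f = 0#
    ∑ (suc n) f = ∑ n f + f n

    ∑-cong : ∀ n {f g} → (∀ k → k ℕ.< n → f k ≈ g k) → ∑ n f ≈ ∑ n g
    ∑-cong zero    h = refl
    ∑-cong (suc n) h = +-cong (∑-cong n (λ k k<n → h k (ℕP.m<n⇒m<1+n k<n))) (h n ℕP.≤-refl)

    ∑-head : ∀ n f → ∑ (suc n) f ≈ f 0 + ∑ n (λ k → f (suc k))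
    ∑-head zero    f = +-comm _ _
    ∑-head (suc n) f = trans (+-congʳ (∑-head n f)) (+-assoc _ _ _)

    ∑-*ˡ : ∀ n c f → c * ∑ n f ≈ ∑ n (λ k → c * f k)
    ∑-*ˡ zero    c f = zeroʳ c
    ∑-*ˡ (suc n) c f = trans (distribˡ _ _ _) (+-congʳ (∑-*ˡ n c f))

    ∑-+ : ∀ n f g → ∑ n (λ k → f k + g k) ≈ ∑ n f + ∑ n g
    ∑-+ zero    f g = sym (+-identityˡ _)
    ∑-+ (suc n) f g = trans (+-congʳ (∑-+ n f g))
      (solve (∑ n f ∷ ∑ n g ∷ f n ∷ g n ∷ []) (λ a b c d → (a :+ b) :+ (c :+ d) := (a :+ c) :+ (b :+ d)) ≡.refl _)

    -- diag n f = Σ_{i+j=n} f i j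
    diag : ℕ → (ℕ → ℕ → Carrier) → Carrier
    diag zero    f = f 0 0
    diag (suc n) f = f (suc n) 0 + diag n (λ i j → f i (suc j))

    diag-cong : ∀ n {f g} → (∀ i j → i ℕ.+ j ≡ n → f i j ≈ g i j) → diag n f ≈ diag n g
    diag-cong zero    h = h 0 0 ≡.refl
    diag-cong (suc n) h = +-cong (h (suc n) 0 (ℕP.+-identityʳ _))
      (diag-cong n (λ i j e → h i (suc j) (≡.trans (ℕP.+-suc i j) (≡.cong suc e))))

    diag-+ : ∀ n f g → diag n (λ i j → f i j + g i j) ≈ diag n f + diag n g
    diag-+ zero    f g = refl
    diag-+ (suc n) f g = trans (+-congˡ (diag-+ n _ _))
      (solve (f (suc n) 0 ∷ g (suc n) 0 ∷ diag n (λ i j → f i (suc j)) ∷ diag n (λ i j → g i (suc j)) ∷ [])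
        (λ a b c d → (a :+ b) :+ (c :+ d) := (a :+ c) :+ (b :+ d)) ≡.refl _)

    diag-*ˡ : ∀ n c f → c * diag n f ≈ diag n (λ i j → c * f i j)
    diag-*ˡ zero    c f = refl
    diag-*ˡ (suc n) c f = trans (distribˡ _ _ _) (+-congˡ (diag-*ˡ n c _))

    diag-neg : ∀ n f → - diag n f ≈ diag n (λ i j → - f i j)
    diag-neg n f = begin
      - diag n f                    ≈⟨ solve (diag n f ∷ []) (λ a → :- a := :- :1 :* a) ≡.refl _ ⟩
      - 1# * diag n f               ≈⟨ diag-*ˡ n (- 1#) f ⟩
      diag n (λ i j → - 1# * f i j) ≈⟨ diag-cong n (λ i j _ → solve (f i j ∷ []) (λ a → :- :1 :* a := :- a) ≡.refl _) ⟩
      diag n (λ i j → - f i j)      ∎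

    diag-- : ∀ n f g → diag n (λ i j → f i j - g i j) ≈ diag n f - diag n g
    diag-- n f g = trans (diag-+ n f (λ i j → - g i j)) (+-congˡ (sym (diag-neg n g)))

    diag-last : ∀ n f → diag (suc n) f ≈ diag n (λ i j → f (suc i) j) + f 0 (suc n)
    diag-last zero    f = refl
    diag-last (suc n) f = trans (+-congˡ (diag-last n (λ i j → f i (suc j)))) (sym (+-assoc _ _ _))

    diag-swap : ∀ n f → diag n f ≈ diag n (λ i j → f j i)
    diag-swap zero    f = refl
    diag-swap (suc n) f = begin
      f (suc n) 0 + diag n (λ i j → f i (suc j))  ≈⟨ +-congˡ (diag-swap n _) ⟩
      f (suc n) 0 + diag n (λ i j → f j (suc i))  ≈⟨ +-comm _ _ ⟩
      diag n (λ i j → f j (suc i)) + f (suc n) 0  ≈⟨ diag-last n (λ i j → f j i) ⟨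
      diag (suc n) (λ i j → f j i)                ∎

    ∑-diag : ∀ n g → ∑ (suc n) (λ k → diag k g) ≈ diag n (λ i j → ∑ (suc i) (λ k → g k j))
    ∑-diag zero    g = refl
    ∑-diag (suc n) g = begin
      ∑ (suc n) (λ k → diag k g) + diag (suc n) g
        ≈⟨ +-cong (∑-diag n g) (diag-last n g) ⟩
      diag n (λ i j → ∑ (suc i) (λ k → g k j)) + (diag n (λ i j → g (suc i) j) + g 0 (suc n))
        ≈⟨ +-assoc _ _ _ ⟨
      diag n (λ i j → ∑ (suc i) (λ k → g k j)) + diag n (λ i j → g (suc i) j) + g 0 (suc n)
        ≈⟨ +-cong (sym (diag-+ n (λ i j → ∑ (suc i) (λ k → g k j)) (λ i j → g (suc i) j))) (sym (+-identityˡ _)) ⟩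
      diag n (λ i j → ∑ (suc (suc i)) (λ k → g k j)) + ∑ 1 (λ k → g k (suc n))
        ≈⟨ diag-last n (λ i j → ∑ (suc i) (λ k → g k j)) ⟨
      diag (suc n) (λ i j → ∑ (suc i) (λ k → g k j)) ∎

    diag-∑ : ∀ n f → ∑ (suc n) f ≈ diag n (λ i j → f j)
    diag-∑ zero    f = +-identityˡ _
    diag-∑ (suc n) f = trans (∑-head (suc n) f) (+-congˡ (diag-∑ n (λ k → f (suc k))))

    -- Neighbours on one antidiagonal cancel, `f (suc i) j` against `g i (suc j)`; only the entry
    -- with i = 0 has no partner.
    diag-telescope : ∀ n (f g : ℕ → ℕ → Carrier) → (∀ i → g i 0 ≈ 0#) → (∀ i j → g i (suc j) ≈ f (suc i) j) →
                     diag n (λ i j → f i j - g i j) ≈ f 0 n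
    diag-telescope zero    f g h₀ h₁ = trans (+-congˡ (-‿cong (h₀ 0))) (solve (f 0 0 ∷ []) (λ a → a :- :0 := a) ≡.refl _)
    diag-telescope (suc n) f g h₀ h₁ = begin
      diag (suc n) (λ i j → f i j - g i j)    ≈⟨ diag-- (suc n) f g ⟩
      diag (suc n) f - diag (suc n) g         ≈⟨ +-cong (diag-last n f) (-‿cong (+-cong (h₀ (suc n)) (diag-cong n (λ i j _ → h₁ i j)))) ⟩
      (diag n (λ i j → f (suc i) j) + f 0 (suc n)) - (0# + diag n (λ i j → f (suc i) j))
        ≈⟨ solve (diag n (λ i j → f (suc i) j) ∷ f 0 (suc n) ∷ []) (λ a b → (a :+ b) :- (:0 :+ a) := b) ≡.refl _ ⟩
      f 0 (suc n) ∎

  module QPochhammer (K : Field) (p : Field.Carrier K) where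
    open FieldLemmas K

    poch : Carrier → ℕ → Carrier
    poch a zero    = 1#
    poch a (suc k) = poch a k * (1# - a * p ^ k)

    poch-cong : ∀ {a b} k → a ≈ b → poch a k ≈ poch b k
    poch-cong zero    e = refl
    poch-cong (suc k) e = *-cong (poch-cong k e) (+-congˡ (-‿cong (*-congʳ e)))

    poch-head : ∀ a k → poch a (suc k) ≈ (1# - a) * poch (a * p) k
    poch-head a zero    = solve (a ∷ []) (λ a → :1 :* (:1 :- a :* :1) := (:1 :- a) :* :1) ≡.refl _
    poch-head a (suc k) = begin
      poch a (suc k) * (1# - a * (p ^ k * p))          ≈⟨ *-congʳ (poch-head a k) ⟩
      (1# - a) * poch (a * p) k * (1# - a * (p ^ k * p))
        ≈⟨ solve (a ∷ poch (a * p) k ∷ p ^ k ∷ p ∷ []) (λ a u k p → (:1 :- a) :* u :* (:1 :- a :* (k :* p)) := (:1 :- a) :* (u :* (:1 :- a :* p :* k))) ≡.refl _ ⟩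
      (1# - a) * poch (a * p) (suc k) ∎

    poch-+ : ∀ a m n → poch a (m ℕ.+ n) ≈ poch a m * poch (a * p ^ m) n
    poch-+ a zero    n = trans (poch-cong n (sym (*-identityʳ a))) (sym (*-identityˡ _))
    poch-+ a (suc m) n = begin
      poch a (suc (m ℕ.+ n))                         ≈⟨ poch-head a (m ℕ.+ n) ⟩
      (1# - a) * poch (a * p) (m ℕ.+ n)              ≈⟨ *-congˡ (poch-+ (a * p) m n) ⟩
      (1# - a) * (poch (a * p) m * poch (a * p * p ^ m) n) ≈⟨ *-assoc _ _ _ ⟨
      (1# - a) * poch (a * p) m * poch (a * p * p ^ m) n   ≈⟨ *-cong (sym (poch-head a m)) (poch-cong n
         (solve (a ∷ p ∷ p ^ m ∷ []) (λ a p m → a :* p :* m := a :* (m :* p)) ≡.refl _)) ⟩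
      poch a (suc m) * poch (a * p ^ suc m) n        ∎

    poch-≉0 : ∀ a n → (∀ k → k ℕ.< n → 1# - a * p ^ k ≉ 0#) → poch a n ≉ 0#
    poch-≉0 a zero    h = 1≉0
    poch-≉0 a (suc n) h = *-≉0 (poch-≉0 a n (λ k k<n → h k (ℕP.m<n⇒m<1+n k<n))) (h n ℕP.≤-refl)

  module Saalschütz (K : Field) (p : Field.Carrier K)
    (1-p^≉0 : ∀ k → Field._≉_ K (Field._-_ K (Field.1# K) (Field._*_ K p (FieldLemmas._^_ K p k))) (Field.0# K)) where
    open FieldLemmas K
    open Sums K
    open QPochhammer K p

    P : ℕ → Carrier
    P = poch p

    P≉0 : ∀ k → P k ≉ 0#
    P≉0 k = poch-≉0 p k (λ i _ → 1-p^≉0 i)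

    PP≉0 : ∀ i j → P i * P j ≉ 0#
    PP≉0 i j = *-≉0 (P≉0 i) (P≉0 j)

    module _ (a b w : Carrier) where
      -- With n = i + j and c = a b w this is the j-th term of the balanced series 3φ2(a, b, p^(-n);
      -- c, a b p^(1-n)/c; p, p), multiplied by (c;p)_n (w;p)_n.
      summand : ℕ → ℕ → Carrier
      summand i j = P (i ℕ.+ j) / (P i * P j) * poch a j * poch b j * poch w i * w ^ j * poch (a * b * w * p ^ j) i

      private
        step : ℕ → Carrier
        step n = (1# - a * w * p ^ n) * (1# - b * w * p ^ n)

        -- WZ certificate
        cert cert' : ℕ → ℕ → Carrier
        cert i j = - (p ^ i * (P (i ℕ.+ j) / (P i * P j)) * poch a (suc j) * poch b (suc j) * w ^ suc j * poch w i * poch (a * b * w * p ^ j) i)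
        cert' i zero    = 0#
        cert' i (suc j) = cert (suc i) j

        -- `step n` is the ratio of the product side at n + 1 and at n. What the summand at n + 1
        -- has in excess of it is a difference along the antidiagonal i + j = n; the entry (0, n +
        -- 1), which has no counterpart there, is supplied by `last` and cancels the boundary term
        -- `cert 0 n`.
        wz : ∀ i j → summand (suc i) j ≈ step (i ℕ.+ j) * summand i j + (cert i j - cert' i j)
        wz i zero = solve-with (a ∷ b ∷ w ∷ p ∷ p ^ i ∷ P i ∷ poch w i ∷ poch (a * b * w * 1#) i ∷ [])
            (P (i ℕ.+ 0) ≔ (λ a b w p I Pi W C → Pi) by reflexive (≡.cong P (ℕP.+-identityʳ i))
            ∷ p ^ (i ℕ.+ 0) ≔ (λ a b w p I Pi W C → I) by reflexive (≡.cong (p ^_) (ℕP.+-identityʳ i))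
            ∷ [])
            (λ a b w p I Pi W C PN Q →
              (PN :* (:1 :- p :* Q)) :/ (Pi :* (:1 :- p :* I) :* :1) :* :1 :* :1 :* (W :* (:1 :- w :* I)) :* :1 :* (C :* (:1 :- a :* b :* w :* :1 :* I))
              := ((:1 :- a :* w :* Q) :* (:1 :- b :* w :* Q)) :* (PN :/ (Pi :* :1) :* :1 :* :1 :* W :* :1 :* C)
                 :+ (:- (I :* (PN :/ (Pi :* :1)) :* (:1 :* (:1 :- a :* :1)) :* (:1 :* (:1 :- b :* :1)) :* (:1 :* w) :* W :* C) :- :0))
            ≡.refl (PP≉0 (suc i) 0 , PP≉0 i 0 , PP≉0 i 0)
        wz i (suc j) = solve-with (a ∷ b ∷ w ∷ p ∷ p ^ i ∷ p ^ j ∷ P i ∷ P j ∷ P (i ℕ.+ suc j) ∷ poch a j ∷ poch b j ∷ poch w i ∷ w ^ j ∷ poch (a * b * w * p ^ suc j) i ∷ [])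
            (p ^ (i ℕ.+ suc j) ≔ (λ a b w p I J Pi Pj PN A B W w' C → I :* (J :* p)) by ^-+ p i (suc j)
            ∷ P (suc i ℕ.+ j) ≔ (λ a b w p I J Pi Pj PN A B W w' C → PN) by reflexive (≡.cong P (≡.sym (ℕP.+-suc i j)))
            ∷ poch (a * b * w * p ^ j) (suc i) ≔ (λ a b w p I J Pi Pj PN A B W w' C → (:1 :- a :* b :* w :* J) :* C)
                by trans (poch-head _ i) (*-congˡ (poch-cong i (*-assoc _ _ _)))
            ∷ [])
            (λ a b w p I J Pi Pj PN A B W w' C Q PN' C' →
              (PN :* (:1 :- p :* Q)) :/ (Pi :* (:1 :- p :* I) :* (Pj :* (:1 :- p :* J))) :* (A :* (:1 :- a :* J)) :* (B :* (:1 :- b :* J)) :* (W :* (:1 :- w :* I)) :* (w' :* w) :* (C :* (:1 :- a :* b :* w :* (J :* p) :* I))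
              := ((:1 :- a :* w :* Q) :* (:1 :- b :* w :* Q)) :* (PN :/ (Pi :* (Pj :* (:1 :- p :* J))) :* (A :* (:1 :- a :* J)) :* (B :* (:1 :- b :* J)) :* W :* (w' :* w) :* C)
                 :+ (:- (I :* (PN :/ (Pi :* (Pj :* (:1 :- p :* J)))) :* (A :* (:1 :- a :* J) :* (:1 :- a :* (J :* p))) :* (B :* (:1 :- b :* J) :* (:1 :- b :* (J :* p))) :* (w' :* w :* w) :* W :* C)
                     :- :- (I :* p :* (PN' :/ (Pi :* (:1 :- p :* I) :* Pj)) :* (A :* (:1 :- a :* J)) :* (B :* (:1 :- b :* J)) :* (w' :* w) :* (W :* (:1 :- w :* I)) :* C')))
            ≡.refl (PP≉0 (suc i) (suc j) , PP≉0 i (suc j) , PP≉0 i (suc j) , PP≉0 (suc i) j)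

        last : ∀ n → summand 0 (suc n) ≈ - cert 0 n
        last n = solve (poch a (suc n) ∷ poch b (suc n) ∷ w ^ suc n ∷ P (suc n) ∷ P n ∷ [])
          (λ A B w P P' → P :/ (:1 :* P) :* A :* B :* :1 :* w :* :1 := :- (:- (:1 :* (P' :/ (:1 :* P')) :* A :* B :* w :* :1 :* :1)))
          ≡.refl (PP≉0 0 (suc n) , PP≉0 0 n)

      -- The q-Pfaff–Saalschütz sum with all denominators cleared.
      saalschütz : ∀ n → diag n summand ≈ poch (a * w) n * poch (b * w) n
      saalschütz zero = solve [] (:1 :/ (:1 :* :1) :* :1 :* :1 :* :1 :* :1 :* :1 := :1 :* :1) ≡.refl (PP≉0 0 0)
      saalschütz (suc n) = begin
        diag (suc n) summand
          ≈⟨ diag-last n summand ⟩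
        diag n (λ i j → summand (suc i) j) + summand 0 (suc n)
          ≈⟨ +-cong (diag-cong n (λ i j e → trans (wz i j) (+-congʳ (*-congʳ (reflexive (≡.cong step e)))))) (last n) ⟩
        diag n (λ i j → step n * summand i j + (cert i j - cert' i j)) - cert 0 n
          ≈⟨ +-congʳ (diag-+ n (λ i j → step n * summand i j) (λ i j → cert i j - cert' i j)) ⟩
        diag n (λ i j → step n * summand i j) + diag n (λ i j → cert i j - cert' i j) - cert 0 n
          ≈⟨ +-congʳ (+-cong (sym (diag-*ˡ n (step n) summand)) (diag-telescope n cert cert' (λ i → refl) (λ i j → refl))) ⟩
        step n * diag n summand + cert 0 n - cert 0 n
          ≈⟨ +-congʳ (+-congʳ (*-congˡ (saalschütz n))) ⟩
        step n * (poch (a * w) n * poch (b * w) n) + cert 0 n - cert 0 n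
          ≈⟨ solve (1# - a * w * p ^ n ∷ 1# - b * w * p ^ n ∷ poch (a * w) n ∷ poch (b * w) n ∷ cert 0 n ∷ [])
               (λ s t A B c → (s :* t) :* (A :* B) :+ c :- c := (A :* s) :* (B :* t)) ≡.refl _ ⟩
        poch (a * w) (suc n) * poch (b * w) (suc n) ∎

-- The truncated very-well-poised sum as a single sum over i + j = M

module WellPoised where

  open import Data.Nat as ℕ using (ℕ; zero; suc)
  import Data.Nat.Properties as ℕP
  open import Data.Vec using ([]; _∷_)
  open import Data.Product using (_,_)
  open import Relation.Binary.PropositionalEquality as ≡ using (_≡_)
  open Fields
  open FieldSolver
  open QSeries

  module WellPoisedSum (K : Field) (p : Field.Carrier K)
    (p≉0 : Field._≉_ K p (Field.0# K))
    (1-p^≉0 : ∀ k → Field._≉_ K (Field._-_ K (Field.1# K) (Field._*_ K p (FieldLemmas._^_ K p k))) (Field.0# K))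
    where
    open FieldLemmas K
    open Sums K
    open QPochhammer K p
    open Saalschütz K p 1-p^≉0

    -- (-1)^j p^(j(j+1)/2), the factor that appears when j factors of a q-shifted factorial are
    -- reversed.
    N : ℕ → Carrier
    N zero    = 1#
    N (suc j) = N j * - p ^ suc j

    -- z^j (p/z;p)_j written without division, hence also meaningful before z is known to be
    -- invertible.
    R : Carrier → ℕ → Carrier
    R z zero    = 1#
    R z (suc j) = R z j * (z - p ^ suc j)

    R-cong : ∀ {a b} j → a ≈ b → R a j ≈ R b j
    R-cong zero    e = refl
    R-cong (suc j) e = *-cong (R-cong j e) (+-congʳ e)

    p^≉0 : ∀ k → p ^ k ≉ 0#
    p^≉0 k = ^-≉0 k p≉0

    N≉0 : ∀ j → N j ≉ 0#
    N≉0 zero    = 1≉0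
    N≉0 (suc j) = *-≉0 (N≉0 j) (neg-≉0 (p^≉0 (suc j)))

    -- Each factor u p^(i+j) - p^l equals -p^l (1 - u p^(i+j-l)); for l from 1 to j these are the
    -- last j factors of (u;p)_(i+j).
    poch-reverse : ∀ u i j → poch u i * R (u * p ^ (i ℕ.+ j)) j ≈ poch u (i ℕ.+ j) * N j
    poch-reverse u i zero = *-congʳ (reflexive (≡.cong (poch u) (≡.sym (ℕP.+-identityʳ i))))
    poch-reverse u i (suc j) = begin
      poch u i * (R z j * (z - p ^ suc j))
        ≈⟨ solve-with (u ∷ p ∷ p ^ i ∷ p ^ j ∷ poch u i ∷ R z j ∷ [])
             (z ≔ (λ u p I J U R → u :* (I :* (J :* p))) by *-congˡ (^-+ p i (suc j)) ∷ [])
             (λ u p I J U R z → U :* (R :* (z :- J :* p)) := (U :* (:1 :- u :* I)) :* R :* :- (J :* p)) ≡.refl _ ⟩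
      poch u (suc i) * R z j * - p ^ suc j
        ≈⟨ *-congʳ (*-congˡ (R-cong j (*-congˡ (reflexive (≡.cong (p ^_) (ℕP.+-suc i j)))))) ⟩
      poch u (suc i) * R (u * p ^ (suc i ℕ.+ j)) j * - p ^ suc j
        ≈⟨ *-congʳ (poch-reverse u (suc i) j) ⟩
      poch u (suc i ℕ.+ j) * N j * - p ^ suc j
        ≈⟨ trans (*-assoc _ _ _) (*-congʳ (reflexive (≡.cong (poch u) (≡.sym (ℕP.+-suc i j))))) ⟩
      poch u (i ℕ.+ suc j) * N (suc j) ∎
      where z = u * p ^ (i ℕ.+ suc j)

    R-1 : ∀ j → R 1# j ≈ P j
    R-1 zero    = refl
    R-1 (suc j) = *-cong (R-1 j) (+-congˡ (-‿cong (*-comm _ _)))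

    P-shift : ∀ i j → P (i ℕ.+ j) ≈ P j * poch (p * p ^ j) i
    P-shift i j = trans (reflexive (≡.cong P (ℕP.+-comm i j))) (poch-+ p j i)

    module _ (u : Carrier) (u≉0 : u ≉ 0#) where
      -- `E j` is (p/u;p)_j u^j N_j, in a form without division.
      U E : ℕ → Carrier
      U = poch u
      E zero    = 1#
      E (suc j) = E j * (p ^ suc j * (p ^ suc j - u))

      u^≉0 : ∀ k → u ^ k ≉ 0#
      u^≉0 k = ^-≉0 k u≉0

      E-poch : ∀ j → E j ≈ poch (p / u) j * u ^ j * N j
      E-poch zero    = solve [] (:1 := :1 :* :1 :* :1) ≡.refl _
      E-poch (suc j) = trans (*-congʳ (E-poch j)) (solve (p ∷ u ∷ p ^ j ∷ poch (p / u) j ∷ u ^ j ∷ N j ∷ [])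
        (λ p u J A u' N → A :* u' :* N :* ((J :* p) :* (J :* p :- u)) := (A :* (:1 :- p :/ u :* J)) :* (u' :* u) :* (N :* :- (J :* p))) ≡.refl u≉0)

      R-p/u : ∀ k → R (p / u) k ≈ p ^ k / u ^ k * U k
      R-p/u zero    = solve [] (:1 := :1 :/ :1 :* :1) ≡.refl 1≉0
      R-p/u (suc k) = trans (*-congʳ (R-p/u k)) (solve (p ∷ u ∷ p ^ k ∷ u ^ k ∷ U k ∷ [])
        (λ p u K u' U → K :/ u' :* U :* (p :/ u :- K :* p) := (K :* p) :/ (u' :* u) :* (U :* (:1 :- u :* K))) ≡.refl (u^≉0 k , u≉0 , u^≉0 (suc k)))

      private
        -- The q-Saalschütz sum at a = u p^k, b = p/u, w = p^(-k). Then a w = u and a b w = p, while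
        -- (b w;p)_k reverses to a power factor times U_k, so the product side is essentially U_k².
        -- The common factor (w;p)_k equals P_k / N_k and may be divided out.
        module Inner (k : ℕ) where
          w v : Carrier
          w = (p ^ k) ⁻¹
          v = p / u * w
          wp^k : w * p ^ k ≈ 1#
          wp^k = inverseˡ (p^≉0 k)

          w-top : P k ≈ poch w k * N k
          w-top = begin
            P k                   ≈⟨ R-1 k ⟨
            R 1# k                ≈⟨ R-cong k (sym wp^k) ⟩
            R (w * p ^ k) k       ≈⟨ *-identityˡ _ ⟨
            1# * R (w * p ^ k) k  ≈⟨ poch-reverse w 0 k ⟩
            poch w k * N k        ∎

          w-mid : ∀ i j → i ℕ.+ j ≡ k → poch w i * P j ≈ poch w k * N j
          w-mid i j ≡.refl = trans (*-congˡ (trans (sym (R-1 j)) (R-cong j (sym wp^k)))) (poch-reverse w i j)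

          v-top : p ^ k / u ^ k * U k ≈ poch v k * N k
          v-top = begin
            p ^ k / u ^ k * U k   ≈⟨ R-p/u k ⟨
            R (p / u) k           ≈⟨ R-cong k (trans (sym (*-identityʳ _)) (trans (*-congˡ (sym wp^k)) (sym (*-assoc _ _ _)))) ⟩
            R (v * p ^ k) k       ≈⟨ *-identityˡ _ ⟨
            1# * R (v * p ^ k) k  ≈⟨ poch-reverse v 0 k ⟩
            poch v k * N k        ∎

          poch-w≉0 : poch w k ≉ 0#
          poch-w≉0 e = P≉0 k (trans w-top (trans (*-congʳ e) (zeroˡ _)))

          square : ℕ → ℕ → Carrier
          square i j = P k * P k / (P i * P j ^ 3) * poch (u * p ^ k) j * E j / (u ^ j * (p ^ k) ^ j)

          w^j : ∀ j → w ^ j * (p ^ k) ^ j ≈ 1#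
          w^j j = trans (sym (^-* _ _ j)) (trans (^-cong j wp^k) (1^ j))

          square-summand : ∀ i j → i ℕ.+ j ≡ k → poch w k * square i j ≈ summand (u * p ^ k) (p / u) w i j
          square-summand i j e = begin
            poch w k * square i j
              ≈⟨ *-congˡ (/-cong (*-congˡ (E-poch j)) refl) ⟩
            poch w k * (P k * P k / (P i * P j ^ 3) * poch (u * p ^ k) j * (poch (p / u) j * u ^ j * N j) / (u ^ j * (p ^ k) ^ j))
              ≈⟨ solve (P k ∷ P i ∷ P j ∷ poch (u * p ^ k) j ∷ poch (p / u) j ∷ u ^ j ∷ N j ∷ (p ^ k) ^ j ∷ poch w k ∷ [])
                   (λ Pk Pi Pj A B u' N K' W → W :* (Pk :* Pk :/ (Pi :* Pj :^ 3) :* A :* (B :* u' :* N) :/ (u' :* K')) := Pk :* Pk :/ (Pi :* Pj :* Pj) :* A :* B :* ((W :* N) :/ Pj) :/ K')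
                   ≡.refl (*-≉0 (P≉0 i) (^-≉0 3 (P≉0 j)) , *-≉0 (u^≉0 j) (^-≉0 j (p^≉0 k)) , *-≉0 (PP≉0 i j) (P≉0 j) , P≉0 j , ^-≉0 j (p^≉0 k)) ⟩
            P k * P k / (P i * P j * P j) * poch (u * p ^ k) j * poch (p / u) j * ((poch w k * N j) / P j) / (p ^ k) ^ j
              ≈⟨ /-cong (*-congˡ (/-cong (sym (w-mid i j e)) refl)) refl ⟩
            P k * P k / (P i * P j * P j) * poch (u * p ^ k) j * poch (p / u) j * ((poch w i * P j) / P j) / (p ^ k) ^ j
              ≈⟨ solve-with (P k ∷ P i ∷ P j ∷ poch (u * p ^ k) j ∷ poch (p / u) j ∷ (p ^ k) ^ j ∷ poch w i ∷ poch (p * p ^ j) i ∷ [])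
                   (P (i ℕ.+ j) ≔ (λ Pk Pi Pj A B K' W C → Pk) by reflexive (≡.cong P e) ∷ [])
                   (λ Pk Pi Pj A B K' W C Pij → Pk :* Pk :/ (Pi :* Pj :* Pj) :* A :* B :* ((W :* Pj) :/ Pj) :/ K' := Pij :/ (Pi :* Pj) :* A :* B :* W :* (:1 :/ K') :* (Pij :/ Pj))
                   ≡.refl (*-≉0 (PP≉0 i j) (P≉0 j) , P≉0 j , ^-≉0 j (p^≉0 k) , PP≉0 i j , ^-≉0 j (p^≉0 k) , P≉0 j) ⟩
            P (i ℕ.+ j) / (P i * P j) * poch (u * p ^ k) j * poch (p / u) j * poch w i * (1# / (p ^ k) ^ j) * (P (i ℕ.+ j) / P j)
              ≈⟨ *-cong (*-congˡ (trans (/-cong (sym (w^j j)) refl) (solve (w ^ j ∷ (p ^ k) ^ j ∷ []) (λ w K → w :* K :/ K := w) ≡.refl (^-≉0 j (p^≉0 k)))))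
                   (trans (/-cong (P-shift i j) refl) (solve (P j ∷ poch (p * p ^ j) i ∷ []) (λ a b → a :* b :/ a := b) ≡.refl (P≉0 j))) ⟩
            P (i ℕ.+ j) / (P i * P j) * poch (u * p ^ k) j * poch (p / u) j * poch w i * w ^ j * poch (p * p ^ j) i
              ≈⟨ *-congˡ (poch-cong i (*-congʳ (sym abw))) ⟩
            summand (u * p ^ k) (p / u) w i j ∎
            where
            abw : u * p ^ k * (p / u) * w ≈ p
            abw = trans (*-congˡ (sym (*-identityˡ w)))
              (solve (u ∷ p ∷ p ^ k ∷ []) (λ u p K → u :* K :* (p :/ u) :* (:1 :/ K) := p) ≡.refl (u≉0 , p^≉0 k))

          square-sum : diag k square ≈ U k * U k / P k * (p ^ k / u ^ k)
          square-sum = *-cancelʳ _ poch-w≉0 (begin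
            diag k square * poch w k                    ≈⟨ *-comm _ _ ⟩
            poch w k * diag k square                    ≈⟨ diag-*ˡ k (poch w k) square ⟩
            diag k (λ i j → poch w k * square i j)      ≈⟨ diag-cong k square-summand ⟩
            diag k (summand (u * p ^ k) (p / u) w)      ≈⟨ saalschütz (u * p ^ k) (p / u) w k ⟩
            poch (u * p ^ k * w) k * poch v k           ≈⟨ *-congʳ (poch-cong k (trans (*-assoc _ _ _) (trans (*-congˡ (inverseʳ (p^≉0 k))) (*-identityʳ _)))) ⟩
            U k * poch v k                              ≈⟨ solve (U k ∷ poch v k ∷ N k ∷ []) (λ U V N → U :* V := U :* (V :* N) :/ N) ≡.refl (N≉0 k) ⟩
            U k * (poch v k * N k) / N k                ≈⟨ /-cong (*-congˡ (sym v-top)) refl ⟩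
            U k * (p ^ k / u ^ k * U k) / N k
              ≈⟨ solve-with (U k ∷ p ^ k ∷ u ^ k ∷ N k ∷ poch w k ∷ []) (P k ≔ (λ U K u' N W → W :* N) by w-top ∷ [])
                   (λ U K u' N W Pk → U :* (K :/ u' :* U) :/ N := U :* U :/ Pk :* (K :/ u') :* W) ≡.refl (u^≉0 k , N≉0 k , P≉0 k , u^≉0 k) ⟩
            U k * U k / P k * (p ^ k / u ^ k) * poch w k ∎)

      -- For p = q^d and u = q^r this is 1 - q times the k-th summand on the left of the theorem.
      term : ℕ → Carrier
      term k = (1# - u * p ^ k * p ^ k) * U k ^ 4 / P k ^ 4 * (p ^ k / (u ^ k * u ^ k))

      part : ℕ → ℕ → Carrier
      part i j = (1# - u * p ^ (i ℕ.+ j) * p ^ (i ℕ.+ j)) * U (i ℕ.+ j) * U (i ℕ.+ j ℕ.+ j) * E j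
        / (P (i ℕ.+ j) * P i * P j ^ 3 * u ^ (i ℕ.+ j ℕ.+ j) * (p ^ (i ℕ.+ j)) ^ j)

      -- One factor U_k²/P_k (p/u)^k of the term is expanded into a sum over i + j = k. The purpose
      -- is that the resulting double sum can be summed in closed form over i for fixed j.
      term-parts : ∀ k → term k ≈ diag k part
      term-parts k = begin
        term k
          ≈⟨ solve (1# - u * p ^ k * p ^ k ∷ U k ∷ P k ∷ p ^ k ∷ u ^ k ∷ [])
               (λ d U P K u' → d :* U :^ 4 :/ P :^ 4 :* (K :/ (u' :* u')) := (d :* U :^ 2 :/ (P :^ 3 :* u')) :* (U :* U :/ P :* (K :/ u')))
               ≡.refl (^-≉0 4 (P≉0 k) , *-≉0 (u^≉0 k) (u^≉0 k) , *-≉0 (^-≉0 3 (P≉0 k)) (u^≉0 k) , P≉0 k , u^≉0 k) ⟩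
        c * (U k * U k / P k * (p ^ k / u ^ k))      ≈⟨ *-congˡ square-sum ⟨
        c * diag k square                            ≈⟨ diag-*ˡ k c square ⟩
        diag k (λ i j → c * square i j)              ≈⟨ diag-cong k eq ⟩
        diag k part                                  ∎
        where
        open Inner k
        c = (1# - u * p ^ k * p ^ k) * U k ^ 2 / (P k ^ 3 * u ^ k)
        eq : ∀ i j → i ℕ.+ j ≡ k → c * square i j ≈ part i j
        eq i j ≡.refl = solve-with
          (1# - u * p ^ k * p ^ k ∷ U k ∷ P k ∷ P i ∷ P j ∷ poch (u * p ^ k) j ∷ E j ∷ u ^ k ∷ u ^ j ∷ (p ^ k) ^ j ∷ [])
          (U (k ℕ.+ j) ≔ (λ d U Pk Pi Pj A E uk uj K' → U :* A) by poch-+ u k j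
          ∷ u ^ (k ℕ.+ j) ≔ (λ d U Pk Pi Pj A E uk uj K' → uk :* uj) by ^-+ u k j ∷ [])
          (λ d U Pk Pi Pj A E uk uj K' Ukj ukj →
            d :* U :^ 2 :/ (Pk :^ 3 :* uk) :* (Pk :* Pk :/ (Pi :* Pj :^ 3) :* A :* E :/ (uj :* K')) := d :* U :* Ukj :* E :/ (Pk :* Pi :* Pj :^ 3 :* ukj :* K'))
          ≡.refl (*-≉0 (^-≉0 3 (P≉0 k)) (u^≉0 k) , *-≉0 (P≉0 i) (^-≉0 3 (P≉0 j)) , *-≉0 (u^≉0 j) (^-≉0 j (p^≉0 k))
                 , *-≉0 (*-≉0 (*-≉0 (PP≉0 k i) (^-≉0 3 (P≉0 j))) (u^≉0 (k ℕ.+ j))) (^-≉0 j (p^≉0 k)))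

      module _ (1-up^≉0 : ∀ j → 1# - u * p ^ j ≉ 0#) where
        -- The indefinite sum of `part i j` over i. The divisor 1 - u p^j arises from this
        -- summation; it is the later source of a pole at y = 0.
        column : ℕ → ℕ → Carrier
        column i j = U (suc (i ℕ.+ j)) * U (suc (i ℕ.+ j ℕ.+ j)) * E j
          / (P (i ℕ.+ j) * P i * P j ^ 3 * u ^ (i ℕ.+ j ℕ.+ j) * (p ^ (i ℕ.+ j)) ^ j * (1# - u * p ^ j))

        private
          den≉0 : ∀ i j → P (i ℕ.+ j) * P i * P j ^ 3 * u ^ (i ℕ.+ j ℕ.+ j) * (p ^ (i ℕ.+ j)) ^ j ≉ 0#
          den≉0 i j = *-≉0 (*-≉0 (*-≉0 (PP≉0 (i ℕ.+ j) i) (^-≉0 3 (P≉0 j))) (u^≉0 (i ℕ.+ j ℕ.+ j))) (^-≉0 j (p^≉0 (i ℕ.+ j)))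

        column-sum : ∀ i j → ∑ (suc i) (λ k → part k j) ≈ column i j
        column-sum zero j = solve-with
          (u ∷ p ∷ p ^ j ∷ U j ∷ U (j ℕ.+ j) ∷ E j ∷ P j ∷ u ^ (j ℕ.+ j) ∷ (p ^ j) ^ j ∷ [])
          (p ^ (j ℕ.+ j) ≔ (λ u p J U U' E P uj K' → J :* J) by ^-+ p j j ∷ [])
          (λ u p J U U' E P uj K' JJ →
            :0 :+ (:1 :- u :* J :* J) :* U :* U' :* E :/ (P :* :1 :* P :^ 3 :* uj :* K')
            := U :* (:1 :- u :* J) :* (U' :* (:1 :- u :* JJ)) :* E :/ (P :* :1 :* P :^ 3 :* uj :* K' :* (:1 :- u :* J)))
          ≡.refl (den≉0 0 j , *-≉0 (den≉0 0 j) (1-up^≉0 j))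
        column-sum (suc i) j = trans (+-congʳ (column-sum i j)) (solve-with
          (u ∷ p ∷ p ^ i ∷ p ^ j ∷ U (i ℕ.+ j) ∷ U (i ℕ.+ j ℕ.+ j) ∷ E j ∷ P (i ℕ.+ j) ∷ P i ∷ P j ∷ u ^ (i ℕ.+ j ℕ.+ j) ∷ (p ^ (i ℕ.+ j)) ^ j ∷ [])
          (p ^ (i ℕ.+ j) ≔ (λ u p I J U U' E Pk Pi Pj uk K' → I :* J) by ^-+ p i j
          ∷ p ^ (i ℕ.+ j ℕ.+ j) ≔ (λ u p I J U U' E Pk Pi Pj uk K' → I :* J :* J) by trans (^-+ p (i ℕ.+ j) j) (*-congʳ (^-+ p i j))
          ∷ (p ^ (suc i ℕ.+ j)) ^ j ≔ (λ u p I J U U' E Pk Pi Pj uk K' → K' :* J) by ^-* (p ^ (i ℕ.+ j)) p j ∷ [])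
          (λ u p I J U U' E Pk Pi Pj uk K' Q Q' K'' →
            (U :* (:1 :- u :* Q)) :* (U' :* (:1 :- u :* Q')) :* E :/ (Pk :* Pi :* Pj :^ 3 :* uk :* K' :* (:1 :- u :* J))
            :+ (:1 :- u :* (Q :* p) :* (Q :* p)) :* (U :* (:1 :- u :* Q)) :* (U' :* (:1 :- u :* Q')) :* E
               :/ (Pk :* (:1 :- p :* Q) :* (Pi :* (:1 :- p :* I)) :* Pj :^ 3 :* (uk :* u) :* K'')
            := (U :* (:1 :- u :* Q) :* (:1 :- u :* (Q :* p))) :* (U' :* (:1 :- u :* Q') :* (:1 :- u :* (Q' :* p))) :* E
               :/ (Pk :* (:1 :- p :* Q) :* (Pi :* (:1 :- p :* I)) :* Pj :^ 3 :* (uk :* u) :* K'' :* (:1 :- u :* J)))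
          ≡.refl (*-≉0 (den≉0 i j) (1-up^≉0 j) , den≉0 (suc i) j , *-≉0 (den≉0 (suc i) j) (1-up^≉0 j)))

        -- The truncation m only bounds the inner indefinite sums once the order of summation is
        -- exchanged, so the formula holds for every m, not just for the two truncations of the
        -- theorem.
        partial-sum : ∀ m → ∑ (suc m) term ≈ diag m column
        partial-sum m = begin
          ∑ (suc m) term                                 ≈⟨ ∑-cong (suc m) (λ k _ → term-parts k) ⟩
          ∑ (suc m) (λ k → diag k part)                  ≈⟨ ∑-diag m part ⟩
          diag m (λ i j → ∑ (suc i) (λ k → part k j))    ≈⟨ diag-cong m (λ i j _ → column-sum i j) ⟩
          diag m column                                  ∎

-- An Apéry-type double sum and its first-order recurrence

module ApérySums where

  open import Data.Nat as ℕ using (ℕ; zero; suc)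
  import Data.Nat.Properties as ℕP
  open import Data.Vec using ([]; _∷_)
  open import Data.Product using (_,_)
  open import Relation.Binary.PropositionalEquality as ≡ using (_≡_)
  open Fields
  open FieldSolver
  open QSeries
  open WellPoised

  module Apéry (K : Field) (p : Field.Carrier K)
    (p≉0 : Field._≉_ K p (Field.0# K))
    (1-p^≉0 : ∀ k → Field._≉_ K (Field._-_ K (Field.1# K) (Field._*_ K p (FieldLemmas._^_ K p k))) (Field.0# K))
    where
    open FieldLemmas K
    open Sums K
    open QPochhammer K p
    open Saalschütz K p 1-p^≉0
    open WellPoisedSum K p p≉0 1-p^≉0 hiding (U)

    -- Indices are shifted by one: `d k` is 1 - p^(k+1), the last factor of `P (suc k)`. Hence
    -- `H i j` sums p^l/(1 - p^l)² over j < l ≤ i + j.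
    d h : ℕ → Carrier
    d k = 1# - p * p ^ k
    h k = p * p ^ k / (d k * d k)

    d≉0 : ∀ k → d k ≉ 0#
    d≉0 = 1-p^≉0

    H : ℕ → ℕ → Carrier
    H i j = ∑ i (λ l → h (j ℕ.+ l))

    H-head : ∀ i j → H (suc i) j ≈ h j + H i (suc j)
    H-head i j = trans (∑-head i _) (+-cong (reflexive (≡.cong h (ℕP.+-identityʳ j)))
      (∑-cong i (λ l _ → reflexive (≡.cong h (ℕP.+-suc j l)))))

    -- (-1)^j p^(j(j-1)/2).
    σ : ℕ → Carrier
    σ zero    = 1#
    σ (suc j) = σ j * - p ^ j

    N-σ : ∀ j → N j ≈ p ^ j * σ j
    N-σ zero    = solve [] (:1 := :1 :* :1) ≡.refl _
    N-σ (suc j) = trans (*-congʳ (N-σ j)) (solve (p ∷ p ^ j ∷ σ j ∷ []) (λ p J s → J :* s :* :- (J :* p) := (J :* p) :* (s :* :- J)) ≡.refl _)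

    V G : ℕ → ℕ → Carrier
    V i j = P (suc (i ℕ.+ j ℕ.+ j))
    G i j = (p ^ suc (i ℕ.+ j)) ^ j

    private
      two three : Carrier
      two   = 1# + 1#
      three = 1# + 1# + 1#

      e₂ : ∀ i j → p ^ (i ℕ.+ suc j) ≈ p ^ i * (p ^ j * p)
      e₂ i j = ^-+ p i (suc j)

      e₃ : ∀ i j → p ^ (i ℕ.+ j ℕ.+ j) ≈ p ^ i * p ^ j * p ^ j
      e₃ i j = trans (^-+ p (i ℕ.+ j) j) (*-congʳ (^-+ p i j))

      1-cong : ∀ {a b} → a ≈ b → 1# - p * a ≈ 1# - p * b
      1-cong e = +-congˡ (-‿cong (*-congˡ e))

    V-sucˡ : ∀ i j → V (suc i) j ≈ V i j * (1# - p * (p ^ i * p ^ j * p ^ j * p))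
    V-sucˡ i j = *-congˡ (1-cong (*-congʳ (e₃ i j)))

    V-sucʳ : ∀ i j → V i (suc j) ≈ V i j * (1# - p * (p ^ i * p ^ j * p ^ j * p)) * (1# - p * (p ^ i * p ^ j * p ^ j * p * p))
    V-sucʳ i j = trans (reflexive (≡.cong P (≡.cong suc (≡.trans (ℕP.+-suc (i ℕ.+ suc j) j) (≡.cong suc (≡.cong (ℕ._+ j) (ℕP.+-suc i j)))))))
      (*-cong (V-sucˡ i j) (1-cong (*-congʳ (*-congʳ (e₃ i j)))))

    G-sucˡ : ∀ i j → G (suc i) j ≈ G i j * p ^ j
    G-sucˡ i j = ^-* _ p j

    G-sucʳ : ∀ i j → G i (suc j) ≈ G i j * p ^ j * (p ^ i * (p ^ j * p) * p)
    G-sucʳ i j = *-cong (trans (^-cong j (*-congʳ (reflexive (≡.cong (p ^_) (ℕP.+-suc i j))))) (^-* _ p j)) (*-congʳ (e₂ i j))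

    G≉0 : ∀ i j → G i j ≉ 0#
    G≉0 i j = ^-≉0 j (p^≉0 (suc (i ℕ.+ j)))

    -- The value of `β u (suc i) j` at u = p^(-(i+j+1)), see `β-weight`. For n = i + j it is, up to
    -- sign and power of p, the Apéry-like (p;p)_(n+j+1) / ((p;p)_j² (p;p)_(n-j+1) (1 - p^(n-j+1))).
    weight : ℕ → ℕ → Carrier
    weight i j = - (σ j * V i j) / (G i j * P j * P j * P (suc i) * d i)

    S : ℕ → Carrier
    S n = diag n (λ i j → weight i j * H (suc i) j)

    -- The coefficients of the first-order recurrence satisfied by both S and T.
    α γ : ℕ → Carrier
    α n = d (suc n) * d (suc n)
    γ n = (1# - p ^ suc (suc n) * p ^ suc (suc n)) * (1# - p ^ suc (suc n) * p ^ suc n) / p ^ suc (suc n)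

    private
      cert cert' : ℕ → ℕ → Carrier
      cert i j = - (σ (suc j) * V (suc i) j) / (G i (suc j) * P j * P j * P (suc i) * d i)
        * (p ^ suc (suc (i ℕ.+ j)) * p ^ suc i * (p ^ suc (suc (i ℕ.+ j)) + two) - (two * p ^ suc (suc (i ℕ.+ j)) + 1#))
      cert' i zero    = 0#
      cert' i (suc j) = cert (suc i) j

      w≉0 : ∀ i j i' j' → G i' j' * P j * P j * P (suc i) * d i ≉ 0#
      w≉0 i j i' j' = *-≉0 (*-≉0 (*-≉0 (*-≉0 (G≉0 i' j') (P≉0 j)) (P≉0 j)) (P≉0 (suc i))) (d≉0 i)

      -- Creative telescoping for the weights without their harmonic factor. That factor is restored
      -- by summation by parts, since between neighbours of an antidiagonal it changes by a single
      -- `h`.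
      recurrence : ∀ i j → α (i ℕ.+ j) * weight (suc i) j + γ (i ℕ.+ j) * weight i j ≈ cert i j - cert' i j
      recurrence i zero = solve-with (p ∷ p ^ i ∷ P i ∷ V i 0 ∷ [])
        (p ^ (i ℕ.+ 0) ≔ (λ p I P V → I) by reflexive (≡.cong (p ^_) (ℕP.+-identityʳ i))
        ∷ V (suc i) 0 ≔ (λ p I P V → V :* (:1 :- p :* (I :* :1 :* :1 :* p))) by V-sucˡ i 0
        ∷ G i 1 ≔ (λ p I P V → I :* p :* p) by trans (G-sucʳ i 0) (solve (p ∷ p ^ i ∷ []) (λ p I → :1 :* :1 :* (I :* (:1 :* p) :* p) := I :* p :* p) ≡.refl _)
        ∷ [])
        (λ p I P V Q V' G →
          let d = λ a → :1 :- p :* a ; 2' = :1 :+ :1 in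
          (d (Q :* p) :* d (Q :* p)) :* (:- (:1 :* V') :/ (:1 :* :1 :* :1 :* (P :* d I :* d (I :* p)) :* d (I :* p)))
          :+ ((:1 :- (Q :* p :* p) :* (Q :* p :* p)) :* (:1 :- (Q :* p :* p) :* (Q :* p)) :/ (Q :* p :* p)) :* (:- (:1 :* V) :/ (:1 :* :1 :* :1 :* (P :* d I) :* d I))
          := :- (:1 :* :- :1 :* V') :/ (G :* :1 :* :1 :* (P :* d I) :* d I)
             :* ((Q :* p :* p) :* (I :* p) :* (Q :* p :* p :+ 2') :- (2' :* (Q :* p :* p) :+ :1)) :- :0)
        ≡.refl (w≉0 (suc i) 0 0 0 , p^≉0 (suc (suc (i ℕ.+ 0))) , w≉0 i 0 0 0 , w≉0 i 0 i 1)
      recurrence i (suc j) = begin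
        α (i ℕ.+ suc j) * weight (suc i) (suc j) + γ (i ℕ.+ suc j) * weight i (suc j)
          ≈⟨ +-cong (*-congˡ eq₁) (*-congˡ eq₂) ⟩
        α (i ℕ.+ suc j) * (ω * r₁) + γ (i ℕ.+ suc j) * (ω * r₂)
          ≈⟨ solve-with (p ∷ p ^ i ∷ p ^ j ∷ ω ∷ [])
               (p ^ (i ℕ.+ suc j) ≔ (λ p I J ω → I :* (J :* p)) by e₂ i j ∷ p ^ (i ℕ.+ j) ≔ (λ p I J ω → I :* J) by ^-+ p i j ∷ [])
               (λ p I J ω Q0 K0 →
                 let d = λ a → :1 :- p :* a ; 2' = :1 :+ :1 ; Q = Q0 :* p :* p ; K = K0 :* p :* p :* p ; J' = J :* p in
                 (d (Q0 :* p) :* d (Q0 :* p)) :* (ω :* (d (I :* J' :* J' :* p) :/ (J' :* d (I :* p) :* d (I :* p))))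
                 :+ ((:1 :- Q :* Q) :* (:1 :- Q :* (Q0 :* p)) :/ Q) :* (ω :* (:1 :/ d I))
                 := ω :* (:- d (I :* J' :* J' :* p) :/ (I :* J' :* p :* p :* d I) :* (Q :* (I :* p) :* (Q :+ 2') :- (2' :* Q :+ :1)))
                    :- ω :* ((d J :* d J) :/ (J' :* d (I :* p) :* d (I :* p)) :* (K :* (I :* p :* p) :* (K :+ 2') :- (2' :* K :+ :1))))
               ≡.refl (*-≉0 (*-≉0 J'≉0 (d≉0 (suc i))) (d≉0 (suc i)) , p^≉0 (suc (suc (i ℕ.+ suc j))) , d≉0 i
                      , *-≉0 (*-≉0 (*-≉0 (*-≉0 (p^≉0 i) J'≉0) p≉0) p≉0) (d≉0 i) , *-≉0 (*-≉0 J'≉0 (d≉0 (suc i))) (d≉0 (suc i))) ⟩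
        ω * (r₃ * t (p ^ suc (suc (i ℕ.+ suc j))) (p ^ suc i)) - ω * (r₄ * t (p ^ suc (suc (suc i ℕ.+ j))) (p ^ suc (suc i)))
          ≈⟨ sub-cong (trans (sym (*-assoc _ _ _)) (*-congʳ (sym eq₃))) (trans (sym (*-assoc _ _ _)) (*-congʳ (sym eq₄))) ⟩
        cert i (suc j) - cert' i (suc j) ∎
        where
        J' = p ^ suc j
        J'≉0 : J' ≉ 0#
        J'≉0 = p^≉0 (suc j)
        t : Carrier → Carrier → Carrier
        t Q I = Q * I * (Q + two) - (two * Q + 1#)
        d' : Carrier → Carrier
        d' a = 1# - p * a
        ω r₁ r₂ r₃ r₄ : Carrier
        -- The common factor of all four terms: the two weights and the two certificates are `ω`
        -- times rational functions of p, p^i and p^j.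
        ω  = - (σ (suc j) * V i (suc j)) / (G i (suc j) * P (suc j) * P (suc j) * P (suc i))
        r₁ = d' (p ^ i * J' * J' * p) / (J' * d (suc i) * d (suc i))
        r₂ = 1# / d i
        r₃ = - d' (p ^ i * J' * J' * p) / (p ^ i * J' * p * p * d i)
        r₄ = d j * d j / (J' * d (suc i) * d (suc i))
        ω≉0 : G i (suc j) * P (suc j) * P (suc j) * P (suc i) ≉ 0#
        ω≉0 = *-≉0 (*-≉0 (*-≉0 (G≉0 i (suc j)) (P≉0 (suc j))) (P≉0 (suc j))) (P≉0 (suc i))
        eq₁ : weight (suc i) (suc j) ≈ ω * r₁
        eq₁ = solve-with (p ∷ p ^ i ∷ p ^ j ∷ P (suc i) ∷ P (suc j) ∷ σ (suc j) ∷ V i (suc j) ∷ G i (suc j) ∷ [])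
          (V (suc i) (suc j) ≔ (λ p I J Pi Pj s V G → V :* (:1 :- p :* (I :* (J :* p) :* (J :* p) :* p))) by V-sucˡ i (suc j)
          ∷ G (suc i) (suc j) ≔ (λ p I J Pi Pj s V G → G :* (J :* p)) by G-sucˡ i (suc j) ∷ [])
          (λ p I J Pi Pj s V G V' G' → let d = λ a → :1 :- p :* a in
            :- (s :* V') :/ (G' :* Pj :* Pj :* (Pi :* d (I :* p)) :* d (I :* p))
            := :- (s :* V) :/ (G :* Pj :* Pj :* Pi) :* (d (I :* (J :* p) :* (J :* p) :* p) :/ ((J :* p) :* d (I :* p) :* d (I :* p))))
          ≡.refl (w≉0 (suc i) (suc j) (suc i) (suc j) , ω≉0 , *-≉0 (*-≉0 J'≉0 (d≉0 (suc i))) (d≉0 (suc i)))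
        eq₂ : weight i (suc j) ≈ ω * r₂
        eq₂ = solve (- (σ (suc j) * V i (suc j)) ∷ G i (suc j) * P (suc j) * P (suc j) * P (suc i) ∷ d i ∷ [])
          (λ n D d → n :/ (D :* d) := n :/ D :* (:1 :/ d)) ≡.refl (*-≉0 ω≉0 (d≉0 i) , ω≉0 , d≉0 i)
        eq₃ : - (σ (suc (suc j)) * V (suc i) (suc j)) / (G i (suc (suc j)) * P (suc j) * P (suc j) * P (suc i) * d i) ≈ ω * r₃
        eq₃ = solve-with (p ∷ p ^ i ∷ p ^ j ∷ P (suc i) ∷ P (suc j) ∷ σ (suc j) ∷ V i (suc j) ∷ G i (suc j) ∷ d i ∷ [])
          (V (suc i) (suc j) ≔ (λ p I J Pi Pj s V G d → V :* (:1 :- p :* (I :* (J :* p) :* (J :* p) :* p))) by V-sucˡ i (suc j)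
          ∷ G i (suc (suc j)) ≔ (λ p I J Pi Pj s V G d → G :* (J :* p) :* (I :* ((J :* p) :* p) :* p)) by G-sucʳ i (suc j) ∷ [])
          (λ p I J Pi Pj s V G di V' G' → let d = λ a → :1 :- p :* a ; J' = J :* p in
            :- (s :* :- J' :* V') :/ (G' :* Pj :* Pj :* Pi :* di)
            := :- (s :* V) :/ (G :* Pj :* Pj :* Pi) :* (:- d (I :* J' :* J' :* p) :/ (I :* J' :* p :* p :* di)))
          ≡.refl (w≉0 i (suc j) i (suc (suc j)) , ω≉0 , *-≉0 (*-≉0 (*-≉0 (*-≉0 (p^≉0 i) J'≉0) p≉0) p≉0) (d≉0 i))
        eq₄ : - (σ (suc j) * V (suc (suc i)) j) / (G (suc i) (suc j) * P j * P j * P (suc (suc i)) * d (suc i)) ≈ ω * r₄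
        eq₄ = solve-with (p ∷ p ^ i ∷ p ^ j ∷ P (suc i) ∷ P j ∷ σ (suc j) ∷ V i j ∷ G i (suc j) ∷ [])
          (V (suc (suc i)) j ≔ (λ p I J Pi Pj s V G → V :* (:1 :- p :* (I :* J :* J :* p)) :* (:1 :- p :* (I :* p :* J :* J :* p)))
            by trans (V-sucˡ (suc i) j) (*-congʳ (V-sucˡ i j))
          ∷ V i (suc j) ≔ (λ p I J Pi Pj s V G → V :* (:1 :- p :* (I :* J :* J :* p)) :* (:1 :- p :* (I :* J :* J :* p :* p))) by V-sucʳ i j
          ∷ G (suc i) (suc j) ≔ (λ p I J Pi Pj s V G → G :* (J :* p)) by G-sucˡ i (suc j) ∷ [])
          (λ p I J Pi Pj s V G V20 V01 G' → let d = λ a → :1 :- p :* a ; J' = J :* p in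
            :- (s :* V20) :/ (G' :* Pj :* Pj :* (Pi :* d (I :* p)) :* d (I :* p))
            := :- (s :* V01) :/ (G :* (Pj :* d J) :* (Pj :* d J) :* Pi) :* ((d J :* d J) :/ (J' :* d (I :* p) :* d (I :* p))))
          ≡.refl (w≉0 (suc i) j (suc i) (suc j) , ω≉0 , *-≉0 (*-≉0 J'≉0 (d≉0 (suc i))) (d≉0 (suc i)))

      -- Summation by parts: `H-head` splits off h j, and the remaining H i (suc j) makes the
      -- products telescope. The surviving boundary entry has i = 0, where the harmonic sum is
      -- empty.
      abel : ∀ n (f g : ℕ → ℕ → Carrier) → (∀ i → g i 0 ≈ 0#) → (∀ i j → g i (suc j) ≈ f (suc i) j) →
             diag n (λ i j → (f i j - g i j) * H (suc i) j) ≈ diag n (λ i j → f i j * h j)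
      abel n f g h₀ h₁ = begin
        diag n (λ i j → (f i j - g i j) * H (suc i) j)
          ≈⟨ diag-cong n (λ i j _ → trans (solve (f i j ∷ g i j ∷ H (suc i) j ∷ []) (λ f g H → (f :- g) :* H := f :* H :- g :* H) ≡.refl _)
               (trans (+-congʳ (trans (*-congˡ (H-head i j)) (distribˡ _ _ _))) (+-assoc _ _ _))) ⟩
        diag n (λ i j → f i j * h j + (F i j - F' i j))  ≈⟨ diag-+ n _ _ ⟩
        diag n (λ i j → f i j * h j) + diag n (λ i j → F i j - F' i j)
          ≈⟨ +-congˡ (diag-telescope n F F' (λ i → trans (*-congʳ (h₀ i)) (zeroˡ _)) (λ i j → *-congʳ (h₁ i j))) ⟩
        diag n (λ i j → f i j * h j) + f 0 n * 0#        ≈⟨ trans (+-congˡ (zeroʳ _)) (+-identityʳ _) ⟩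
        diag n (λ i j → f i j * h j)                     ∎
        where
        F F' : ℕ → ℕ → Carrier
        F  i j = f i j * H i (suc j)
        F' i j = g i j * H (suc i) j

      Q : ℕ → Carrier
      Q n = p ^ suc (suc n)

      -- On the antidiagonal n + 1 every harmonic factor ends in the same term h_(n+1), whose
      -- denominator is `α n`; this yields `Q n` times the plain sum of weights. The rest vanishes
      -- at i = 0, so it lives on the antidiagonal n, where `recurrence` and `abel` apply.
      S-step : ∀ n → α n * S (suc n) + γ n * S n ≈ diag n (λ i j → cert i j * h j) + Q n * diag (suc n) weight
      S-step n = begin
        α n * S (suc n) + γ n * S n
          ≈⟨ +-congʳ (*-congˡ (trans (diag-cong (suc n) split) (diag-+ (suc n) W₀ W₁))) ⟩
        α n * (diag (suc n) W₀ + diag (suc n) W₁) + γ n * S n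
          ≈⟨ +-congʳ (*-congˡ (+-cong last₀ (sym (diag-*ˡ (suc n) (h (suc n)) weight)))) ⟩
        α n * (diag n W₀' + h (suc n) * diag (suc n) weight) + γ n * S n
          ≈⟨ solve (d (suc n) ∷ p * p ^ suc n ∷ γ n ∷ diag n W₀' ∷ S n ∷ diag (suc n) weight ∷ [])
               (λ d q γ a s w → d :* d :* (a :+ q :/ (d :* d) :* w) :+ γ :* s := d :* d :* a :+ γ :* s :+ q :* w) ≡.refl (*-≉0 (d≉0 (suc n)) (d≉0 (suc n))) ⟩
        α n * diag n W₀' + γ n * S n + p * p ^ suc n * diag (suc n) weight
          ≈⟨ +-cong (trans (+-cong (diag-*ˡ n (α n) W₀') (diag-*ˡ n (γ n) _)) (sym (diag-+ n _ _))) (*-congʳ (*-comm _ _)) ⟩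
        diag n (λ i j → α n * W₀' i j + γ n * (weight i j * H (suc i) j)) + Q n * diag (suc n) weight
          ≈⟨ +-congʳ (diag-cong n step) ⟩
        diag n (λ i j → (cert i j - cert' i j) * H (suc i) j) + Q n * diag (suc n) weight
          ≈⟨ +-congʳ (abel n cert cert' (λ i → refl) (λ i j → refl)) ⟩
        diag n (λ i j → cert i j * h j) + Q n * diag (suc n) weight ∎
        where
        W₀ W₁ W₀' : ℕ → ℕ → Carrier
        W₀  i j = weight i j * H i j
        W₁  i j = h (suc n) * weight i j
        W₀' i j = weight (suc i) j * H (suc i) j
        split : ∀ i j → i ℕ.+ j ≡ suc n → weight i j * H (suc i) j ≈ W₀ i j + W₁ i j
        split i j e = trans (distribˡ _ _ _) (+-congˡ (trans (*-congˡ (reflexive (≡.cong h (≡.trans (ℕP.+-comm j i) e)))) (*-comm _ _)))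
        last₀ : diag (suc n) W₀ ≈ diag n W₀'
        last₀ = trans (diag-last n W₀) (trans (+-congˡ (zeroʳ _)) (+-identityʳ _))
        step : ∀ i j → i ℕ.+ j ≡ n → α n * W₀' i j + γ n * (weight i j * H (suc i) j) ≈ (cert i j - cert' i j) * H (suc i) j
        step i j ≡.refl = trans (solve (α n ∷ γ n ∷ weight (suc i) j ∷ weight i j ∷ H (suc i) j ∷ [])
          (λ a c w w' H → a :* (w :* H) :+ c :* (w' :* H) := (a :* w :+ c :* w') :* H) ≡.refl _) (*-congʳ (recurrence i j))

      -- Certificate of a second telescoping: after summation by parts no harmonic factor is left,
      -- and what remains is again a difference along the antidiagonal.
      B B' : ℕ → ℕ → Carrier
      B i j = (p ^ suc (i ℕ.+ j) + 1#) * (p ^ suc (i ℕ.+ j) + 1#) * p ^ j * σ j * V i j / (d (i ℕ.+ j) * d (i ℕ.+ j) * G i j * P j * P j * P i)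
      B' i zero    = 0#
      B' i (suc j) = B (suc i) j

      B≉0 : ∀ i j → d (i ℕ.+ j) * d (i ℕ.+ j) * G i j * P j * P j * P i ≉ 0#
      B≉0 i j = *-≉0 (*-≉0 (*-≉0 (*-≉0 (*-≉0 (d≉0 (i ℕ.+ j)) (d≉0 (i ℕ.+ j))) (G≉0 i j)) (P≉0 j)) (P≉0 j)) (P≉0 i)

      dd≉0 : ∀ i → d i * d i ≉ 0#
      dd≉0 i = *-≉0 (d≉0 i) (d≉0 i)

      step-suc : ∀ i j → cert i j * h j + Q (i ℕ.+ j) * weight i (suc j) ≈ B i (suc j) - B (suc i) j
      step-suc i j = solve-with (p ∷ p ^ i ∷ p ^ j ∷ P i ∷ P j ∷ σ j ∷ V (suc i) j ∷ G (suc i) j ∷ [])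
        (p ^ (i ℕ.+ j) ≔ (λ p I J Pi Pj s V G → I :* J) by ^-+ p i j
        ∷ p ^ (i ℕ.+ suc j) ≔ (λ p I J Pi Pj s V G → I :* (J :* p)) by e₂ i j
        ∷ V i (suc j) ≔ (λ p I J Pi Pj s V G → V :* (:1 :- p :* (I :* J :* J :* p :* p)))
            by trans (V-sucʳ i j) (*-congʳ (sym (V-sucˡ i j)))
        ∷ G i (suc j) ≔ (λ p I J Pi Pj s V G → G :* (I :* (J :* p) :* p)) by trans (G-sucʳ i j) (*-congʳ (sym (G-sucˡ i j))) ∷ [])
        (λ p I J Pi Pj s V G Q0 Q1 V01 G01 → let d = λ a → :1 :- p :* a ; 2' = :1 :+ :1 ; Q = Q0 :* p :* p in
          :- (s :* :- J :* V) :/ (G01 :* Pj :* Pj :* (Pi :* d I) :* d I) :* (Q :* (I :* p) :* (Q :+ 2') :- (2' :* Q :+ :1)) :* (p :* J :/ (d J :* d J))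
          :+ Q :* (:- (s :* :- J :* V01) :/ (G01 :* (Pj :* d J) :* (Pj :* d J) :* (Pi :* d I) :* d I))
          := (Q1 :* p :+ :1) :* (Q1 :* p :+ :1) :* (J :* p) :* (s :* :- J) :* V01 :/ (d Q1 :* d Q1 :* G01 :* (Pj :* d J) :* (Pj :* d J) :* Pi)
             :- (Q0 :* p :* p :+ :1) :* (Q0 :* p :* p :+ :1) :* J :* s :* V :/ (d (Q0 :* p) :* d (Q0 :* p) :* G :* Pj :* Pj :* (Pi :* d I)))
        ≡.refl (w≉0 i j i (suc j) , dd≉0 j , w≉0 i (suc j) i (suc j) , B≉0 i (suc j) , B≉0 (suc i) j)

      -- This is Q + (Q + 1)². The entry (n + 1, 0) contributes Q times its weight, while
      -- `B (suc n) 0` is -(Q + 1)² times that weight, so completing the telescoping pattern costs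
      -- (Q + 1)².
      3Q : ℕ → Carrier
      3Q n = Q n * Q n + three * Q n + 1#

      step-zero : ∀ n → Q n * weight (suc n) 0 ≈ 3Q n * weight (suc n) 0 + (B (suc n) 0 - 0#)
      step-zero n = solve-with (p ∷ p ^ n ∷ P (suc n) ∷ [])
        (p ^ (n ℕ.+ 0) ≔ (λ p Q P → Q) by reflexive (≡.cong (p ^_) (ℕP.+-identityʳ n))
        ∷ V (suc n) 0 ≔ (λ p Q P → P :* (:1 :- p :* (Q :* p))) by reflexive (≡.cong (λ k → P (suc (suc k))) (≡.trans (ℕP.+-identityʳ _) (ℕP.+-identityʳ n))) ∷ [])
        (λ p Q P Q' V → let d = λ a → :1 :- p :* a ; K = Q :* p :* p ; K' = Q' :* p :* p ; w = :- (:1 :* V) :/ (:1 :* :1 :* :1 :* (P :* d (Q :* p)) :* d (Q :* p)) in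
          K :* w := (K :* K :+ (:1 :+ :1 :+ :1) :* K :+ :1) :* w
            :+ ((K' :+ :1) :* (K' :+ :1) :* :1 :* :1 :* V :/ (d (Q' :* p) :* d (Q' :* p) :* :1 :* :1 :* :1 :* P) :- :0))
        ≡.refl (w≉0 (suc n) 0 0 0 , w≉0 (suc n) 0 0 0 , B≉0 (suc n) 0)

      S-recurrence : ∀ n → α n * S (suc n) + γ n * S n ≈ 3Q n * weight (suc n) 0 + B 0 (suc n)
      S-recurrence n = begin
        α n * S (suc n) + γ n * S n
          ≈⟨ S-step n ⟩
        C + Q n * (weight (suc n) 0 + diag n (λ i j → weight i (suc j)))
          ≈⟨ trans (+-congˡ (trans (distribˡ _ _ _) (+-cong (step-zero n) (diag-*ˡ n (Q n) _))))
               (solve (C ∷ 3Q n * weight (suc n) 0 ∷ B (suc n) 0 - 0# ∷ diag n (λ i j → Q n * weight i (suc j)) ∷ [])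
                 (λ c a b e → c :+ (a :+ b :+ e) := a :+ (b :+ (c :+ e))) ≡.refl _) ⟩
        3Q n * weight (suc n) 0 + ((B (suc n) 0 - 0#) + (C + diag n (λ i j → Q n * weight i (suc j))))
          ≈⟨ +-congˡ (+-congˡ (trans (sym (diag-+ n _ _)) (diag-cong n (λ { i j ≡.refl → step-suc i j })))) ⟩
        3Q n * weight (suc n) 0 + diag (suc n) (λ i j → B i j - B' i j)
          ≈⟨ +-congˡ (diag-telescope (suc n) B B' (λ i → refl) (λ i j → refl)) ⟩
        3Q n * weight (suc n) 0 + B 0 (suc n) ∎
        where C = diag n (λ i j → cert i j * h j)

    1-inv≉0 : ∀ m k → k ℕ.< m → 1# - 1# / p ^ m * p ^ k ≉ 0#
    1-inv≉0 m k k<m e = d≉0 l (*-cancelʳ _ (p^≉0 k) (begin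
      d l * p ^ k
        ≈⟨ solve-with (p ∷ p ^ k ∷ p ^ l ∷ []) (p ^ m ≔ (λ p K L → K :* (L :* p)) by pm ∷ [])
             (λ p K L M → (:1 :- p :* L) :* K := :- (M :* (:1 :- :1 :/ M :* K))) ≡.refl (p^≉0 m) ⟩
      - (p ^ m * (1# - 1# / p ^ m * p ^ k))   ≈⟨ -‿cong (*-congˡ e) ⟩
      - (p ^ m * 0#)                          ≈⟨ solve (p ^ m ∷ p ^ k ∷ []) (λ a b → :- (a :* :0) := :0 :* b) ≡.refl _ ⟩
      0# * p ^ k                              ∎))
      where
      l = m ℕ.∸ suc k
      pm : p ^ m ≈ p ^ k * p ^ suc l
      pm = trans (reflexive (≡.cong (p ^_) (≡.sym (≡.trans (ℕP.+-suc k l) (ℕP.m+[n∸m]≡n k<m))))) (^-+ p k (suc l))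

    -- For u = q^r and x = q^n the summand k = i + 1 of the last sum in the theorem, without its
    -- prefactor [n]⁴, is this times (1 - q)³ x^(2N-2-i).
    summandT : Carrier → ℕ → Carrier
    summandT u i = p ^ i * (u * u) * P i * poch (u * u) i / ((1# - u * p ^ i) ^ 3 * poch u i ^ 2)

    summandT-cong : ∀ {u v} i → u ≈ v → summandT u i ≈ summandT v i
    summandT-cong i e = /-cong (*-cong (*-congʳ (*-congˡ (*-cong e e))) (poch-cong i (*-cong e e)))
      (*-cong (^-cong 3 (+-congˡ (-‿cong (*-congʳ e)))) (^-cong 2 (poch-cong i e)))

    ∑-telescope : ∀ n (f : ℕ → Carrier) → ∑ n (λ k → f (suc k) - f k) ≈ f n - f 0
    ∑-telescope zero    f = sym (-‿inverseʳ _)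
    ∑-telescope (suc n) f = trans (+-congʳ (∑-telescope n f))
      (solve (f n ∷ f 0 ∷ f (suc n) ∷ []) (λ a b c → (a :- b) :+ (c :- a) := c :- b) ≡.refl _)

    -- For u p^k = 1 the factor u - p^l is u (1 - p^(k+l)), so that the reversed product continues
    -- (p;p)_k upwards.
    R-inverse : ∀ u k j → u * p ^ k ≈ 1# → R u j ≈ u ^ j * poch (p * p ^ k) j
    R-inverse u k zero    e = sym (*-identityˡ _)
    R-inverse u k (suc j) e = begin
      R u j * (u - p ^ j * p)                         ≈⟨ *-cong (R-inverse u k j e) (begin
          u - p ^ j * p                ≈⟨ solve (u ∷ p ^ j ∷ p ∷ []) (λ u J p → u :- J :* p := u :- :1 :* J :* p) ≡.refl _ ⟩
          u - 1# * p ^ j * p           ≈⟨ +-congˡ (-‿cong (*-congʳ (*-congʳ (sym e)))) ⟩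
          u - u * p ^ k * p ^ j * p    ∎) ⟩
      u ^ j * poch (p * p ^ k) j * (u - u * p ^ k * p ^ j * p)
        ≈⟨ solve (u ∷ p ∷ p ^ k ∷ p ^ j ∷ u ^ j ∷ poch (p * p ^ k) j ∷ [])
             (λ u p K J u' A → u' :* A :* (u :- u :* K :* J :* p) := (u' :* u) :* (A :* (:1 :- p :* K :* J))) ≡.refl _ ⟩
      u ^ suc j * poch (p * p ^ k) (suc j) ∎

    private
      -- Here u = p^(-(n+2)) is the argument in T (n + 1), and u p is the one in T n. Rewriting
      -- `α n` and `γ n` through u makes the step an identity in u, p and p^i.
      module TStep (n : ℕ) where
        u = 1# / p ^ suc (suc n)
        q = p ^ suc n

        Q≉0 : q * p ≉ 0#
        Q≉0 = p^≉0 (suc (suc n))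

        u≉0 : u ≉ 0#
        u≉0 = /-≉0 1≉0 Q≉0

        uQ : u * Q n ≈ 1#
        uQ = trans (*-assoc _ _ _) (trans (*-identityˡ _) (inverseˡ Q≉0))

        1-u≉0 : 1# - u ≉ 0#
        1-u≉0 = ≉0-cong (+-congˡ (-‿cong (*-identityʳ u))) (1-inv≉0 (suc (suc n)) 0 (ℕ.s≤s ℕ.z≤n))

        1-uup≉0 : 1# - u * u * p ≉ 0#
        1-uup≉0 e = d≉0 (n ℕ.+ suc (suc n)) (begin
          d (n ℕ.+ suc (suc n))
            ≈⟨ solve-with (p ∷ p ^ n ∷ []) (p ^ (n ℕ.+ suc (suc n)) ≔ (λ p N → N :* (N :* p :* p)) by ^-+ p n (suc (suc n)) ∷ [])
                 (λ p N M → :1 :- p :* M := :- ((N :* p :* p) :* (N :* p) :* (:1 :- :1 :/ (N :* p :* p) :* (:1 :/ (N :* p :* p)) :* p))) ≡.refl (Q≉0 , Q≉0) ⟩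
          - (q * p * q * (1# - u * u * p))    ≈⟨ -‿cong (*-congˡ e) ⟩
          - (q * p * q * 0#)                  ≈⟨ solve (q ∷ p ∷ []) (λ q p → :- (q :* p :* q :* :0) := :0) ≡.refl _ ⟩
          0#                                  ∎)

        αu : α n ≈ (1# - u) * (1# - u) / (u * u)
        αu = solve (q ∷ p ∷ []) (λ q p → (:1 :- p :* q) :* (:1 :- p :* q) := (:1 :- :1 :/ (q :* p)) :* (:1 :- :1 :/ (q :* p)) :/ (:1 :/ (q :* p) :* (:1 :/ (q :* p)))) ≡.refl
          (Q≉0 , Q≉0 , Q≉0 , Q≉0 , *-≉0 u≉0 u≉0)

        γu : γ n ≈ (1# - u * u) * (1# - u * u * p) / (u * u * u * p)
        γu = solve (q ∷ p ∷ []) (λ q p → let u = :1 :/ (q :* p) in (:1 :- (q :* p) :* (q :* p)) :* (:1 :- (q :* p) :* q) :/ (q :* p) := (:1 :- u :* u) :* (:1 :- u :* u :* p) :/ (u :* u :* u :* p)) ≡.refl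
          (Q≉0 , Q≉0 , Q≉0 , Q≉0 , Q≉0 , Q≉0 , Q≉0 , Q≉0 , *-≉0 (*-≉0 (*-≉0 u≉0 u≉0) u≉0) p≉0)

        c : Carrier
        c = - ((1# + u) * (1# + u)) / (u * (1# - u))

        Bt : ℕ → Carrier
        Bt i = P i * poch (u * u * p) i / poch (u * p) i ^ 2

        1-up^≉0 : ∀ k → k ℕ.≤ suc n → 1# - u * p ^ k ≉ 0#
        1-up^≉0 k k≤ = 1-inv≉0 (suc (suc n)) k (ℕ.s≤s k≤)

        up-factor : ∀ k → 1# - u * p ^ suc k ≈ 1# - u * p * p ^ k
        up-factor k = solve (u ∷ p ∷ p ^ k ∷ []) (λ u p K → :1 :- u :* (K :* p) := :1 :- u :* p :* K) ≡.refl _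

        W≉0 : ∀ i → i ℕ.≤ suc n → poch (u * p) i ≉ 0#
        W≉0 i i≤ = poch-≉0 (u * p) i (λ k k<i → ≉0-cong (up-factor k) (1-up^≉0 (suc k) (ℕP.≤-trans k<i i≤)))

        poch-u : ∀ i → poch u (suc i) ≈ (1# - u) * poch (u * p) i
        poch-u i = poch-head u i

        -- Term i + 1 at u and term i at u p share the cubed factor 1 - u p^(i+1), which dictates
        -- this pairing; `c` and `Bt` are the telescoping certificate.
        step : ∀ i → i ℕ.≤ n → α n * summandT u (suc i) + γ n * summandT (u * p) i ≈ c * (Bt (suc i) - Bt i)
        step i i≤n = trans (+-cong (*-congʳ αu) (*-congʳ γu)) (solve-with (p ∷ u ∷ p ^ i ∷ P i ∷ poch (u * p) i ∷ r ∷ [])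
          (poch (u * u * p) i ≔ (λ p u I P W r → (:1 :- u :* u :* p) :* r) by r-def
          ∷ poch (u * u) (suc i) ≔ (λ p u I P W r → (:1 :- u :* u) :* ((:1 :- u :* u :* p) :* r)) by trans (poch-head (u * u) i) (*-congˡ r-def)
          ∷ poch (u * p * (u * p)) i ≔ (λ p u I P W r → (:1 :- u :* u :* p :* I) :* r) by uupp
          ∷ poch u (suc i) ≔ (λ p u I P W r → (:1 :- u) :* W) by poch-u i ∷ [])
          (λ p u I P W r A1 A0 A2 U →
            (:1 :- u) :* (:1 :- u) :/ (u :* u) :* (I :* p :* (u :* u) :* (P :* (:1 :- p :* I)) :* A0 :/ ((:1 :- u :* (I :* p)) :^ 3 :* U :^ 2))
            :+ (:1 :- u :* u) :* (:1 :- u :* u :* p) :/ (u :* u :* u :* p) :* (I :* (u :* p :* (u :* p)) :* P :* A2 :/ ((:1 :- u :* p :* I) :^ 3 :* W :^ 2))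
            := :- ((:1 :+ u) :* (:1 :+ u)) :/ (u :* (:1 :- u)) :* (P :* (:1 :- p :* I) :* (A1 :* (:1 :- u :* u :* p :* I)) :/ (W :* (:1 :- u :* p :* I)) :^ 2 :- P :* A1 :/ W :^ 2))
          ≡.refl (*-≉0 u≉0 u≉0 , *-≉0 (^-≉0 3 (1-up^≉0 (suc i) (ℕ.s≤s i≤n))) (^-≉0 2 (≉0-cong (sym (poch-u i)) (*-≉0 1-u≉0 Wi≉0)))
                 , *-≉0 (*-≉0 (*-≉0 u≉0 u≉0) u≉0) p≉0 , *-≉0 (^-≉0 3 d'≉0) (^-≉0 2 Wi≉0)
                 , *-≉0 u≉0 1-u≉0 , ^-≉0 2 (*-≉0 Wi≉0 d'≉0) , ^-≉0 2 Wi≉0))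
          where
          Wi≉0 = W≉0 i (ℕP.m≤n⇒m≤1+n i≤n)
          d'≉0 : 1# - u * p * p ^ i ≉ 0#
          d'≉0 = ≉0-cong (up-factor i) (1-up^≉0 (suc i) (ℕ.s≤s i≤n))
          -- For i ≥ 1 this is (u²p²;p)_(i-1), the common part of the three factorials with base u².
          -- Defining it by division lets i = 0 follow the same formula.
          r = poch (u * u * p) i / (1# - u * u * p)
          r-def : poch (u * u * p) i ≈ (1# - u * u * p) * r
          r-def = solve (poch (u * u * p) i ∷ 1# - u * u * p ∷ []) (λ a b → a := b :* (a :/ b)) ≡.refl 1-uup≉0
          uupp : poch (u * p * (u * p)) i ≈ (1# - u * u * p * p ^ i) * r
          uupp = *-cancelʳ _ 1-uup≉0 (begin
            poch (u * p * (u * p)) i * (1# - u * u * p)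
              ≈⟨ *-congʳ (poch-cong i (solve (u ∷ p ∷ []) (λ u p → u :* p :* (u :* p) := u :* u :* p :* p) ≡.refl _)) ⟩
            poch (u * u * p * p) i * (1# - u * u * p)      ≈⟨ *-comm _ _ ⟩
            (1# - u * u * p) * poch (u * u * p * p) i      ≈⟨ poch-head (u * u * p) i ⟨
            poch (u * u * p) i * (1# - u * u * p * p ^ i)
              ≈⟨ solve (poch (u * u * p) i ∷ 1# - u * u * p ∷ 1# - u * u * p * p ^ i ∷ []) (λ a b c → a :* c := c :* (a :/ b) :* b) ≡.refl 1-uup≉0 ⟩
            (1# - u * u * p * p ^ i) * r * (1# - u * u * p) ∎)

    T : ℕ → Carrier
    T n = ∑ (suc n) (summandT (1# / p ^ suc n))

    private
      -- The pairing leaves term 0 of T (n + 1) and the two ends of `Bt`. Because u p^(n+2) = 1,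
      -- reversal turns the upper end, times `c`, into `B 0 (suc n)`; term 0 and the lower end
      -- together give the multiple of `weight (suc n) 0`. This is the same inhomogeneity as for
      -- `S`.
      T-recurrence : ∀ n → α n * T (suc n) + γ n * T n ≈ 3Q n * weight (suc n) 0 + B 0 (suc n)
      T-recurrence n = begin
        α n * T (suc n) + γ n * T n
          ≈⟨ +-cong (*-congˡ (∑-head (suc n) (summandT u))) (*-congˡ (∑-cong (suc n) (λ k _ → summandT-cong k up))) ⟩
        α n * (summandT u 0 + ∑ (suc n) (λ i → summandT u (suc i))) + γ n * ∑ (suc n) (summandT (u * p))
          ≈⟨ trans (+-congʳ (distribˡ _ _ _)) (+-assoc _ _ _) ⟩
        α n * summandT u 0 + (α n * ∑ (suc n) (λ i → summandT u (suc i)) + γ n * ∑ (suc n) (summandT (u * p)))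
          ≈⟨ +-congˡ (trans (+-cong (∑-*ˡ (suc n) (α n) _) (∑-*ˡ (suc n) (γ n) _)) (sym (∑-+ (suc n) _ _))) ⟩
        α n * summandT u 0 + ∑ (suc n) (λ i → α n * summandT u (suc i) + γ n * summandT (u * p) i)
          ≈⟨ +-congˡ (∑-cong (suc n) (λ { i (ℕ.s≤s i≤n) → step i i≤n })) ⟩
        α n * summandT u 0 + ∑ (suc n) (λ i → c * (Bt (suc i) - Bt i))
          ≈⟨ +-congˡ (trans (sym (∑-*ˡ (suc n) c _)) (*-congˡ (∑-telescope (suc n) Bt))) ⟩
        α n * summandT u 0 + c * (Bt (suc n) - Bt 0)
          ≈⟨ +-congˡ (*-congˡ (+-congʳ Bt-closed)) ⟩
        α n * summandT u 0 + c * (R u m * N m / P m - Bt 0)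
          ≈⟨ +-congˡ (*-congˡ (+-congʳ (/-cong (*-cong (R-inverse u (suc m) m uQ) (N-σ m)) refl))) ⟩
        α n * summandT u 0 + c * (u ^ m * poch (p * p ^ suc m) m * (p ^ m * σ m) / P m - Bt 0)
          ≈⟨ +-congˡ (*-congˡ (+-congʳ (/-cong (*-congʳ (*-congʳ u^m)) refl))) ⟩
        α n * summandT u 0 + c * (1# / G 0 m * poch (p * p ^ suc m) m * (p ^ m * σ m) / P m - Bt 0)
          ≈⟨ solve-with (p ∷ p ^ m ∷ P m ∷ poch (p * p ^ suc m) m ∷ G 0 m ∷ σ m ∷ [])
               (V m 0 ≔ (λ p J P A G s → P :* (:1 :- p :* J)) by reflexive (≡.cong (λ k → P (suc k)) (≡.trans (ℕP.+-identityʳ _) (ℕP.+-identityʳ m)))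
               ∷ V 0 m ≔ (λ p J P A G s → P :* (:1 :- p :* J) :* A) by poch-+ p (suc m) m ∷ [])
               (λ p J P A G s V0 V → let d = λ a → :1 :- p :* a ; Q = J :* p ; u = :1 :/ Q ; Bt0 = :1 :* :1 :/ :1 :^ 2 in
                 d J :* d J :* (:1 :* (u :* u) :* :1 :* :1 :/ ((:1 :- u :* :1) :^ 3 :* :1 :^ 2))
                 :+ (:- ((:1 :+ u) :* (:1 :+ u)) :/ (u :* (:1 :- u))) :* (:1 :/ G :* A :* (J :* s) :/ P :- Bt0)
                 := (Q :* Q :+ (:1 :+ :1 :+ :1) :* Q :+ :1) :* (:- (:1 :* V0) :/ (:1 :* :1 :* :1 :* (P :* d J) :* d J))
                    :+ (Q :+ :1) :* (Q :+ :1) :* J :* s :* V :/ (d J :* d J :* G :* P :* P :* :1))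
               ≡.refl (Q≉0 , Q≉0 , Q≉0 , *-≉0 (^-≉0 3 (1-up^≉0 0 ℕ.z≤n)) (^-≉0 2 1≉0) , Q≉0 , Q≉0 , Q≉0 , Q≉0 , *-≉0 u≉0 1-u≉0 , G≉0 0 m , P≉0 m , ^-≉0 2 1≉0
                      , w≉0 m 0 0 0 , B≉0 0 m)
             ⟩
        3Q n * weight (suc n) 0 + B 0 (suc n) ∎
        where
        open TStep n
        m = suc n
        up : 1# / p ^ suc n ≈ u * p
        up = solve (q ∷ p ∷ []) (λ q p → :1 :/ q := :1 :/ (q :* p) :* p) ≡.refl (p^≉0 (suc n) , Q≉0)
        u^m : u ^ m ≈ 1# / G 0 m
        u^m = 1/-^ m Q≉0
        upp^m : u * p * p ^ m ≈ 1#
        upp^m = trans (*-assoc _ _ _) (trans (*-congˡ (*-comm _ _)) uQ)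
        P-top : P m ≈ poch (u * p) m * N m
        P-top = trans (sym (R-1 m)) (trans (R-cong m (sym upp^m)) (trans (sym (*-identityˡ _)) (poch-reverse (u * p) 0 m)))
        R-top : R u m ≈ poch (u * u * p) m * N m
        R-top = trans (R-cong m (trans (sym (*-identityʳ u)) (trans (*-congˡ (sym upp^m))
                  (solve (u ∷ p ∷ p ^ m ∷ []) (λ u p M → u :* (u :* p :* M) := u :* u :* p :* M) ≡.refl _))))
                (trans (sym (*-identityˡ _)) (poch-reverse (u * u * p) 0 m))
        Bt-closed : Bt m ≈ R u m * N m / P m
        Bt-closed = solve-with (poch (u * p) m ∷ poch (u * u * p) m ∷ N m ∷ [])
          (P m ≔ (λ W A N → W :* N) by P-top ∷ R u m ≔ (λ W A N → A :* N) by R-top ∷ [])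
          (λ W A N P R → P :* A :/ W :^ 2 := R :* N :/ P) ≡.refl (^-≉0 2 (W≉0 m ℕP.≤-refl) , P≉0 m)

    -- Both sums satisfy one recurrence with non-zero leading coefficient `α n`, so agreement at n =
    -- 0 suffices.
    S≈T : ∀ n → S n ≈ T n
    S≈T zero = solve (p ∷ []) (λ p → let d = λ a → :1 :- p :* a ; u = :1 :/ (:1 :* p) in
        :- (:1 :* (:1 :* d :1)) :/ (:1 :* :1 :* :1 :* (:1 :* d :1) :* d :1) :* (:0 :+ p :* :1 :/ (d :1 :* d :1))
        := :0 :+ :1 :* (u :* u) :* :1 :* :1 :/ ((:1 :- u :* :1) :^ 3 :* :1 :^ 2))
      ≡.refl (w≉0 0 0 0 0 , *-≉0 (d≉0 0) (d≉0 0) , p^≉0 1 , p^≉0 1 , p^≉0 1 , *-≉0 (^-≉0 3 (1-inv≉0 1 0 (ℕ.s≤s ℕ.z≤n))) (^-≉0 2 1≉0))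
    S≈T (suc n) = *-cancelʳ _ (*-≉0 (d≉0 (suc n)) (d≉0 (suc n))) (begin
      S (suc n) * α n
        ≈⟨ solve (S (suc n) ∷ α n ∷ γ n ∷ S n ∷ []) (λ s a c s' → s :* a := a :* s :+ c :* s' :- c :* s') ≡.refl _ ⟩
      α n * S (suc n) + γ n * S n - γ n * S n
        ≈⟨ +-cong (trans (S-recurrence n) (sym (T-recurrence n))) (-‿cong (*-congˡ (S≈T n))) ⟩
      α n * T (suc n) + γ n * T n - γ n * T n
        ≈⟨ solve (T (suc n) ∷ α n ∷ γ n ∷ T n ∷ []) (λ s a c s' → a :* s :+ c :* s' :- c :* s' := s :* a) ≡.refl _ ⟩
      T (suc n) * α n ∎)

    N² : ∀ m → N m * N m ≈ (p ^ m) ^ m * p ^ m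
    N² zero    = refl
    N² (suc m) = begin
      N m * - p ^ suc m * (N m * - p ^ suc m)
        ≈⟨ solve (N m ∷ p ^ suc m ∷ []) (λ N q → N :* :- q :* (N :* :- q) := N :* N :* q :* q) ≡.refl _ ⟩
      N m * N m * p ^ suc m * p ^ suc m         ≈⟨ *-congʳ (*-congʳ (N² m)) ⟩
      (p ^ m) ^ m * p ^ m * (p ^ m * p) * p ^ suc m ≈⟨ *-congʳ (*-congʳ (^-* (p ^ m) p m)) ⟨
      (p ^ suc m) ^ m * p ^ suc m * p ^ suc m   ∎

    -- What is left of `column` after removing y² and the perturbed product, see `column≈β`. Its
    -- divisor 1 - u p^j equals y when i = 0.
    β : Carrier → ℕ → ℕ → Carrier
    β u i j = poch u (i ℕ.+ j) * R u j * poch u i / (u ^ (i ℕ.+ j) * P (i ℕ.+ j) * P i * P j * (1# - u * p ^ j))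

    -- At u p^(i+j+1) = 1 every factorial based on u reverses into quotients of (p;p) factorials;
    -- the factor (u;p)_m with m = i + j + 1, which all of them share, drops out.
    β-weight : ∀ i j → let u = 1# / p ^ suc (i ℕ.+ j) in β u (suc i) j ≈ weight i j
    β-weight i j = begin
      β u (suc i) j
        ≈⟨ /-cong (*-cong (*-congˡ R-eq) U-eq) (*-cong (*-congʳ (*-congʳ (*-congʳ (u^ m)))) 1-eq) ⟩
      U m * (1# / G i j * V i j / P m) * (U m * N j / P j) / (1# / (p ^ m) ^ m * P m * P (suc i) * P j * (- d i / p ^ suc i))
        ≈⟨ /-cong refl (*-congʳ (*-congʳ (*-congʳ (*-congʳ (trans q-eq (/-cong refl (sym (N² m)))))))) ⟩
      U m * (1# / G i j * V i j / P m) * (U m * N j / P j) / (p ^ m / (N m * N m) * P m * P (suc i) * P j * (- d i / p ^ suc i))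
        ≈⟨ solve-with (p ∷ p ^ i ∷ p ^ j ∷ U m ∷ N m ∷ P (suc i) ∷ P j ∷ σ j ∷ V i j ∷ G i j ∷ [])
             (p ^ (i ℕ.+ j) ≔ (λ p I J U N Pi Pj s V G → I :* J) by ^-+ p i j
             ∷ P m ≔ (λ p I J U N Pi Pj s V G → U :* N) by P-top
             ∷ N j ≔ (λ p I J U N Pi Pj s V G → J :* s) by N-σ j ∷ [])
             (λ p I J U N Pi Pj s V G Q Pm Nj → let d = λ a → :1 :- p :* a in
               U :* (:1 :/ G :* V :/ Pm) :* (U :* Nj :/ Pj) :/ ((Q :* p) :/ (N :* N) :* Pm :* Pi :* Pj :* (:- d I :/ (I :* p)))
               := :- (s :* V) :/ (G :* Pj :* Pj :* Pi :* d I))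
             ≡.refl (G≉0 i j , P≉0 m , P≉0 j , *-≉0 (N≉0 m) (N≉0 m) , p^≉0 (suc i)
                    , *-≉0 (*-≉0 (*-≉0 (*-≉0 (/-≉0 (p^≉0 m) (*-≉0 (N≉0 m) (N≉0 m))) (P≉0 m)) (P≉0 (suc i))) (P≉0 j)) (/-≉0 (neg-≉0 (d≉0 i)) (p^≉0 (suc i)))
                    , *-≉0 (*-≉0 (*-≉0 (*-≉0 (G≉0 i j) (P≉0 j)) (P≉0 j)) (P≉0 (suc i))) (d≉0 i)) ⟩
      weight i j ∎
      where
      m = suc (i ℕ.+ j)
      u = 1# / p ^ m
      U : ℕ → Carrier
      U = poch u
      up^m : u * p ^ m ≈ 1#
      up^m = trans (*-assoc _ _ _) (trans (*-identityˡ _) (inverseˡ (p^≉0 m)))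
      u^ : ∀ k → u ^ k ≈ 1# / (p ^ m) ^ k
      u^ k = 1/-^ k (p^≉0 m)
      P-top : P m ≈ U m * N m
      P-top = trans (sym (R-1 m)) (trans (R-cong m (sym up^m)) (trans (sym (*-identityˡ _)) (poch-reverse u 0 m)))
      U-eq : U (suc i) ≈ U m * N j / P j
      U-eq = begin
        U (suc i)             ≈⟨ solve (U (suc i) ∷ P j ∷ []) (λ a b → a := a :* b :/ b) ≡.refl (P≉0 j) ⟩
        U (suc i) * P j / P j ≈⟨ /-cong (trans (*-congˡ (trans (sym (R-1 j)) (R-cong j (sym up^m)))) (poch-reverse u (suc i) j)) refl ⟩
        U m * N j / P j       ∎
      R-eq : R u j ≈ 1# / G i j * V i j / P m
      R-eq = begin
        R u j                                            ≈⟨ R-inverse u m j up^m ⟩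
        u ^ j * poch (p * p ^ m) j                       ≈⟨ solve (u ^ j ∷ poch (p * p ^ m) j ∷ P m ∷ []) (λ a b c → a :* b := a :* (c :* b) :/ c) ≡.refl (P≉0 m) ⟩
        u ^ j * (P m * poch (p * p ^ m) j) / P m         ≈⟨ /-cong (*-cong (u^ j) (sym (poch-+ p m j))) refl ⟩
        1# / G i j * V i j / P m                         ∎
      1-eq : 1# - u * p ^ j ≈ - d i / p ^ suc i
      1-eq = solve-with (p ∷ p ^ i ∷ p ^ j ∷ []) (p ^ (i ℕ.+ j) ≔ (λ p I J → I :* J) by ^-+ p i j ∷ [])
        (λ p I J Q → :1 :- :1 :/ (Q :* p) :* J := :- (:1 :- p :* I) :/ (I :* p)) ≡.refl (p^≉0 m , p^≉0 (suc i))
      q-eq : 1# / (p ^ m) ^ m ≈ p ^ m / ((p ^ m) ^ m * p ^ m)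
      q-eq = solve ((p ^ m) ^ m ∷ p ^ m ∷ []) (λ a b → :1 :/ a := b :/ (a :* b)) ≡.refl (^-≉0 m (p^≉0 m) , *-≉0 (^-≉0 m (p^≉0 m)) (p^≉0 m))

    apéry : ∀ n → let u = 1# / p ^ suc n in
            diag n (λ i j → β u (suc i) j * H (suc i) j) ≈ ∑ (suc n) (summandT u)
    apéry n = trans (diag-cong n (λ { i j ≡.refl → *-congʳ (β-weight i j) })) (S≈T n)

-- Divisibility and congruences in a local ring

module Localisations where

  open import Data.Nat as ℕ using (ℕ; zero; suc)
  import Data.Nat.Properties as ℕP
  open import Data.Vec using ([]; _∷_)
  open import Data.Product using (_,_)
  open import Relation.Binary.PropositionalEquality as ≡ using (_≡_)
  open Fields
  open FieldSolver
  open QSeries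

  -- `O` is a subring of the field and `φ` the element whose powers measure divisibility; the
  -- intended instance is the local ring of ℚ[q] at a cyclotomic polynomial.
  record Localisation (K : Field) : Set₁ where
    open Field K
    field
      O      : Carrier → Set
      O-cong : ∀ {a b} → a ≈ b → O a → O b
      O-1    : O 1#
      O-+    : ∀ {a b} → O a → O b → O (a + b)
      O-*    : ∀ {a b} → O a → O b → O (a * b)
      O-neg  : ∀ {a} → O a → O (- a)
      φ      : Carrier
      φ≉0    : φ ≉ 0#
      O-φ    : O φ

  module Divisibility (K : Field) (L : Localisation K) where
    open FieldLemmas K
    open Sums K
    open Localisation L public

    O-0 : O 0#
    O-0 = O-cong (-‿inverseʳ 1#) (O-+ O-1 (O-neg O-1))

    O-^ : ∀ {a} k → O a → O (a ^ k)
    O-^ zero    h = O-1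
    O-^ (suc k) h = O-* (O-^ k h) h

    record Dv (e : ℕ) (z : Carrier) : Set where
      constructor dv
      field
        quotient   : Carrier
        O-quotient : O quotient
        factor     : z ≈ φ ^ e * quotient

    Dv-cong : ∀ {e a b} → a ≈ b → Dv e a → Dv e b
    Dv-cong h (dv w o e) = dv w o (trans (sym h) e)

    Dv-O : ∀ {a} → O a → Dv 0 a
    Dv-O o = dv _ o (sym (*-identityˡ _))

    O-Dv : ∀ {e a} → Dv e a → O a
    O-Dv {e} (dv w o h) = O-cong (sym h) (O-* (O-^ e O-φ) o)

    Dv-+ : ∀ {e a b} → Dv e a → Dv e b → Dv e (a + b)
    Dv-+ (dv v o h) (dv w o' h') = dv (v + w) (O-+ o o') (trans (+-cong h h') (sym (distribˡ _ _ _)))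

    Dv-neg : ∀ {e a} → Dv e a → Dv e (- a)
    Dv-neg {e} (dv w o h) = dv (- w) (O-neg o) (trans (-‿cong h) (solve (φ ^ e ∷ w ∷ []) (λ a b → :- (a :* b) := a :* :- b) ≡.refl _))

    Dv-* : ∀ {e f a b} → Dv e a → Dv f b → Dv (e ℕ.+ f) (a * b)
    Dv-* {e} {f} (dv v o h) (dv w o' h') = dv (v * w) (O-* o o') (trans (*-cong h h')
      (trans (solve (φ ^ e ∷ φ ^ f ∷ v ∷ w ∷ []) (λ a b v w → (a :* v) :* (b :* w) := (a :* b) :* (v :* w)) ≡.refl _) (*-congʳ (sym (^-+ φ e f)))))

    Dv-weaken : ∀ {e} f {a} → Dv (f ℕ.+ e) a → Dv e a
    Dv-weaken {e} f (dv w o h) = dv (φ ^ f * w) (O-* (O-^ f O-φ) o)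
      (trans h (trans (*-congʳ (^-+ φ f e)) (solve (φ ^ f ∷ φ ^ e ∷ w ∷ []) (λ a b w → a :* b :* w := b :* (a :* w)) ≡.refl _)))

    Dv-*ˡ : ∀ {e a b} → O a → Dv e b → Dv e (a * b)
    Dv-*ˡ o = Dv-* {0} (Dv-O o)

    Dv-*ʳ : ∀ {e a b} → Dv e a → O b → Dv e (a * b)
    Dv-*ʳ d o = Dv-cong (*-comm _ _) (Dv-*ˡ o d)

    Dv-0 : ∀ {e} → Dv e 0#
    Dv-0 = dv 0# O-0 (sym (zeroʳ _))

    Dv-^ : ∀ {a} k → Dv 1 a → Dv k (a ^ k)
    Dv-^ zero        d = Dv-O O-1
    Dv-^ {a} (suc k) d = ≡.subst (λ e → Dv e (a ^ suc k)) (ℕP.+-comm k 1) (Dv-* (Dv-^ k d) d)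

    Dv-∑ : ∀ {e} n f → (∀ k → k ℕ.< n → Dv e (f k)) → Dv e (∑ n f)
    Dv-∑ zero    f h = Dv-0
    Dv-∑ (suc n) f h = Dv-+ (Dv-∑ n f (λ k k<n → h k (ℕP.m<n⇒m<1+n k<n))) (h n ℕP.≤-refl)

    Dv-diag : ∀ {e} n f → (∀ i j → i ℕ.+ j ≡ n → Dv e (f i j)) → Dv e (diag n f)
    Dv-diag zero    f h = h 0 0 ≡.refl
    Dv-diag (suc n) f h = Dv-+ (h (suc n) 0 (ℕP.+-identityʳ _))
      (Dv-diag n (λ i j → f i (suc j)) (λ i j e → h i (suc j) (≡.trans (ℕP.+-suc i j) (≡.cong suc e))))

    record Unit (a : Carrier) : Set where
      constructor unit
      field
        ≉0  : a ≉ 0#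
        O-a : O a
        O-⁻¹ : O (a ⁻¹)
    open Unit public

    recip-* : ∀ {a b} → a ≉ 0# → b ≉ 0# → (a * b) ⁻¹ ≈ a ⁻¹ * b ⁻¹
    recip-* {a} {b} ha hb = begin
      (a * b) ⁻¹          ≈⟨ *-identityˡ _ ⟨
      1# / (a * b)        ≈⟨ solve (a ∷ b ∷ []) (λ a b → :1 :/ (a :* b) := (:1 :/ a) :* (:1 :/ b)) ≡.refl (*-≉0 ha hb , ha , hb) ⟩
      1# / a * (1# / b)   ≈⟨ *-cong (*-identityˡ _) (*-identityˡ _) ⟩
      a ⁻¹ * b ⁻¹         ∎

    recip-recip : ∀ {a} → a ≉ 0# → (a ⁻¹) ⁻¹ ≈ a
    recip-recip {a} h = *-cancelʳ _ (⁻¹-≉0 h) (trans (inverseˡ (⁻¹-≉0 h)) (sym (inverseʳ h)))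

    recip-1 : 1# ⁻¹ ≈ 1#
    recip-1 = trans (sym (*-identityˡ _)) (inverseʳ 1≉0)

    unit-* : ∀ {a b} → Unit a → Unit b → Unit (a * b)
    unit-* (unit h o p) (unit h' o' p') = unit (*-≉0 h h') (O-* o o') (O-cong (sym (recip-* h h')) (O-* p p'))

    unit-1 : Unit 1#
    unit-1 = unit 1≉0 O-1 (O-cong (sym recip-1) O-1)

    unit-^ : ∀ {a} k → Unit a → Unit (a ^ k)
    unit-^ zero    u = unit-1
    unit-^ (suc k) u = unit-* (unit-^ k u) u

    unit-⁻¹ : ∀ {a} → Unit a → Unit (a ⁻¹)
    unit-⁻¹ (unit h o p) = unit (⁻¹-≉0 h) p (O-cong (sym (recip-recip h)) o)

    unit-/ : ∀ {a b} → Unit a → Unit b → Unit (a / b)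
    unit-/ u v = unit-* u (unit-⁻¹ v)

    unit-cong : ∀ {a b} → a ≈ b → Unit a → Unit b
    unit-cong e (unit h o p) = unit (≉0-cong e h) (O-cong e o) (O-cong (⁻¹-cong e) p)

    unit-neg : ∀ {a} → Unit a → Unit (- a)
    unit-neg {a} u = unit-cong (solve (a ∷ []) (λ a → :- :1 :* a := :- a) ≡.refl _) (unit-* -1-unit u)
      where
      -1-unit : Unit (- 1#)
      -1-unit = unit (neg-≉0 1≉0) (O-neg O-1)
        (O-cong (trans (solve [] (:- :1 := :1 :/ (:- :1)) ≡.refl (neg-≉0 1≉0)) (*-identityˡ _)) (O-neg O-1))

    O-/ : ∀ {a b} → O a → Unit b → O (a / b)
    O-/ o u = O-* o (O-⁻¹ u)

    infix 4 _≅_ _≅ˣ_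
    -- Integrality of both sides is carried along because products of congruences depend on it.
    record _≅_ (a b : Carrier) : Set where
      constructor cong
      field
        left  : O a
        right : O b
        diff  : Dv 1 (a - b)
    open _≅_ public

    ≅-refl : ∀ {a} → O a → a ≅ a
    ≅-refl o = cong o o (Dv-cong (sym (-‿inverseʳ _)) Dv-0)

    ≅-reflexive : ∀ {a b} → O a → a ≈ b → a ≅ b
    ≅-reflexive o e = cong o (O-cong e o) (Dv-cong (trans (sym (-‿inverseʳ _)) (+-congˡ (-‿cong e))) Dv-0)

    ≅-sym : ∀ {a b} → a ≅ b → b ≅ a
    ≅-sym {a} {b} (cong l r d) = cong r l (Dv-cong (solve (a ∷ b ∷ []) (λ a b → :- (a :- b) := b :- a) ≡.refl _) (Dv-neg d))

    ≅-trans : ∀ {a b c} → a ≅ b → b ≅ c → a ≅ c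
    ≅-trans {a} {b} {c} (cong l _ d) (cong _ r d') =
      cong l r (Dv-cong (solve (a ∷ b ∷ c ∷ []) (λ a b c → (a :- b) :+ (b :- c) := a :- c) ≡.refl _) (Dv-+ d d'))

    ≅-+ : ∀ {a b c d} → a ≅ b → c ≅ d → a + c ≅ b + d
    ≅-+ {a} {b} {c} {d} (cong l r h) (cong l' r' h') = cong (O-+ l l') (O-+ r r')
      (Dv-cong (solve (a ∷ b ∷ c ∷ d ∷ []) (λ a b c d → (a :- b) :+ (c :- d) := (a :+ c) :- (b :+ d)) ≡.refl _) (Dv-+ h h'))

    ≅-neg : ∀ {a b} → a ≅ b → - a ≅ - b
    ≅-neg {a} {b} (cong l r h) = cong (O-neg l) (O-neg r)
      (Dv-cong (solve (a ∷ b ∷ []) (λ a b → :- (a :- b) := :- a :- :- b) ≡.refl _) (Dv-neg h))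

    ≅-* : ∀ {a b c d} → a ≅ b → c ≅ d → a * c ≅ b * d
    ≅-* {a} {b} {c} {d} (cong l r h) (cong l' r' h') = cong (O-* l l') (O-* r r')
      (Dv-cong (solve (a ∷ b ∷ c ∷ d ∷ []) (λ a b c d → a :* (c :- d) :+ (a :- b) :* d := a :* c :- b :* d) ≡.refl _)
        (Dv-+ (Dv-*ˡ l h') (Dv-*ʳ h r')))

    ≅-^ : ∀ {a b} k → a ≅ b → a ^ k ≅ b ^ k
    ≅-^ zero    h = ≅-refl O-1
    ≅-^ (suc k) h = ≅-* (≅-^ k h) h

    ≅-∑ : ∀ n {f g} → (∀ k → k ℕ.< n → f k ≅ g k) → ∑ n f ≅ ∑ n g
    ≅-∑ zero    h = ≅-refl O-0
    ≅-∑ (suc n) h = ≅-+ (≅-∑ n (λ k k<n → h k (ℕP.m<n⇒m<1+n k<n))) (h n ℕP.≤-refl)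

    ≅-diag : ∀ n {f g : ℕ → ℕ → Carrier} → (∀ i j → i ℕ.+ j ≡ n → f i j ≅ g i j) → diag n f ≅ diag n g
    ≅-diag zero    h = h 0 0 ≡.refl
    ≅-diag (suc n) h = ≅-+ (h (suc n) 0 (ℕP.+-identityʳ _))
      (≅-diag n (λ i j e → h i (suc j) (≡.trans (ℕP.+-suc i j) (≡.cong suc e))))

    -- Congruent units, that is, the congruences that may be inverted: 1/a - 1/b is -(a - b)/(a b).
    record _≅ˣ_ (a b : Carrier) : Set where
      constructor congˣ
      field
        unitˡ : Unit a
        unitʳ : Unit b
        diffˣ : Dv 1 (a - b)
    open _≅ˣ_ public

    ≅ˣ⇒≅ : ∀ {a b} → a ≅ˣ b → a ≅ b
    ≅ˣ⇒≅ (congˣ u v d) = cong (O-a u) (O-a v) d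

    ≅ˣ-* : ∀ {a b c d} → a ≅ˣ b → c ≅ˣ d → a * c ≅ˣ b * d
    ≅ˣ-* p@(congˣ u v _) q@(congˣ u' v' _) = congˣ (unit-* u u') (unit-* v v') (diff (≅-* (≅ˣ⇒≅ p) (≅ˣ⇒≅ q)))

    ≅ˣ-refl : ∀ {a} → Unit a → a ≅ˣ a
    ≅ˣ-refl u = congˣ u u (diff (≅-refl (O-a u)))

    ≅ˣ-^ : ∀ {a b} k → a ≅ˣ b → a ^ k ≅ˣ b ^ k
    ≅ˣ-^ k p@(congˣ u v _) = congˣ (unit-^ k u) (unit-^ k v) (diff (≅-^ k (≅ˣ⇒≅ p)))

    ≅ˣ-⁻¹ : ∀ {a b} → a ≅ˣ b → a ⁻¹ ≅ˣ b ⁻¹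
    ≅ˣ-⁻¹ {a} {b} (congˣ u v d) = congˣ (unit-⁻¹ u) (unit-⁻¹ v)
      (Dv-cong (begin
          - (a - b) * (a ⁻¹ * b ⁻¹)
            ≈⟨ solve (a ∷ b ∷ a ⁻¹ ∷ b ⁻¹ ∷ []) (λ a b c d → :- (a :- b) :* (c :* d) := c :* (b :* d) :- a :* c :* d) ≡.refl _ ⟩
          a ⁻¹ * (b * b ⁻¹) - a * a ⁻¹ * b ⁻¹
            ≈⟨ sub-cong (trans (*-congˡ (inverseʳ (≉0 v))) (*-identityʳ _)) (trans (*-congʳ (inverseʳ (≉0 u))) (*-identityˡ _)) ⟩
          a ⁻¹ - b ⁻¹ ∎)
        (Dv-*ʳ (Dv-neg d) (O-* (O-⁻¹ u) (O-⁻¹ v))))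

    ≅-/ : ∀ {a b c d} → a ≅ b → c ≅ˣ d → a / c ≅ b / d
    ≅-/ p q = ≅-* p (≅ˣ⇒≅ (≅ˣ-⁻¹ q))

-- First-order perturbation in y

module Perturbations where

  open import Data.Nat as ℕ using (ℕ; zero; suc)
  import Data.Nat.Properties as ℕP
  open import Data.Vec using ([]; _∷_)
  open import Data.Product using (_,_)
  open import Relation.Binary.PropositionalEquality as ≡ using (_≡_)
  open Fields
  open FieldSolver
  open QSeries
  open WellPoised
  open ApérySums
  open Localisations

  module Perturbation (K : Field) (p : Field.Carrier K)
    (p≉0 : Field._≉_ K p (Field.0# K))
    (1-p^≉0 : ∀ k → Field._≉_ K (Field._-_ K (Field.1# K) (Field._*_ K p (FieldLemmas._^_ K p k))) (Field.0# K))
    (u : Field.Carrier K) (u≉0 : Field._≉_ K u (Field.0# K))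
    (1-up^≉0 : ∀ j → Field._≉_ K (Field._-_ K (Field.1# K) (Field._*_ K u (FieldLemmas._^_ K p j))) (Field.0# K))
    where
    open FieldLemmas K
    open Sums K
    open QPochhammer K p
    open Saalschütz K p 1-p^≉0
    open WellPoisedSum K p p≉0 1-p^≉0
    open Apéry K p p≉0 1-p^≉0

    x y τ : ℕ → Carrier
    x m = u * p ^ m
    y m = 1# - x m
    τ m = - (y m * y m) / x m

    x≉0 : ∀ m → x m ≉ 0#
    x≉0 m = *-≉0 u≉0 (p^≉0 m)

    Π : Carrier → ℕ → Carrier
    Π t zero    = 1#
    Π t (suc j) = Π t j * (1# + t * h j)

    -- `R (x m) j` is x^j (p/x;p)_j, so this is the identity that defines τ, multiplied over the
    -- first j factors.
    Π-factor : ∀ m j → Π (τ m) j * (P j * P j) * x m ^ j ≈ poch (x m * p) j * R (x m) j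
    Π-factor m zero    = solve [] (:1 :* (:1 :* :1) :* :1 := :1 :* :1) ≡.refl _
    Π-factor m (suc j) = begin
      Π (τ m) j * (1# + τ m * h j) * (P j * d j * (P j * d j)) * (x m ^ j * x m)
        ≈⟨ solve (p ∷ p ^ j ∷ x m ∷ x m ^ j ∷ P j ∷ Π (τ m) j ∷ [])
             (λ p J x x' P T → let d = :1 :- p :* J ; y = :1 :- x in
               T :* (:1 :+ :- (y :* y) :/ x :* (p :* J :/ (d :* d))) :* (P :* d :* (P :* d)) :* (x' :* x)
               := T :* (P :* P) :* x' :* ((:1 :- x :* p :* J) :* (x :- J :* p)))
             ≡.refl (x≉0 m , *-≉0 (d≉0 j) (d≉0 j)) ⟩
      Π (τ m) j * (P j * P j) * x m ^ j * ((1# - x m * p * p ^ j) * (x m - p ^ suc j))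
        ≈⟨ *-congʳ (Π-factor m j) ⟩
      poch (x m * p) j * R (x m) j * ((1# - x m * p * p ^ j) * (x m - p ^ suc j))
        ≈⟨ solve (poch (x m * p) j ∷ R (x m) j ∷ 1# - x m * p * p ^ j ∷ x m - p ^ suc j ∷ []) (λ a b c d → a :* b :* (c :* d) := (a :* c) :* (b :* d)) ≡.refl _ ⟩
      poch (x m * p) (suc j) * R (x m) (suc j) ∎

    E-R : ∀ j → E u u≉0 j ≈ R u j * N j
    E-R zero    = sym (*-identityˡ _)
    E-R (suc j) = trans (*-congʳ (E-R j)) (solve (R u j ∷ N j ∷ u ∷ p ^ suc j ∷ [])
      (λ R N u q → R :* N :* (q :* (q :- u)) := (R :* (u :- q)) :* (N :* :- q)) ≡.refl _)

    R-poch : ∀ j → R u j ≈ poch (p / u) j * u ^ j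
    R-poch zero    = sym (*-identityˡ _)
    R-poch (suc j) = trans (*-congʳ (R-poch j)) (solve (p ∷ u ∷ p ^ j ∷ poch (p / u) j ∷ u ^ j ∷ [])
      (λ p u J A u' → A :* u' :* (u :- J :* p) := (A :* (:1 :- p :/ u :* J)) :* (u' :* u)) ≡.refl u≉0)

    poch-x : ∀ k j → poch u (suc (k ℕ.+ j)) ≈ poch u (suc k) * poch (x k * p) j
    poch-x k j = trans (poch-+ u (suc k) j) (*-congˡ (poch-cong j (sym (*-assoc _ _ _))))

    -- Both (u;p)_(k+1) and (u;p)_(k+j+1) with k = i + j contain the factor 1 - u p^k = y, whence
    -- y². Of the rest, U_k N_j reverses to U_i R_j(x), and R_j(x) (x p;p)_j is the product that
    -- `Π-factor` compares with P_j².
    column≈β : ∀ m i j → i ℕ.+ j ≡ m → column u u≉0 1-up^≉0 i j ≈ y m * y m * β u i j * Π (τ m) j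
    column≈β .(i ℕ.+ j) i j ≡.refl = begin
      column u u≉0 1-up^≉0 i j
        ≈⟨ /-cong (*-congˡ (E-R j)) refl ⟩
      poch u (suc k) * poch u (suc (k ℕ.+ j)) * (R u j * N j) / (P k * P i * P j ^ 3 * u ^ (k ℕ.+ j) * (p ^ k) ^ j * (1# - u * p ^ j))
        ≈⟨ solve-with (y k ∷ poch u k ∷ poch (x k * p) j ∷ R u j ∷ N j ∷ P k ∷ P i ∷ P j ∷ u ^ k ∷ u ^ j ∷ (p ^ k) ^ j ∷ 1# - u * p ^ j ∷ [])
             (poch u (suc (k ℕ.+ j)) ≔ (λ y U A R N Pk Pi Pj uk uj q d → U :* y :* A) by poch-x k j
             ∷ u ^ (k ℕ.+ j) ≔ (λ y U A R N Pk Pi Pj uk uj q d → uk :* uj) by ^-+ u k j ∷ [])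
             (λ y U A R N Pk Pi Pj uk uj q d Ukj ukj →
               U :* y :* Ukj :* (R :* N) :/ (Pk :* Pi :* Pj :^ 3 :* ukj :* q :* d)
               := y :* y :* U :* R :/ (Pk :* Pi :* Pj :^ 3 :* uk :* uj :* q :* d) :* (A :* (U :* N)))
             ≡.refl (*-≉0 (*-≉0 (*-≉0 (*-≉0 (*-≉0 (P≉0 k) (P≉0 i)) (^-≉0 3 (P≉0 j))) (u^≉0' (k ℕ.+ j))) (^-≉0 j (p^≉0 k))) (1-up^≉0 j) , den≉0) ⟩
      c * (poch (x k * p) j * (poch u k * N j))           ≈⟨ *-congˡ (*-congˡ (poch-reverse u i j)) ⟨
      c * (poch (x k * p) j * (poch u i * R (x k) j))
        ≈⟨ solve (c ∷ poch (x k * p) j ∷ poch u i ∷ R (x k) j ∷ []) (λ c a b r → c :* (a :* (b :* r)) := c :* (b :* (a :* r))) ≡.refl _ ⟩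
      c * (poch u i * (poch (x k * p) j * R (x k) j))     ≈⟨ *-congˡ (*-congˡ (Π-factor k j)) ⟨
      c * (poch u i * (Π (τ k) j * (P j * P j) * x k ^ j))
        ≈⟨ *-congˡ (*-congˡ (*-congˡ (^-* u (p ^ k) j))) ⟩
      c * (poch u i * (Π (τ k) j * (P j * P j) * (u ^ j * (p ^ k) ^ j)))
        ≈⟨ solve (y k ∷ poch u k ∷ poch u i ∷ R u j ∷ P k ∷ P i ∷ P j ∷ u ^ k ∷ u ^ j ∷ (p ^ k) ^ j ∷ 1# - u * p ^ j ∷ Π (τ k) j ∷ [])
             (λ y U V R Pk Pi Pj uk uj q d T →
               y :* y :* U :* R :/ (Pk :* Pi :* Pj :^ 3 :* uk :* uj :* q :* d) :* (V :* (T :* (Pj :* Pj) :* (uj :* q)))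
               := y :* y :* (U :* R :* V :/ (uk :* Pk :* Pi :* Pj :* d)) :* T)
             ≡.refl (den≉0 , *-≉0 (*-≉0 (*-≉0 (*-≉0 (u^≉0' k) (P≉0 k)) (P≉0 i)) (P≉0 j)) (1-up^≉0 j)) ⟩
      y k * y k * β u i j * Π (τ k) j ∎
      where
      k = i ℕ.+ j
      u^≉0' : ∀ n → u ^ n ≉ 0#
      u^≉0' = u^≉0 u u≉0
      c = y k * y k * poch u k * R u j / (P k * P i * P j ^ 3 * u ^ k * u ^ j * (p ^ k) ^ j * (1# - u * p ^ j))
      den≉0 : P k * P i * P j ^ 3 * u ^ k * u ^ j * (p ^ k) ^ j * (1# - u * p ^ j) ≉ 0#
      den≉0 = *-≉0 (*-≉0 (*-≉0 (*-≉0 (*-≉0 (*-≉0 (P≉0 k) (P≉0 i)) (^-≉0 3 (P≉0 j))) (u^≉0' k)) (u^≉0' j)) (^-≉0 j (p^≉0 k))) (1-up^≉0 j)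

    -- Since U_k y = (u;p)_(k+1) contains the factor 1 - u p^j, multiplying by one y removes the
    -- divisor of `β`, also at i = 0.
    yβ : ∀ m i j → i ℕ.+ j ≡ m → y m * β u i j ≈ poch u j * poch (u * p ^ j * p) i * R u j * poch u i / (u ^ m * P m * P i * P j)
    yβ .(i ℕ.+ j) i j ≡.refl = begin
      y k * β u i j
        ≈⟨ solve (y k ∷ poch u k ∷ R u j ∷ poch u i ∷ P k ∷ P i ∷ P j ∷ u ^ k ∷ 1# - u * p ^ j ∷ [])
             (λ y U R V Pk Pi Pj uk d → y :* (U :* R :* V :/ (uk :* Pk :* Pi :* Pj :* d)) := (U :* y) :* R :* V :/ (uk :* Pk :* Pi :* Pj :* d))
             ≡.refl (den≉0 , den≉0) ⟩
      poch u (suc k) * R u j * poch u i / (u ^ k * P k * P i * P j * (1# - u * p ^ j))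
        ≈⟨ /-cong (*-congʳ (*-congʳ (trans (reflexive (≡.cong (λ n → poch u (suc n)) (ℕP.+-comm i j))) (poch-x j i)))) refl ⟩
      poch u (suc j) * poch (x j * p) i * R u j * poch u i / (u ^ k * P k * P i * P j * (1# - u * p ^ j))
        ≈⟨ solve (poch u j ∷ 1# - u * p ^ j ∷ poch (x j * p) i ∷ R u j ∷ poch u i ∷ P k ∷ P i ∷ P j ∷ u ^ k ∷ [])
             (λ U d A R V Pk Pi Pj uk → U :* d :* A :* R :* V :/ (uk :* Pk :* Pi :* Pj :* d) := U :* A :* R :* V :/ (uk :* Pk :* Pi :* Pj))
             ≡.refl (den≉0 , den'≉0) ⟩
      poch u j * poch (u * p ^ j * p) i * R u j * poch u i / (u ^ k * P k * P i * P j) ∎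
      where
      k = i ℕ.+ j
      den'≉0 : u ^ k * P k * P i * P j ≉ 0#
      den'≉0 = *-≉0 (*-≉0 (*-≉0 (u^≉0 u u≉0 k) (P≉0 k)) (P≉0 i)) (P≉0 j)
      den≉0 : u ^ k * P k * P i * P j * (1# - u * p ^ j) ≉ 0#
      den≉0 = *-≉0 den'≉0 (1-up^≉0 j)

    main : ℕ → Carrier
    main m = poch (u * u) m / (u ^ m * P m)

    -- The q-Saalschütz sum at a = p/u, b = w = u, where a w = p and b w = u².
    yβ-sum : ∀ m → diag m (λ i j → y m * β u i j) ≈ main m
    yβ-sum m = begin
      diag m (λ i j → y m * β u i j)                  ≈⟨ diag-cong m eq ⟩
      diag m (λ i j → c * summand (p / u) u u i j)    ≈⟨ diag-*ˡ m c _ ⟨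
      c * diag m (summand (p / u) u u)                ≈⟨ *-congˡ (saalschütz (p / u) u u m) ⟩
      c * (poch (p / u * u) m * poch (u * u) m)       ≈⟨ *-congˡ (*-congʳ (poch-cong m (solve (p ∷ u ∷ []) (λ p u → p :/ u :* u := p) ≡.refl u≉0))) ⟩
      c * (P m * poch (u * u) m)
        ≈⟨ solve (u ^ m ∷ P m ∷ poch (u * u) m ∷ []) (λ v P A → :1 :/ (v :* P :* P) :* (P :* A) := A :/ (v :* P)) ≡.refl (den≉0 , *-≉0 (u^≉0 u u≉0 m) (P≉0 m)) ⟩
      main m ∎
      where
      c = 1# / (u ^ m * P m * P m)
      den≉0 : u ^ m * P m * P m ≉ 0#
      den≉0 = *-≉0 (*-≉0 (u^≉0 u u≉0 m) (P≉0 m)) (P≉0 m)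
      eq : ∀ i j → i ℕ.+ j ≡ m → y m * β u i j ≈ c * summand (p / u) u u i j
      eq i j e = begin
        y m * β u i j
          ≈⟨ yβ m i j e ⟩
        poch u j * poch (u * p ^ j * p) i * R u j * poch u i / (u ^ m * P m * P i * P j)
          ≈⟨ /-cong (*-congʳ (*-congˡ (R-poch j))) refl ⟩
        poch u j * poch (u * p ^ j * p) i * (poch (p / u) j * u ^ j) * poch u i / (u ^ m * P m * P i * P j)
          ≈⟨ solve (poch u j ∷ poch (u * p ^ j * p) i ∷ poch (p / u) j ∷ u ^ j ∷ poch u i ∷ u ^ m ∷ P m ∷ P i ∷ P j ∷ [])
               (λ U A B uj V um Pm Pi Pj → U :* A :* (B :* uj) :* V :/ (um :* Pm :* Pi :* Pj) := (:1 :/ (um :* Pm :* Pm)) :* (Pm :/ (Pi :* Pj) :* B :* U :* V :* uj :* A))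
               ≡.refl (*-≉0 (*-≉0 (*-≉0 (u^≉0 u u≉0 m) (P≉0 m)) (P≉0 i)) (P≉0 j) , den≉0 , PP≉0 i j) ⟩
        c * (P m / (P i * P j) * poch (p / u) j * poch u j * poch u i * u ^ j * poch (u * p ^ j * p) i)
          ≈⟨ *-congˡ (*-cong (*-congʳ (*-congʳ (*-congʳ (*-congʳ (/-cong (reflexive (≡.cong P (≡.sym e))) refl)))))
               (poch-cong i (solve (u ∷ p ∷ p ^ j ∷ []) (λ u p J → u :* J :* p := p :/ u :* u :* u :* J) ≡.refl u≉0))) ⟩
        c * summand (p / u) u u i j ∎

    -- The entry i = 0 drops out because its harmonic factor is empty; the other entries are those
    -- of `apéry`.
    apéry′ : ∀ m → diag m (λ i j → β (1# / p ^ m) i j * H i j) ≈ ∑ m (summandT (1# / p ^ m))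
    apéry′ zero    = zeroʳ _
    apéry′ (suc n) = trans (diag-last n (λ i j → β (1# / p ^ suc n) i j * H i j)) (trans (+-cong (apéry n) (zeroʳ _)) (+-identityʳ _))

  -- The truncation at N modulo the fifth power

  module FifthPower (K : Field) (L : Localisation K) (p : Field.Carrier K)
    (p≉0 : Field._≉_ K p (Field.0# K))
    (1-p^≉0 : ∀ k → Field._≉_ K (Field._-_ K (Field.1# K) (Field._*_ K p (FieldLemmas._^_ K p k))) (Field.0# K))
    (u : Field.Carrier K) (u≉0 : Field._≉_ K u (Field.0# K))
    (1-up^≉0 : ∀ j → Field._≉_ K (Field._-_ K (Field.1# K) (Field._*_ K u (FieldLemmas._^_ K p j))) (Field.0# K))
    (m : ℕ)
    (unit-p : Divisibility.Unit K L p) (unit-u : Divisibility.Unit K L u)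
    (unit-d : ∀ l → l ℕ.< m → Divisibility.Unit K L (Apéry.d K p p≉0 1-p^≉0 l))
    (unit-1-up : ∀ j → j ℕ.< m → Divisibility.Unit K L (Field._-_ K (Field.1# K) (Field._*_ K u (FieldLemmas._^_ K p j))))
    (Dv-y : Divisibility.Dv K L 1 (Field._-_ K (Field.1# K) (Field._*_ K u (FieldLemmas._^_ K p m))))
    where
    open FieldLemmas K
    open Sums K
    open QPochhammer K p
    open Saalschütz K p 1-p^≉0
    open WellPoisedSum K p p≉0 1-p^≉0
    open Apéry K p p≉0 1-p^≉0
    open Divisibility K L
    open Perturbation K p p≉0 1-p^≉0 u u≉0 1-up^≉0 renaming (x to x′; y to y′; τ to τ′)

    x y τ : Carrier
    x = x′ m
    y = y′ m
    τ = τ′ m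

    unit-p^ : ∀ k → Unit (p ^ k)
    unit-p^ k = unit-^ k unit-p

    unit-P : ∀ k → k ℕ.≤ m → Unit (P k)
    unit-P zero    h = unit-1
    unit-P (suc k) h = unit-* (unit-P k (ℕP.≤-trans (ℕP.n≤1+n k) h)) (unit-d k h)

    unit-x : Unit x
    unit-x = unit-* unit-u (unit-p^ m)

    O-sub : ∀ {a b} → O a → O b → O (a - b)
    O-sub h k = O-+ h (O-neg k)

    O-poch : ∀ {a} k → O a → O (poch a k)
    O-poch zero    h = O-1
    O-poch (suc k) h = O-* (O-poch k h) (O-sub O-1 (O-* h (O-a (unit-p^ k))))

    O-R : ∀ {a} j → O a → O (R a j)
    O-R zero    h = O-1
    O-R (suc j) h = O-* (O-R j h) (O-sub h (O-a (unit-p^ (suc j))))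

    O-h : ∀ l → l ℕ.< m → O (h l)
    O-h l l<m = O-/ (O-* (O-a unit-p) (O-a (unit-p^ l))) (unit-* (unit-d l l<m) (unit-d l l<m))

    O-∑ : ∀ n f → (∀ k → k ℕ.< n → O (f k)) → O (∑ n f)
    O-∑ n f hyp = O-Dv (Dv-∑ {0} n f (λ k k<n → Dv-O (hyp k k<n)))

    O-H : ∀ i j → i ℕ.+ j ℕ.≤ m → O (H i j)
    O-H i j le = O-∑ i _ (λ l l<i → O-h (j ℕ.+ l) (ℕP.≤-trans (ℕP.+-monoʳ-< j l<i) (ℕP.≤-trans (ℕP.≤-reflexive (ℕP.+-comm j i)) le)))

    Dv-τ : Dv 2 τ
    Dv-τ = Dv-*ʳ (Dv-neg (Dv-* Dv-y Dv-y)) (O-⁻¹ unit-x)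

    O-yβ : ∀ i j → i ℕ.+ j ≡ m → O (y * β u i j)
    O-yβ i j e = O-cong (sym (yβ m i j e)) (O-/
      (O-* (O-* (O-* (O-poch j Ou) (O-poch i (O-* (O-* Ou (O-a (unit-p^ j))) (O-a unit-p)))) (O-R j Ou)) (O-poch i Ou))
      (unit-* (unit-* (unit-* (unit-^ m unit-u) (unit-P m ℕP.≤-refl)) (unit-P i (≡.subst (i ℕ.≤_) e (ℕP.m≤m+n i j)))) (unit-P j (≡.subst (j ℕ.≤_) e (ℕP.m≤n+m j i)))))
      where Ou = O-a unit-u

    ρ : ℕ → Carrier
    ρ j = Π τ j - (1# + τ * H j 0)

    -- The error beyond the linear term is a combination of τ², and τ is divisible by φ² because y
    -- is divisible by φ.
    Dv-ρ : ∀ j → j ℕ.≤ m → Dv 4 (ρ j)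
    Dv-ρ zero    _ = Dv-cong (solve (τ ∷ []) (λ t → :0 := :1 :- (:1 :+ t :* :0)) ≡.refl _) Dv-0
    Dv-ρ (suc j) j<m = Dv-cong
      (solve (τ ∷ h j ∷ H j 0 ∷ Π τ j ∷ []) (λ t h H T → (t :* t) :* (H :* h) :+ (T :- (:1 :+ t :* H)) :* (:1 :+ t :* h) := T :* (:1 :+ t :* h) :- (:1 :+ t :* (H :+ h))) ≡.refl _)
      (Dv-+ (Dv-*ʳ (Dv-* Dv-τ Dv-τ) (O-* (O-H j 0 (ℕP.≤-trans (ℕP.≤-reflexive (ℕP.+-identityʳ j)) j≤m)) (O-h j j<m)))
            (Dv-*ʳ (Dv-ρ j j≤m) (O-+ O-1 (O-* (O-Dv Dv-τ) (O-h j j<m)))))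
      where j≤m = ℕP.≤-trans (ℕP.n≤1+n j) j<m

    S₀ Y : Carrier
    S₀ = y * main m
    Y  = diag m (λ i j → β u i j * H i j)

    H-split : ∀ i j → H (i ℕ.+ j) 0 ≈ H j 0 + H i j
    H-split zero    j = sym (+-identityʳ _)
    H-split (suc i) j = trans (+-congʳ (H-split i j)) (trans (+-assoc _ _ _) (+-congˡ (+-congˡ (reflexive (≡.cong h (ℕP.+-comm i j))))))

    O-main : O (main m)
    O-main = O-/ (O-poch m (O-* (O-a unit-u) (O-a unit-u))) (unit-* (unit-^ m unit-u) (unit-P m ℕP.≤-refl))

    F : Carrier
    F = ∑ (suc m) (term u u≉0)

    -- With H_j = H_m - `H i j` from `H-split`, the linear term separates into a multiple of the
    -- whole sum and the sum `Y`. In the error, y (y β) contributes one φ, as y β is integral, and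
    -- `ρ` contributes four.
    F-expansion : Dv 5 (F - (S₀ + τ * H m 0 * S₀ - τ * (y * y) * Y))
    F-expansion = Dv-cong (sym eq) (Dv-diag m _ (λ i j e → Dv-* {1} {4} (Dv-* {1} {0} Dv-y (Dv-O (O-yβ i j e))) (Dv-ρ j (≡.subst (j ℕ.≤_) e (ℕP.m≤n+m j i)))))
      where
      X : ℕ → ℕ → Carrier
      X i j = y * (y * β u i j)
      parts : ∀ i j → i ℕ.+ j ≡ m → column u u≉0 1-up^≉0 i j ≈ (1# + τ * H m 0) * X i j + (- (τ * (y * y)) * (β u i j * H i j) + X i j * ρ j)
      parts i j e = trans (column≈β m i j e) (trans
        (solve (y ∷ β u i j ∷ Π τ j ∷ H j 0 ∷ H i j ∷ τ ∷ [])
          (λ y b T Hj Hi t → y :* y :* b :* T := (:1 :+ t :* (Hj :+ Hi)) :* (y :* (y :* b)) :+ (:- (t :* (y :* y)) :* (b :* Hi) :+ y :* (y :* b) :* (T :- (:1 :+ t :* Hj)))) ≡.refl _)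
        (+-congʳ (*-congʳ (+-congˡ (*-congˡ (trans (sym (H-split i j)) (reflexive (≡.cong (λ k → H k 0) e))))))))
      eq : F - (S₀ + τ * H m 0 * S₀ - τ * (y * y) * Y) ≈ diag m (λ i j → X i j * ρ j)
      eq = begin
        F - (S₀ + τ * H m 0 * S₀ - τ * (y * y) * Y)
          ≈⟨ +-congʳ (trans (partial-sum u u≉0 1-up^≉0 m) (trans (diag-cong m parts) (trans (diag-+ m _ _) (+-congˡ (diag-+ m _ _))))) ⟩
        diag m (λ i j → (1# + τ * H m 0) * X i j) + (diag m (λ i j → - (τ * (y * y)) * (β u i j * H i j)) + diag m (λ i j → X i j * ρ j)) - (S₀ + τ * H m 0 * S₀ - τ * (y * y) * Y)
          ≈⟨ +-congʳ (+-cong (trans (sym (diag-*ˡ m _ X)) (*-congˡ (trans (sym (diag-*ˡ m y _)) (*-congˡ (yβ-sum m))))) (+-congʳ (sym (diag-*ˡ m _ _)))) ⟩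
        (1# + τ * H m 0) * S₀ + (- (τ * (y * y)) * Y + diag m (λ i j → X i j * ρ j)) - (S₀ + τ * H m 0 * S₀ - τ * (y * y) * Y)
          ≈⟨ solve (τ ∷ H m 0 ∷ S₀ ∷ y ∷ Y ∷ diag m (λ i j → X i j * ρ j) ∷ [])
               (λ t H S y Y Z → (:1 :+ t :* H) :* S :+ (:- (t :* (y :* y)) :* Y :+ Z) :- (S :+ t :* H :* S :- t :* (y :* y) :* Y) := Z) ≡.refl _ ⟩
        diag m (λ i j → X i j * ρ j) ∎

    T₀ : Carrier
    T₀ = ∑ m (λ i → summandT u i / x ^ i)

    rhs : Carrier
    rhs = S₀ - (y ^ 3 + y ^ 4) * main m * H m 0 + y ^ 4 * T₀

    -- The value of u at x = 1; it is congruent to u modulo φ.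
    u₁ : Carrier
    u₁ = 1# / p ^ m

    unit-u₁ : Unit u₁
    unit-u₁ = unit-/ unit-1 (unit-p^ m)

    u≅u₁ : u ≅ˣ u₁
    u≅u₁ = congˣ unit-u unit-u₁ (Dv-cong
      (solve (u ∷ p ^ m ∷ []) (λ u M → :- (:1 :- u :* M) :/ M := u :- :1 :/ M) ≡.refl (p^≉0 m , p^≉0 m))
      (Dv-*ʳ (Dv-neg Dv-y) (O-⁻¹ (unit-p^ m))))

    x≅1 : x ≅ˣ 1#
    x≅1 = congˣ unit-x unit-1 (Dv-cong (solve (x ∷ []) (λ x → :- (:1 :- x) := x :- :1) ≡.refl _) (Dv-neg Dv-y))

    poch-≅ : ∀ {a b} k → a ≅ b → poch a k ≅ poch b k
    poch-≅ zero    e = ≅-refl O-1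
    poch-≅ (suc k) e = ≅-* (poch-≅ k e) (≅-+ (≅-refl O-1) (≅-neg (≅-* e (≅-refl (O-a (unit-p^ k))))))

    R-≅ : ∀ {a b} j → a ≅ b → R a j ≅ R b j
    R-≅ zero    e = ≅-refl O-1
    R-≅ (suc j) e = ≅-* (R-≅ j e) (≅-+ e (≅-neg (≅-refl (O-a (unit-p^ (suc j))))))

    unit-1-u₁p : ∀ j → j ℕ.< m → Unit (1# - u₁ * p ^ j)
    unit-1-u₁p j j<m = unit-cong
      (solve-with (p ∷ p ^ l ∷ p ^ j ∷ []) (p ^ m ≔ (λ p L J → J :* (L :* p)) by pm ∷ [])
        (λ p L J M → :- (:1 :- p :* L) :/ (L :* p) := :1 :- :1 :/ M :* J) ≡.refl (p^≉0 (suc l) , p^≉0 m))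
      (unit-/ (unit-neg (unit-d l l<m)) (unit-p^ (suc l)))
      where
      l = m ℕ.∸ suc j
      l<m : l ℕ.< m
      l<m = ℕP.≤-trans (ℕP.≤-trans (ℕP.≤-reflexive (ℕP.+-comm 1 l)) (ℕP.+-monoʳ-≤ l (ℕ.s≤s (ℕ.z≤n {j})))) (ℕP.≤-reflexive (ℕP.m∸n+n≡m j<m))
      pm : p ^ m ≈ p ^ j * p ^ suc l
      pm = trans (reflexive (≡.cong (p ^_) (≡.sym (≡.trans (ℕP.+-suc j l) (ℕP.m+[n∸m]≡n j<m))))) (^-+ p j (suc l))

    1-u≅ : ∀ j → j ℕ.< m → 1# - u * p ^ j ≅ˣ 1# - u₁ * p ^ j
    1-u≅ j j<m = congˣ (unit-1-up j j<m) (unit-1-u₁p j j<m)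
      (diff (≅-+ (≅-refl O-1) (≅-neg (≅-* (≅ˣ⇒≅ u≅u₁) (≅-refl (O-a (unit-p^ j)))))))

    poch-≅ˣ : ∀ k → k ℕ.≤ m → poch u k ≅ˣ poch u₁ k
    poch-≅ˣ zero    h = ≅ˣ-refl unit-1
    poch-≅ˣ (suc k) h = ≅ˣ-* (poch-≅ˣ k (ℕP.≤-trans (ℕP.n≤1+n k) h)) (1-u≅ k h)

    -- Stated only for positive first index: at index 0 the divisor 1 - u p^j is y, which is not a
    -- unit.
    β-≅ : ∀ i j → suc i ℕ.+ j ≡ m → β u (suc i) j ≅ β u₁ (suc i) j
    β-≅ i j e = ≅-/ (≅-* (≅-* (poch-≅ (suc i ℕ.+ j) u≅) (R-≅ j u≅)) (poch-≅ (suc i) u≅))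
      (≅ˣ-* (≅ˣ-* (≅ˣ-* (≅ˣ-* (≅ˣ-^ (suc i ℕ.+ j) u≅u₁) (≅ˣ-refl (unit-P _ (ℕP.≤-reflexive e)))) (≅ˣ-refl (unit-P (suc i) (≡.subst (suc i ℕ.≤_) e (ℕP.m≤m+n (suc i) j)))))
        (≅ˣ-refl (unit-P j (≡.subst (j ℕ.≤_) e (ℕP.m≤n+m j (suc i)))))) (1-u≅ j (≡.subst (j ℕ.<_) e (ℕ.s≤s (ℕP.m≤n+m j i)))))
      where u≅ = ≅ˣ⇒≅ u≅u₁

    T-≅ : ∀ i → i ℕ.< m → summandT u i / x ^ i ≅ summandT u₁ i
    T-≅ i i<m = ≅-trans
      (≅-/ (≅-/ (≅-* (≅-* (≅-* (≅-refl (O-a (unit-p^ i))) (≅-* u≅ u≅)) (≅-refl (O-a (unit-P i (ℕP.<⇒≤ i<m))))) (poch-≅ i (≅-* u≅ u≅)))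
                (≅ˣ-* (≅ˣ-^ 3 (1-u≅ i i<m)) (≅ˣ-^ 2 (poch-≅ˣ i (ℕP.<⇒≤ i<m)))))
           (≅ˣ-^ i x≅1))
      (≅-reflexive (O-/ (O-/ (O-* (O-* (O-* (O-a (unit-p^ i)) (O-* Ou₁ Ou₁)) (O-a (unit-P i (ℕP.<⇒≤ i<m)))) (O-poch i (O-* Ou₁ Ou₁)))
                       (unit-* (unit-^ 3 (unit-1-u₁p i i<m)) (unit-^ 2 (unitʳ (poch-≅ˣ i (ℕP.<⇒≤ i<m)))))) (unit-^ i unit-1))
        (trans (/-cong refl (1^ i)) (trans (*-congˡ recip-1) (*-identityʳ _))))
      where
      u≅ = ≅ˣ⇒≅ u≅u₁
      Ou₁ = O-a unit-u₁

    -- Next to y⁴ only a congruence modulo φ is required, so u may be replaced by `u₁`, where the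
    -- Apéry identity is exact. The entries with i = 0 vanish through their harmonic factor.
    Y-≅ : Y / x ≅ T₀
    Y-≅ = ≅-trans (≅-/ (≅-diag m termwise) x≅1)
      (≅-trans (≅-reflexive (O-/ OY₁ unit-1) (trans (*-congˡ recip-1) (trans (*-identityʳ _) (apéry′ m))))
               (≅-sym (≅-∑ m T-≅)))
      where
      termwise : ∀ i j → i ℕ.+ j ≡ m → β u i j * H i j ≅ β u₁ i j * H i j
      termwise zero    j e = ≅-trans (≅-reflexive (O-cong (sym (zeroʳ _)) O-0) (zeroʳ _)) (≅-reflexive O-0 (sym (zeroʳ _)))
      termwise (suc i) j e = ≅-* (β-≅ i j e) (≅-refl (O-H (suc i) j (ℕP.≤-reflexive e)))
      OY₁ : O (diag m (λ i j → β u₁ i j * H i j))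
      OY₁ = right (≅-diag m termwise)

    F-congruence : Dv 5 (F - rhs)
    F-congruence = Dv-cong
      -- From 1/x = 1 + y + y²/x, replacing y³/x by y³ + y⁴ costs only a multiple of y⁵; this is the
      -- second of the three summands.
      (solve-with (F ∷ main m ∷ x ∷ H m 0 ∷ Y ∷ T₀ ∷ []) (y ≔ (λ F M x H Y T → :1 :- x) by refl ∷ [])
        (λ F M x H Y T y → let τ = :- (y :* y) :/ x ; S = y :* M in
          (F :- (S :+ τ :* H :* S :- τ :* (y :* y) :* Y)) :+ (y :^ 4 :* (y :* (:- H :* M :/ x)) :+ y :^ 4 :* (Y :/ x :- T))
          := F :- (S :- (y :^ 3 :+ y :^ 4) :* M :* H :+ y :^ 4 :* T)) ≡.refl (x≉ , x≉ , x≉ , x≉))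
      (Dv-+ F-expansion (Dv-+ (Dv-* (Dv-^ 4 Dv-y) (Dv-* {1} {0} Dv-y (Dv-O (O-/ (O-* (O-neg (O-H m 0 (ℕP.≤-reflexive (ℕP.+-identityʳ m)))) O-main) unit-x))))
                              (Dv-* (Dv-^ 4 Dv-y) (diff Y-≅))))
      where
      x≉ = x≉0 m

    -- The terms with N < k < n

    module Tail (l : ℕ) (unit-d′ : ∀ i → i ℕ.≤ m ℕ.+ l → Unit (d i)) (p^n : Dv 1 (1# - p ^ (suc (suc m) ℕ.+ l))) where
      n : ℕ
      n = suc (suc m) ℕ.+ l

      p^n≅1 : p ^ n ≅ 1#
      p^n≅1 = cong (O-a (unit-p^ n)) O-1 (Dv-cong (solve (p ^ n ∷ []) (λ a → :- (:1 :- a) := a :- :1) ≡.refl _) (Dv-neg p^n))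

      unit-P′ : ∀ k → k ℕ.≤ suc (m ℕ.+ l) → Unit (P k)
      unit-P′ zero    h = unit-1
      unit-P′ (suc k) h = unit-* (unit-P′ k (ℕP.≤-trans (ℕP.n≤1+n k) h)) (unit-d′ k (ℕP.≤-pred h))

      p^-* : ∀ a b → (p ^ a) ^ b ≈ p ^ (a ℕ.* b)
      p^-* a zero    = reflexive (≡.cong (p ^_) (≡.sym (ℕP.*-zeroʳ a)))
      p^-* a (suc b) = trans (*-congʳ (p^-* a b)) (trans (sym (^-+ p (a ℕ.* b) a)) (reflexive (≡.cong (p ^_) (≡.trans (ℕP.+-comm _ a) (≡.sym (ℕP.*-suc a b))))))

      p^multiple : ∀ t → p ^ (n ℕ.* t) ≅ 1#
      p^multiple t = ≅-trans (≅-reflexive (O-a (unit-p^ (n ℕ.* t))) (sym (p^-* n t))) (≅-trans (≅-^ t p^n≅1) (≅-reflexive (O-^ t O-1) (1^ t)))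

      -- Everything in it except the leading `p ^ j` is symmetric in i and j, so `A i j - A j i`
      -- carries the factor p^j - p^i of the well-poised term.
      A : ℕ → ℕ → Carrier
      A i j = p ^ j * (p ^ i * p ^ j) ^ 2 * (p ^ (i ℕ.* j)) ^ 2 * (P i * P j) ^ 4

      c₀ : Carrier
      c₀ = p ^ 3 * poch u m ^ 4 / P (suc (m ℕ.+ l)) ^ 4

      -- The term k = m + 1 + i without y⁴: beyond m each (u;p)_k contains the factor y, and it
      -- occurs to the fourth power.
      θ : ℕ → Carrier
      θ i = (1# - u * p ^ k * p ^ k) * (poch u m * poch (x * p) i) ^ 4 / P k ^ 4 * (p ^ k / (u ^ k * u ^ k))
        where k = suc m ℕ.+ i

      term-θ : ∀ i → term u u≉0 (suc m ℕ.+ i) ≈ y ^ 4 * θ i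
      term-θ i = solve-with (y ∷ poch u m ∷ poch (x * p) i ∷ P k ∷ 1# - u * p ^ k * p ^ k ∷ p ^ k / (u ^ k * u ^ k) ∷ [])
        (poch u k ≔ (λ y U A P d z → U :* y :* A) by poch-x m i ∷ [])
        (λ y U A P d z Uk → d :* Uk :^ 4 :/ P :^ 4 :* z := y :^ 4 :* (d :* (U :* A) :^ 4 :/ P :^ 4 :* z)) ≡.refl (^-≉0 4 (P≉0 k) , ^-≉0 4 (P≉0 k))
        where k = suc m ℕ.+ i

      -- Modulo φ both p^n and x are 1, so all quantities with index k reduce to ones with index i
      -- or j = l - i. The result is antisymmetric under exchange of i and j, which pairs k with n +
      -- m - k.
      θ-≅ : ∀ i j → i ℕ.+ j ≡ l → θ i ≅ c₀ * (A i j - A j i)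
      θ-≅ i j ≡.refl = ≅-trans
        (≅-* (≅-/ (≅-* factor₁ (≅-^ 4 (≅-* (≅-refl (O-poch m (O-a unit-u))) (≅-trans (poch-≅ i (≅-* (≅ˣ⇒≅ x≅1) (≅-refl (O-a unit-p)))) (≅-reflexive (O-poch i (O-* O-1 (O-a unit-p))) (poch-cong i (*-identityˡ p)))))))
                  (≅ˣ-^ 4 P-≅)) power)
        (≅-reflexive (O-* (O-/ (O-* (O-+ O-1 (O-neg (O-/ (O-a (unit-p^ i)) (unit-p^ j)))) (O-^ 4 (O-* (O-poch m (O-a unit-u)) (O-poch i (O-a unit-p)))))
                               (unit-^ 4 (unitʳ P-≅))) (O-a (unit-p^ e)))
          (solve-with (p ∷ p ^ i ∷ p ^ j ∷ poch u m ∷ P i ∷ P j ∷ P n-1 ∷ N j ∷ (p ^ (i ℕ.* j)) ∷ [])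
            (p ^ e ≔ (λ p I J U Pi Pj Pn N ij → p :^ 3 :* I :^ 2 :* J :^ 3 :* ij :^ 2 :* N :^ 4) by p^e
            ∷ p ^ (j ℕ.* i) ≔ (λ p I J U Pi Pj Pn N ij → ij) by reflexive (≡.cong (p ^_) (ℕP.*-comm j i)) ∷ [])
            (λ p I J U Pi Pj Pn N ij pe ji →
              (:1 :- I :/ J) :* (U :* Pi) :^ 4 :/ (Pn :* N :/ Pj) :^ 4 :* pe
              := p :^ 3 :* U :^ 4 :/ Pn :^ 4 :* (J :* (I :* J) :^ 2 :* ij :^ 2 :* (Pi :* Pj) :^ 4 :- I :* (J :* I) :^ 2 :* ji :^ 2 :* (Pj :* Pi) :^ 4))
            ≡.refl (p^≉0 j , P≉0 j , ^-≉0 4 (/-≉0 (*-≉0 (P≉0 n-1) (N≉0 j)) (P≉0 j)) , ^-≉0 4 (P≉0 n-1))))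
        where
        import Data.Nat.Tactic.RingSolver as ℕS
        k n-1 e : ℕ
        k   = suc m ℕ.+ i
        n-1 = suc (m ℕ.+ l)
        -- As u is congruent to p^(-m), the power p^k/u^(2k) becomes p^(k(2m+1)). Modulo n one has k
        -- = -(1 + j) and 2m + 1 = -(3 + 2i + 2j), so the exponent is congruent to their product,
        -- which is free of m.
        e   = (1 ℕ.+ j) ℕ.* (3 ℕ.+ 2 ℕ.* i ℕ.+ 2 ℕ.* j)
        k+j : k ℕ.+ j ≡ n-1
        k+j = ≡.cong suc (ℕP.+-assoc m i j)
        v : Carrier
        v = 1# / p ^ j
        unit-v : Unit v
        unit-v = unit-/ unit-1 (unit-p^ j)
        pk+j : p ^ k * p ^ j * p ≈ p ^ n
        pk+j = *-congʳ (trans (sym (^-+ p k j)) (reflexive (≡.cong (p ^_) k+j)))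
        pp^k≅v : p * p ^ k ≅ v
        pp^k≅v = ≅-trans
          (≅-reflexive (O-* (O-a unit-p) (O-a (unit-p^ k))) (trans (solve (p ∷ p ^ k ∷ p ^ j ∷ []) (λ p K J → p :* K := (K :* J :* p) :/ J) ≡.refl (p^≉0 j)) (/-cong pk+j refl)))
          (≅-/ p^n≅1 (≅ˣ-refl (unit-p^ j)))
        vp^j : v * p ^ j ≈ 1#
        vp^j = trans (*-assoc _ _ _) (trans (*-identityˡ _) (inverseˡ (p^≉0 j)))
        unit-N : ∀ j → Unit (N j)
        unit-N zero    = unit-1
        unit-N (suc j) = unit-* (unit-N j) (unit-neg (unit-p^ (suc j)))
        -- P_(n-1) is P_k times (p^(k+1);p)_j, and p^(k+1) is congruent to p^(-j) because k + 1 + j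
        -- = n; reversing (p^(-j);p)_j gives P_j/N_j.
        P-≅ : P k ≅ˣ P n-1 * N j / P j
        P-≅ = congˣ (unit-P′ k k≤) (unit-/ (unit-* (unit-P′ n-1 ℕP.≤-refl) (unit-N j)) (unit-P′ j j≤)) (diff (≅-sym P-≅′))
          where
          k≤ : k ℕ.≤ n-1
          k≤ = ≡.subst (k ℕ.≤_) k+j (ℕP.m≤m+n k j)
          j≤ : j ℕ.≤ n-1
          j≤ = ≡.subst (j ℕ.≤_) k+j (ℕP.m≤n+m j k)
          Pv : P j ≈ poch v j * N j
          Pv = trans (sym (R-1 j)) (trans (R-cong j (sym vp^j)) (trans (sym (*-identityˡ _)) (poch-reverse v 0 j)))
          P-≅′ : P n-1 * N j / P j ≅ P k
          P-≅′ = ≅-trans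
            (≅-/ (≅-* (≅-trans (≅-reflexive (O-a (unit-P′ n-1 ℕP.≤-refl)) (trans (reflexive (≡.cong P (≡.sym k+j))) (poch-+ p k j)))
                               (≅-* (≅-refl (O-a (unit-P′ k k≤))) (poch-≅ j pp^k≅v))) (≅-refl (O-a (unit-N j))))
                 (≅ˣ-refl (unit-P′ j j≤)))
            (≅-reflexive (O-/ (O-* (O-* (O-a (unit-P′ k k≤)) (O-poch j (O-a unit-v))) (O-a (unit-N j))) (unit-P′ j j≤))
              (solve-with (P k ∷ poch v j ∷ N j ∷ []) (P j ≔ (λ P V N → V :* N) by Pv ∷ []) (λ P V N Pj → P :* V :* N :/ Pj := P) ≡.refl (P≉0 j)))
        factor₁ : 1# - u * p ^ k * p ^ k ≅ 1# - p ^ i / p ^ j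
        factor₁ = ≅-+ (≅-refl O-1) (≅-neg (≅-trans
          (≅-reflexive (O-* (O-* (O-a unit-u) (O-a (unit-p^ k))) (O-a (unit-p^ k)))
            (trans (*-congʳ (trans (*-congˡ (^-+ p (suc m) i)) (solve (u ∷ p ^ m ∷ p ∷ p ^ i ∷ []) (λ u M p I → u :* (M :* p :* I) := u :* M :* (p :* I)) ≡.refl _)))
                   (solve (x ∷ p ∷ p ^ i ∷ p ^ k ∷ []) (λ x p I K → x :* (p :* I) :* K := x :* I :* (p :* K)) ≡.refl _)))
          (≅-trans (≅-* (≅-* (≅ˣ⇒≅ x≅1) (≅-refl (O-a (unit-p^ i)))) pp^k≅v)
            (≅-reflexive (O-* (O-* O-1 (O-a (unit-p^ i))) (O-a unit-v)) (solve (p ^ i ∷ p ^ j ∷ []) (λ I J → :1 :* I :* (:1 :/ J) := I :/ J) ≡.refl (p^≉0 j , p^≉0 j))))))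
        -- `e₂` is the additive inverse modulo n of both `e₁` and `e`; inserting p^(e₂ + e),
        -- congruent to 1, exchanges one exponent for the other without subtraction.
        e₁ e₂ : ℕ
        e₁ = k ℕ.+ m ℕ.* k ℕ.+ m ℕ.* k
        e₂ = (1 ℕ.+ 2 ℕ.* m) ℕ.* (1 ℕ.+ j)
        power : p ^ k / (u ^ k * u ^ k) ≅ p ^ e
        power = ≅-trans (≅-/ (≅-refl (O-a (unit-p^ k))) (≅ˣ-* (≅ˣ-^ k u≅u₁) (≅ˣ-^ k u≅u₁)))
          (≅-trans (≅-reflexive (O-/ (O-a (unit-p^ k)) (unit-* (unit-^ k unit-u₁) (unit-^ k unit-u₁)))
              (trans (/-cong refl (*-cong (u₁^ k) (u₁^ k)))
              (trans (solve (p ^ k ∷ p ^ (m ℕ.* k) ∷ []) (λ K M → K :/ ((:1 :/ M) :* (:1 :/ M)) := K :* M :* M) ≡.refl (p^≉0 (m ℕ.* k) , p^≉0 (m ℕ.* k) , *-≉0 (/-≉0 1≉0 (p^≉0 (m ℕ.* k))) (/-≉0 1≉0 (p^≉0 (m ℕ.* k)))))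
                     (sym (trans (^-+ p (k ℕ.+ m ℕ.* k) (m ℕ.* k)) (*-congʳ (^-+ p k (m ℕ.* k))))))))
            (≅-trans (≅-reflexive (O-a (unit-p^ e₁)) (sym (*-identityʳ _)))
            (≅-trans (≅-* (≅-refl (O-a (unit-p^ e₁))) (≅-sym (≅-trans (≅-reflexive (O-a (unit-p^ (e₂ ℕ.+ e))) (reflexive (≡.cong (p ^_) e₂+e))) (p^multiple (2 ℕ.* (1 ℕ.+ j))))))
            (≅-trans (≅-reflexive (O-* (O-a (unit-p^ e₁)) (O-a (unit-p^ (e₂ ℕ.+ e))))
                (trans (*-congˡ (^-+ p e₂ e)) (trans (sym (*-assoc _ _ _)) (*-congʳ (trans (sym (^-+ p e₁ e₂)) (reflexive (≡.cong (p ^_) e₁+e₂)))))))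
            (≅-trans (≅-* (p^multiple (1 ℕ.+ 2 ℕ.* m)) (≅-refl (O-a (unit-p^ e)))) (≅-reflexive (O-* O-1 (O-a (unit-p^ e))) (*-identityˡ _)))))))
          where
          u₁^ : ∀ t → u₁ ^ t ≈ 1# / p ^ (m ℕ.* t)
          u₁^ t = trans (1/-^ t (p^≉0 m)) (/-cong refl (p^-* m t))
          e₂+e : e₂ ℕ.+ e ≡ n ℕ.* (2 ℕ.* (1 ℕ.+ j))
          e₂+e = ident m i j
            where
            ident : ∀ m i j → (1 ℕ.+ 2 ℕ.* m) ℕ.* (1 ℕ.+ j) ℕ.+ (1 ℕ.+ j) ℕ.* (3 ℕ.+ 2 ℕ.* i ℕ.+ 2 ℕ.* j) ≡ (2 ℕ.+ m ℕ.+ (i ℕ.+ j)) ℕ.* (2 ℕ.* (1 ℕ.+ j))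
            ident = ℕS.solve-∀
          e₁+e₂ : e₁ ℕ.+ e₂ ≡ n ℕ.* (1 ℕ.+ 2 ℕ.* m)
          e₁+e₂ = ident m i j
            where
            ident : ∀ m i j → (1 ℕ.+ m ℕ.+ i) ℕ.+ m ℕ.* (1 ℕ.+ m ℕ.+ i) ℕ.+ m ℕ.* (1 ℕ.+ m ℕ.+ i) ℕ.+ (1 ℕ.+ 2 ℕ.* m) ℕ.* (1 ℕ.+ j) ≡ (2 ℕ.+ m ℕ.+ (i ℕ.+ j)) ℕ.* (1 ℕ.+ 2 ℕ.* m)
            ident = ℕS.solve-∀
        -- The part p^(2j(j+1)) of the power is N_j⁴, which cancels the fourth power of N_j brought
        -- in by reflecting P_k.
        p^e : p ^ e ≈ p ^ 3 * (p ^ i) ^ 2 * (p ^ j) ^ 3 * (p ^ (i ℕ.* j)) ^ 2 * N j ^ 4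
        p^e = begin
          p ^ e                                                          ≡⟨ ≡.cong (p ^_) (exponent i j) ⟩
          p ^ (3 ℕ.+ i ℕ.* 2 ℕ.+ j ℕ.* 3 ℕ.+ (i ℕ.* j) ℕ.* 2 ℕ.+ (j ℕ.* j ℕ.+ j) ℕ.* 2)
            ≈⟨ ^-+₅ 3 (i ℕ.* 2) (j ℕ.* 3) ((i ℕ.* j) ℕ.* 2) ((j ℕ.* j ℕ.+ j) ℕ.* 2) ⟩
          p ^ 3 * p ^ (i ℕ.* 2) * p ^ (j ℕ.* 3) * p ^ ((i ℕ.* j) ℕ.* 2) * p ^ ((j ℕ.* j ℕ.+ j) ℕ.* 2)
            ≈⟨ *-cong (*-cong (*-cong (*-congˡ (p^-* i 2)) (p^-* j 3)) (p^-* (i ℕ.* j) 2)) (p^-* (j ℕ.* j ℕ.+ j) 2) ⟨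
          p ^ 3 * (p ^ i) ^ 2 * (p ^ j) ^ 3 * (p ^ (i ℕ.* j)) ^ 2 * (p ^ (j ℕ.* j ℕ.+ j)) ^ 2
            ≈⟨ *-congˡ (trans (^-cong 2 (trans (^-+ p (j ℕ.* j) j) (trans (*-congʳ (sym (p^-* j j))) (sym (N² j)))))
                 (solve (N j ∷ []) (λ N → (N :* N) :^ 2 := N :^ 4) ≡.refl _)) ⟩
          p ^ 3 * (p ^ i) ^ 2 * (p ^ j) ^ 3 * (p ^ (i ℕ.* j)) ^ 2 * N j ^ 4 ∎
          where
          exponent : ∀ i j → (1 ℕ.+ j) ℕ.* (3 ℕ.+ 2 ℕ.* i ℕ.+ 2 ℕ.* j) ≡ 3 ℕ.+ i ℕ.* 2 ℕ.+ j ℕ.* 3 ℕ.+ (i ℕ.* j) ℕ.* 2 ℕ.+ (j ℕ.* j ℕ.+ j) ℕ.* 2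
          exponent = ℕS.solve-∀
          ^-+₅ : ∀ a b c d e → p ^ (a ℕ.+ b ℕ.+ c ℕ.+ d ℕ.+ e) ≈ p ^ a * p ^ b * p ^ c * p ^ d * p ^ e
          ^-+₅ a b c d e = trans (^-+ p (a ℕ.+ b ℕ.+ c ℕ.+ d) e) (*-congʳ (trans (^-+ p (a ℕ.+ b ℕ.+ c) d) (*-congʳ (trans (^-+ p (a ℕ.+ b) c) (*-congʳ (^-+ p a b))))))

      -- y⁴ supplies four powers of φ; the fifth comes from the antisymmetric sum, which equals its
      -- own negative by `diag-swap` and is 0 because the two copies cancel term by term.
      tail : Dv 5 (∑ (suc l) (λ i → term u u≉0 (suc m ℕ.+ i)))
      tail = Dv-cong (sym (trans (∑-cong (suc l) (λ i _ → term-θ i)) (sym (∑-*ˡ (suc l) (y ^ 4) θ)))) (Dv-* (Dv-^ 4 Dv-y) Dv-θ)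
        where
        zero-sum : diag l (λ i j → c₀ * (A j i - A i j)) ≈ 0#
        zero-sum = begin
          diag l (λ i j → c₀ * (A j i - A i j))       ≈⟨ diag-*ˡ l c₀ _ ⟨
          c₀ * diag l (λ i j → A j i - A i j)         ≈⟨ *-congˡ (trans (diag-- l (λ i j → A j i) A) (+-congʳ (sym (diag-swap l A)))) ⟩
          c₀ * (diag l A - diag l A)                  ≈⟨ solve (c₀ ∷ diag l A ∷ []) (λ c a → c :* (a :- a) := :0) ≡.refl _ ⟩
          0#                                          ∎
        Dv-θ : Dv 1 (∑ (suc l) θ)
        Dv-θ = Dv-cong (trans (+-cong (sym (diag-∑ l θ)) (-‿cong zero-sum)) (solve (∑ (suc l) θ ∷ []) (λ a → a :- :0 := a) ≡.refl _))
          (diff (≅-diag l (λ i j e → θ-≅ j i (≡.trans (ℕP.+-comm j i) e))))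

-- Valuations at a divisor m of n, by counting

module Valuations where

  open import Data.Nat as ℕ using (ℕ; zero; suc; NonZero)
  import Data.Nat.Properties as ℕP
  open import Data.Nat.DivMod using (m*n/n≡m; /-monoˡ-≤; m/n*n≤m; m<n*o⇒m/o<n; m<n⇒m/n≡0)
  open import Data.Nat.Divisibility using (_∣_; _∣?_; divides)
  open import Data.Vec using ([]; _∷_)
  open import Data.Product using (_,_)
  open import Relation.Nullary using (¬_; yes; no)
  open import Relation.Binary.PropositionalEquality as ≡ using (_≡_)
  open Fields
  open FieldSolver
  open QSeries
  open WellPoised
  open ApérySums
  open Localisations
  open Perturbations

  module _ (m : ℕ) .{{_ : NonZero m}} where
    private
      _/m : ℕ → ℕ
      k /m = k ℕ./ m

    /-superadd : ∀ a b → a /m ℕ.+ b /m ℕ.≤ (a ℕ.+ b) /m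
    /-superadd a b = ≡.subst (ℕ._≤ (a ℕ.+ b) /m) (m*n/n≡m (a /m ℕ.+ b /m) m) (/-monoˡ-≤ m
      (≡.subst (ℕ._≤ a ℕ.+ b) (≡.sym (ℕP.*-distribʳ-+ m (a /m) (b /m))) (ℕP.+-mono-≤ (m/n*n≤m a m) (m/n*n≤m b m))))

    /-suc : ∀ n s → s ℕ.≤ m → (n ℕ.+ s) /m ℕ.≤ suc (n /m)
    /-suc n s s≤m = ℕP.≤-pred (m<n*o⇒m/o<n {n ℕ.+ s} {suc (suc (n /m))} {m} (begin-strict
      n ℕ.+ s                               ≤⟨ ℕP.+-monoʳ-≤ n s≤m ⟩
      n ℕ.+ m                               <⟨ ℕP.+-monoˡ-< m (n<) ⟩
      (suc (n /m)) ℕ.* m ℕ.+ m              ≡⟨ ℕP.+-comm _ m ⟩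
      suc (suc (n /m)) ℕ.* m                ∎))
      where
      open ℕP.≤-Reasoning
      open import Data.Nat.DivMod using (m≡m%n+[m/n]*n; m%n<n)
      n< : n ℕ.< suc (n /m) ℕ.* m
      n< = begin-strict
        n                             ≡⟨ m≡m%n+[m/n]*n n m ⟩
        n ℕ.% m ℕ.+ n /m ℕ.* m        <⟨ ℕP.+-monoˡ-< (n /m ℕ.* m) (m%n<n n m) ⟩
        m ℕ.+ n /m ℕ.* m              ∎

    -- The floor of n/m serves as a counter of multiples of m: it stays put off the multiples and,
    -- by `/-∣`, advances at each of them.
    /-∤ : ∀ n → ¬ m ∣ suc n → suc n /m ℕ.≤ n /m
    /-∤ n m∤ = ≡.subst (ℕ._≤ n /m) (m*n/n≡m (suc n /m) m) (/-monoˡ-≤ m (ℕP.≤-pred (ℕP.≤∧≢⇒< (m/n*n≤m (suc n) m) (λ e → m∤ (divides (suc n /m) (≡.sym e))))))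

    /-∣ : ∀ n → m ∣ suc n → suc (n /m) ℕ.≤ suc n /m
    /-∣ n (divides c e) = ≡.subst (suc (n /m) ℕ.≤_) (≡.sym (≡.trans (≡.cong _/m e) (m*n/n≡m c m)))
      (m<n*o⇒m/o<n {n} {c} {m} (≡.subst (suc n ℕ.≤_) e ℕP.≤-refl))

  module Denominators (K : Field) (L : Localisation K) where
    open FieldLemmas K
    open Divisibility K L

    -- The counterpart of `Dv` for divisors: k bounds the valuation of z from above.
    record Den (k : ℕ) (z : Carrier) : Set where
      constructor den
      field
        nonzero : z ≉ 0#
        bounded : O (φ ^ k / z)
    open Den public

    Den-* : ∀ {k l z w} → Den k z → Den l w → Den (k ℕ.+ l) (z * w)
    Den-* {k} {l} {z} {w} (den h o) (den h' o') = den (*-≉0 h h') (O-cong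
      (trans (solve (φ ^ k ∷ φ ^ l ∷ z ∷ w ∷ []) (λ a b z w → a :/ z :* (b :/ w) := a :* b :/ (z :* w)) ≡.refl (h , h' , *-≉0 h h')) (*-congʳ (sym (^-+ φ k l)))) (O-* o o'))

    Den-weaken : ∀ {k l z} → k ℕ.≤ l → Den k z → Den l z
    Den-weaken {k} {l} {z} k≤l (den h o) = den h (O-cong
      (trans (solve (φ ^ (l ℕ.∸ k) ∷ φ ^ k ∷ z ∷ []) (λ a b z → a :* (b :/ z) := a :* b :/ z) ≡.refl (h , h))
             (*-congʳ (trans (sym (^-+ φ (l ℕ.∸ k) k)) (reflexive (≡.cong (φ ^_) (ℕP.m∸n+n≡m k≤l)))))) (O-* (O-^ (l ℕ.∸ k) O-φ) o))

    Den-unit : ∀ {z} → Unit z → Den 0 z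
    Den-unit (unit h o o') = den h (O-cong (sym (*-identityˡ _)) o')

    Den-^ : ∀ {k z} n → Den k z → Den (n ℕ.* k) (z ^ n)
    Den-^ zero        d = Den-unit unit-1
    Den-^ {k} {z} (suc n) d = ≡.subst (λ e → Den e (z ^ suc n)) (ℕP.+-comm (n ℕ.* k) k) (Den-* (Den-^ n d) d)

    Dv-/ : ∀ {a b z w} e → b ℕ.+ e ℕ.≤ a → Dv a z → Den b w → Dv e (z / w)
    Dv-/ {a} {b} {z} {w} e le (dv v o f) (den h o') = dv (φ ^ (a ℕ.∸ (b ℕ.+ e)) * v * (φ ^ b / w)) (O-* (O-* (O-^ (a ℕ.∸ (b ℕ.+ e)) O-φ) o) o') (begin
      z / w               ≈⟨ *-congʳ f ⟩
      φ ^ a * v / w       ≈⟨ *-congʳ (*-congʳ (trans (reflexive (≡.cong (φ ^_) (≡.sym (ℕP.m∸n+n≡m le)))) (trans (^-+ φ c (b ℕ.+ e)) (*-congˡ (^-+ φ b e))))) ⟩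
      φ ^ c * (φ ^ b * φ ^ e) * v / w
        ≈⟨ solve (φ ^ c ∷ φ ^ b ∷ φ ^ e ∷ v ∷ w ∷ []) (λ c b e v w → c :* (b :* e) :* v :/ w := e :* (c :* v :* (b :/ w))) ≡.refl (h , h) ⟩
      φ ^ e * (φ ^ c * v * (φ ^ b / w)) ∎)
      where c = a ℕ.∸ (b ℕ.+ e)

    Dv-≤ : ∀ {a e z} → e ℕ.≤ a → Dv a z → Dv e z
    Dv-≤ {a} {e} le h = Dv-weaken (a ℕ.∸ e) (≡.subst (λ k → Dv k _) (≡.sym (ℕP.m∸n+n≡m le)) h)

  module DivisorCongruence (K : Field) (L : Localisation K) (p : Field.Carrier K)
    (p≉0 : Field._≉_ K p (Field.0# K))
    (1-p^≉0 : ∀ k → Field._≉_ K (Field._-_ K (Field.1# K) (Field._*_ K p (FieldLemmas._^_ K p k))) (Field.0# K))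
    (u : Field.Carrier K) (u≉0 : Field._≉_ K u (Field.0# K))
    (1-up^≉0 : ∀ j → Field._≉_ K (Field._-_ K (Field.1# K) (Field._*_ K u (FieldLemmas._^_ K p j))) (Field.0# K))
    (unit-p : Divisibility.Unit K L p) (unit-u : Divisibility.Unit K L u)
    (m : ℕ) .{{_ : NonZero m}}
    where
    open FieldLemmas K hiding (begin_; _∎; step-≡-⟩; step-≡-∣; step-≡-⟨)
    open Sums K
    open QPochhammer K p
    open Saalschütz K p 1-p^≉0
    open WellPoisedSum K p p≉0 1-p^≉0
    open Apéry K p p≉0 1-p^≉0
    open Divisibility K L
    open Denominators K L
    open Perturbation K p p≉0 1-p^≉0 u u≉0 1-up^≉0

    -- t records the residue class modulo m of the indices i at which φ divides 1 - a p^i.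
    record Pattern (a : Carrier) (t : ℕ) : Set where
      field
        t<m    : t ℕ.< m
        O-base : O a
        hit    : ∀ i → m ∣ suc (i ℕ.+ t) → Dv 1 (1# - a * p ^ i)
    open Pattern public

    -- For use in denominators the valuation of each factor has to be bounded above as well: by one
    -- at the hits and by zero elsewhere.
    record DenPattern (a : Carrier) (t : ℕ) : Set where
      field
        pattern′ : Pattern a t
        hit-den  : ∀ i → m ∣ suc (i ℕ.+ t) → Den 1 (1# - a * p ^ i)
        miss     : ∀ i → ¬ m ∣ suc (i ℕ.+ t) → Den 0 (1# - a * p ^ i)
    open DenPattern public

    -- The hits among i < k are the multiples of m in the range t + 1, ..., t + k; as t < m, their
    -- number is the floor of (k + t)/m.
    Dv-poch : ∀ {a t} → Pattern a t → ∀ k → Dv ((k ℕ.+ t) ℕ./ m) (poch a k)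
    Dv-poch {a} {t} P zero = ≡.subst (λ e → Dv e 1#) (≡.sym (m<n⇒m/n≡0 (t<m P))) (Dv-O O-1)
    Dv-poch {a} {t} P (suc k) with m ∣? suc (k ℕ.+ t)
    ... | yes h = Dv-≤ (ℕP.≤-trans (≡.subst (λ e → e ℕ./ m ℕ.≤ suc ((k ℕ.+ t) ℕ./ m)) (ℕP.+-comm (k ℕ.+ t) 1) (/-suc m (k ℕ.+ t) 1 (ℕP.≤-trans (ℕ.s≤s ℕ.z≤n) (t<m P))))
                         (ℕP.≤-reflexive (ℕP.+-comm 1 _))) (Dv-* (Dv-poch P k) (hit P k h))
    ... | no ¬h = Dv-≤ (/-∤ m (k ℕ.+ t) ¬h) (Dv-*ʳ (Dv-poch P k) (O-+ O-1 (O-neg (O-* (O-base P) (O-^ k (O-a unit-p))))))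

    Den-poch : ∀ {a t} → DenPattern a t → ∀ k → Den ((k ℕ.+ t) ℕ./ m) (poch a k)
    Den-poch {a} {t} P zero = Den-weaken ℕ.z≤n (Den-unit unit-1)
    Den-poch {a} {t} P (suc k) with m ∣? suc (k ℕ.+ t)
    ... | yes h = Den-weaken (ℕP.≤-trans (ℕP.≤-reflexive (ℕP.+-comm _ 1)) (/-∣ m (k ℕ.+ t) h)) (Den-* (Den-poch P k) (hit-den P k h))
    ... | no ¬h = Den-weaken (ℕP.≤-trans (ℕP.≤-reflexive (ℕP.+-identityʳ _)) (/-monoˡ-≤ m (ℕP.n≤1+n (k ℕ.+ t)))) (Den-* (Den-poch P k) (miss P k ¬h))

    Den-factor : ∀ {a t} → DenPattern a t → ∀ k → Den 1 (1# - a * p ^ k)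
    Den-factor {a} {t} P k with m ∣? suc (k ℕ.+ t)
    ... | yes h = hit-den P k h
    ... | no ¬h = Den-weaken ℕ.z≤n (miss P k ¬h)

    module _ {t t′ t″ : ℕ} (pat-p : DenPattern p 0) (pat-u : DenPattern u t) (pat-p/u : Pattern (p / u) t′) (pat-uu : Pattern (u * u) t″)
             (N′ : ℕ) (Dv-y : Dv 1 (y N′)) where

      Den-P : ∀ k → Den (k ℕ./ m) (P k)
      Den-P k = ≡.subst (λ e → Den (e ℕ./ m) (P k)) (ℕP.+-identityʳ k) (Den-poch pat-p k)

      Dv-P : ∀ k → Dv (k ℕ./ m) (P k)
      Dv-P k = ≡.subst (λ e → Dv (e ℕ./ m) (P k)) (ℕP.+-identityʳ k) (Dv-poch (pattern′ pat-p) k)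

      unit-N : ∀ j → Unit (N j)
      unit-N zero    = unit-1
      unit-N (suc j) = unit-* (unit-N j) (unit-neg (unit-^ (suc j) unit-p))

      -- By `large`, U_(M+1) exceeds P_M by one. By superadditivity of the floor, U_(M+j+1) pays for
      -- P_i, two of the three P_j and the divisor 1 - u p^j, and (p/u;p)_j pays for the third P_j.
      -- One power of φ remains.
      Dv-column : ∀ M → suc (M ℕ./ m) ℕ.≤ (suc M ℕ.+ t) ℕ./ m → ∀ i j → i ℕ.+ j ≡ M → Dv 1 (column u u≉0 1-up^≉0 i j)
      Dv-column .(i ℕ.+ j) large i j ≡.refl = Dv-cong (/-cong (*-congˡ (sym (trans (E-R j) (*-congʳ (R-poch j))))) refl)
        (Dv-/ 1 bound
          (Dv-* (Dv-* (Dv-poch (pattern′ pat-u) (suc M)) (Dv-poch (pattern′ pat-u) (suc (M ℕ.+ j)))) (Dv-*ʳ (Dv-*ʳ (Dv-poch pat-p/u j) (O-a (unit-^ j unit-u))) (O-a (unit-N j))))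
          (Den-* (Den-* (Den-* (Den-* (Den-* (Den-P M) (Den-P i)) (Den-^ 3 (Den-P j))) (Den-unit (unit-^ (M ℕ.+ j) unit-u))) (Den-unit (unit-^ j (unit-^ M unit-p)))) (Den-factor pat-u j)))
        where
        M = i ℕ.+ j
        open ℕP.≤-Reasoning
        import Data.Nat.Tactic.RingSolver as ℕS
        rearrange : ∀ M i j → M ℕ.+ i ℕ.+ (j ℕ.+ (j ℕ.+ (j ℕ.+ 0))) ℕ.+ 0 ℕ.+ 0 ℕ.+ 1 ℕ.+ 1 ≡ suc M ℕ.+ (suc (i ℕ.+ j) ℕ.+ j) ℕ.+ j
        rearrange = ℕS.solve-∀
        idx : ∀ M j t → suc M ℕ.+ t ℕ.+ j ≡ suc (M ℕ.+ j) ℕ.+ t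
        idx = ℕS.solve-∀
        second : suc (i ℕ./ m ℕ.+ j ℕ./ m) ℕ.+ j ℕ./ m ℕ.≤ (suc (M ℕ.+ j) ℕ.+ t) ℕ./ m
        second = begin
          suc (i ℕ./ m ℕ.+ j ℕ./ m) ℕ.+ j ℕ./ m    ≤⟨ ℕP.+-monoˡ-≤ (j ℕ./ m) (ℕ.s≤s (/-superadd m i j)) ⟩
          suc (M ℕ./ m) ℕ.+ j ℕ./ m                ≤⟨ ℕP.+-monoˡ-≤ (j ℕ./ m) large ⟩
          (suc M ℕ.+ t) ℕ./ m ℕ.+ j ℕ./ m          ≤⟨ /-superadd m (suc M ℕ.+ t) j ⟩
          (suc M ℕ.+ t ℕ.+ j) ℕ./ m                ≡⟨ ≡.cong (ℕ._/ m) (idx M j t) ⟩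
          (suc (M ℕ.+ j) ℕ.+ t) ℕ./ m              ∎
        bound : M ℕ./ m ℕ.+ i ℕ./ m ℕ.+ 3 ℕ.* (j ℕ./ m) ℕ.+ 0 ℕ.+ 0 ℕ.+ 1 ℕ.+ 1
                ℕ.≤ (suc M ℕ.+ t) ℕ./ m ℕ.+ (suc (M ℕ.+ j) ℕ.+ t) ℕ./ m ℕ.+ (j ℕ.+ t′) ℕ./ m
        bound = begin
          M ℕ./ m ℕ.+ i ℕ./ m ℕ.+ 3 ℕ.* (j ℕ./ m) ℕ.+ 0 ℕ.+ 0 ℕ.+ 1 ℕ.+ 1
            ≡⟨ rearrange (M ℕ./ m) (i ℕ./ m) (j ℕ./ m) ⟩
          suc (M ℕ./ m) ℕ.+ (suc (i ℕ./ m ℕ.+ j ℕ./ m) ℕ.+ j ℕ./ m) ℕ.+ j ℕ./ m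
            ≤⟨ ℕP.+-mono-≤ (ℕP.+-mono-≤ large second) (/-monoˡ-≤ m (ℕP.m≤m+n j t′)) ⟩
          (suc M ℕ.+ t) ℕ./ m ℕ.+ (suc (M ℕ.+ j) ℕ.+ t) ℕ./ m ℕ.+ (j ℕ.+ t′) ℕ./ m ∎

      Dv-sum : ∀ M → suc (M ℕ./ m) ℕ.≤ (suc M ℕ.+ t) ℕ./ m → Dv 1 (∑ (suc M) (term u u≉0))
      Dv-sum M large = Dv-cong (sym (partial-sum u u≉0 1-up^≉0 M)) (Dv-diag M _ (Dv-column M large))

      -- The hits of (u²;p) are shifted by t″ ≥ 0 against those of (p;p), so the numerator has at
      -- least as many.
      O-main : O (main N′)
      O-main = O-Dv (Dv-/ {(N′ ℕ.+ t″) ℕ./ m} {N′ ℕ./ m} 0 (ℕP.≤-trans (ℕP.≤-reflexive (ℕP.+-identityʳ _)) (/-monoˡ-≤ m (ℕP.m≤m+n N′ t″)))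
        (Dv-poch pat-uu N′) (Den-* (Den-unit (unit-^ N′ unit-u)) (Den-P N′)))

      private
        Y′ = y N′

      -- The squared divisor 1 - p^(l+1) costs at most two powers of φ, and y³ supplies three.
      Dv-y³h : ∀ l → Dv 1 (Y′ ^ 3 * h l)
      Dv-y³h l = Dv-cong (*-assoc _ _ _) (Dv-/ 1 ℕP.≤-refl (Dv-*ʳ (Dv-^ 3 Dv-y) (O-* (O-a unit-p) (O-a (unit-^ l unit-p)))) (Den-* (Den-factor pat-p l) (Den-factor pat-p l)))

      -- The denominator (1 - u p^i)³ U_i² is regrouped as U_(i+1)² (1 - u p^i), with valuation at
      -- most 2 (a + 1) + 1 for a the floor of i/m. The numerator has y⁴ and two factorials of
      -- valuation at least a, so one power remains.
      Dv-y⁴T : ∀ i → Dv 1 (Y′ ^ 4 * (summandT u i / x N′ ^ i))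
      Dv-y⁴T i = Dv-cong
        (solve (Y′ ∷ p ^ i ∷ u ∷ P i ∷ poch (u * u) i ∷ 1# - u * p ^ i ∷ poch u i ∷ x N′ ^ i ∷ [])
          (λ y I u P A d U x' → (y :^ 4 :* (I :* (u :* u))) :* P :* A :/ ((U :* d) :^ 2 :* d :* x') := y :^ 4 :* (I :* (u :* u) :* P :* A :/ (d :^ 3 :* U :^ 2) :/ x'))
          ≡.refl (nonzero D , *-≉0 (^-≉0 3 (1-up^≉0 i)) (^-≉0 2 (nonzero (Den-poch pat-u i))) , ^-≉0 i (x≉0 N′)))
        (Dv-/ 1 bound (Dv-* (Dv-* (Dv-*ʳ (Dv-^ 4 Dv-y) (O-* (O-^ i (O-a unit-p)) (O-* (O-a unit-u) (O-a unit-u)))) (Dv-P i)) (Dv-poch pat-uu i)) D)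
        where
        D = Den-* (Den-* (Den-^ 2 (Den-poch pat-u (suc i))) (Den-factor pat-u i)) (Den-unit (unit-^ i (unit-* unit-u (unit-^ N′ unit-p))))
        open ℕP.≤-Reasoning
        import Data.Nat.Tactic.RingSolver as ℕS
        rearrange : ∀ a → (suc a ℕ.+ (suc a ℕ.+ 0)) ℕ.+ 1 ℕ.+ 0 ℕ.+ 1 ≡ 4 ℕ.+ a ℕ.+ a
        rearrange = ℕS.solve-∀
        step : (suc i ℕ.+ t) ℕ./ m ℕ.≤ suc (i ℕ./ m)
        step = ≡.subst (λ e → e ℕ./ m ℕ.≤ suc (i ℕ./ m)) (ℕP.+-suc i t) (/-suc m i (suc t) (t<m (pattern′ pat-u)))
        bound : 2 ℕ.* ((suc i ℕ.+ t) ℕ./ m) ℕ.+ 1 ℕ.+ 0 ℕ.+ 1 ℕ.≤ 4 ℕ.+ i ℕ./ m ℕ.+ (i ℕ.+ t″) ℕ./ m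
        bound = begin
          2 ℕ.* ((suc i ℕ.+ t) ℕ./ m) ℕ.+ 1 ℕ.+ 0 ℕ.+ 1
            ≤⟨ ℕP.+-monoˡ-≤ 1 (ℕP.+-monoˡ-≤ 0 (ℕP.+-monoˡ-≤ 1 (ℕP.*-monoʳ-≤ 2 step))) ⟩
          2 ℕ.* suc (i ℕ./ m) ℕ.+ 1 ℕ.+ 0 ℕ.+ 1       ≡⟨ rearrange (i ℕ./ m) ⟩
          4 ℕ.+ i ℕ./ m ℕ.+ i ℕ./ m                   ≤⟨ ℕP.+-monoʳ-≤ (4 ℕ.+ i ℕ./ m) (/-monoˡ-≤ m (ℕP.m≤m+n i t″)) ⟩
          4 ℕ.+ i ℕ./ m ℕ.+ (i ℕ.+ t″) ℕ./ m          ∎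

      Dv-rhs : Dv 1 (Y′ * main N′ - (Y′ ^ 3 + Y′ ^ 4) * main N′ * H N′ 0 + Y′ ^ 4 * ∑ N′ (λ i → summandT u i / x N′ ^ i))
      Dv-rhs = Dv-+ (Dv-+ (Dv-*ʳ Dv-y O-main)
        -- y³ + y⁴ is y³ (1 + y), and y³ clears the denominators of the harmonic sum term by term.
        (Dv-neg (Dv-cong (solve (Y′ ∷ main N′ ∷ H N′ 0 ∷ []) (λ y M H → (y :^ 3 :* H) :* ((:1 :+ y) :* M) := (y :^ 3 :+ y :^ 4) :* M :* H) ≡.refl _)
          (Dv-*ʳ (Dv-cong (sym (∑-*ˡ N′ (Y′ ^ 3) _)) (Dv-∑ N′ _ (λ l _ → Dv-y³h l))) (O-* (O-+ O-1 (O-Dv Dv-y)) O-main)))))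
        (Dv-cong (sym (∑-*ˡ N′ (Y′ ^ 4) _)) (Dv-∑ N′ _ (λ i _ → Dv-y⁴T i)))

-- Exact division, coprimality and cyclotomic polynomials

module CyclotomicPolynomials where

  open import Defs
  open import Algebra.Bundles using (CommutativeRing)
  open import Data.Nat as ℕ using (ℕ; zero; suc)
  import Data.Nat.Properties as ℕP
  open import Data.Nat.Divisibility as ∣ using (_∣_; _∣?_; divides)
  open import Data.Nat.GCD using (gcd; GCD; gcd-GCD; module Bézout; gcd[m,n]∣m; gcd[m,n]∣n)
  open import Data.Integer as ℤ using (ℤ; +_)
  import Data.Integer.Properties as ℤP
  open import Data.List using (List; []; _∷_; _++_; length; filter; map)
  open import Data.List.Properties using (filter-++; map-++; filter-accept; filter-reject)
  open import Data.Bool using (true; false; if_then_else_; T)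
  open import Data.Empty using (⊥-elim)
  open import Data.Unit using (tt)
  open import Data.Product using (∃; _×_; _,_; proj₁; proj₂)
  open import Data.Sum using (_⊎_; inj₁; inj₂)
  open import Data.Vec using ([]; _∷_)
  open import Relation.Nullary using (¬_; yes; no)
  open import Relation.Binary.PropositionalEquality as ≡ using (_≡_)
  open SparseNormalForms
  open Fields
  open IntegerPolynomials

  module PolyFractions = Fractions polyRing zero? *P-cancel-zero oneP≉0
  open CommutativeRing polyRing using (refl; sym; trans; reflexive; setoid; *-cong; +-cong; +-congˡ; +-congʳ; -‿cong; *-assoc; *-comm; *-identityˡ; *-identityʳ; zeroʳ; +-identityʳ; +-identityˡ)
  open RingSolver polyRing using (solve; _:=_; _:+_; _:*_; _:-_; :-_; :1)
  open import Relation.Binary.Reasoning.Setoid setoid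

  mul-congʳ : ∀ r {p s} → p ≋ s → p *P r ≋ s *P r
  mul-congʳ r e = *P-cong e ≈-refl

  add-congˡ : ∀ p {r s} → r ≋ s → p +P r ≋ p +P s
  add-congˡ p e = +P-cong (≈-refl {p}) e

  constP-*-hom : ∀ a b → constP (a ℤ.* b) ≋ constP a *P constP b
  constP-*-hom a b = wrap λ { zero → ≡.sym (ℤP.+-identityʳ _) ; (suc i) → ≡.refl }

  constP-+-hom : ∀ a b → constP (a ℤ.+ b) ≋ constP a +P constP b
  constP-+-hom a b = wrap λ { zero → ≡.refl ; (suc i) → ≡.refl }

  constP≉0 : ∀ {c} → ¬ c ≡ + 0 → ¬ constP c ≋ []
  constP≉0 c≢0 e = c≢0 (at e 0)

  cancelP : ∀ {a b} c → ¬ c ≋ [] → a *P c ≋ b *P c → a ≋ b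
  cancelP {a} {b} c h = PolyFractions.cancel a b c h

  DegreeAtMost : Poly → ℕ → Set
  DegreeAtMost f n = ∀ i → n ℕ.< i → coeff f i ≡ + 0

  record Monic (f : Poly) (n : ℕ) : Set where
    constructor monic
    field
      leading : coeff f n ≡ + 1
      above   : DegreeAtMost f n
  open Monic

  monic-cong : ∀ {f g n} → f ≋ g → Monic f n → Monic g n
  monic-cong e (monic l a) = monic (≡.trans (≡.sym (at e _)) l) (λ i h → ≡.trans (≡.sym (at e i)) (a i h))

  *P-cons : ∀ a f g i → coeff ((a ∷ f) *P g) (suc i) ≡ a ℤ.* coeff g (suc i) ℤ.+ coeff (f *P g) i
  *P-cons a f g i = ≡.trans (coeff-+ (a ·P g) (+ 0 ∷ (f *P g)) (suc i)) (≡.cong (λ z → z ℤ.+ coeff (f *P g) i) (coeff-· a g (suc i)))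

  degree-* : ∀ f g m n → DegreeAtMost f m → DegreeAtMost g n →
             DegreeAtMost (f *P g) (m ℕ.+ n) × coeff (f *P g) (m ℕ.+ n) ≡ coeff f m ℤ.* coeff g n
  degree-* []      g m       n hf hg = (λ i h → ≡.refl) , ≡.refl
  degree-* (a ∷ f) g zero    n hf hg = (λ i h → ≡.trans (at fg i) (≡.trans (coeff-· a g i) (≡.trans (≡.cong (a ℤ.*_) (hg i h)) (ℤP.*-zeroʳ a)))) , ≡.trans (at fg n) (coeff-· a g n)
    where
    fg : (a ∷ f) *P g ≋ a ·P g
    fg = begin
      (a ·P g) +P (+ 0 ∷ (f *P g))  ≈⟨ +P-cong ≈-refl (∷-cong ≡.refl (mul-congʳ g {f} {[]} (wrap (λ i → hf (suc i) (ℕ.s≤s ℕ.z≤n))))) ⟩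
      (a ·P g) +P (+ 0 ∷ [])        ≈⟨ +-congˡ 0∷[] ⟩
      (a ·P g) +P []                ≈⟨ +-identityʳ _ ⟩
      a ·P g                        ∎
  degree-* (a ∷ f) g (suc m) n hf hg with degree-* f g m n (λ i h → hf (suc i) (ℕ.s≤s h)) hg
  ... | above-fg , lead-fg = (λ { (suc i) (ℕ.s≤s h) → ≡.trans (shift i (ℕP.≤-trans (ℕP.m≤n+m n m) (ℕP.<⇒≤ h))) (above-fg i h) })
                           , ≡.trans (shift (m ℕ.+ n) (ℕP.m≤n+m n m)) lead-fg
    where
    shift : ∀ i → n ℕ.≤ i → coeff ((a ∷ f) *P g) (suc i) ≡ coeff (f *P g) i
    shift i h = ≡.trans (*P-cons a f g i) (≡.trans (≡.cong (λ z → a ℤ.* z ℤ.+ coeff (f *P g) i) (hg (suc i) (ℕ.s≤s h)))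
      (≡.trans (≡.cong (λ z → z ℤ.+ coeff (f *P g) i) (ℤP.*-zeroʳ a)) (ℤP.+-identityˡ _)))

  monic-* : ∀ {f g m n} → Monic f m → Monic g n → Monic (f *P g) (m ℕ.+ n)
  monic-* {f} {g} {m} {n} (monic lf af) (monic lg ag) with degree-* f g m n af ag
  ... | a , l = monic (≡.trans l (≡.cong₂ ℤ._*_ lf lg)) a

  monic-1 : Monic oneP 0
  monic-1 = monic ≡.refl (λ { (suc i) h → ≡.refl })

  monic≉0 : ∀ {f n} → Monic f n → ¬ f ≋ []
  monic≉0 (monic l _) e with ≡.trans (≡.sym l) (at e _)
  ... | ()

  -- No non-zero multiple of g has degree below n. The induction removes the constant coefficient of
  -- w: once the remaining w is zero, the coefficient of degree n reads off `a`.
  monic-vanish : ∀ {g n} → Monic g n → ∀ w → (∀ i → n ℕ.≤ i → coeff (g *P w) i ≡ + 0) → w ≋ []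
  monic-vanish {g} {n} M []      h = refl
  monic-vanish {g} {n} M (a ∷ w) h = wrap λ { zero → a≡0 ; (suc i) → at w≋0 i }
    where
    expand : ∀ i → coeff (g *P (a ∷ w)) i ≡ a ℤ.* coeff g i ℤ.+ coeff (+ 0 ∷ (g *P w)) i
    expand i = ≡.trans (at (*P-∷ g a w) i) (≡.trans (coeff-+ (a ·P g) (+ 0 ∷ (g *P w)) i) (≡.cong (λ z → z ℤ.+ coeff (+ 0 ∷ (g *P w)) i) (coeff-· a g i)))
    w≋0 : w ≋ []
    w≋0 = monic-vanish M w λ i n≤i →
      ≡.trans (≡.sym (ℤP.+-identityˡ _))
      (≡.trans (≡.cong (λ z → z ℤ.+ coeff (g *P w) i) (≡.sym (≡.trans (≡.cong (a ℤ.*_) (above M (suc i) (ℕ.s≤s n≤i))) (ℤP.*-zeroʳ a))))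
      (≡.trans (≡.sym (expand (suc i))) (h (suc i) (ℕP.m≤n⇒m≤1+n n≤i))))
    shifted≡0 : ∀ i → coeff (+ 0 ∷ (g *P w)) i ≡ + 0
    shifted≡0 zero    = ≡.refl
    shifted≡0 (suc i) = at (trans (*P-congˡ g w≋0) (zeroʳ g)) i
    a≡0 : a ≡ + 0
    a≡0 = ≡.trans (≡.sym (≡.trans (≡.cong (λ z → a ℤ.* z ℤ.+ coeff (+ 0 ∷ (g *P w)) n) (leading M))
            (≡.trans (≡.cong (λ z → a ℤ.* + 1 ℤ.+ z) (shifted≡0 n)) (≡.trans (ℤP.+-identityʳ _) (ℤP.*-identityʳ a)))))
          (≡.trans (≡.sym (expand n)) (h n ℕP.≤-refl))

  strip-≋ : ∀ f → strip f ≋ f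
  strip-≋ [] = refl
  strip-≋ (a ∷ f) with strip f | strip-≋ f
  ... | b ∷ g | e = ∷-cong ≡.refl e
  ... | []    | e with a ℤ.≟ + 0
  ...   | yes ≡.refl = wrap λ { zero → ≡.refl ; (suc i) → at e i }
  ...   | no _       = ∷-cong ≡.refl e

  strip-length : ∀ f n → (∀ i → n ℕ.≤ i → coeff f i ≡ + 0) → length (strip f) ℕ.≤ n
  strip-length [] n h = ℕ.z≤n
  strip-length (a ∷ f) n h with strip f | (λ m → strip-length f m)
  strip-length (a ∷ f) zero h | b ∷ g | ih with ih 0 (λ i _ → h (suc i) ℕ.z≤n)
  ... | ()
  strip-length (a ∷ f) (suc n) h | b ∷ g | ih = ℕ.s≤s (ih n (λ i le → h (suc i) (ℕ.s≤s le)))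
  strip-length (a ∷ f) n h | [] | ih with a ℤ.≟ + 0
  ... | yes _ = ℕ.z≤n
  strip-length (a ∷ f) zero h | [] | ih | no a≢0 = ⊥-elim (a≢0 (h 0 ℕ.z≤n))
  strip-length (a ∷ f) (suc n) h | [] | ih | no a≢0 = ℕ.s≤s ℕ.z≤n

  coeff-beyond : ∀ f i → length f ℕ.≤ i → coeff f i ≡ + 0
  coeff-beyond []      i       h         = ≡.refl
  coeff-beyond (a ∷ f) (suc i) (ℕ.s≤s h) = coeff-beyond f i h

  lead-coeff : ∀ f e → length f ≡ suc e → lead f ≡ coeff f e
  lead-coeff (a ∷ [])    zero    h = ≡.refl
  lead-coeff (a ∷ b ∷ f) (suc e) h = lead-coeff (b ∷ f) e (ℕP.suc-injective h)

  monic-strip-length : ∀ {g n} → Monic g n → length (strip g) ≡ suc n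
  monic-strip-length {g} {n} (monic l a) = ℕP.≤-antisym (strip-length g (suc n) a) (ℕP.≰⇒> λ le → contra (≡.trans (≡.sym l) (≡.trans (≡.sym (at (strip-≋ g) n)) (coeff-beyond (strip g) n le))))
    where
    contra : ¬ + 1 ≡ + 0
    contra ()

  XP-degree : ∀ k → Monic (XP k) k
  XP-degree zero    = monic-1
  XP-degree (suc k) = monic (leading (XP-degree k)) λ { (suc i) (ℕ.s≤s h) → above (XP-degree k) i h }

  quotFuel-step : ∀ t f g → quotFuel (suc t) f g ≡
    (if length (strip f) ℕ.<ᵇ length (strip g) then []
     else (lead (strip f) ·P XP (length (strip f) ℕ.∸ length (strip g)))
          +P quotFuel t (strip f -P ((lead (strip f) ·P XP (length (strip f) ℕ.∸ length (strip g))) *P strip g)) (strip g))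
  quotFuel-step t f g with strip f | strip g
  ... | f' | g' with length f' ℕ.<ᵇ length g'
  ...   | true  = ≡.refl
  ...   | false = ≡.refl

  -- Divisibility is assumed only for a multiple c f, since it will come from Bézout identities with
  -- integer constants. Long division by a monic g is exact all the same: the remainder keeps the
  -- property, its stripped length drops below the fuel at every step, and once its degree is below
  -- n it must vanish.
  quotFuel-exact : ∀ t f g n w c → Monic g n → ¬ c ≡ + 0 → g *P w ≋ constP c *P f → length (strip f) ℕ.≤ t →
                   quotFuel t f g *P g ≋ f
  quotFuel-exact zero f g n w c M c≢0 e le = sym (trans (sym (strip-≋ f)) (reflexive (empty (strip f) le)))
    where
    empty : ∀ (l : Poly) → length l ℕ.≤ 0 → l ≡ []
    empty [] _ = ≡.refl
  quotFuel-exact (suc t) f g n w c M c≢0 e le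
    rewrite quotFuel-step t f g with length (strip f) ℕ.<ᵇ length (strip g) in lt
  -- Here g w = c f has no coefficient in degree n or above, so w = 0 by `monic-vanish`, hence c f =
  -- 0 and f = 0.
  ... | true = sym (*P-cancel-zero f (constP c) (constP≉0 c≢0) (trans (*-comm f (constP c)) (trans (sym e) (trans (*P-congˡ g w≋0) (zeroʳ g)))))
    where
    len< : length (strip f) ℕ.≤ n
    len< = ℕP.≤-pred (≡.subst (length (strip f) ℕ.<_) (monic-strip-length M) (ℕP.<ᵇ⇒< _ _ (≡.subst T (≡.sym lt) tt)))
    f-above : ∀ i → n ℕ.≤ i → coeff f i ≡ + 0
    f-above i h = ≡.trans (≡.sym (at (strip-≋ f) i)) (coeff-beyond (strip f) i (ℕP.≤-trans len< h))
    w≋0 : w ≋ []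
    w≋0 = monic-vanish M w λ i h → ≡.trans (at e i) (≡.trans (at (constP-* c f) i) (≡.trans (coeff-· c f i) (≡.trans (≡.cong (c ℤ.*_) (f-above i h)) (ℤP.*-zeroʳ c))))
  ... | false = begin
    (m +P quotFuel t f₁ g') *P g            ≈⟨ *P-congˡ (m +P quotFuel t f₁ g') (sym (strip-≋ g)) ⟩
    (m +P quotFuel t f₁ g') *P g'           ≈⟨ solve (m ∷ quotFuel t f₁ g' ∷ g' ∷ []) (λ m q g → (m :+ q) :* g := m :* g :+ q :* g) ≡.refl ⟩
    (m *P g') +P (quotFuel t f₁ g' *P g')   ≈⟨ +-congˡ (quotFuel-exact t f₁ g' n (w -P (constP c *P m)) c M' c≢0 e₁ len₁) ⟩
    (m *P g') +P f₁                         ≈⟨ solve (f' ∷ m *P g' ∷ []) (λ f q → q :+ (f :- q) := f) ≡.refl ⟩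
    f'                                      ≈⟨ strip-≋ f ⟩
    f                                       ∎
    where
    f' g' m f₁ : Poly
    f' = strip f
    g' = strip g
    k  = length f' ℕ.∸ length g'
    m  = lead f' ·P XP k
    f₁ = f' -P (m *P g')
    M' : Monic g' n
    M' = monic-cong (sym (strip-≋ g)) M
    len≥ : suc n ℕ.≤ length f'
    len≥ = ≡.subst (ℕ._≤ length f') (monic-strip-length M) (ℕP.≮⇒≥ λ h → ≡.subst T lt (ℕP.<⇒<ᵇ h))
    d = k ℕ.+ n
    len-f' : length f' ≡ suc d
    len-f' = ≡.trans (≡.sym (ℕP.m∸n+n≡m len≥)) (≡.trans (≡.cong (λ z → length f' ℕ.∸ z ℕ.+ suc n) (≡.sym (monic-strip-length M))) (ℕP.+-suc k n))
    m-above : DegreeAtMost m k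
    m-above i h = ≡.trans (coeff-· (lead f') (XP k) i) (≡.trans (≡.cong (lead f' ℤ.*_) (above (XP-degree k) i h)) (ℤP.*-zeroʳ (lead f')))
    m-lead : coeff m k ≡ lead f'
    m-lead = ≡.trans (coeff-· (lead f') (XP k) k) (≡.trans (≡.cong (lead f' ℤ.*_) (leading (XP-degree k))) (ℤP.*-identityʳ _))
    mg = degree-* m g' k n m-above (above M')
    f₁-vanish : ∀ i → d ℕ.≤ i → coeff f₁ i ≡ + 0
    f₁-vanish i h = ≡.trans (coeff-+ f' (negP (m *P g')) i) (≡.trans (≡.cong (λ z → coeff f' i ℤ.+ z) (coeff-neg (m *P g') i)) (case (ℕP.m≤n⇒m<n∨m≡n h)))
      where
      case : d ℕ.< i ⊎ d ≡ i → coeff f' i ℤ.+ ℤ.- coeff (m *P g') i ≡ + 0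
      case (inj₁ d<i) = ≡.cong₂ (λ a b → a ℤ.+ ℤ.- b) (coeff-beyond f' i (≡.subst (ℕ._≤ i) (≡.sym len-f') d<i)) (proj₁ mg i d<i)
      case (inj₂ ≡.refl) = ≡.trans (≡.cong₂ (λ a b → a ℤ.+ ℤ.- b) (≡.sym (lead-coeff f' d len-f'))
        (≡.trans (proj₂ mg) (≡.trans (≡.cong₂ ℤ._*_ m-lead (leading M')) (ℤP.*-identityʳ _)))) (ℤP.+-inverseʳ (lead f'))
    len₁ : length (strip f₁) ℕ.≤ t
    len₁ = ℕP.≤-trans (strip-length f₁ d f₁-vanish) (ℕP.≤-pred (≡.subst (ℕ._≤ suc t) len-f' le))
    e₁ : g' *P (w -P (constP c *P m)) ≋ constP c *P f₁
    e₁ = begin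
      g' *P (w -P (constP c *P m))
        ≈⟨ solve (g' ∷ w ∷ constP c ∷ m ∷ []) (λ g w c m → g :* (w :- c :* m) := g :* w :- c :* (m :* g)) ≡.refl ⟩
      (g' *P w) -P (constP c *P (m *P g'))
        ≈⟨ +-congʳ (trans (mul-congʳ w (strip-≋ g)) (trans e (*P-congˡ (constP c) (sym (strip-≋ f))))) ⟩
      (constP c *P f') -P (constP c *P (m *P g'))
        ≈⟨ solve (constP c ∷ f' ∷ m *P g' ∷ []) (λ c f q → c :* f :- c :* q := c :* (f :- q)) ≡.refl ⟩
      constP c *P f₁ ∎

  quotMonic-exact : ∀ f g n w c → Monic g n → ¬ c ≡ + 0 → g *P w ≋ constP c *P f → quotMonic f g *P g ≋ f
  quotMonic-exact f g n w c M c≢0 e = quotFuel-exact (suc (length f)) f g n w c M c≢0 e (strip-length f (suc (length f)) (λ i h → coeff-beyond f i (ℕP.≤-trans (ℕP.n≤1+n _) h)))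

  -- As g is monic, the top coefficient of q is also that of q g. A non-zero one must therefore be
  -- the leading 1 of f; its index is read off from the stripped list.
  monic-quotient : ∀ f g q m n → Monic g n → Monic f m → q *P g ≋ f → ∃ λ k → Monic q k
  monic-quotient f g q m n Mg Mf e = result (length (strip q)) ≡.refl
    where
    q-above : ∀ i → length (strip q) ℕ.≤ i → coeff q i ≡ + 0
    q-above i h = ≡.trans (≡.sym (at (strip-≋ q) i)) (coeff-beyond (strip q) i h)
    result : ∀ l → length (strip q) ≡ l → ∃ λ k → Monic q k
    result zero    h = ⊥-elim (monic≉0 Mf (trans (sym e) (mul-congʳ g {q} {[]} (wrap (λ i → q-above i (≡.subst (ℕ._≤ i) (≡.sym h) ℕ.z≤n))))))
    result (suc k) h with degree-* q g k n (λ i k<i → q-above i (≡.subst (ℕ._≤ i) (≡.sym h) k<i)) (above Mg)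
    ... | a , l = k , monic (compare (ℕP.<-cmp (k ℕ.+ n) m)) (λ i k<i → q-above i (≡.subst (ℕ._≤ i) (≡.sym h) k<i))
      where
      open import Relation.Binary.Definitions using (tri<; tri≈; tri>)
      lead-q : coeff f (k ℕ.+ n) ≡ coeff q k
      lead-q = ≡.trans (≡.sym (at e _)) (≡.trans l (≡.trans (≡.cong (coeff q k ℤ.*_) (leading Mg)) (ℤP.*-identityʳ _)))
      1≢0 : ¬ + 1 ≡ + 0
      1≢0 ()
      compare : _ → coeff q k ≡ + 1
      compare (tri< lt _ _) = ⊥-elim (1≢0 (≡.trans (≡.sym (leading Mf)) (≡.trans (≡.sym (at e m)) (a m lt))))
      compare (tri≈ _ eq _) = ≡.trans (≡.sym lead-q) (≡.trans (≡.cong (coeff f) eq) (leading Mf))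
      compare (tri> _ _ gt) = ⊥-elim (strict (≡.trans (≡.sym lead-q) (above Mf _ gt)))
        where
        strict : ¬ coeff q k ≡ + 0
        strict z = ℕP.<-irrefl ≡.refl (ℕP.≤-trans (ℕP.≤-reflexive (≡.sym h)) (strip-length q k vanish))
          where
          vanish : ∀ i → k ℕ.≤ i → coeff q i ≡ + 0
          vanish i k≤i with ℕP.m≤n⇒m<n∨m≡n k≤i
          ... | inj₁ k<i    = q-above i (≡.subst (ℕ._≤ i) (≡.sym h) k<i)
          ... | inj₂ ≡.refl = z

  infix 4 _∥_
  -- `CoprimeP` as a record over `_≋_`, so that its two polynomials can be inferred.
  record _∥_ (V P : Poly) : Set where
    constructor coprime
    field
      S′ T′ : Poly
      const : ℤ
      const≢0 : ¬ const ≡ + 0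
      bezout  : (S′ *P V) +P (T′ *P P) ≋ constP const

  ∥-sym : ∀ {V P} → V ∥ P → P ∥ V
  ∥-sym {V} {P} (coprime S T c h e) = coprime T S c h (trans (+P-comm (T *P P) (S *P V)) e)

  *≢0 : ∀ {a b} → ¬ a ≡ + 0 → ¬ b ≡ + 0 → ¬ a ℤ.* b ≡ + 0
  *≢0 {a} {b} h k e with ℤP.i*j≡0⇒i≡0∨j≡0 a e
  ... | inj₁ z = h z
  ... | inj₂ z = k z

  ∥-* : ∀ {V W P} → V ∥ P → W ∥ P → V *P W ∥ P
  ∥-* {V} {W} {P} (coprime S T c h e) (coprime S' T' c' h' e') = coprime (S *P S') ((S *P V *P T') +P (T *P (S' *P W)) +P (T *P P *P T')) (c ℤ.* c') (*≢0 h h')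
    (trans (solve (S ∷ V ∷ T ∷ P ∷ S' ∷ W ∷ T' ∷ []) (λ S V T P S' W T' →
       S :* S' :* (V :* W) :+ (S :* V :* T' :+ T :* (S' :* W) :+ T :* P :* T') :* P := (S :* V :+ T :* P) :* (S' :* W :+ T' :* P)) ≡.refl)
     (trans (*-cong e e') (sym (constP-*-hom c c'))))

  ∥-congˡ : ∀ {V W P} → V ≋ W → V ∥ P → W ∥ P
  ∥-congˡ eq (coprime S T c h e) = coprime S T c h (trans (+-congʳ (*P-congˡ S (sym eq))) e)

  ∥-congʳ : ∀ {V P Q} → P ≋ Q → V ∥ P → V ∥ Q
  ∥-congʳ eq p = ∥-sym (∥-congˡ eq (∥-sym p))

  ∥-divisor : ∀ {V W P} → V *P W ∥ P → V ∥ P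
  ∥-divisor {V} {W} (coprime S T c h e) = coprime (S *P W) T c h
    (trans (+-congʳ (solve (S ∷ W ∷ V ∷ []) (λ S W V → S :* W :* V := S :* (V :* W)) ≡.refl)) e)

  ∥-+ : ∀ {V P} Z → V ∥ P → V +P (Z *P P) ∥ P
  ∥-+ {V} {P} Z (coprime S T c h e) = coprime S (T -P (S *P Z)) c h
    (trans (solve (S ∷ V ∷ Z ∷ P ∷ T ∷ []) (λ S V Z P T → S :* (V :+ Z :* P) :+ (T :- S :* Z) :* P := S :* V :+ T :* P) ≡.refl) e)

  ∥-const : ∀ {c P} → ¬ c ≡ + 0 → constP c ∥ P
  ∥-const {c} {P} h = coprime oneP [] c h (trans (+-identityʳ _) (*-identityˡ _))

  ∥-1 : ∀ {P} → oneP ∥ P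
  ∥-1 = ∥-const {+ 1} (λ ())

  ∥-powP : ∀ {V P} k → V ∥ P → V ∥ powP P k
  ∥-powP zero    h = ∥-sym ∥-1
  ∥-powP (suc k) h = ∥-sym (∥-* (∥-sym (∥-powP k h)) (∥-sym h))

  XP-+ : ∀ a b → XP (a ℕ.+ b) ≋ XP a *P XP b
  XP-+ zero    b = sym (*-identityˡ _)
  XP-+ (suc a) b = trans (∷-cong ≡.refl (XP-+ a b)) (sym (X-* (XP a) (XP b)))

  X^_∸1 : ℕ → Poly
  X^ n ∸1 = XP n -P oneP

  geom : ℕ → ℕ → Poly
  geom n zero    = []
  geom n (suc c) = geom n c +P XP (n ℕ.* c)

  X^-1-* : ∀ n c → X^ n ℕ.* c ∸1 ≋ X^ n ∸1 *P geom n c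
  X^-1-* n zero    = trans (reflexive (≡.cong X^_∸1 (ℕP.*-zeroʳ n))) (trans (negP-inverseʳ oneP) (sym (*P-zeroʳ (X^ n ∸1))))
  X^-1-* n (suc c) = begin
    X^ n ℕ.* suc c ∸1                         ≈⟨ +-congʳ (trans (reflexive (≡.cong XP (≡.trans (ℕP.*-suc n c) (ℕP.+-comm n _)))) (XP-+ (n ℕ.* c) n)) ⟩
    (XP (n ℕ.* c) *P XP n) -P oneP            ≈⟨ solve (XP (n ℕ.* c) ∷ XP n ∷ []) (λ a b → a :* b :- :1 := (a :- :1) :+ (b :- :1) :* a) ≡.refl ⟩
    X^ n ℕ.* c ∸1 +P (X^ n ∸1 *P XP (n ℕ.* c))  ≈⟨ +-congʳ (X^-1-* n c) ⟩
    (X^ n ∸1 *P geom n c) +P (X^ n ∸1 *P XP (n ℕ.* c)) ≈⟨ solve (X^ n ∸1 ∷ geom n c ∷ XP (n ℕ.* c) ∷ []) (λ w g x → w :* g :+ w :* x := w :* (g :+ x)) ≡.refl ⟩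
    X^ n ∸1 *P geom n (suc c)                 ∎

  geom-const : ∀ n c → ∃ λ Z → geom n c ≋ constP (+ c) +P (Z *P X^ n ∸1)
  geom-const n zero    = [] , sym (trans (+-identityʳ _) 0∷[])
  geom-const n (suc c) with geom-const n c
  ... | Z , e = Z +P geom n c , (begin
    geom n c +P XP (n ℕ.* c)                  ≈⟨ +-cong e (solve (XP (n ℕ.* c) ∷ []) (λ x → x := :1 :+ (x :- :1)) ≡.refl) ⟩
    (constP (+ c) +P (Z *P X^ n ∸1)) +P (oneP +P X^ n ℕ.* c ∸1)
      ≈⟨ add-congˡ (constP (+ c) +P (Z *P X^ n ∸1)) (add-congˡ oneP (X^-1-* n c)) ⟩
    (constP (+ c) +P (Z *P X^ n ∸1)) +P (oneP +P (X^ n ∸1 *P geom n c))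
      ≈⟨ solve (constP (+ c) ∷ Z ∷ X^ n ∸1 ∷ geom n c ∷ []) (λ c Z w g → (c :+ Z :* w) :+ (:1 :+ w :* g) := (:1 :+ c) :+ (Z :+ g) :* w) ≡.refl ⟩
    (oneP +P constP (+ c)) +P ((Z +P geom n c) *P X^ n ∸1)
      ≈⟨ +P-cong (sym (constP-+-hom (+ 1) (+ c))) (≈-refl {(Z +P geom n c) *P X^ n ∸1}) ⟩
    constP (+ suc c) +P ((Z +P geom n c) *P X^ n ∸1) ∎)

  -- (X^(nc) - 1)/(X^n - 1) is a sum of c powers of X^n, each congruent to 1 modulo X^n - 1, hence
  -- congruent to the non-zero constant c. This replaces the argument through simple roots.
  geom-∥ : ∀ n c → geom n (suc c) ∥ X^ n ∸1
  geom-∥ n c = ∥-congˡ {constP (+ suc c) +P (Z *P X^ n ∸1)} {geom n (suc c)} (sym (proj₂ (geom-const n (suc c)))) (∥-+ {constP (+ suc c)} {X^ n ∸1} Z (∥-const {+ suc c} {X^ n ∸1} (λ ())))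
    where
    Z : Poly
    Z = proj₁ (geom-const n (suc c))

  X^-1-monic : ∀ n → Monic X^ suc n ∸1 (suc n)
  X^-1-monic n = monic (≡.trans (coeff-+ (XP (suc n)) (negP oneP) (suc n)) (≡.cong₂ ℤ._+_ (leading (XP-degree (suc n))) (high n)))
    λ { (suc i) h → ≡.trans (coeff-+ (XP (suc n)) (negP oneP) (suc i)) (≡.cong₂ ℤ._+_ (above (XP-degree (suc n)) (suc i) h) (high i)) }
    where
    high : ∀ i → coeff (negP oneP) (suc i) ≡ + 0
    high i = ≡.refl

  X^-1-split : ∀ d k → X^ d ℕ.+ k ∸1 ≋ X^ d ∸1 +P (XP d *P X^ k ∸1)
  X^-1-split d k = trans (+-congʳ (XP-+ d k)) (solve (XP d ∷ XP k ∷ []) (λ a b → a :* b :- :1 := (a :- :1) :+ a :* (b :- :1)) ≡.refl)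

  X^-1-∣ : ∀ {a b} → a ∣ b → ∃ λ Q → X^ b ∸1 ≋ X^ a ∸1 *P Q
  X^-1-∣ {a} (divides c ≡.refl) = geom a c , trans (reflexive (≡.cong X^_∸1 (ℕP.*-comm c a))) (X^-1-* a c)

  -- Bézout on the exponents: g + y b = x a splits X^(xa) - 1 into (X^g - 1) + X^g (X^(yb) - 1).
  X^-1-gcd : ∀ {a b g} → GCD a b g → ∃ λ A → ∃ λ B → X^ g ∸1 ≋ (A *P X^ a ∸1) +P (B *P X^ b ∸1)
  X^-1-gcd {a} {b} {g} G with Bézout.identity G
  ... | Bézout.+- x y e = geom a x , negP (XP g *P geom b y) , combine a b x y e
    where
    combine : ∀ a b x y → g ℕ.+ y ℕ.* b ≡ x ℕ.* a → X^ g ∸1 ≋ (geom a x *P X^ a ∸1) +P (negP (XP g *P geom b y) *P X^ b ∸1)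
    combine a b x y e = begin
      X^ g ∸1   ≈⟨ solve (X^ g ∸1 ∷ XP g *P X^ y ℕ.* b ∸1 ∷ []) (λ a b → a := (a :+ b) :- b) ≡.refl ⟩
      (X^ g ∸1 +P (XP g *P X^ y ℕ.* b ∸1)) -P (XP g *P X^ y ℕ.* b ∸1)
        ≈⟨ +-cong (trans (sym (X^-1-split g (y ℕ.* b))) (trans (reflexive (≡.cong X^_∸1 (≡.trans e (ℕP.*-comm x a)))) (X^-1-* a x)))
                  (-‿cong (*P-congˡ (XP g) (trans (reflexive (≡.cong X^_∸1 (ℕP.*-comm y b))) (X^-1-* b y)))) ⟩
      (X^ a ∸1 *P geom a x) -P (XP g *P (X^ b ∸1 *P geom b y))
        ≈⟨ solve (X^ a ∸1 ∷ geom a x ∷ XP g ∷ X^ b ∸1 ∷ geom b y ∷ []) (λ A p G B q → A :* p :- G :* (B :* q) := p :* A :+ :- (G :* q) :* B) ≡.refl ⟩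
      (geom a x *P X^ a ∸1) +P (negP (XP g *P geom b y) *P X^ b ∸1) ∎
  ... | Bézout.-+ x y e = negP (XP g *P geom a x) , geom b y , combine
    where
    combine : X^ g ∸1 ≋ (negP (XP g *P geom a x) *P X^ a ∸1) +P (geom b y *P X^ b ∸1)
    combine = begin
      X^ g ∸1   ≈⟨ solve (X^ g ∸1 ∷ XP g *P X^ x ℕ.* a ∸1 ∷ []) (λ a b → a := (a :+ b) :- b) ≡.refl ⟩
      (X^ g ∸1 +P (XP g *P X^ x ℕ.* a ∸1)) -P (XP g *P X^ x ℕ.* a ∸1)
        ≈⟨ +-cong (trans (sym (X^-1-split g (x ℕ.* a))) (trans (reflexive (≡.cong X^_∸1 (≡.trans e (ℕP.*-comm y b)))) (X^-1-* b y)))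
                  (-‿cong (*P-congˡ (XP g) (trans (reflexive (≡.cong X^_∸1 (ℕP.*-comm x a))) (X^-1-* a x)))) ⟩
      (X^ b ∸1 *P geom b y) -P (XP g *P (X^ a ∸1 *P geom a x))
        ≈⟨ solve (X^ b ∸1 ∷ geom b y ∷ XP g ∷ X^ a ∸1 ∷ geom a x ∷ []) (λ A p G B q → A :* p :- G :* (B :* q) := :- (G :* q) :* B :+ p :* A) ≡.refl ⟩
      (negP (XP g *P geom a x) *P X^ a ∸1) +P (geom b y *P X^ b ∸1) ∎

  Φ : ℕ → Poly
  Φ = cyclotomic

  -- For j = N - 1 the denominator in the definition of Φ_N. The range j is kept apart from N, so
  -- that products for different N can be compared.
  divisorProduct : ℕ → ℕ → Poly
  divisorProduct N zero    = oneP
  divisorProduct N (suc j) with suc j ∣? N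
  ... | yes _ = divisorProduct N j *P Φ (suc j)
  ... | no _  = divisorProduct N j

  lastPoly-++ : ∀ xs k f → lastPoly (xs ++ (k , f) ∷ []) ≡ f
  lastPoly-++ []             k f = ≡.refl
  lastPoly-++ (x ∷ [])       k f = ≡.refl
  lastPoly-++ (x ∷ y ∷ xs)   k f = lastPoly-++ (y ∷ xs) k f

  prodP-++ : ∀ xs ys → prodP (xs ++ ys) ≋ prodP xs *P prodP ys
  prodP-++ []       ys = sym (*-identityˡ _)
  prodP-++ (x ∷ xs) ys = trans (*P-congˡ x (prodP-++ xs ys)) (sym (*-assoc x _ _))

  denominator : ℕ → Poly
  denominator n = prodP (map proj₂ (filter (λ dp → proj₁ dp ∣? suc n) (cycList n)))

  Φ-suc : ∀ n → Φ (suc n) ≡ quotMonic X^ suc n ∸1 (denominator n)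
  Φ-suc n = lastPoly-++ (cycList n) (suc n) _

  cycList-suc : ∀ n → cycList (suc n) ≡ cycList n ++ (suc n , Φ (suc n)) ∷ []
  cycList-suc n = ≡.cong (λ f → cycList n ++ (suc n , f) ∷ []) (≡.sym (Φ-suc n))

  filtered-product : ∀ N j → prodP (map proj₂ (filter (λ dp → proj₁ dp ∣? N) (cycList j))) ≋ divisorProduct N j
  filtered-product N zero    = refl
  filtered-product N (suc j) = trans (reflexive (≡.cong prodP (≡.trans (≡.cong (λ xs → map proj₂ (filter div? xs)) (cycList-suc j))
      (≡.trans (≡.cong (map proj₂) (filter-++ div? (cycList j) _)) (map-++ proj₂ (filter div? (cycList j)) _)))))
    (trans (prodP-++ (map proj₂ (filter div? (cycList j))) _) (trans (mul-congʳ (prodP (map proj₂ (filter div? ((suc j , Φ (suc j)) ∷ [])))) (filtered-product N j)) last-factor))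
    where
    div? = λ (dp : ℕ × Poly) → proj₁ dp ∣? N
    last-factor : divisorProduct N j *P prodP (map proj₂ (filter div? ((suc j , Φ (suc j)) ∷ []))) ≋ divisorProduct N (suc j)
    last-factor with suc j ∣? N
    ... | yes h = *P-congˡ (divisorProduct N j) (trans (reflexive (≡.cong (λ xs → prodP (map proj₂ xs)) (filter-accept div? {suc j , Φ (suc j)} {[]} h))) (*-identityʳ (Φ (suc j))))
    ... | no ¬h = trans (*P-congˡ (divisorProduct N j) (reflexive (≡.cong (λ xs → prodP (map proj₂ xs)) (filter-reject div? {suc j , Φ (suc j)} {[]} ¬h)))) (*-identityʳ _)

  record CyclotomicFacts (n : ℕ) : Set where
    field
      degree  : ℕ
      Φ-monic : Monic (Φ (suc n)) degree
      product : X^ suc n ∸1 ≋ divisorProduct (suc n) n *P Φ (suc n)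
  open CyclotomicFacts

  divisorProduct-monoˡ : ∀ N N′ j → (∀ i → i ℕ.≤ j → i ∣ N → i ∣ N′) → ∃ λ Q → divisorProduct N′ j ≋ divisorProduct N j *P Q
  divisorProduct-monoˡ N N′ zero    h = oneP , sym (*-identityʳ _)
  divisorProduct-monoˡ N N′ (suc j) h with divisorProduct-monoˡ N N′ j (λ i le → h i (ℕP.m≤n⇒m≤1+n le)) | suc j ∣? N | suc j ∣? N′
  ... | Q , e | yes _ | yes _ = Q , trans (mul-congʳ (Φ (suc j)) e)
        (solve (divisorProduct N j ∷ Q ∷ Φ (suc j) ∷ []) (λ D Q F → D :* Q :* F := D :* F :* Q) ≡.refl)
  ... | Q , e | yes d | no ¬d = ⊥-elim (¬d (h (suc j) ℕP.≤-refl d))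
  ... | Q , e | no _  | yes _ = Q *P Φ (suc j) , trans (mul-congʳ (Φ (suc j)) e) (*P-assoc (divisorProduct N j) Q (Φ (suc j)))
  ... | Q , e | no _  | no _  = Q , e

  divisorProduct-monoʳ : ∀ N j d → ∃ λ Q → divisorProduct N (d ℕ.+ j) ≋ divisorProduct N j *P Q
  divisorProduct-monoʳ N j zero    = oneP , sym (*-identityʳ _)
  divisorProduct-monoʳ N j (suc d) with divisorProduct-monoʳ N j d | suc (d ℕ.+ j) ∣? N
  ... | Q , e | yes _ = Q *P Φ (suc (d ℕ.+ j)) , trans (mul-congʳ (Φ (suc (d ℕ.+ j))) e) (*P-assoc (divisorProduct N j) Q (Φ (suc (d ℕ.+ j))))
  ... | Q , e | no _  = Q , e

  divisorProduct-top : ∀ n → CyclotomicFacts n → X^ suc n ∸1 ≋ divisorProduct (suc n) (suc n)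
  divisorProduct-top n F with suc n ∣? suc n
  ... | yes _ = product F
  ... | no ¬d = ⊥-elim (¬d ∣.∣-refl)

  -- Put g = gcd(a, k + 1), a proper divisor of k + 1. Then Φ_(k+1) divides (X^(k+1) - 1)/(X^g - 1),
  -- which is coprime to X^g - 1; and X^g - 1 is a combination of X^a - 1 and of X^(k+1) - 1, where
  -- the latter is a multiple of Φ_(k+1).
  Φ-∥-X^ : ∀ k → (∀ i → i ℕ.≤ k → CyclotomicFacts i) → ∀ a → ¬ suc k ∣ a → Φ (suc k) ∥ X^ a ∸1
  Φ-∥-X^ k facts a k∤a with gcd a (suc k) in eq | gcd[m,n]∣m a (suc k) | gcd[m,n]∣n a (suc k) | gcd-GCD a (suc k)
  ... | zero | _ | divides c e | _ = ⊥-elim (ℕP.1+n≢0 (≡.trans e (ℕP.*-zeroʳ c)))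
  ... | suc g | _ | divides zero () | _
  ... | suc g | g∣a | g∣k@(divides (suc c) e) | G = bezout (∥-divisor (∥-congˡ geom≋ (geom-∥ (suc g) c))) (X^-1-gcd G)
    where
    g<k : suc g ℕ.≤ k
    g<k = ℕP.≤-pred (ℕP.≤∧≢⇒< (∣.∣⇒≤ g∣k) (λ g≡k → k∤a (≡.subst (_∣ a) g≡k g∣a)))
    W D : Poly
    W = X^ suc g ∸1
    D = divisorProduct (suc k) k
    D₁ : ∃ λ Q → divisorProduct (suc k) (suc g) ≋ divisorProduct (suc g) (suc g) *P Q
    D₁ = divisorProduct-monoˡ (suc g) (suc k) (suc g) (λ i _ i∣g → ∣.∣-trans i∣g g∣k)
    D₂ : ∃ λ Q → divisorProduct (suc k) (k ℕ.∸ suc g ℕ.+ suc g) ≋ divisorProduct (suc k) (suc g) *P Q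
    D₂ = divisorProduct-monoʳ (suc k) (suc g) (k ℕ.∸ suc g)
    Q : Poly
    Q = proj₁ D₁ *P proj₁ D₂
    D≋ : D ≋ W *P Q
    D≋ = trans (reflexive (≡.cong (divisorProduct (suc k)) (≡.sym (ℕP.m∸n+n≡m g<k))))
      (trans (proj₂ D₂) (trans (mul-congʳ (proj₁ D₂) (trans (proj₂ D₁) (mul-congʳ (proj₁ D₁) (sym (divisorProduct-top g (facts g (ℕP.≤-trans (ℕP.n≤1+n g) g<k)))))))
        (*P-assoc W (proj₁ D₁) (proj₁ D₂))))
    geom≋ : geom (suc g) (suc c) ≋ Φ (suc k) *P Q
    geom≋ = cancelP W (monic≉0 (X^-1-monic g)) (trans (*P-comm (geom (suc g) (suc c)) W)
      (trans (sym (X^-1-* (suc g) (suc c))) (trans (reflexive (≡.cong X^_∸1 (≡.trans (ℕP.*-comm (suc g) (suc c)) (≡.sym e))))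
      (trans (product (facts k ℕP.≤-refl)) (trans (mul-congʳ (Φ (suc k)) D≋) (solve (W ∷ Q ∷ Φ (suc k) ∷ []) (λ W Q F → W :* Q :* F := F :* Q :* W) ≡.refl))))))
    bezout : Φ (suc k) ∥ W → (∃ λ A → ∃ λ B → W ≋ (A *P X^ a ∸1) +P (B *P X^ suc k ∸1)) → Φ (suc k) ∥ X^ a ∸1
    bezout (coprime S T c′ h b) (A , B , w) = coprime (S +P (T *P B *P D)) (T *P A) c′ h (begin
      ((S +P (T *P B *P D)) *P Φ (suc k)) +P (T *P A *P X^ a ∸1)
        ≈⟨ solve (S ∷ T ∷ B ∷ D ∷ Φ (suc k) ∷ A ∷ X^ a ∸1 ∷ []) (λ S T B D F A Xa → (S :+ T :* B :* D) :* F :+ T :* A :* Xa := S :* F :+ T :* (A :* Xa :+ B :* (D :* F))) ≡.refl ⟩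
      (S *P Φ (suc k)) +P (T *P ((A *P X^ a ∸1) +P (B *P (D *P Φ (suc k)))))
        ≈⟨ add-congˡ (S *P Φ (suc k)) (*P-congˡ T (trans (add-congˡ (A *P X^ a ∸1) (*P-congˡ B (sym (product (facts k ℕP.≤-refl))))) (sym w))) ⟩
      (S *P Φ (suc k)) +P (T *P W)  ≈⟨ b ⟩
      constP c′ ∎)

  Φ-∥-Φ : ∀ k → (∀ i → i ℕ.≤ k → CyclotomicFacts i) → ∀ j → j ℕ.< k → Φ (suc j) ∥ Φ (suc k)
  Φ-∥-Φ k facts j j<k = ∥-divisor (∥-congˡ (trans (product (facts j (ℕP.<⇒≤ j<k))) (*P-comm (divisorProduct (suc j) j) (Φ (suc j))))
    (∥-sym (Φ-∥-X^ k facts (suc j) (λ d → ℕP.<-irrefl ≡.refl (ℕP.≤-trans (ℕ.s≤s j<k) (∣.∣⇒≤ d))))))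

  divisorProduct-∥ : ∀ k → (∀ i → i ℕ.≤ k → CyclotomicFacts i) → ∀ N j → j ℕ.≤ k → divisorProduct N j ∥ Φ (suc k)
  divisorProduct-∥ k facts N zero    h = ∥-1
  divisorProduct-∥ k facts N (suc j) h with suc j ∣? N
  ... | yes _ = ∥-* (divisorProduct-∥ k facts N j (ℕP.<⇒≤ h)) (Φ-∥-Φ k facts j h)
  ... | no _  = divisorProduct-∥ k facts N j (ℕP.<⇒≤ h)

  divisorProduct-monic : ∀ N j → (∀ i → i ℕ.< j → CyclotomicFacts i) → ∃ (Monic (divisorProduct N j))
  divisorProduct-monic N zero    facts = 0 , monic-1
  divisorProduct-monic N (suc j) facts with divisorProduct-monic N j (λ i h → facts i (ℕP.m<n⇒m<1+n h)) | suc j ∣? N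
  ... | k , M | yes _ = _ , monic-* M (Φ-monic (facts j ℕP.≤-refl))
  ... | k , M | no _  = k , M

  record DividesUpToConstant (g f : Poly) : Set where
    constructor dividing
    field
      cofactor : Poly
      scale    : ℤ
      scale≢0  : ¬ scale ≡ + 0
      equation : g *P cofactor ≋ constP scale *P f

  -- A product of coprime divisors of X^N - 1 divides it; each use of a Bézout identity multiplies
  -- `scale` by its constant.
  divisorProduct-divides : ∀ N j → (∀ i → i ℕ.< j → CyclotomicFacts i) → DividesUpToConstant (divisorProduct N j) X^ N ∸1
  divisorProduct-divides N zero    facts = dividing X^ N ∸1 (+ 1) (λ ()) refl
  divisorProduct-divides N (suc j) facts with divisorProduct-divides N j (λ i h → facts i (ℕP.m<n⇒m<1+n h)) | suc j ∣? N
  ... | d | no _ = d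
  ... | dividing E c c≢0 e | yes d = combine (divisorProduct-∥ j (λ i h → facts i (ℕ.s≤s h)) N j ℕP.≤-refl) (X^-1-∣ d)
    where
    F D D′ : Poly
    F  = Φ (suc j)
    D  = divisorProduct N j
    D′ = divisorProduct (suc j) j
    combine : D ∥ F → (∃ λ Q → X^ N ∸1 ≋ X^ suc j ∸1 *P Q) → DividesUpToConstant (D *P F) X^ N ∸1
    combine (coprime S T s s≢0 b) (Q , w) = dividing ((S *P constP c *P (D′ *P Q)) +P (T *P E)) (s ℤ.* c) (*≢0 s≢0 c≢0) (begin
      D *P F *P ((S *P constP c *P (D′ *P Q)) +P (T *P E))
        ≈⟨ solve (D ∷ F ∷ S ∷ constP c ∷ D′ ∷ Q ∷ T ∷ E ∷ []) (λ D F S c D′ Q T E → D :* F :* (S :* c :* (D′ :* Q) :+ T :* E) := S :* D :* (c :* ((D′ :* F) :* Q)) :+ T :* F :* (D :* E)) ≡.refl ⟩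
      (S *P D *P (constP c *P (D′ *P F *P Q))) +P (T *P F *P (D *P E))
        ≈⟨ +P-cong (*P-congˡ (S *P D) (*P-congˡ (constP c) (sym (trans w (mul-congʳ Q (product (facts j ℕP.≤-refl))))))) (*P-congˡ (T *P F) e) ⟩
      (S *P D *P (constP c *P X^ N ∸1)) +P (T *P F *P (constP c *P X^ N ∸1))
        ≈⟨ solve (S ∷ D ∷ T ∷ F ∷ constP c ∷ X^ N ∸1 ∷ []) (λ S D T F c W → S :* D :* (c :* W) :+ T :* F :* (c :* W) := (S :* D :+ T :* F) :* c :* W) ≡.refl ⟩
      ((S *P D) +P (T *P F)) *P constP c *P X^ N ∸1
        ≈⟨ mul-congʳ X^ N ∸1 (trans (mul-congʳ (constP c) b) (sym (constP-*-hom s c))) ⟩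
      constP (s ℤ.* c) *P X^ N ∸1 ∎)

  -- Strong induction: the facts for smaller indices give pairwise coprimality, so the denominator
  -- divides X^(n+1) - 1 up to a constant; being monic it divides exactly, which is the product
  -- formula at n + 1.
  cyclotomicFacts : ∀ n → CyclotomicFacts n
  cyclotomicFacts = <-rec CyclotomicFacts λ n ih → construct n (λ i h → ih h)
    where
    open import Data.Nat.Induction using (<-rec)
    construct : ∀ n → (∀ i → i ℕ.< n → CyclotomicFacts i) → CyclotomicFacts n
    construct n facts = record { degree = proj₁ q ; Φ-monic = proj₂ q ; product = product′ }
      where
      D : Poly
      D = divisorProduct (suc n) n
      D≋ : denominator n ≋ D
      D≋ = filtered-product (suc n) n
      M : ∃ (Monic D)
      M = divisorProduct-monic (suc n) n facts
      M′ : Monic (denominator n) (proj₁ M)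
      M′ = monic-cong (sym D≋) (proj₂ M)
      exact : Φ (suc n) *P denominator n ≋ X^ suc n ∸1
      exact with divisorProduct-divides (suc n) n facts
      ... | dividing E c c≢0 e = trans (mul-congʳ (denominator n) (reflexive (Φ-suc n)))
        (quotMonic-exact X^ suc n ∸1 (denominator n) (proj₁ M) E c M′ c≢0 (trans (mul-congʳ E D≋) e))
      product′ : X^ suc n ∸1 ≋ D *P Φ (suc n)
      product′ = trans (sym exact) (trans (*P-congˡ (Φ (suc n)) D≋) (*P-comm (Φ (suc n)) D))
      q : ∃ (Monic (Φ (suc n)))
      q = monic-quotient X^ suc n ∸1 (denominator n) (Φ (suc n)) (suc n) (proj₁ M) M′ (X^-1-monic n) exact

  Φ-coprime : ∀ k a → ¬ suc k ∣ a → X^ a ∸1 ∥ Φ (suc k)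
  Φ-coprime k a h = ∥-sym (Φ-∥-X^ k (λ i _ → cyclotomicFacts i) a h)

  -- Coprimality of the cofactor says that Φ_(k+1) divides X^((k+1)(c+1)) - 1 exactly once; all
  -- valuations of 1 - q^a rest on this.
  Φ-cofactor : ∀ k c → ∃ λ V → (V ∥ Φ (suc k)) × X^ suc k ℕ.* suc c ∸1 ≋ Φ (suc k) *P V
  Φ-cofactor k c = D *P geom (suc k) (suc c) , ∥-* (divisorProduct-∥ k (λ i _ → cyclotomicFacts i) (suc k) k ℕP.≤-refl) geom-coprime ,
    trans (X^-1-* (suc k) (suc c)) (trans (mul-congʳ (geom (suc k) (suc c)) (product (cyclotomicFacts k)))
      (solve (D ∷ Φ (suc k) ∷ geom (suc k) (suc c) ∷ []) (λ D F g → D :* F :* g := F :* (D :* g)) ≡.refl))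
    where
    D : Poly
    D = divisorProduct (suc k) k
    geom-coprime : geom (suc k) (suc c) ∥ Φ (suc k)
    geom-coprime = ∥-sym (∥-divisor (∥-congˡ (trans (product (cyclotomicFacts k)) (*P-comm D (Φ (suc k)))) (∥-sym (geom-∥ (suc k) c))))

  Φ-∥-Φ′ : ∀ j k → j ℕ.< k → Φ (suc j) ∥ Φ (suc k)
  Φ-∥-Φ′ j k = Φ-∥-Φ k (λ i _ → cyclotomicFacts i) j

  Φ≉0 : ∀ k → ¬ Φ (suc k) ≋ []
  Φ≉0 k = monic≉0 (Φ-monic (cyclotomicFacts k))

  qintPoly-* : ∀ n → X^ n ∸1 ≋ X^ 1 ∸1 *P qintPoly n
  qintPoly-* n = trans (reflexive (≡.cong X^_∸1 (≡.sym (ℕP.*-identityˡ n)))) (trans (X^-1-* 1 n) (*P-congˡ X^ 1 ∸1 (geom-1 n)))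
    where
    geom-1 : ∀ n → geom 1 n ≋ qintPoly n
    geom-1 zero    = refl
    geom-1 (suc n) = +P-cong (geom-1 n) (reflexive (≡.cong XP (ℕP.*-identityˡ n)))

  -- Π_{1<k≤j+1, k∣N} Φ_k
  properProduct : ℕ → ℕ → Poly
  properProduct N zero    = oneP
  properProduct N (suc j) with suc (suc j) ∣? N
  ... | yes _ = properProduct N j *P Φ (suc (suc j))
  ... | no _  = properProduct N j

  divisorProduct-proper : ∀ N j → divisorProduct N (suc j) ≋ X^ 1 ∸1 *P properProduct N j
  divisorProduct-proper N zero with 1 ∣? N
  ... | yes _ = sym (trans (*-identityʳ _) (product (cyclotomicFacts 0)))
  ... | no ¬d = ⊥-elim (¬d (∣.1∣ N))
  divisorProduct-proper N (suc j) with divisorProduct-proper N j | suc (suc j) ∣? N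
  ... | e | yes _ = trans (mul-congʳ (Φ (suc (suc j))) e) (*P-assoc X^ 1 ∸1 (properProduct N j) (Φ (suc (suc j))))
  ... | e | no _  = e

  qintPoly-factor : ∀ n → qintPoly (suc (suc n)) ≋ properProduct (suc (suc n)) n *P Φ (suc (suc n))
  qintPoly-factor n = cancelP X^ 1 ∸1 (monic≉0 (X^-1-monic 0)) (begin
    qintPoly N *P X^ 1 ∸1                        ≈⟨ *P-comm (qintPoly N) X^ 1 ∸1 ⟩
    X^ 1 ∸1 *P qintPoly N                        ≈⟨ qintPoly-* N ⟨
    X^ N ∸1                                      ≈⟨ product (cyclotomicFacts (suc n)) ⟩
    divisorProduct N (suc n) *P Φ N              ≈⟨ mul-congʳ (Φ N) (divisorProduct-proper N n) ⟩
    X^ 1 ∸1 *P properProduct N n *P Φ N          ≈⟨ solve (X^ 1 ∸1 ∷ properProduct N n ∷ Φ N ∷ []) (λ a b c → a :* b :* c := b :* c :* a) ≡.refl ⟩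
    properProduct N n *P Φ N *P X^ 1 ∸1          ∎)
    where N = suc (suc n)

-- Powers of q, the local ring at Φ_m and combination of moduli

module QPowersAndModuli where

  open import Defs hiding (num; den)
  open import Data.Nat as ℕ using (ℕ; zero; suc)
  import Data.Nat.Properties as ℕP
  open import Data.Nat.Divisibility as ∣ using (_∣_; _∣?_; divides)
  open import Data.Integer as ℤ using (ℤ; +_; -[1+_])
  import Data.Integer.Properties as ℤP
  open import Data.List using ([]; _∷_)
  open import Data.Empty using (⊥-elim)
  open import Data.Product using (_,_; proj₁; proj₂)
  open import Data.Vec using ([]; _∷_)
  open import Relation.Nullary using (¬_; yes; no)
  open import Relation.Binary.PropositionalEquality as ≡ using (_≡_)
  open Fields
  open FieldSolver
  open IntegerPolynomials
  open CyclotomicPolynomials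
  open Localisations
  open Valuations

  -- The argument sees the field of rational functions only through this interface; the actual field
  -- of fractions enters with `polyEmbedding`.
  record PolyEmbedding (K : Field) : Set where
    open Field K
    field
      ι           : Poly → Carrier
      ι-cong      : ∀ {f g} → f ≋ g → ι f ≈ ι g
      ι-+         : ∀ f g → ι (f +P g) ≈ ι f + ι g
      ι-*         : ∀ f g → ι (f *P g) ≈ ι f * ι g
      ι-neg       : ∀ f → ι (negP f) ≈ - ι f
      ι-1         : ι oneP ≈ 1#
      ι-injective : ∀ {f g} → ι f ≈ ι g → f ≋ g

    ι-0 : ι [] ≈ 0#
    ι-0 = trans (ι-cong (≈-sym (negP-inverseʳ oneP))) (trans (ι-+ oneP (negP oneP)) (trans (+-congˡ (ι-neg oneP)) (-‿inverseʳ _)))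

    ι-≉0 : ∀ {f} → ¬ f ≋ [] → ι f ≉ 0#
    ι-≉0 h e = h (ι-injective (trans e (sym ι-0)))

  module IntegerPowers (K : Field) (q : Field.Carrier K) (q≉0 : Field._≉_ K q (Field.0# K)) where
    open FieldLemmas K

    pow : ℤ → Carrier
    pow (+ k)    = q ^ k
    pow -[1+ k ] = (q ^ suc k) ⁻¹

    q^≉0 : ∀ k → q ^ k ≉ 0#
    q^≉0 k = ^-≉0 k q≉0

    pow≉0 : ∀ a → pow a ≉ 0#
    pow≉0 (+ k)    = q^≉0 k
    pow≉0 -[1+ k ] = ⁻¹-≉0 (q^≉0 (suc k))

    pow-⊖ : ∀ m n → pow (m ℤ.⊖ n) ≈ q ^ m / q ^ n
    pow-⊖ m zero = begin
      pow (m ℤ.⊖ 0)   ≡⟨ ≡.cong pow (ℤP.⊖-≥ (ℕ.z≤n {m})) ⟩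
      q ^ m          ≈⟨ solve (q ^ m ∷ []) (λ a → a := a :/ :1) ≡.refl 1≉0 ⟩
      q ^ m / 1#     ∎
    pow-⊖ zero    (suc n) = sym (*-identityˡ _)
    pow-⊖ (suc m) (suc n) = begin
      pow (suc m ℤ.⊖ suc n)     ≡⟨ ≡.cong pow (ℤP.[1+m]⊖[1+n]≡m⊖n m n) ⟩
      pow (m ℤ.⊖ n)             ≈⟨ pow-⊖ m n ⟩
      q ^ m / q ^ n            ≈⟨ solve (q ^ m ∷ q ^ n ∷ q ∷ []) (λ a b q → a :/ b := a :* q :/ (b :* q)) ≡.refl (q^≉0 n , q^≉0 (suc n)) ⟩
      q ^ suc m / q ^ suc n    ∎

    pow-+ : ∀ a b → pow (a ℤ.+ b) ≈ pow a * pow b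
    pow-+ (+ m)    (+ n)    = ^-+ q m n
    pow-+ (+ m)    -[1+ n ] = pow-⊖ m (suc n)
    pow-+ -[1+ m ] (+ n)    = trans (pow-⊖ n (suc m)) (*-comm _ _)
    pow-+ -[1+ m ] -[1+ n ] = begin
      (q ^ suc (suc (m ℕ.+ n))) ⁻¹        ≡⟨ ≡.cong (λ k → (q ^ suc k) ⁻¹) (ℕP.+-suc m n) ⟨
      (q ^ (suc m ℕ.+ suc n)) ⁻¹          ≈⟨ ⁻¹-cong (^-+ q (suc m) (suc n)) ⟩
      (q ^ suc m * q ^ suc n) ⁻¹          ≈⟨ *-identityˡ _ ⟨
      1# / (q ^ suc m * q ^ suc n)        ≈⟨ solve (q ^ suc m ∷ q ^ suc n ∷ []) (λ a b → :1 :/ (a :* b) := (:1 :/ a) :* (:1 :/ b)) ≡.refl (*-≉0 (q^≉0 (suc m)) (q^≉0 (suc n)) , q^≉0 (suc m) , q^≉0 (suc n)) ⟩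
      1# / q ^ suc m * (1# / q ^ suc n)   ≈⟨ *-cong (*-identityˡ _) (*-identityˡ _) ⟩
      (q ^ suc m) ⁻¹ * (q ^ suc n) ⁻¹     ∎

    pow-neg : ∀ a → pow (ℤ.- a) ≈ 1# / pow a
    pow-neg a = *-cancelʳ _ (pow≉0 a) (begin
      pow (ℤ.- a) * pow a    ≈⟨ pow-+ (ℤ.- a) a ⟨
      pow (ℤ.- a ℤ.+ a)      ≡⟨ ≡.cong pow (ℤP.+-inverseˡ a) ⟩
      1#                    ≈⟨ solve (pow a ∷ []) (λ a → :1 := :1 :/ a :* a) ≡.refl (pow≉0 a) ⟩
      1# / pow a * pow a     ∎)

    pow-- : ∀ a b → pow (a ℤ.- b) ≈ pow a / pow b
    pow-- a b = trans (pow-+ a (ℤ.- b)) (*-congˡ (trans (pow-neg b) (*-identityˡ _)))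

    pow-* : ∀ a k → pow (a ℤ.* + k) ≈ pow a ^ k
    pow-* a zero    = reflexive (≡.cong pow (ℤP.*-zeroʳ a))
    pow-* a (suc k) = begin
      pow (a ℤ.* + suc k)      ≡⟨ ≡.cong pow (≡.trans (≡.cong (a ℤ.*_) (≡.cong +_ (ℕP.+-comm 1 k))) (≡.trans (ℤP.*-distribˡ-+ a (+ k) (+ 1)) (≡.cong (λ z → a ℤ.* + k ℤ.+ z) (ℤP.*-identityʳ a)))) ⟩
      pow (a ℤ.* + k ℤ.+ a)    ≈⟨ pow-+ (a ℤ.* + k) a ⟩
      pow (a ℤ.* + k) * pow a  ≈⟨ *-congʳ (pow-* a k) ⟩
      pow a ^ k * pow a        ∎

  module QPowers (K : Field) (emb : PolyEmbedding K) where
    open FieldLemmas K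
    open PolyEmbedding emb

    q : Carrier
    q = ι (XP 1)

    q≉0 : q ≉ 0#
    q≉0 = ι-≉0 (monic≉0 (XP-degree 1))

    open IntegerPowers K q q≉0 public

    ι-XP : ∀ k → ι (XP k) ≈ q ^ k
    ι-XP zero    = ι-1
    ι-XP (suc k) = trans (ι-cong (≈-trans (XP-+ 1 k) (*P-comm (XP 1) (XP k)))) (trans (ι-* (XP k) (XP 1)) (*-congʳ (ι-XP k)))

    ι-X^ : ∀ k → ι (X^ k ∸1) ≈ q ^ k - 1#
    ι-X^ k = trans (ι-+ (XP k) (negP oneP)) (+-cong (ι-XP k) (trans (ι-neg oneP) (-‿cong ι-1)))

    -- Reduces negative exponents to positive ones up to a unit; they do occur, since r may be
    -- negative.
    1-pow-neg : ∀ k → - (pow -[1+ k ]) * (1# - pow (+ suc k)) ≈ 1# - pow -[1+ k ]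
    1-pow-neg k = trans (*-congʳ (-‿cong (sym (*-identityˡ _)))) (trans
      (solve (q ^ suc k ∷ []) (λ Q → :- (:1 :/ Q) :* (:1 :- Q) := :1 :- :1 :/ Q) ≡.refl (q^≉0 (suc k) , q^≉0 (suc k)))
      (+-congˡ (-‿cong (*-identityˡ _))))

    1-q^≉0 : ∀ j → 1# - q ^ suc j ≉ 0#
    1-q^≉0 j e = ι-≉0 (monic≉0 (X^-1-monic j)) (trans (ι-X^ (suc j)) (trans (solve (q ^ suc j ∷ []) (λ a → a :- :1 := :- (:1 :- a)) ≡.refl _) (trans (-‿cong e) (solve [] (:- :0 := :0) ≡.refl _))))

    1-pow≉0 : ∀ a → ¬ a ≡ + 0 → 1# - pow a ≉ 0#
    1-pow≉0 (+ zero)  h = ⊥-elim (h ≡.refl)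
    1-pow≉0 (+ suc j) h = 1-q^≉0 j
    1-pow≉0 -[1+ j ]  h = ≉0-cong (1-pow-neg j) (*-≉0 (neg-≉0 (pow≉0 -[1+ j ])) (1-q^≉0 j))

  module AtCyclotomic (K : Field) (emb : PolyEmbedding K) (k : ℕ) where
    open FieldLemmas K
    open PolyEmbedding emb
    open QPowers K emb

    m : ℕ
    m = suc k

    -- The local ring of ℚ[q] at Φ_m, with the denominator multiplied out.
    record Integral (z : Carrier) : Set where
      constructor integral
      field
        denominator-part numerator-part : Poly
        is-coprime : denominator-part ∥ Φ m
        clears     : ι denominator-part * z ≈ ι numerator-part

    localisation : Localisation K
    localisation = record
      { O      = Integral
      ; O-cong = λ { e (integral V U c h) → integral V U c (trans (*-congˡ (sym e)) h) }
      ; O-1    = integral oneP oneP ∥-1 (*-identityʳ _)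
      ; O-+    = λ { {a} {b} (integral V U c h) (integral V′ U′ c′ h′) → integral (V *P V′) ((U *P V′) +P (V *P U′)) (∥-* c c′) (begin
          ι (V *P V′) * (a + b)              ≈⟨ *-congʳ (ι-* V V′) ⟩
          ι V * ι V′ * (a + b)               ≈⟨ solve (ι V ∷ ι V′ ∷ a ∷ b ∷ []) (λ V W a b → V :* W :* (a :+ b) := (V :* a) :* W :+ V :* (W :* b)) ≡.refl _ ⟩
          ι V * a * ι V′ + ι V * (ι V′ * b)  ≈⟨ +-cong (*-congʳ h) (*-congˡ h′) ⟩
          ι U * ι V′ + ι V * ι U′            ≈⟨ trans (ι-+ (U *P V′) (V *P U′)) (+-cong (ι-* U V′) (ι-* V U′)) ⟨
          ι ((U *P V′) +P (V *P U′))         ∎) }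
      ; O-*    = λ { {a} {b} (integral V U c h) (integral V′ U′ c′ h′) → integral (V *P V′) (U *P U′) (∥-* c c′) (begin
          ι (V *P V′) * (a * b)              ≈⟨ *-congʳ (ι-* V V′) ⟩
          ι V * ι V′ * (a * b)               ≈⟨ solve (ι V ∷ ι V′ ∷ a ∷ b ∷ []) (λ V W a b → V :* W :* (a :* b) := (V :* a) :* (W :* b)) ≡.refl _ ⟩
          ι V * a * (ι V′ * b)               ≈⟨ *-cong h h′ ⟩
          ι U * ι U′                         ≈⟨ ι-* U U′ ⟨
          ι (U *P U′)                        ∎) }
      ; O-neg  = λ { {a} (integral V U c h) → integral V (negP U) c (trans (solve (ι V ∷ a ∷ []) (λ V a → V :* :- a := :- (V :* a)) ≡.refl _) (trans (-‿cong h) (sym (ι-neg U)))) }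
      ; φ      = ι (Φ m)
      ; φ≉0    = ι-≉0 (Φ≉0 k)
      ; O-φ    = integral oneP (Φ m) ∥-1 (trans (*-congʳ ι-1) (*-identityˡ _)) }

    open Divisibility K localisation
    open Denominators K localisation

    O-ι : ∀ f → O (ι f)
    O-ι f = integral oneP f ∥-1 (trans (*-congʳ ι-1) (*-identityˡ _))

    unit-ι : ∀ {V} → V ∥ Φ m → ι V ≉ 0# → Unit (ι V)
    unit-ι {V} c h = unit h (O-ι V) (integral V oneP c (trans (inverseʳ h) (sym ι-1)))

    -- q^(m-1) q - (q^m - 1) = 1, and Φ_m divides q^m - 1.
    unit-q : Unit q
    unit-q = unit-ι (X-coprime (CyclotomicFacts.product (cyclotomicFacts k))) q≉0
      where
      X-coprime : X^ suc k ∸1 ≋ divisorProduct (suc k) k *P Φ m → XP 1 ∥ Φ m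
      X-coprime e = coprime (XP k) (negP (divisorProduct (suc k) k)) (+ 1) (λ ()) (≈-trans
        (+P-cong (≈-trans (*P-comm (XP k) (XP 1)) (≈-sym (XP-+ 1 k))) (≈-trans (neg-* (divisorProduct (suc k) k) (Φ m)) (negP-cong (≈-sym e))))
        (cancel-X (XP (suc k))))
        where
        open SparseNormalForms
        open RingSolver polyRing using () renaming (solve to solveP; _:=_ to _:≡_; _:*_ to _⊛_; _:+_ to _⊞_; _:-_ to _⊟_; :-_ to ⊟_; :1 to one)
        neg-* : ∀ a b → negP a *P b ≋ negP (a *P b)
        neg-* a b = solveP (a ∷ b ∷ []) (λ a b → (⊟ a) ⊛ b :≡ ⊟ (a ⊛ b)) ≡.refl
        cancel-X : ∀ a → a +P negP (a -P oneP) ≋ oneP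
        cancel-X a = solveP (a ∷ []) (λ a → a ⊞ (⊟ (a ⊟ one)) :≡ one) ≡.refl

    unit-pow : ∀ a → Unit (pow a)
    unit-pow (+ k)    = unit-^ k unit-q
    unit-pow -[1+ k ] = unit-⁻¹ (unit-^ (suc k) unit-q)

    private
      -- Valuation exactly one, from which both the lower bound `Dv-hit` and the upper bound
      -- `Den-hit` are read off.
      record Split (z : Carrier) : Set where
        constructor splitting
        field
          cofactor : Carrier
          unit-cofactor : Unit cofactor
          split : z ≈ φ * cofactor

      split-positive : ∀ j → m ∣ suc j → Split (1# - pow (+ suc j))
      split-positive j (divides zero ())
      split-positive j (divides (suc c) e) = factored (proj₁ (Φ-cofactor k c)) (proj₁ (proj₂ (Φ-cofactor k c))) (proj₂ (proj₂ (Φ-cofactor k c)))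
        where
        factored : ∀ V → V ∥ Φ m → X^ m ℕ.* suc c ∸1 ≋ Φ m *P V → Split (1# - pow (+ suc j))
        factored V V∥ h = splitting (- ι V) (unit-neg (unit-ι V∥ V≉0)) (begin
          1# - q ^ suc j              ≈⟨ solve (q ^ suc j ∷ []) (λ a → :1 :- a := :- (a :- :1)) ≡.refl _ ⟩
          - (q ^ suc j - 1#)          ≈⟨ -‿cong (trans (sym (ι-X^ (suc j))) X≈) ⟩
          - (ι (Φ m) * ι V)           ≈⟨ solve (ι (Φ m) ∷ ι V ∷ []) (λ a b → :- (a :* b) := a :* :- b) ≡.refl _ ⟩
          ι (Φ m) * - ι V             ∎)
          where
          X≈ : ι (X^ suc j ∸1) ≈ ι (Φ m) * ι V
          X≈ = trans (reflexive (≡.cong (λ k → ι (X^ k ∸1)) (≡.trans e (ℕP.*-comm (suc c) m)))) (trans (ι-cong h) (ι-* (Φ m) V))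
          V≉0 : ι V ≉ 0#
          V≉0 z = ι-≉0 (monic≉0 (X^-1-monic j)) (trans X≈ (trans (*-congˡ z) (zeroʳ _)))

      split : ∀ a → ¬ a ≡ + 0 → m ∣ ℤ.∣ a ∣ → Split (1# - pow a)
      split (+ zero)  h d = ⊥-elim (h ≡.refl)
      split (+ suc j) h d = split-positive j d
      split -[1+ j ]  h d with split-positive j d
      ... | splitting w u e = splitting (- pow -[1+ j ] * w) (unit-* (unit-neg (unit-pow -[1+ j ])) u)
        (trans (sym (1-pow-neg j)) (trans (*-congˡ e) (solve (- pow -[1+ j ] ∷ ι (Φ m) ∷ w ∷ []) (λ a b c → a :* (b :* c) := b :* (a :* c)) ≡.refl _)))

    Dv-hit : ∀ a → m ∣ ℤ.∣ a ∣ → Dv 1 (1# - pow a)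
    Dv-hit a d with a ℤ.≟ + 0
    -- For exponent 0 the element is zero and divisible by every power; only the upper bound needs a
    -- non-zero exponent.
    ... | yes ≡.refl = Dv-cong (sym (-‿inverseʳ 1#)) Dv-0
    ... | no h with split a h d
    ...   | splitting w u e = dv w (O-a u) (trans e (*-congʳ (sym (*-identityˡ _))))

    Den-hit : ∀ a → ¬ a ≡ + 0 → m ∣ ℤ.∣ a ∣ → Den 1 (1# - pow a)
    Den-hit a h d with split a h d
    ... | splitting w u e = den (1-pow≉0 a h) (O-cong (begin
        w ⁻¹                       ≈⟨ *-identityˡ _ ⟨
        1# / w                     ≈⟨ solve (φ ∷ w ∷ []) (λ f w → :1 :/ w := :1 :* f :/ (f :* w)) ≡.refl (≉0 u , *-≉0 φ≉0 (≉0 u)) ⟩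
        1# * φ / (φ * w)           ≈⟨ *-congˡ (⁻¹-cong (sym e)) ⟩
        φ ^ 1 / (1# - pow a)       ∎) (O-⁻¹ u))

    unit-miss-positive : ∀ j → ¬ m ∣ suc j → Unit (1# - q ^ suc j)
    unit-miss-positive j h = unit-cong (trans (-‿cong (ι-X^ (suc j))) (solve (q ^ suc j ∷ []) (λ a → :- (a :- :1) := :1 :- a) ≡.refl _))
      (unit-neg (unit-ι (Φ-coprime k (suc j) h) (ι-≉0 (monic≉0 (X^-1-monic j)))))

    unit-miss : ∀ a → ¬ m ∣ ℤ.∣ a ∣ → Unit (1# - pow a)
    unit-miss (+ zero)  h = ⊥-elim (h (m ∣.∣0))
    unit-miss (+ suc j) h = unit-miss-positive j h
    unit-miss -[1+ j ]  h = unit-cong (1-pow-neg j) (unit-* (unit-neg (unit-pow -[1+ j ])) (unit-miss-positive j h))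

  -- Q ∣ U for some representation z = U / V with V coprime to Q, as in the definition of the congruences.
  module Modulo (K : Field) (emb : PolyEmbedding K) where
    open FieldLemmas K
    open PolyEmbedding emb

    record DivisibleBy (Q : Poly) (z : Carrier) : Set where
      constructor divisible
      field
        clearing cofactor : Poly
        is-coprime : clearing ∥ Q
        equation   : ι clearing * z ≈ ι (Q *P cofactor)

    divisible-0 : ∀ {Q z} → z ≈ 0# → DivisibleBy Q z
    divisible-0 {Q} e = divisible oneP [] ∥-1 (trans (*-congˡ e) (trans (zeroʳ _) (trans (sym ι-0) (ι-cong (≈-sym (*P-zeroʳ Q))))))

    divisible-value : ∀ {Q z w} → z ≈ w → DivisibleBy Q z → DivisibleBy Q w
    divisible-value e (divisible V W c h) = divisible V W c (trans (*-congˡ (sym e)) h)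

    divisible-cong : ∀ {P Q z} → P ≋ Q → DivisibleBy P z → DivisibleBy Q z
    divisible-cong e (divisible V W c h) = divisible V W (∥-congʳ e c) (trans h (ι-cong (*P-cong e ≈-refl)))

    -- Modulo P the combined clearing factor is V Q, and modulo Q it is V′ P; both are coprime to
    -- the modulus in question because P and Q are coprime.
    divisible-* : ∀ {P Q z} → P ∥ Q → DivisibleBy P z → DivisibleBy Q z → DivisibleBy (P *P Q) z
    divisible-* {P} {Q} {z} PQ (divisible V W c h) (divisible V′ W′ c′ h′) = divisible ((V *P Q) +P (V′ *P P)) (W +P W′)
      (∥-sym (∥-* (∥-sym (∥-+ V′ (∥-* c (∥-sym PQ)))) (∥-sym (∥-congˡ (+P-comm (V′ *P P) (V *P Q)) (∥-+ V (∥-* c′ PQ)))))) (begin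
        ι ((V *P Q) +P (V′ *P P)) * z
          ≈⟨ *-congʳ (trans (ι-+ (V *P Q) (V′ *P P)) (+-cong (ι-* V Q) (ι-* V′ P))) ⟩
        (ι V * ι Q + ι V′ * ι P) * z
          ≈⟨ solve (ι V ∷ ι Q ∷ ι V′ ∷ ι P ∷ z ∷ []) (λ V Q V' P z → (V :* Q :+ V' :* P) :* z := (V :* z) :* Q :+ (V' :* z) :* P) ≡.refl _ ⟩
        ι V * z * ι Q + ι V′ * z * ι P
          ≈⟨ +-cong (*-congʳ (trans h (ι-* P W))) (*-congʳ (trans h′ (ι-* Q W′))) ⟩
        ι P * ι W * ι Q + ι Q * ι W′ * ι P
          ≈⟨ solve (ι P ∷ ι W ∷ ι Q ∷ ι W′ ∷ []) (λ P W Q W' → P :* W :* Q :+ Q :* W' :* P := (P :* Q) :* (W :+ W')) ≡.refl _ ⟩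
        ι P * ι Q * (ι W + ι W′)
          ≈⟨ trans (ι-* (P *P Q) (W +P W′)) (*-cong (ι-* P Q) (ι-+ W W′)) ⟨
        ι (P *P Q *P (W +P W′)) ∎)

    Dv-divisible : ∀ k e {z} → Divisibility.Dv K (AtCyclotomic.localisation K emb k) e z → DivisibleBy (powP (Φ (suc k)) e) z
    Dv-divisible k e {z} (Divisibility.dv w (AtCyclotomic.integral V U c h) f) = divisible V U (∥-powP e c) (begin
      ι V * z                              ≈⟨ *-congˡ f ⟩
      ι V * (ι (Φ (suc k)) ^ e * w)        ≈⟨ solve (ι V ∷ ι (Φ (suc k)) ^ e ∷ w ∷ []) (λ V f w → V :* (f :* w) := f :* (V :* w)) ≡.refl _ ⟩
      ι (Φ (suc k)) ^ e * (ι V * w)        ≈⟨ *-cong (sym (ι-powP e)) h ⟩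
      ι (powP (Φ (suc k)) e) * ι U         ≈⟨ ι-* (powP (Φ (suc k)) e) U ⟨
      ι (powP (Φ (suc k)) e *P U)          ∎)
      where
      ι-powP : ∀ e → ι (powP (Φ (suc k)) e) ≈ ι (Φ (suc k)) ^ e
      ι-powP zero    = ι-1
      ι-powP (suc e) = trans (ι-* (powP (Φ (suc k)) e) (Φ (suc k))) (*-congʳ (ι-powP e))

    properProduct-∥ : ∀ N j k → j ℕ.≤ k → properProduct N j ∥ Φ (suc (suc k))
    properProduct-∥ N zero    k h = ∥-1
    properProduct-∥ N (suc j) k h with suc (suc j) ∣? N
    ... | yes _ = ∥-* (properProduct-∥ N j k (ℕP.<⇒≤ h)) (Φ-∥-Φ′ (suc j) (suc k) (ℕ.s≤s h))
    ... | no _  = properProduct-∥ N j k (ℕP.<⇒≤ h)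

    divisible-properProduct : ∀ N j {z} → (∀ k → k ℕ.< j → suc (suc k) ∣ N → DivisibleBy (Φ (suc (suc k))) z) → DivisibleBy (properProduct N j) z
    -- Modulo 1 even the clearing factor 0 is coprime, so z need not be a fraction of polynomials.
    divisible-properProduct N zero    {z} h = divisible [] [] (coprime [] oneP (+ 1) (λ ()) (*-identityP oneP))
      (trans (*-congʳ ι-0) (trans (zeroˡ _) (trans (sym ι-0) (ι-cong (≈-sym (*P-zeroʳ oneP))))))
      where
      *-identityP : ∀ f → oneP *P f ≋ f
      *-identityP f = ≈-trans (constP-* (+ 1) f) (1·P f)
    divisible-properProduct N (suc j) h with suc (suc j) ∣? N
    ... | yes d = divisible-* (properProduct-∥ N j j ℕP.≤-refl) (divisible-properProduct N j (λ k k<j → h k (ℕP.m<n⇒m<1+n k<j))) (h j ℕP.≤-refl d)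
    ... | no _  = divisible-properProduct N j (λ k k<j → h k (ℕP.m<n⇒m<1+n k<j))

-- The congruences modulo the individual cyclotomic polynomials

module LocalCongruences where

  open import Data.Nat as ℕ using (ℕ; zero; suc)
  import Data.Nat.Properties as ℕP
  open import Data.Nat.DivMod using (m≡m%n+[m/n]*n; m%n<n; m*n/n≡m; /-monoˡ-≤; m<n⇒m%n≡m)
  open import Data.Nat.Divisibility as ∣ using (_∣_; divides)
  open import Data.Nat.Coprimality using (Coprime; coprime-divisor)
  open import Data.Integer as ℤ using (ℤ; +_)
  import Data.Integer.Properties as ℤP
  import Data.Integer.Divisibility.Signed as ℤ∣
  open import Data.Integer.Tactic.RingSolver using (solve-∀)
  open import Data.Product using (_,_)
  open import Data.Sum using (_⊎_; inj₁; inj₂)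
  open import Data.Vec using ([]; _∷_)
  open import Relation.Nullary using (¬_)
  open import Relation.Binary.PropositionalEquality as ≡ using (_≡_)
  open Fields
  open FieldSolver
  open QSeries
  open WellPoised
  open ApérySums
  open Localisations
  open Perturbations
  open Valuations
  open QPowersAndModuli

  module Setting (K : Field) (emb : PolyEmbedding K) (n₁ d : ℕ) (r : ℤ) (N : ℕ)
    (d≢0 : ¬ d ≡ 0) (coprime-nd : Coprime (suc n₁) d)
    (r-def : r ≡ + suc n₁ ℤ.- + N ℤ.* + d) (N≤n₁ : N ℕ.≤ n₁) where
    open FieldLemmas K
    open PolyEmbedding emb
    open QPowers K emb
    open Sums K

    n : ℕ
    n = suc n₁

    p u : Carrier
    p = pow (+ d)
    u = pow r

    p≉0 : p ≉ 0#
    p≉0 = pow≉0 (+ d)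

    u≉0 : u ≉ 0#
    u≉0 = pow≉0 r

    pow-progression : ∀ a i → pow (a ℤ.+ + d ℤ.* + i) ≈ pow a * p ^ i
    pow-progression a i = trans (pow-+ a (+ d ℤ.* + i)) (*-congˡ (pow-* (+ d) i))

    1-p^≉0 : ∀ k → 1# - p * p ^ k ≉ 0#
    1-p^≉0 k = ≉0-cong (+-congˡ (-‿cong (pow-progression (+ d) k))) (1-pow≉0 (+ d ℤ.+ + d ℤ.* + k) nonzero)
      where
      nonzero : ¬ + d ℤ.+ + d ℤ.* + k ≡ + 0
      nonzero e = d≢0 (ℕP.m+n≡0⇒m≡0 d (ℤP.+-injective (≡.trans (≡.cong (λ z → + d ℤ.+ z) (ℤP.pos-* d k)) e)))

    -- If r + d j vanished, then n + d j = N d, so d would divide n; coprimality forces d = 1 and N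
    -- = n + j, against N ≤ n - 1.
    r+dj≢0 : ∀ j → ¬ r ℤ.+ + d ℤ.* + j ≡ + 0
    r+dj≢0 j e = ℕP.<-irrefl ≡.refl (ℕP.≤-trans (ℕ.s≤s N≤n₁) (ℕP.≤-trans (ℕP.m≤m+n n j) (ℕP.≤-reflexive n+j)))
      where
      rearrange : ∀ n N d j → n ℤ.+ d ℤ.* j ≡ (n ℤ.- N ℤ.* d ℤ.+ d ℤ.* j) ℤ.+ N ℤ.* d
      rearrange = solve-∀
      eqℤ : + n ℤ.+ + d ℤ.* + j ≡ + N ℤ.* + d
      eqℤ = ≡.trans (rearrange (+ n) (+ N) (+ d) (+ j)) (≡.trans (≡.cong (λ z → z ℤ.+ + N ℤ.* + d) (≡.trans (≡.cong (λ z → z ℤ.+ + d ℤ.* + j) (≡.sym r-def)) e)) (ℤP.+-identityˡ _))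
      eqℕ : n ℕ.+ d ℕ.* j ≡ N ℕ.* d
      eqℕ = ℤP.+-injective (≡.trans (≡.cong (λ z → + n ℤ.+ z) (ℤP.pos-* d j)) (≡.trans eqℤ (≡.sym (ℤP.pos-* N d))))
      d∣n : d ∣ n
      d∣n = ∣.∣m+n∣m⇒∣n (≡.subst (d ∣_) (≡.trans (≡.sym eqℕ) (ℕP.+-comm n (d ℕ.* j))) (divides N ≡.refl)) (∣.m∣m*n j)
      d≡1 : d ≡ 1
      d≡1 = coprime-nd (d∣n , ∣.∣-refl)
      n+j : n ℕ.+ j ≡ N
      n+j = ≡.trans (≡.cong (n ℕ.+_) (≡.trans (≡.sym (ℕP.*-identityˡ j)) (≡.cong (ℕ._* j) (≡.sym d≡1)))) (≡.trans eqℕ (≡.trans (≡.cong (N ℕ.*_) d≡1) (ℕP.*-identityʳ N)))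

    1-up^≉0 : ∀ j → 1# - u * p ^ j ≉ 0#
    1-up^≉0 j = ≉0-cong (+-congˡ (-‿cong (pow-progression r j))) (1-pow≉0 (r ℤ.+ + d ℤ.* + j) (r+dj≢0 j))

    open QPochhammer K p public
    open Saalschütz K p 1-p^≉0 public
    open WellPoisedSum K p p≉0 1-p^≉0 public using (term; p^≉0; u^≉0)
    open Apéry K p p≉0 1-p^≉0 public using (h; H; summandT; d≉0)
    open Perturbation K p p≉0 1-p^≉0 u u≉0 1-up^≉0 public using (x; y; main; x≉0)

    x-pow : x N ≈ pow (+ n)
    x-pow = trans (sym (pow-progression r N)) (reflexive (≡.cong pow (≡.trans (≡.cong (λ z → z ℤ.+ + d ℤ.* + N) r-def) (rearrange (+ n) (+ N) (+ d)))))
      where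
      rearrange : ∀ n N d → n ℤ.- N ℤ.* d ℤ.+ d ℤ.* N ≡ n
      rearrange = solve-∀

    F : ℕ → Carrier
    F M = ∑ (suc M) (term u u≉0)

    -- `κ` is x^(2N-2), written as a quotient because N may be 0. It is the part of the q-power in
    -- the last sum that is constant in k and not already in `summandT`.
    T₀ κ rhs : Carrier
    T₀  = ∑ N (λ i → summandT u i / x N ^ i)
    κ   = x N ^ N * x N ^ N / (x N * x N)
    rhs = y N * main N - (y N ^ 3 + y N ^ 4) * main N * H N 0 + y N ^ 4 * (κ * T₀)

    module At (k : ℕ) (m∣n : suc k ∣ n) where
      open AtCyclotomic K emb k
      open Divisibility K localisation
      open Denominators K localisation

      unit-p : Unit p
      unit-p = unit-pow (+ d)

      unit-u : Unit u
      unit-u = unit-pow r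

      open DivisorCongruence K localisation p p≉0 1-p^≉0 u u≉0 1-up^≉0 unit-p unit-u m public

      coprime-md : Coprime m d
      coprime-md (i∣m , i∣d) = coprime-nd (∣.∣-trans i∣m m∣n , i∣d)

      -- Since A + d i = d (i + t + 1) + m s and m is coprime to d, divisibility of A + d i by m
      -- depends only on i + t + 1.
      module Residue (A : ℤ) (t : ℕ) (s : ℤ) (A-def : A ≡ + d ℤ.* + suc t ℤ.+ + m ℤ.* s) where
        private
          rearrange : ∀ d t m s i → (d ℤ.* t ℤ.+ m ℤ.* s) ℤ.+ d ℤ.* i ≡ d ℤ.* (i ℤ.+ t) ℤ.+ m ℤ.* s
          rearrange = solve-∀

          index : ∀ i → A ℤ.+ + d ℤ.* + i ≡ + d ℤ.* + suc (i ℕ.+ t) ℤ.+ + m ℤ.* s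
          index i = ≡.trans (≡.cong (λ z → z ℤ.+ + d ℤ.* + i) A-def) (≡.trans (rearrange (+ d) (+ suc t) (+ m) s (+ i))
            (≡.cong (λ z → + d ℤ.* + z ℤ.+ + m ℤ.* s) (ℕP.+-suc i t)))

          m∣ms : + m ℤ∣.∣ + m ℤ.* s
          m∣ms = ℤ∣.∣m⇒∣m*n s ℤ∣.∣-refl

        hits : ∀ i → m ∣ suc (i ℕ.+ t) → m ∣ ℤ.∣ A ℤ.+ + d ℤ.* + i ∣
        hits i h = ≡.subst (λ z → m ∣ ℤ.∣ z ∣) (≡.sym (index i)) (ℤ∣.∣⇒∣ᵤ (ℤ∣.∣m∣n⇒∣m+n (ℤ∣.∣n⇒∣m*n (+ d) (ℤ∣.∣ᵤ⇒∣ {+ m} {+ suc (i ℕ.+ t)} h)) m∣ms))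

        misses : ∀ i → ¬ m ∣ suc (i ℕ.+ t) → ¬ m ∣ ℤ.∣ A ℤ.+ + d ℤ.* + i ∣
        misses i ¬h h = ¬h (coprime-divisor coprime-md (≡.subst (m ∣_) (ℤP.abs-* (+ d) (+ suc (i ℕ.+ t)))
          (ℤ∣.∣⇒∣ᵤ {+ m} {+ d ℤ.* + suc (i ℕ.+ t)} (ℤ∣.∣m+n∣n⇒∣m {+ m} {+ d ℤ.* + suc (i ℕ.+ t)} {+ m ℤ.* s} (≡.subst (λ z → + m ℤ∣.∣ z) (index i) (ℤ∣.∣ᵤ⇒∣ {+ m} h)) m∣ms))))

        factor : ∀ i → 1# - pow (A ℤ.+ + d ℤ.* + i) ≈ 1# - pow A * p ^ i
        factor i = +-congˡ (-‿cong (pow-progression A i))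

        Dv-factor : ∀ i → m ∣ suc (i ℕ.+ t) → Dv 1 (1# - pow A * p ^ i)
        Dv-factor i h = Dv-cong (factor i) (Dv-hit (A ℤ.+ + d ℤ.* + i) (hits i h))

        unit-factor : ∀ i → ¬ m ∣ suc (i ℕ.+ t) → Unit (1# - pow A * p ^ i)
        unit-factor i ¬h = unit-cong (factor i) (unit-miss (A ℤ.+ + d ℤ.* + i) (misses i ¬h))

        pattern-of : t ℕ.< m → Pattern (pow A) t
        pattern-of t<m = record { t<m = t<m ; O-base = O-a (unit-pow A) ; hit = Dv-factor }

        den-pattern-of : t ℕ.< m → (∀ i → ¬ A ℤ.+ + d ℤ.* + i ≡ + 0) → DenPattern (pow A) t
        den-pattern-of t<m ≢0 = record
          { pattern′ = pattern-of t<m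
          ; hit-den  = λ i h → Den-cong (factor i) (Den-hit (A ℤ.+ + d ℤ.* + i) (≢0 i) (hits i h))
          ; miss     = λ i ¬h → Den-unit (unit-factor i ¬h) }
          where
          Den-cong : ∀ {a b} → a ≈ b → Den 1 a → Den 1 b
          Den-cong e (den h o) = den (≉0-cong e h) (O-cong (*-congˡ (⁻¹-cong e)) o)

      private
        n′ = _∣_.quotient m∣n

        n≡ : + n ≡ + n′ ℤ.* + m
        n≡ = ≡.trans (≡.cong +_ (_∣_.equality m∣n)) (ℤP.pos-* n′ m)

      -- The shifts for p/u, u and u². From r = n - N d and m ∣ n, modulo m, r is -N d and d - r is
      -- (N + 1) d. In the normal form d (t + 1) + m s this means t = m - 1 - b and b = N mod m;
      -- doubling r gives 2t + 1, reduced modulo m.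
      b t t₂ : ℕ
      b  = N ℕ.% m
      t  = m ℕ.∸ suc b
      t₂ = suc (t ℕ.+ t) ℕ.% m

      b<m : b ℕ.< m
      b<m = m%n<n N m

      b+t : suc b ℕ.+ t ≡ m
      b+t = ℕP.m+[n∸m]≡n b<m

      t< : t ℕ.< m
      t< = ≡.subst (suc t ℕ.≤_) (≡.trans (≡.cong suc (ℕP.+-comm t b)) b+t) (ℕ.s≤s (ℕP.m≤m+n t b))

      private
        N≡ : + N ≡ + b ℤ.+ + (N ℕ./ m) ℤ.* + m
        N≡ = ≡.trans (≡.cong +_ (m≡m%n+[m/n]*n N m)) (≡.cong (λ z → + b ℤ.+ z) (ℤP.pos-* (N ℕ./ m) m))

        m≡ : + m ≡ + 1 ℤ.+ + b ℤ.+ + t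
        m≡ = ≡.cong +_ (≡.sym b+t)

        t₂≡ : + suc (t ℕ.+ t) ≡ + t₂ ℤ.+ + (suc (t ℕ.+ t) ℕ./ m) ℤ.* + m
        t₂≡ = ≡.trans (≡.cong +_ (m≡m%n+[m/n]*n (suc (t ℕ.+ t)) m)) (≡.cong (λ z → + t₂ ℤ.+ z) (ℤP.pos-* (suc (t ℕ.+ t) ℕ./ m) m))

        s-u s-p/u s-uu : ℤ
        s-u   = + n′ ℤ.- + d ℤ.* (+ (N ℕ./ m) ℤ.+ + 1)
        s-p/u = + d ℤ.* + (N ℕ./ m) ℤ.- + n′
        s-uu  = s-u ℤ.+ s-u ℤ.+ + d ℤ.* + (suc (t ℕ.+ t) ℕ./ m)

        r-residue : r ≡ + d ℤ.* + suc t ℤ.+ + m ℤ.* s-u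
        r-residue = ≡.trans r-def (≡.trans (≡.cong₂ (λ a c → a ℤ.- c ℤ.* + d) n≡ N≡) (≡.trans
          (ident (+ n′) (+ m) (+ b) (+ (N ℕ./ m)) (+ d) (+ suc t)) (≡.trans (≡.cong (λ z → + d ℤ.* + suc t ℤ.+ + m ℤ.* s-u ℤ.+ + d ℤ.* z) m-b-t) (tidy _ (+ d)))))
          where
          ident : ∀ n' m b N' d t → n' ℤ.* m ℤ.- (b ℤ.+ N' ℤ.* m) ℤ.* d ≡ d ℤ.* t ℤ.+ m ℤ.* (n' ℤ.- d ℤ.* (N' ℤ.+ + 1)) ℤ.+ d ℤ.* (m ℤ.- b ℤ.- t)
          ident = solve-∀
          m-b-t : + m ℤ.- + b ℤ.- + suc t ≡ + 0
          m-b-t = ≡.trans (≡.cong (λ z → z ℤ.- + b ℤ.- + suc t) m≡) (zero-sum (+ b) (+ t))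
            where
            zero-sum : ∀ b t → + 1 ℤ.+ b ℤ.+ t ℤ.- b ℤ.- (+ 1 ℤ.+ t) ≡ + 0
            zero-sum = solve-∀
          tidy : ∀ a d → a ℤ.+ d ℤ.* + 0 ≡ a
          tidy = solve-∀

        p/u-residue : + d ℤ.- r ≡ + d ℤ.* + suc b ℤ.+ + m ℤ.* s-p/u
        p/u-residue = ≡.trans (≡.cong (λ z → + d ℤ.- z) (≡.trans r-def (≡.cong₂ (λ a c → a ℤ.- c ℤ.* + d) n≡ N≡))) (ident (+ n′) (+ m) (+ b) (+ (N ℕ./ m)) (+ d))
          where
          ident : ∀ n' m b N' d → d ℤ.- (n' ℤ.* m ℤ.- (b ℤ.+ N' ℤ.* m) ℤ.* d) ≡ d ℤ.* (+ 1 ℤ.+ b) ℤ.+ m ℤ.* (d ℤ.* N' ℤ.- n')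
          ident = solve-∀

        uu-residue : r ℤ.+ r ≡ + d ℤ.* + suc t₂ ℤ.+ + m ℤ.* s-uu
        uu-residue = ≡.trans (≡.cong₂ ℤ._+_ r-residue r-residue) (≡.trans (double (+ d) (+ t) (+ m) s-u)
          (≡.trans (≡.cong (λ z → + d ℤ.* (+ 1 ℤ.+ z) ℤ.+ + m ℤ.* (s-u ℤ.+ s-u)) t₂≡) (ident (+ d) (+ t₂) (+ (suc (t ℕ.+ t) ℕ./ m)) (+ m) s-u)))
          where
          double : ∀ d t m s → (d ℤ.* (+ 1 ℤ.+ t) ℤ.+ m ℤ.* s) ℤ.+ (d ℤ.* (+ 1 ℤ.+ t) ℤ.+ m ℤ.* s) ≡ d ℤ.* (+ 1 ℤ.+ (+ 1 ℤ.+ (t ℤ.+ t))) ℤ.+ m ℤ.* (s ℤ.+ s)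
          double = solve-∀
          ident : ∀ d t₂ c m s → d ℤ.* (+ 1 ℤ.+ (t₂ ℤ.+ c ℤ.* m)) ℤ.+ m ℤ.* (s ℤ.+ s) ≡ d ℤ.* (+ 1 ℤ.+ t₂) ℤ.+ m ℤ.* (s ℤ.+ s ℤ.+ d ℤ.* c)
          ident = solve-∀

        p-residue : + d ≡ + d ℤ.* + 1 ℤ.+ + m ℤ.* + 0
        p-residue = ident (+ d) (+ m)
          where
          ident : ∀ d m → d ≡ d ℤ.* + 1 ℤ.+ m ℤ.* + 0
          ident = solve-∀

      module U  = Residue r t s-u r-residue
      module P′ = Residue (+ d) 0 (+ 0) p-residue

      pat-u : DenPattern u t
      pat-u = U.den-pattern-of t< r+dj≢0

      pat-p : DenPattern p 0
      pat-p = P′.den-pattern-of (ℕ.s≤s ℕ.z≤n) λ i e → d≢0 (ℕP.m+n≡0⇒m≡0 d (ℤP.+-injective (≡.trans (≡.cong (λ z → + d ℤ.+ z) (ℤP.pos-* d i)) e)))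

      pattern-cong : ∀ {a c s} → a ≈ c → Pattern a s → Pattern c s
      pattern-cong e P = record { t<m = Pattern.t<m P ; O-base = O-cong e (Pattern.O-base P)
        ; hit = λ i h → Dv-cong (+-congˡ (-‿cong (*-congʳ e))) (Pattern.hit P i h) }

      pat-p/u : Pattern (p / u) b
      pat-p/u = pattern-cong (pow-- (+ d) r) (Residue.pattern-of (+ d ℤ.- r) b s-p/u p/u-residue b<m)

      pat-uu : Pattern (u * u) t₂
      pat-uu = pattern-cong (pow-+ r r) (Residue.pattern-of (r ℤ.+ r) t₂ s-uu uu-residue (m%n<n (suc (t ℕ.+ t)) m))

      Dv-y : Dv 1 (y N)
      Dv-y = Dv-cong (+-congˡ (-‿cong (sym x-pow))) (Dv-hit (+ n) m∣n)

      unit-x : Unit (x N)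
      unit-x = unit-* unit-u (unit-^ N unit-p)

      unit-κ : Unit κ
      unit-κ = unit-/ (unit-* (unit-^ N unit-x) (unit-^ N unit-x)) (unit-* unit-x unit-x)

      -- N is itself a hit, as u p^N = q^n: N + 1 + t is exactly the next multiple of m after N.
      large-N : suc (N ℕ./ m) ℕ.≤ (suc N ℕ.+ t) ℕ./ m
      large-N = ℕP.≤-reflexive (≡.sym (≡.trans (≡.cong (ℕ._/ m) eq) (m*n/n≡m (suc (N ℕ./ m)) m)))
        where
        eq : suc N ℕ.+ t ≡ suc (N ℕ./ m) ℕ.* m
        eq = ≡.trans (≡.cong (λ z → suc z ℕ.+ t) (m≡m%n+[m/n]*n N m)) (≡.trans (shuffle b (N ℕ./ m ℕ.* m) t) (≡.cong (ℕ._+ N ℕ./ m ℕ.* m) b+t))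
          where
          shuffle : ∀ b c t → suc (b ℕ.+ c) ℕ.+ t ≡ suc b ℕ.+ t ℕ.+ c
          shuffle b c t = ≡.cong suc (≡.trans (ℕP.+-assoc b c t) (≡.trans (≡.cong (b ℕ.+_) (ℕP.+-comm c t)) (≡.sym (ℕP.+-assoc b t c))))

      large-n : suc (n₁ ℕ./ m) ℕ.≤ (suc n₁ ℕ.+ t) ℕ./ m
      large-n = ℕP.≤-trans (/-∣ m n₁ m∣n) (/-monoˡ-≤ m (ℕP.m≤m+n n t))

      Dv-T : Dv 1 (y N ^ 4 * T₀)
      Dv-T = Dv-cong (sym (∑-*ˡ N (y N ^ 4) _)) (Dv-∑ N _ (λ i _ → Dv-y⁴T pat-p pat-u pat-p/u pat-uu N Dv-y i))

      -- `Dv-rhs` treats the last sum without `κ`. As `κ` is a unit, restoring it changes the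
      -- difference by an integral multiple of y⁴ T₀, which is divisible by itself.
      Dv-difference : ∀ M → M ≡ N ⊎ M ≡ n₁ → Dv 1 (F M - rhs)
      Dv-difference M h = Dv-cong
        (solve (F M ∷ y N * main N ∷ (y N ^ 3 + y N ^ 4) * main N * H N 0 ∷ y N ^ 4 ∷ κ ∷ T₀ ∷ [])
          (λ F A B y κ T → F :- (A :- B :+ y :* T) :+ (:1 :- κ) :* (y :* T) := F :- (A :- B :+ y :* (κ :* T))) ≡.refl _)
        (Dv-+ (Dv-+ (Dv-sum pat-p pat-u pat-p/u pat-uu N Dv-y M (large h)) (Dv-neg (Dv-rhs pat-p pat-u pat-p/u pat-uu N Dv-y)))
              (Dv-*ˡ (O-+ O-1 (O-neg (O-a unit-κ))) Dv-T))
        where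
        large : M ≡ N ⊎ M ≡ n₁ → suc (M ℕ./ m) ℕ.≤ (suc M ℕ.+ t) ℕ./ m
        large (inj₁ ≡.refl) = large-N
        large (inj₂ ≡.refl) = large-n

    ∑-++ : ∀ a c f → ∑ (a ℕ.+ c) f ≈ ∑ a f + ∑ c (λ i → f (a ℕ.+ i))
    ∑-++ a zero    f = trans (reflexive (≡.cong (λ k → ∑ k f) (ℕP.+-identityʳ a))) (sym (+-identityʳ _))
    ∑-++ a (suc c) f = trans (reflexive (≡.cong (λ k → ∑ k f) (ℕP.+-suc a c))) (trans (+-congʳ (∑-++ a c f)) (+-assoc _ _ _))

    module Top where
      open At n₁ ∣.∣-refl
      open AtCyclotomic K emb n₁ using (localisation; Dv-hit)
      open Divisibility K localisation

      n∤ : ∀ i → suc i ℕ.≤ n₁ → ¬ n ∣ suc i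
      n∤ i h d = ℕP.<-irrefl ≡.refl (ℕP.≤-trans (ℕ.s≤s h) (∣.∣⇒≤ d))

      b≡N : b ≡ N
      b≡N = m<n⇒m%n≡m (ℕ.s≤s N≤n₁)

      unit-d : ∀ i → suc i ℕ.≤ n₁ → Unit (1# - p * p ^ i)
      unit-d i h = P′.unit-factor i (λ d → n∤ (i ℕ.+ 0) (≡.subst (λ z → suc z ℕ.≤ n₁) (≡.sym (ℕP.+-identityʳ i)) h) d)

      unit-1-up : ∀ j → j ℕ.< N → Unit (1# - u * p ^ j)
      unit-1-up j j<N = U.unit-factor j (n∤ (j ℕ.+ t) (ℕP.≤-trans (ℕP.+-monoˡ-≤ t j<N) (ℕP.≤-reflexive (ℕP.suc-injective (≡.trans (≡.cong (λ z → suc z ℕ.+ t) (≡.sym b≡N)) b+t)))))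

      open FifthPower K localisation p p≉0 1-p^≉0 u u≉0 1-up^≉0 N unit-p unit-u
        (λ l l<N → unit-d l (ℕP.≤-trans l<N N≤n₁)) unit-1-up Dv-y using (F-congruence; Y-≅; x≅1; module Tail)

      Dv-κ : Dv 1 (κ - 1#)
      Dv-κ = Divisibility.diff (≅-trans (≅-/ (≅-* (≅-^ N (≅ˣ⇒≅ x≅1)) (≅-^ N (≅ˣ⇒≅ x≅1))) (≅ˣ-* x≅1 x≅1))
        (≅-reflexive (O-/ (O-* (O-^ N O-1) (O-^ N O-1)) (unit-* unit-1 unit-1))
          (trans (/-cong (*-cong (1^ N) (1^ N)) refl) (inverseʳ (*-≉0 1≉0 1≉0)))))

      -- At Φ_n one has x congruent to 1, hence `κ` congruent to 1, and next to y⁴ inserting it is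
      -- invisible modulo φ⁵.
      Dv-N : Dv 5 (F N - rhs)
      Dv-N = Dv-cong
        (solve (F N ∷ y N * main N ∷ (y N ^ 3 + y N ^ 4) * main N * H N 0 ∷ y N ^ 4 ∷ κ ∷ T₀ ∷ [])
          (λ F A B y κ T → F :- (A :- B :+ y :* T) :+ :- (y :* ((κ :- :1) :* T)) := F :- (A :- B :+ y :* (κ :* T))) ≡.refl _)
        (Dv-+ F-congruence (Dv-neg (Dv-* (Dv-^ 4 Dv-y) (Dv-*ʳ Dv-κ (Divisibility.right Y-≅)))))

      Dv-n : ∀ l → n₁ ≡ suc N ℕ.+ l → Dv 5 (F n₁ - rhs)
      Dv-n l e = Dv-cong
        (trans (solve (F N ∷ rhs ∷ ∑ (suc l) (λ i → term u u≉0 (suc N ℕ.+ i)) ∷ []) (λ F r t → F :- r :+ t := F :+ t :- r) ≡.refl _)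
          (+-congʳ (trans (sym (∑-++ (suc N) (suc l) (term u u≉0))) (reflexive (≡.cong (λ k → ∑ k (term u u≉0)) (≡.trans (ℕP.+-suc (suc N) l) (≡.cong suc (≡.sym e))))))))
        (Dv-+ Dv-N (Tail.tail l (λ i h → unit-d i (≡.subst (suc i ℕ.≤_) (≡.sym e) (ℕ.s≤s h)))
          (Dv-cong (+-congˡ (-‿cong (trans (pow-* (+ d) n) (reflexive (≡.cong (λ k → p ^ suc k) e))))) (Dv-hit (+ d ℤ.* + n) (≡.subst (n ∣_) (≡.sym (ℤP.abs-* (+ d) (+ n))) (∣.n∣m*n d))))))

      Dv-difference⁵ : ∀ M → M ≡ N ⊎ M ≡ n₁ → Dv 5 (F M - rhs)
      Dv-difference⁵ M (inj₁ ≡.refl) = Dv-N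
      Dv-difference⁵ M (inj₂ ≡.refl) with ℕP.m≤n⇒m<n∨m≡n N≤n₁
      ... | inj₁ N<n₁   = Dv-n (n₁ ℕ.∸ suc N) (≡.sym (ℕP.m+[n∸m]≡n N<n₁))
      -- For N = n - 1 the two truncations coincide and there is no tail.
      ... | inj₂ ≡.refl = Dv-N

-- Assembly modulo [n]Φ_n⁴ and evaluation of the formal fractions

module GlobalCongruence where

  open import Defs
  open import Data.Nat as ℕ using (ℕ; zero; suc; NonZero; _∸_)
  import Data.Nat.Properties as ℕP
  import Data.Nat.Divisibility as ℕ∣
  open import Data.Nat.Coprimality using (Coprime)
  open import Data.Integer as ℤ using (ℤ; +_; -[1+_]; _≤_; ∣_∣)
  import Data.Integer.Properties as ℤP
  import Data.Integer.DivMod as ℤD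
  open import Data.Integer.Divisibility using (_∣_)
  open import Data.Integer.Tactic.RingSolver using (solve-∀)
  open import Data.List using ([]; _∷_)
  open import Data.Empty using (⊥-elim)
  open import Data.Product using (_,_)
  open import Data.Sum using (_⊎_; inj₁; inj₂)
  open import Data.Vec using ([]; _∷_)
  open import Relation.Nullary using (¬_)
  open import Relation.Binary.PropositionalEquality as ≡ using (_≡_)
  open Fields
  open FieldSolver
  open IntegerPolynomials
  open QSeries
  open Localisations
  open CyclotomicPolynomials
  open QPowersAndModuli
  open LocalCongruences

  module Quotient (K : Field) (emb : PolyEmbedding K) (n₁ d : ℕ) (r : ℤ) (N : ℕ)
    (d≢0 : ¬ d ≡ 0) (coprime-nd : Coprime (suc n₁) d)
    (r-def : r ≡ + suc n₁ ℤ.- + N ℤ.* + d) (N≤n₁ : N ℕ.≤ n₁) where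
    open FieldLemmas K
    open QPowers K emb using (q)
    open Modulo K emb
    open Setting K emb n₁ d r N d≢0 coprime-nd r-def N≤n₁

    difference : ℕ → Carrier
    difference M = (F M - rhs) / (1# - q)

    -- Division by 1 - q is harmless at Φ_m for m ≥ 2, which does not divide the exponent 1.
    Dv-quotient : ∀ k → suc (suc k) ℕ∣.∣ n → ∀ e {z} → Divisibility.Dv K (AtCyclotomic.localisation K emb (suc k)) e z →
                  DivisibleBy (powP (Φ (suc (suc k))) e) (z / (1# - q))
    Dv-quotient k m∣n e h = Dv-divisible (suc k) e (Dv-*ʳ h (O-⁻¹ (unit-cong (+-congˡ (-‿cong (*-identityˡ q))) (unit-miss (+ 1) (λ d → not-one (ℕ∣.∣1⇒≡1 d))))))
      where
      open AtCyclotomic K emb (suc k)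
      open Divisibility K localisation
      not-one : ¬ suc (suc k) ≡ 1
      not-one ()

  -- At Φ_1 the divisor 1 - q is not a unit, so n = 1 is separate: there N = M = 0 and the two sides
  -- are equal. For n ≥ 2 the factor Φ_n of [n] joins Φ_n⁴ to the fifth power, and the other factors
  -- of [n] occur once.
  difference-divisible : ∀ K emb n₁ d r N (d≢0 : ¬ d ≡ 0) (cop : Coprime (suc n₁) d) (r-def : r ≡ + suc n₁ ℤ.- + N ℤ.* + d) (N≤n₁ : N ℕ.≤ n₁) M → M ≡ N ⊎ M ≡ n₁ →
    Modulo.DivisibleBy K emb (qintPoly (suc n₁) *P powP (Φ (suc n₁)) 4) (Quotient.difference K emb n₁ d r N d≢0 cop r-def N≤n₁ M)
  difference-divisible K emb zero d r zero d≢0 cop r-def N≤n₁ M M≡ = divisible-0 (trans (*-congʳ (trivial M M≡)) (zeroˡ _))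
    where
    open FieldLemmas K
    open Modulo K emb
    open Setting K emb 0 d r 0 d≢0 cop r-def N≤n₁
    trivial₀ : F 0 - rhs ≈ 0#
    trivial₀ = solve (u ∷ κ ∷ [])
      (λ u κ → let y = :1 :- u :* :1 ; M = :1 :/ (:1 :* :1) in
        (:0 :+ (:1 :- u :* :1 :* :1) :* :1 :^ 4 :/ :1 :^ 4 :* (:1 :/ (:1 :* :1))) :- (y :* M :- (y :^ 3 :+ y :^ 4) :* M :* :0 :+ y :^ 4 :* (κ :* :0)) := :0)
      ≡.refl (^-≉0 4 1≉0 , *-≉0 1≉0 1≉0 , *-≉0 1≉0 1≉0 , *-≉0 1≉0 1≉0)
    trivial : ∀ M → M ≡ 0 ⊎ M ≡ 0 → F M - rhs ≈ 0#
    trivial .0 (inj₁ ≡.refl) = trivial₀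
    trivial .0 (inj₂ ≡.refl) = trivial₀
  difference-divisible K emb (suc n₀) d r N d≢0 cop r-def N≤n₁ M M≡ =
    divisible-cong regroup (divisible-* (∥-powP 5 (properProduct-∥ n n₀ n₀ ℕP.≤-refl))
      (divisible-properProduct n n₀ (λ k _ k∣n → divisible-cong (one-power (Φ (suc (suc k)))) (Dv-quotient k k∣n 1 (At.Dv-difference (suc k) k∣n M M≡))))
      (Dv-quotient n₀ ℕ∣.∣-refl 5 (Top.Dv-difference⁵ M M≡)))
    where
    open Modulo K emb
    open Setting K emb (suc n₀) d r N d≢0 cop r-def N≤n₁
    open Quotient K emb (suc n₀) d r N d≢0 cop r-def N≤n₁
    one-power : ∀ f → powP f 1 ≋ f
    one-power f = ≈-trans (constP-* (+ 1) f) (1·P f)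
    regroup : properProduct n n₀ *P powP (Φ n) 5 ≋ qintPoly n *P powP (Φ n) 4
    regroup = ≈-trans (rearrange (properProduct n n₀) (powP (Φ n) 4) (Φ n)) (mul-congʳ (powP (Φ n) 4) (≈-sym (qintPoly-factor n₀)))
      where
      rearrange : ∀ a b c → a *P (b *P c) ≋ a *P c *P b
      rearrange a b c = ≈-trans (*P-congˡ a (*P-comm b c)) (≈-sym (*P-assoc a c b))

  module Evaluation (K : Field) (emb : PolyEmbedding K) where
    open FieldLemmas K
    open PolyEmbedding emb
    open QPowers K emb
    open Sums K

    infix 4 _↦_
    -- A formal fraction is a bare pair of polynomials, so the relation itself has to assert that
    -- the denominator is non-zero.
    record _↦_ (A : RatFun) (z : Carrier) : Set where
      constructor evaluates
      field
        den≉0 : ¬ den A ≋ []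
        value : ι (num A) ≈ z * ι (den A)
    open _↦_ public

    ιden≉0 : ∀ {A z} → A ↦ z → ι (den A) ≉ 0#
    ιden≉0 h = ι-≉0 (den≉0 h)

    product≉0 : ∀ {f g} → ι f ≉ 0# → ι g ≉ 0# → ¬ f *P g ≋ []
    product≉0 {f} {g} hf hg e = *-≉0 hf hg (trans (sym (ι-* f g)) (trans (ι-cong e) ι-0))

    ↦-cong : ∀ {A a b} → a ≈ b → A ↦ a → A ↦ b
    ↦-cong e (evaluates h v) = evaluates h (trans v (*-congʳ e))

    ↦-poly : ∀ f → polyR f ↦ ι f
    ↦-poly f = evaluates oneP≉0 (sym (trans (*-congˡ ι-1) (*-identityʳ _)))

    ↦-1 : intR (+ 1) ↦ 1#
    ↦-1 = ↦-cong ι-1 (↦-poly oneP)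

    ↦-0 : intR (+ 0) ↦ 0#
    ↦-0 = ↦-cong (trans (ι-cong 0∷[]) ι-0) (↦-poly (constP (+ 0)))

    ↦-+ : ∀ {A B a b} → A ↦ a → B ↦ b → A +R B ↦ a + b
    ↦-+ {nA // dA} {nB // dB} {a} {b} hA@(evaluates _ v) hB@(evaluates _ w) = evaluates (product≉0 (ιden≉0 hA) (ιden≉0 hB)) (begin
      ι ((nA *P dB) +P (nB *P dA))     ≈⟨ trans (ι-+ (nA *P dB) (nB *P dA)) (+-cong (trans (ι-* nA dB) (*-congʳ v)) (trans (ι-* nB dA) (*-congʳ w))) ⟩
      a * ι dA * ι dB + b * ι dB * ι dA ≈⟨ solve (a ∷ b ∷ ι dA ∷ ι dB ∷ []) (λ a b c d → a :* c :* d :+ b :* d :* c := (a :+ b) :* (c :* d)) ≡.refl _ ⟩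
      (a + b) * (ι dA * ι dB)          ≈⟨ *-congˡ (ι-* dA dB) ⟨
      (a + b) * ι (dA *P dB)           ∎)

    ↦-neg : ∀ {A a} → A ↦ a → -R A ↦ - a
    ↦-neg {nA // dA} {a} (evaluates h v) = evaluates h (trans (ι-neg nA) (trans (-‿cong v) (solve (a ∷ ι dA ∷ []) (λ a d → :- (a :* d) := :- a :* d) ≡.refl _)))

    ↦-- : ∀ {A B a b} → A ↦ a → B ↦ b → A -R B ↦ a - b
    ↦-- hA hB = ↦-+ hA (↦-neg hB)

    ↦-* : ∀ {A B a b} → A ↦ a → B ↦ b → A *R B ↦ a * b
    ↦-* {nA // dA} {nB // dB} {a} {b} hA@(evaluates _ v) hB@(evaluates _ w) = evaluates (product≉0 (ιden≉0 hA) (ιden≉0 hB)) (begin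
      ι (nA *P nB)                 ≈⟨ trans (ι-* nA nB) (*-cong v w) ⟩
      (a * ι dA) * (b * ι dB)      ≈⟨ solve (a ∷ b ∷ ι dA ∷ ι dB ∷ []) (λ a b c d → (a :* c) :* (b :* d) := a :* b :* (c :* d)) ≡.refl _ ⟩
      a * b * (ι dA * ι dB)        ≈⟨ *-congˡ (ι-* dA dB) ⟨
      a * b * ι (dA *P dB)         ∎)

    ↦-inv : ∀ {A a} → a ≉ 0# → A ↦ a → invR A ↦ a ⁻¹
    ↦-inv {nA // dA} {a} a≉0 hA@(evaluates h v) = evaluates
      (λ e → *-≉0 a≉0 (ιden≉0 hA) (trans (sym v) (trans (ι-cong e) ι-0)))
      (sym (trans (*-congˡ v) (trans (sym (*-assoc _ _ _)) (trans (*-congʳ (inverseˡ a≉0)) (*-identityˡ _)))))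

    ↦-/ : ∀ {A B a b} → b ≉ 0# → A ↦ a → B ↦ b → A /R B ↦ a / b
    ↦-/ b≉0 hA hB = ↦-* hA (↦-inv b≉0 hB)

    ↦-^ : ∀ {A a} k → A ↦ a → A ^R k ↦ a ^ k
    ↦-^ zero    h = ↦-1
    ↦-^ (suc k) h = ↦-* (↦-^ k h) h

    ↦-pow : ∀ a → qpow a ↦ pow a
    ↦-pow (+ k)    = ↦-cong (ι-XP k) (↦-poly (XP k))
    ↦-pow -[1+ k ] = ↦-cong (⁻¹-cong (ι-XP (suc k))) (↦-inv (≉0-cong (sym (ι-XP (suc k))) (q^≉0 (suc k))) (↦-poly (XP (suc k))))

    1-q≉0 : 1# - q ≉ 0#
    1-q≉0 = ≉0-cong (+-congˡ (-‿cong (*-identityˡ q))) (1-q^≉0 0)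

    ↦-qint : ∀ a → qint a ↦ (1# - pow a) / (1# - q)
    ↦-qint a = ↦-/ 1-q≉0 (↦-- ↦-1 (↦-pow a)) (↦-- ↦-1 (↦-poly (XP 1)))

    ↦-poch : ∀ {A B a b} k → A ↦ a → B ↦ b → poch A B k ↦ QPochhammer.poch K b a k
    ↦-poch zero    hA hB = ↦-1
    ↦-poch (suc k) hA hB = ↦-* (↦-poch k hA hB) (↦-- ↦-1 (↦-* hA (↦-^ k hB)))

    ↦-sum0 : ∀ M {f g} → (∀ k → f k ↦ g k) → sum0 M f ↦ ∑ (suc M) g
    ↦-sum0 ℕ.zero h = ↦-cong (sym (+-identityˡ _)) (h 0)
    ↦-sum0 (suc M) h = ↦-+ (↦-sum0 M h) (h (suc M))

    ↦-sum1 : ∀ M {f g} → (∀ k → f (suc k) ↦ g k) → sum1 M f ↦ ∑ M g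
    ↦-sum1 ℕ.zero h = ↦-0
    ↦-sum1 (suc M) h = ↦-+ (↦-sum1 M h) (h M)

    -- The witnesses are P times the cofactor and the clearing factor; the polynomial equation is
    -- checked after embedding, which is injective.
    congruence : ∀ {A B a b P} → A ↦ a → B ↦ b → Modulo.DivisibleBy K emb P (a - b) → A ≡R B [mod P ]
    congruence {nA // dA} {nB // dB} {a} {b} {P} (evaluates _ v) (evaluates _ w) (Modulo.divisible V W (coprime S T c c≢0 e) h) =
      P *P W , V , (S , T , c , c≢0 , at e) , (W , λ i → ≡.refl) , at (ι-injective (begin
        ι (((nA *P dB) -P (nB *P dA)) *P V)
          ≈⟨ trans (ι-* ((nA *P dB) -P (nB *P dA)) V) (*-congʳ (trans (ι-+ (nA *P dB) (negP (nB *P dA))) (+-cong (ι-* nA dB) (trans (ι-neg (nB *P dA)) (-‿cong (ι-* nB dA)))))) ⟩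
        (ι nA * ι dB - ι nB * ι dA) * ι V
          ≈⟨ *-congʳ (+-cong (*-congʳ v) (-‿cong (*-congʳ w))) ⟩
        (a * ι dA * ι dB - b * ι dB * ι dA) * ι V
          ≈⟨ solve (a ∷ b ∷ ι dA ∷ ι dB ∷ ι V ∷ []) (λ a b c d V → (a :* c :* d :- b :* d :* c) :* V := V :* (a :- b) :* (c :* d)) ≡.refl _ ⟩
        ι V * (a - b) * (ι dA * ι dB)
          ≈⟨ *-cong h (sym (ι-* dA dB)) ⟩
        ι (P *P W) * ι (dA *P dB)
          ≈⟨ ι-* (P *P W) (dA *P dB) ⟨
        ι (P *P W *P (dA *P dB)) ∎))

  -- The remainder is a multiple of d smaller than d, hence zero; so the quotients in the exponents
  -- of the theorem are exact.
  /-exact : ∀ A d .{{_ : NonZero d}} → (A ℤ.* + d) ℤ./ + d ≡ A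
  /-exact A d = ≡.sym (ℤP.*-cancelʳ-≡ A Q (+ d) (≡.trans (ℤD.a≡a%n+[a/n]*n (A ℤ.* + d) (+ d)) (≡.trans (≡.cong (λ z → + z ℤ.+ Q ℤ.* + d) remainder≡0) (ℤP.+-identityˡ _))))
    where
    Q : ℤ
    Q = (A ℤ.* + d) ℤ./ + d
    ρ : ℕ
    ρ = (A ℤ.* + d) ℤ.% + d
    rearrange : ∀ A ρ Q d → A ℤ.* d ≡ ρ ℤ.+ Q ℤ.* d → ρ ≡ (A ℤ.- Q) ℤ.* d
    rearrange A ρ Q d e = ≡.trans (cancel ρ (Q ℤ.* d)) (≡.trans (≡.cong (λ z → z ℤ.- Q ℤ.* d) (≡.sym e)) (factor A Q d))
      where
      cancel : ∀ a b → a ≡ a ℤ.+ b ℤ.- b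
      cancel = solve-∀
      factor : ∀ A Q d → A ℤ.* d ℤ.- Q ℤ.* d ≡ (A ℤ.- Q) ℤ.* d
      factor = solve-∀
    ρ-multiple : ρ ≡ ∣ A ℤ.- Q ∣ ℕ.* d
    ρ-multiple = ≡.trans (≡.cong ∣_∣ (rearrange A (+ ρ) Q (+ d) (ℤD.a≡a%n+[a/n]*n (A ℤ.* + d) (+ d)))) (ℤP.abs-* (A ℤ.- Q) (+ d))
    small-multiple : ∀ c → c ℕ.* d ℕ.< d → c ℕ.* d ≡ 0
    small-multiple ℕ.zero  h = ≡.refl
    small-multiple (suc c) h = ⊥-elim (ℕP.<-irrefl ≡.refl (ℕP.≤-trans h (ℕP.m≤m+n d (c ℕ.* d))))
    remainder≡0 : ρ ≡ 0
    remainder≡0 = ≡.trans ρ-multiple (small-multiple ∣ A ℤ.- Q ∣ (≡.subst (ℕ._< d) ρ-multiple (ℤD.n%d<d (A ℤ.* + d) (+ d))))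

  -- The two sides of the theorem as elements of the field

  module Sides (K : Field) (emb : PolyEmbedding K) (n₁ d : ℕ) .{{_ : NonZero d}} (r : ℤ) (N : ℕ)
    (d≢0 : ¬ d ≡ 0) (coprime-nd : Coprime (suc n₁) d)
    (r-def : r ≡ + suc n₁ ℤ.- + N ℤ.* + d) (N≤n₁ : N ℕ.≤ n₁) where
    open FieldLemmas K
    open QPowers K emb hiding (1-q^≉0)
    open Evaluation K emb
    open Sums K
    open Setting K emb n₁ d r N d≢0 coprime-nd r-def N≤n₁ hiding (poch)

    private
      D : ℤ
      D = + d
      R1 [n] : RatFun
      R1  = intR (+ 1)
      [n] = qint (+ n)
      c : Carrier
      c = 1# - q

    left : ℕ → RatFun
    left M = sum0 M (λ k →
      qint (+ (2 ℕ.* d ℕ.* k) ℤ.+ r)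
      *R (poch (qpow r) (qpow D) k ^R 4)
      /R (poch (qpow D) (qpow D) k ^R 4)
      *R qpow ((D ℤ.- + 2 ℤ.* r) ℤ.* + k))

    right : RatFun
    right =
      (qpow ((r ℤ.* (r ℤ.- + n)) ℤ./ D)
        *R poch (qpow (+ 2 ℤ.* r)) (qpow D) N
        /R poch (qpow D) (qpow D) N
        *R ([n] -R ((([n] ^R 3) +R (([n] ^R 4) *R (R1 -R qR)))
                    *R sum1 N (λ k → qpow (+ (k ℕ.* d)) /R (qint (+ (k ℕ.* d)) ^R 2)))))
      +R (([n] ^R 4) *R sum1 N (λ k →
            qpow (((+ (k ℕ.* d) ℤ.- D ℤ.- + (2 ℕ.* n) ℤ.+ + 2 ℤ.* r) ℤ.* (D ℤ.- + n)) ℤ./ D)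
            *R poch (qpow D) (qpow D) (k ∸ 1)
            *R poch (qpow (+ 2 ℤ.* r)) (qpow D) (k ∸ 1)
            /R ((qint (+ (d ℕ.* k) ℤ.- D ℤ.+ r) ^R 3)
                *R (poch (qpow r) (qpow D) (k ∸ 1) ^R 2))))

    pow-double : pow (+ 2 ℤ.* r) ≈ u * u
    pow-double = trans (reflexive (≡.cong pow (two-times r))) (pow-+ r r)
      where
      two-times : ∀ r → + 2 ℤ.* r ≡ r ℤ.+ r
      two-times = solve-∀

    left-↦ : ∀ M → left M ↦ F M / c
    left-↦ M = ↦-cong (trans (∑-cong (suc M) (λ k _ → summand≈ k)) (trans (sym (∑-*ˡ (suc M) (c ⁻¹) (term u u≉0))) (*-comm _ _)))
      (↦-sum0 M (λ k → ↦-* (↦-/ (^-≉0 4 (P≉0 k)) (↦-* (↦-qint (+ (2 ℕ.* d ℕ.* k) ℤ.+ r)) (↦-^ 4 (↦-poch k (↦-pow r) (↦-pow D)))) (↦-^ 4 (↦-poch k (↦-pow D) (↦-pow D))))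
        (↦-pow ((D ℤ.- + 2 ℤ.* r) ℤ.* + k))))
      where
      pow₁ : ∀ k → pow (+ (2 ℕ.* d ℕ.* k) ℤ.+ r) ≈ u * p ^ k * p ^ k
      pow₁ k = trans (reflexive (≡.cong pow (≡.trans (≡.cong (λ z → z ℤ.+ r) (≡.trans (ℤP.pos-* (2 ℕ.* d) k) (≡.cong (λ z → z ℤ.* + k) (ℤP.pos-* 2 d)))) (ident (+ d) (+ k) r))))
        (trans (pow-progression (r ℤ.+ D ℤ.* + k) k) (*-congʳ (pow-progression r k)))
        where
        ident : ∀ d k r → + 2 ℤ.* d ℤ.* k ℤ.+ r ≡ r ℤ.+ d ℤ.* k ℤ.+ d ℤ.* k
        ident = solve-∀
      pow₂ : ∀ k → pow ((D ℤ.- + 2 ℤ.* r) ℤ.* + k) ≈ p ^ k / (u ^ k * u ^ k)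
      pow₂ k = trans (reflexive (≡.cong pow (ident D r (+ k)))) (trans (pow-- (D ℤ.* + k) (r ℤ.* + k ℤ.+ r ℤ.* + k))
        (/-cong (pow-* D k) (trans (pow-+ (r ℤ.* + k) (r ℤ.* + k)) (*-cong (pow-* r k) (pow-* r k)))))
        where
        ident : ∀ d r k → (d ℤ.- + 2 ℤ.* r) ℤ.* k ≡ d ℤ.* k ℤ.- (r ℤ.* k ℤ.+ r ℤ.* k)
        ident = solve-∀
      summand≈ : ∀ k → (1# - pow (+ (2 ℕ.* d ℕ.* k) ℤ.+ r)) / c * QPochhammer.poch K p u k ^ 4 / P k ^ 4 * pow ((D ℤ.- + 2 ℤ.* r) ℤ.* + k) ≈ c ⁻¹ * term u u≉0 k
      summand≈ k = trans (*-cong (*-congʳ (*-congʳ (*-congʳ (+-congˡ (-‿cong (pow₁ k)))))) (pow₂ k))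
        (trans (solve (1# - u * p ^ k * p ^ k ∷ c ∷ QPochhammer.poch K p u k ^ 4 ∷ P k ^ 4 ∷ p ^ k / (u ^ k * u ^ k) ∷ [])
          (λ a c U P z → a :/ c :* U :/ P :* z := :1 :/ c :* (a :* U :/ P :* z)) ≡.refl (1-q≉0 , ^-≉0 4 (P≉0 k) , 1-q≉0 , ^-≉0 4 (P≉0 k)))
          (*-congʳ (*-identityˡ _)))

    Y : Carrier
    Y = y N / c

    [n]-↦ : [n] ↦ Y
    [n]-↦ = ↦-cong (*-congʳ (+-congˡ (-‿cong (sym x-pow)))) (↦-qint (+ n))

    -- r - n is -N d, so the exponent is -r N.
    pow-first : pow ((r ℤ.* (r ℤ.- + n)) ℤ./ D) ≈ 1# / u ^ N
    pow-first = trans (reflexive (≡.cong pow (≡.trans (≡.cong (λ z → z ℤ./ D) factored) (/-exact (ℤ.- (r ℤ.* + N)) d))))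
      (trans (pow-neg (r ℤ.* + N)) (*-congˡ (⁻¹-cong (pow-* r N))))
      where
      ident : ∀ r n N d → r ℤ.* (n ℤ.- N ℤ.* d ℤ.- n) ≡ ℤ.- (r ℤ.* N) ℤ.* d
      ident = solve-∀
      factored : r ℤ.* (r ℤ.- + n) ≡ ℤ.- (r ℤ.* + N) ℤ.* D
      factored = ≡.trans (≡.cong (λ z → r ℤ.* (z ℤ.- + n)) r-def) (ident r (+ n) (+ N) D)

    pow-multiple : ∀ l → pow (+ (suc l ℕ.* d)) ≈ p * p ^ l
    pow-multiple l = trans (reflexive (≡.cong pow (≡.cong (λ z → D ℤ.+ z) (≡.trans (ℤP.pos-* l d) (ℤP.*-comm (+ l) D))))) (pow-progression D l)

    sum₁ : ∀ l → pow (+ (suc l ℕ.* d)) / ((1# - pow (+ (suc l ℕ.* d))) / c) ^ 2 ≈ c ^ 2 * h l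
    sum₁ l = trans (/-cong (pow-multiple l) (^-cong 2 (*-congʳ (+-congˡ (-‿cong (pow-multiple l))))))
      (solve (p ∷ p ^ l ∷ c ∷ []) (λ p L c → let d = :1 :- p :* L in p :* L :/ (d :/ c) :^ 2 := c :^ 2 :* (p :* L :/ (d :* d))) ≡.refl
        (1-q≉0 , ^-≉0 2 (/-≉0 (d≉0 l) 1-q≉0) , *-≉0 (d≉0 l) (d≉0 l)))

    sum₁-↦ : sum1 N (λ k → qpow (+ (k ℕ.* d)) /R (qint (+ (k ℕ.* d)) ^R 2)) ↦ c ^ 2 * H N 0
    sum₁-↦ = ↦-cong (trans (∑-cong N (λ l _ → sum₁ l)) (sym (∑-*ˡ N (c ^ 2) _)))
      (↦-sum1 N (λ l → ↦-/ (^-≉0 2 (/-≉0 (≉0-cong (+-congˡ (-‿cong (sym (pow-multiple l)))) (d≉0 l)) 1-q≉0)) (↦-pow (+ (suc l ℕ.* d))) (↦-^ 2 (↦-qint (+ (suc l ℕ.* d))))))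

    -- For k = l + 1 the first factor of the exponent is (l - 2N) d, so the quotient by d is (l -
    -- 2N)(d - n), and q^(d-n) is p/x.
    pow-second : ∀ l → pow (((+ (suc l ℕ.* d) ℤ.- D ℤ.- + (2 ℕ.* n) ℤ.+ + 2 ℤ.* r) ℤ.* (D ℤ.- + n)) ℤ./ D)
                       ≈ (p / x N) ^ l / ((p / x N) ^ N * (p / x N) ^ N)
    pow-second l = trans (reflexive (≡.cong pow (≡.trans (≡.cong (λ z → z ℤ./ D) factored) (/-exact (g ℤ.* + l ℤ.- (g ℤ.* + N ℤ.+ g ℤ.* + N)) d))))
      (trans (pow-- (g ℤ.* + l) (g ℤ.* + N ℤ.+ g ℤ.* + N)) (/-cong (power l) (trans (pow-+ (g ℤ.* + N) (g ℤ.* + N)) (*-cong (power N) (power N)))))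
      where
      g : ℤ
      g = D ℤ.- + n
      power : ∀ k → pow (g ℤ.* + k) ≈ (p / x N) ^ k
      power k = trans (pow-* g k) (^-cong k (trans (pow-- D (+ n)) (/-cong refl (sym x-pow))))
      ident : ∀ d l n N → (d ℤ.+ l ℤ.* d ℤ.- d ℤ.- + 2 ℤ.* n ℤ.+ + 2 ℤ.* (n ℤ.- N ℤ.* d)) ℤ.* (d ℤ.- n)
              ≡ ((d ℤ.- n) ℤ.* l ℤ.- ((d ℤ.- n) ℤ.* N ℤ.+ (d ℤ.- n) ℤ.* N)) ℤ.* d
      ident = solve-∀
      factored : (+ (suc l ℕ.* d) ℤ.- D ℤ.- + (2 ℕ.* n) ℤ.+ + 2 ℤ.* r) ℤ.* (D ℤ.- + n) ≡ (g ℤ.* + l ℤ.- (g ℤ.* + N ℤ.+ g ℤ.* + N)) ℤ.* D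
      factored = ≡.trans (≡.cong₂ (λ a b → (a ℤ.- D ℤ.- b ℤ.+ + 2 ℤ.* r) ℤ.* g) (≡.cong (λ z → D ℤ.+ z) (ℤP.pos-* l d)) (ℤP.pos-* 2 n))
        (≡.trans (≡.cong (λ z → (D ℤ.+ + l ℤ.* D ℤ.- D ℤ.- + 2 ℤ.* + n ℤ.+ + 2 ℤ.* z) ℤ.* g) r-def) (ident D (+ l) (+ n) (+ N)))

    pow-third : ∀ l → pow (+ (d ℕ.* suc l) ℤ.- D ℤ.+ r) ≈ u * p ^ l
    pow-third l = trans (reflexive (≡.cong pow (≡.trans (≡.cong (λ z → z ℤ.- D ℤ.+ r) (≡.trans (≡.cong +_ (ℕP.*-suc d l)) (≡.cong (λ z → D ℤ.+ z) (ℤP.pos-* d l)))) (ident D (+ l) r))))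
      (pow-progression r l)
      where
      ident : ∀ d l r → d ℤ.+ d ℤ.* l ℤ.- d ℤ.+ r ≡ r ℤ.+ d ℤ.* l
      ident = solve-∀

    U : ℕ → Carrier
    U = QPochhammer.poch K p u

    U≉0 : ∀ k → U k ≉ 0#
    U≉0 k = QPochhammer.poch-≉0 K p u k (λ i _ → 1-up^≉0 i)

    -- In (p/x)^(-2N) the part p^(-2N) equals u²/x²: it supplies the u² of `summandT`, and the
    -- remaining x^(2N)/x² is `κ`.
    sum₂ : ∀ l → pow (((+ (suc l ℕ.* d) ℤ.- D ℤ.- + (2 ℕ.* n) ℤ.+ + 2 ℤ.* r) ℤ.* (D ℤ.- + n)) ℤ./ D)
                 * P l * QPochhammer.poch K p (pow (+ 2 ℤ.* r)) l / (((1# - pow (+ (d ℕ.* suc l) ℤ.- D ℤ.+ r)) / c) ^ 3 * U l ^ 2)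
                 ≈ c ^ 3 * κ * (summandT u l / x N ^ l)
    sum₂ l = trans (/-cong (*-cong (*-congʳ (pow-second l)) (QPochhammer.poch-cong K p l pow-double)) (*-congʳ (^-cong 3 (*-congʳ (+-congˡ (-‿cong (pow-third l)))))))
      (trans (*-congʳ (*-congʳ (*-congʳ (/-cong (/-^ l (x≉0 N)) (*-cong (/-^ N (x≉0 N)) (/-^ N (x≉0 N)))))))
      (solve-with (u ∷ p ^ N ∷ x N ^ N ∷ p ^ l ∷ x N ^ l ∷ P l ∷ QPochhammer.poch K p (u * u) l ∷ 1# - u * p ^ l ∷ U l ∷ c ∷ [])
        (x N ≔ (λ u pN xN pl xl P A e U c → u :* pN) by refl ∷ [])
        (λ u pN xN pl xl P A e U c x →
          pl :/ xl :/ ((pN :/ xN) :* (pN :/ xN)) :* P :* A :/ ((e :/ c) :^ 3 :* U :^ 2)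
          := c :^ 3 :* (xN :* xN :/ (x :* x)) :* (pl :* (u :* u) :* P :* A :/ (e :^ 3 :* U :^ 2) :/ xl))
        ≡.refl (xl≉0 , xN≉0 , xN≉0 , *-≉0 (/-≉0 (p^≉0 N) xN≉0) (/-≉0 (p^≉0 N) xN≉0) , 1-q≉0 , *-≉0 (^-≉0 3 (/-≉0 (1-up^≉0 l) 1-q≉0)) (^-≉0 2 (U≉0 l))
               , *-≉0 (x≉0 N) (x≉0 N) , *-≉0 (^-≉0 3 (1-up^≉0 l)) (^-≉0 2 (U≉0 l)) , xl≉0)))
      where
      xl≉0 = ^-≉0 l (x≉0 N)
      xN≉0 = ^-≉0 N (x≉0 N)

    right-↦ : right ↦ rhs / c
    right-↦ = ↦-cong total (↦-+
        (↦-* (↦-/ (P≉0 N) (↦-* (↦-cong pow-first (↦-pow ((r ℤ.* (r ℤ.- + n)) ℤ./ D))) (↦-poch N (↦-cong pow-double (↦-pow (+ 2 ℤ.* r))) (↦-pow D))) (↦-poch N (↦-pow D) (↦-pow D)))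
             (↦-- [n]-↦ (↦-* (↦-+ (↦-^ 3 [n]-↦) (↦-* (↦-^ 4 [n]-↦) (↦-- ↦-1 (↦-poly (XP 1))))) sum₁-↦)))
        (↦-* (↦-^ 4 [n]-↦) (↦-cong (trans (∑-cong N (λ l _ → sum₂ l)) (sym (∑-*ˡ N (c ^ 3 * κ) _)))
          (↦-sum1 N (λ l → ↦-/ (*-≉0 (^-≉0 3 (/-≉0 (≉0-cong (+-congˡ (-‿cong (sym (pow-third l)))) (1-up^≉0 l)) 1-q≉0)) (^-≉0 2 (U≉0 l)))
            (↦-* (↦-* (↦-pow (((+ (suc l ℕ.* d) ℤ.- D ℤ.- + (2 ℕ.* n) ℤ.+ + 2 ℤ.* r) ℤ.* (D ℤ.- + n)) ℤ./ D)) (↦-poch l (↦-pow D) (↦-pow D))) (↦-poch l (↦-pow (+ 2 ℤ.* r)) (↦-pow D)))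
            (↦-* (↦-^ 3 (↦-qint (+ (d ℕ.* suc l) ℤ.- D ℤ.+ r))) (↦-^ 2 (↦-poch l (↦-pow r) (↦-pow D)))))))))
      where
      total : 1# / u ^ N * QPochhammer.poch K p (u * u) N / P N * (Y - (Y ^ 3 + Y ^ 4 * c) * (c ^ 2 * H N 0)) + Y ^ 4 * (c ^ 3 * κ * T₀) ≈ rhs / c
      -- Each bracket is a difference divided by c = 1 - q, and after counting brackets every
      -- summand retains exactly one factor 1/c.
      total = solve (u ^ N ∷ QPochhammer.poch K p (u * u) N ∷ P N ∷ y N ∷ c ∷ H N 0 ∷ κ ∷ T₀ ∷ [])
        (λ uN A P y c H κ T → let Y = y :/ c ; M = A :/ (uN :* P) in
          :1 :/ uN :* A :/ P :* (Y :- (Y :^ 3 :+ Y :^ 4 :* c) :* (c :^ 2 :* H)) :+ Y :^ 4 :* (c :^ 3 :* κ :* T)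
          := (y :* M :- (y :^ 3 :+ y :^ 4) :* M :* H :+ y :^ 4 :* (κ :* T)) :/ c)
        ≡.refl (u^≉0 u u≉0 N , P≉0 N , 1-q≉0 , 1-q≉0 , 1-q≉0 , 1-q≉0 , uP≉0 , uP≉0 , 1-q≉0)
        where
        uP≉0 : u ^ N * P N ≉ 0#
        uP≉0 = *-≉0 (u^≉0 u u≉0 N) (P≉0 N)

    congruent : ∀ M → M ≡ N ⊎ M ≡ n₁ → left M ≡R right [mod qintPoly n *P powP (cyclotomic n) 4 ]
    congruent M M≡ = congruence (left-↦ M) right-↦ (divisible-value (solve (F M ∷ rhs ∷ c ∷ []) (λ F r c → (F :- r) :/ c := F :/ c :- r :/ c) ≡.refl (1-q≉0 , 1-q≉0 , 1-q≉0))
        (difference-divisible K emb n₁ d r N d≢0 coprime-nd r-def N≤n₁ M M≡))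
      where
      open Modulo K emb

  polyEmbedding : PolyEmbedding PolyFractions.fractionField
  polyEmbedding = record
    { ι = PolyFractions.embed
    ; ι-cong = PolyFractions.embed-cong
    ; ι-+ = PolyFractions.embed-+
    ; ι-* = PolyFractions.embed-*
    ; ι-neg = λ f → Field.refl PolyFractions.fractionField
    ; ι-1 = Field.refl PolyFractions.fractionField
    ; ι-injective = PolyFractions.embed-injective }

-- The hypotheses on r in terms of N = (n - r)/d

open import Defs
open import Data.Nat as ℕ using (ℕ; zero; suc; _∸_)
open import Data.Nat.GCD using (gcd)
open import Data.Integer as ℤ using (ℤ; +_; _≤_; ∣_∣)
open import Data.Integer.Divisibility using (_∣_)
open import Data.Sum using (_⊎_)
open import Relation.Binary.PropositionalEquality as ≡ using (_≡_)
import Data.Nat.Properties as ℕP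
open import Data.Nat.DivMod using (m*n/n≡m)
open import Data.Nat.Divisibility using (divides)
open import Data.Nat.Coprimality using (gcd≡1⇒coprime)
import Data.Integer.Properties as ℤP
open import Data.Integer.Tactic.RingSolver using (solve-∀)
open CyclotomicPolynomials
open GlobalCongruence

quotient-formula : ∀ n d .{{_ : ℕ.NonZero d}} r → r ≤ + n → + d ∣ (+ n ℤ.- r) → r ≡ + n ℤ.- + (∣ + n ℤ.- r ∣ ℕ./ d) ℤ.* + d
quotient-formula n d r r≤n (divides c e) = ≡.trans (rearrange r (+ n)) (≡.cong (λ z → + n ℤ.- z) n-r)
  where
  rearrange : ∀ r n → r ≡ n ℤ.- (n ℤ.- r)
  rearrange = solve-∀
  n-r : + n ℤ.- r ≡ + (∣ + n ℤ.- r ∣ ℕ./ d) ℤ.* + d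
  n-r = ≡.trans (≡.sym (ℤP.0≤i⇒+∣i∣≡i (ℤP.i≤j⇒0≤j-i r≤n))) (≡.trans (≡.cong +_ (≡.trans e (≡.cong (ℕ._* d) (≡.sym (≡.trans (≡.cong (ℕ._/ d) e) (m*n/n≡m c d)))))) (ℤP.pos-* (∣ + n ℤ.- r ∣ ℕ./ d) d))

-- Adding N d + n d - n to both sides of the lower bound on r gives (N + 1) d ≤ n d, and d cancels.
quotient-bound : ∀ n₁ d .{{_ : ℕ.NonZero d}} r N → r ≡ + suc n₁ ℤ.- + N ℤ.* + d →
                 (+ suc n₁ ℤ.+ + d ℤ.- + (suc n₁ ℕ.* d)) ≤ r → N ℕ.≤ n₁
quotient-bound n₁ d r N r-def lower = ℕP.≤-pred (ℕP.*-cancelʳ-≤ (suc N) (suc n₁) d (ℤP.drop‿+≤+ (≡.subst₂ _≤_ left right (ℤP.+-monoʳ-≤ shift lower))))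
  where
  shift : ℤ
  shift = + N ℤ.* + d ℤ.+ + suc n₁ ℤ.* + d ℤ.- + suc n₁
  identˡ : ∀ N d n → N ℤ.* d ℤ.+ n ℤ.* d ℤ.- n ℤ.+ (n ℤ.+ d ℤ.- n ℤ.* d) ≡ d ℤ.+ N ℤ.* d
  identˡ = solve-∀
  identʳ : ∀ N d n → N ℤ.* d ℤ.+ n ℤ.* d ℤ.- n ℤ.+ (n ℤ.- N ℤ.* d) ≡ n ℤ.* d
  identʳ = solve-∀
  left : shift ℤ.+ (+ suc n₁ ℤ.+ + d ℤ.- + (suc n₁ ℕ.* d)) ≡ + (suc N ℕ.* d)
  left = ≡.trans (≡.cong (λ z → shift ℤ.+ (+ suc n₁ ℤ.+ + d ℤ.- z)) (ℤP.pos-* (suc n₁) d)) (≡.trans (identˡ (+ N) (+ d) (+ suc n₁)) (≡.cong (λ z → + d ℤ.+ z) (≡.sym (ℤP.pos-* N d))))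
  right : shift ℤ.+ r ≡ + (suc n₁ ℕ.* d)
  right = ≡.trans (≡.cong (λ z → shift ℤ.+ z) r-def) (≡.trans (identʳ (+ N) (+ d) (+ suc n₁)) (≡.sym (ℤP.pos-* (suc n₁) d)))

theorem1p1 : (n d : ℕ) → .{{_ : ℕ.NonZero n}} → .{{_ : ℕ.NonZero d}} →
  gcd n d ≡ 1 →
  (r : ℤ) → (+ n ℤ.+ + d ℤ.- + (n ℕ.* d)) ≤ r → r ≤ + n →
  + d ∣ (+ n ℤ.- r) →
  (M : ℕ) → (M ≡ (∣ + n ℤ.- r ∣ ℕ./ d) ⊎ M ≡ n ∸ 1) →
  let N  = ∣ + n ℤ.- r ∣ ℕ./ d
      D  = + d
      R1 = intR (+ 1)
      [n] = qint (+ n)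
  in
  sum0 M (λ k →
      qint (+ (2 ℕ.* d ℕ.* k) ℤ.+ r)
      *R (poch (qpow r) (qpow D) k ^R 4)
      /R (poch (qpow D) (qpow D) k ^R 4)
      *R qpow ((D ℤ.- + 2 ℤ.* r) ℤ.* + k))
  ≡R
    (qpow ((r ℤ.* (r ℤ.- + n)) ℤ./ D)
      *R poch (qpow (+ 2 ℤ.* r)) (qpow D) N
      /R poch (qpow D) (qpow D) N
      *R ([n] -R ((([n] ^R 3) +R (([n] ^R 4) *R (R1 -R qR)))
                  *R sum1 N (λ k → qpow (+ (k ℕ.* d)) /R (qint (+ (k ℕ.* d)) ^R 2)))))
    +R (([n] ^R 4) *R sum1 N (λ k →
          qpow (((+ (k ℕ.* d) ℤ.- D ℤ.- + (2 ℕ.* n) ℤ.+ + 2 ℤ.* r) ℤ.* (D ℤ.- + n)) ℤ./ D)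
          *R poch (qpow D) (qpow D) (k ∸ 1)
          *R poch (qpow (+ 2 ℤ.* r)) (qpow D) (k ∸ 1)
          /R ((qint (+ (d ℕ.* k) ℤ.- D ℤ.+ r) ^R 3)
              *R (poch (qpow r) (qpow D) (k ∸ 1) ^R 2))))
  [mod qintPoly n *P powP (cyclotomic n) 4 ]
theorem1p1 zero d {{()}}
theorem1p1 (suc n₁) d gcd≡1 r lower upper d∣n-r M M≡ =
  Sides.congruent PolyFractions.fractionField polyEmbedding n₁ d r (∣ + suc n₁ ℤ.- r ∣ ℕ./ d)
    (ℕ.≢-nonZero⁻¹ d) (gcd≡1⇒coprime gcd≡1) r-def (quotient-bound n₁ d r (∣ + suc n₁ ℤ.- r ∣ ℕ./ d) r-def lower) M M≡
  where
  r-def = quotient-formula (suc n₁) d r upper d∣n-r
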